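{- Let $\lambda/\mu$ be a skew partition and suppose that $\mu_i=\lambda_i$ for all $i<\ell(\mu)$. Then, for every partition $\nu$, \[v_{\lambda/\mu,\nu}(\alpha)=c'_\mu(\alpha)\, v_{\lambda,\mu\cup\nu}(\alpha).\] In particular, $\tilde v_{\lambda/\mu,\nu}(\alpha)$ is a polynomial in $\alpha$ with nonnegative integer coefficients.
   Context: Partitions and diagrams: a partition $\lambda=(\lambda_1\ge\lambda_2\ge\cdots)$ has diagram the set of boxes $(i,j)$ (row $i$, column $j$) with $1\le j\le\lambda_i$; $\lambda'$ is the transposed partition, $\ell(\lambda)$ the number of nonzero parts, $|\lambda|$ the sum of parts. $\mu\subset\lambda$ means containment of diagrams; a skew partition $\lambda/\mu$ is a pair $\mu\subset\lambda$. $\mu\cup\nu$ is the partition whose multiset of parts is the union (with multiplicities added) of those of $\mu$ and $\nu$. Jack functions: work in the ring of symmetric functions in $x=(x_1,x_2,\dots)$ over $\mathbb Q(\alpha)$, with the scalar product for which the power sums $p_\lambda$ are pairwise orthogonal and $\langle p_\lambda,p_\lambda\rangle=z_\lambda\alpha^{\ell(\lambda)}$, where $z_\lambda=\prod_i i^{k_i}k_i!$ and $k_i$ is the number of parts of $\lambda$ equal to $i$. The Jack symmetric functions $J_\lambda=J_\lambda(x;\alpha)$ are the unique symmetric functions that are pairwise orthogonal, of the form $J_\lambda=\sum_{\mu\le\lambda}v_{\lambda,\mu}(\alpha)m_\mu$ ($m_\mu$ the monomial symmetric functions, $\le$ the dominance order; $v_{\lambda,\mu}=0$ if $\mu\not\le\lambda$),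 and normalized by $v_{\lambda,(1^n)}=n!$ for $n=|\lambda|$. The skew Jack function $J_{\lambda/\mu}$ is defined by $\langle J_{\lambda/\mu},J_\nu\rangle=\langle J_\lambda,J_\mu J_\nu\rangle$ for all partitions $\nu$. Write $J_{\lambda/\mu}=\sum_\nu v_{\lambda/\mu,\nu}(\alpha)m_\nu$ and $\tilde v_{\lambda/\mu,\nu}=u_\nu^{ -1}v_{\lambda/\mu,\nu}$, where $u_\nu=\prod_{i\ge1}k_i!$ with $k_i$ the number of parts of $\nu$ equal to $i$. For $s=(i,j)\in\mu$ put $a_{\mu,s}=\mu_i-j$, $\ell_{\mu,s}=\mu'_j-i$, and $c'_\mu=\prod_{s\in\mu}\bigl((a_{\mu,s}+1)\alpha+\ell_{\mu,s}\bigr)$. -}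

module Defs where

open import Algebra.Bundles using (CommutativeRing)
open import Algebra.Structures using (IsCommutativeRing)
open import Data.Bool.Base using (if_then_else_)
import Data.Integer.Base as ℤ
open import Data.List.Base using (List; []; _∷_; _∷ʳ_; map; foldr; filter; length; take; replicate; merge; applyUpTo; upTo; concatMap)
import Data.List.Properties as List
open import Data.List.Membership.Propositional using (_∈_)
open import Data.List.Membership.Propositional.Properties using (∈-upTo⁻)
open import Data.List.Relation.Binary.Permutation.Propositional as Perm using (_↭_; ↭-sym; ↭-trans; ↭⇒↭ₛ)
import Data.List.Relation.Binary.Permutation.Propositional.Properties as Perm
open import Data.List.Relation.Binary.Pointwise using (Pointwise-≡⇒≡)
open import Data.List.Relation.Binary.Subset.Propositional using (_⊆_)
open import Data.List.Relation.Unary.All as All using (All)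
import Data.List.Relation.Unary.All.Properties as All
open import Data.List.Relation.Unary.AllPairs using (_∷_)
open import Data.List.Relation.Unary.Any using (here; there)
open import Data.List.Relation.Unary.Linked as Linked using (Linked; []; [-]; _∷_)
import Data.List.Relation.Unary.Sorted.TotalOrder.Properties as Sorted
open import Data.List.Relation.Unary.Unique.Propositional using (Unique)
import Data.List.Sort.Base as Sort
import Data.List.Sort.InsertionSort as InsertionSort
open import Data.Maybe.Base using (nothing)
open import Data.Nat.Base as ℕ using (ℕ; zero; suc; _≤_; _<_; _≥_; _∸_; _!; NonZero)
open import Data.Nat.ListAction using (sum; product)
open import Data.Nat.ListAction.Properties using (product≢0; sum-↭)
import Data.Nat.Properties as ℕ
open import Data.Product.Base using (_×_; _,_; ∃; proj₂)
open import Data.Rational.Base as ℚ using (ℚ; 0ℚ; 1ℚ)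
import Data.Rational.Properties as ℚ
open import Data.Sum.Base using (_⊎_; inj₁; inj₂; [_,_]′)
open import Function.Base using (_∘_)
open import Level using (0ℓ)
open import Relation.Binary.Bundles using (Setoid)
open import Relation.Binary.Properties.DecTotalOrder ℕ.≤-decTotalOrder using (≥-decTotalOrder; ≥-totalOrder)
open import Relation.Binary.PropositionalEquality as ≡ using (_≡_; _≢_; cong; cong₂)
import Relation.Binary.Reasoning.Setoid as SetoidReasoning
open import Relation.Nullary using (¬_; Dec; yes; no; does; contradiction)
import Tactic.RingSolver.Core.AlmostCommutativeRing as ACR

module Polynomials where

  Poly : Set
  Poly = List ℚ

  -- c₀ ∷ c₁ ∷ … stands for c₀ + c₁ α + …
  coeff : Poly → ℕ → ℚ
  coeff []      _       = 0ℚ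
  coeff (a ∷ p) zero    = a
  coeff (a ∷ p) (suc n) = coeff p n

  infix 4 _≈_
  record _≈_ (p q : Poly) : Set where
    constructor mk≈
    field at : ∀ n → coeff p n ≡ coeff q n
  open _≈_ public

  infixl 6 _+_
  infixl 7 _*_ _·_
  infix  8 -_

  _+_ : Poly → Poly → Poly
  []      + q       = q
  (a ∷ p) + []      = a ∷ p
  (a ∷ p) + (b ∷ q) = (a ℚ.+ b) ∷ (p + q)

  _·_ : ℚ → Poly → Poly
  c · p = map (c ℚ.*_) p

  -_ : Poly → Poly
  - p = map ℚ.-_ p

  _*_ : Poly → Poly → Poly
  []      * q = []
  (a ∷ p) * q = a · q + (0ℚ ∷ p * q)

  0P 1P : Poly
  0P = []
  1P = 1ℚ ∷ []

  coeff-+ : ∀ p q n → coeff (p + q) n ≡ coeff p n ℚ.+ coeff q n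
  coeff-+ []      q       n       = ≡.sym (ℚ.+-identityˡ _)
  coeff-+ (a ∷ p) []      n       = ≡.sym (ℚ.+-identityʳ _)
  coeff-+ (a ∷ p) (b ∷ q) zero    = ≡.refl
  coeff-+ (a ∷ p) (b ∷ q) (suc n) = coeff-+ p q n

  coeff-· : ∀ c p n → coeff (c · p) n ≡ c ℚ.* coeff p n
  coeff-· c []      n       = ≡.sym (ℚ.*-zeroʳ c)
  coeff-· c (a ∷ p) zero    = ≡.refl
  coeff-· c (a ∷ p) (suc n) = coeff-· c p n

  coeff-- : ∀ p n → coeff (- p) n ≡ ℚ.- coeff p n
  coeff-- []      n       = ≡.refl
  coeff-- (a ∷ p) zero    = ≡.refl
  coeff-- (a ∷ p) (suc n) = coeff-- p n

  ≈-refl : ∀ {p} → p ≈ p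
  ≈-refl .at n = ≡.refl

  ≈-sym : ∀ {p q} → p ≈ q → q ≈ p
  ≈-sym e .at n = ≡.sym (e .at n)

  ≈-trans : ∀ {p q r} → p ≈ q → q ≈ r → p ≈ r
  ≈-trans e f .at n = ≡.trans (e .at n) (f .at n)

  ∷-cong : ∀ {a b p q} → a ≡ b → p ≈ q → a ∷ p ≈ b ∷ q
  ∷-cong e f .at zero    = e
  ∷-cong e f .at (suc n) = f .at n

  tail-≈ : ∀ {a b p q} → a ∷ p ≈ b ∷ q → p ≈ q
  tail-≈ e .at n = e .at (suc n)

  ∷-zero : ∀ {a p} → a ≡ 0ℚ → p ≈ [] → a ∷ p ≈ []
  ∷-zero e f .at zero    = e
  ∷-zero e f .at (suc n) = f .at n

  ∷-zero⁻ : ∀ {a p} → a ∷ p ≈ [] → a ≡ 0ℚ × p ≈ []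
  ∷-zero⁻ e = e .at zero , mk≈ λ n → e .at (suc n)

  +-cong : ∀ {p p′ q q′} → p ≈ p′ → q ≈ q′ → p + q ≈ p′ + q′
  +-cong {p} {p′} {q} {q′} e f .at n = ≡.trans (coeff-+ p q n)
    (≡.trans (cong₂ ℚ._+_ (e .at n) (f .at n)) (≡.sym (coeff-+ p′ q′ n)))

  +-comm : ∀ p q → p + q ≈ q + p
  +-comm p q .at n = ≡.trans (coeff-+ p q n)
    (≡.trans (ℚ.+-comm (coeff p n) (coeff q n)) (≡.sym (coeff-+ q p n)))

  +-assoc : ∀ p q r → (p + q) + r ≈ p + (q + r)
  +-assoc p q r .at n = begin
    coeff ((p + q) + r) n                     ≡⟨ coeff-+ (p + q) r n ⟩
    coeff (p + q) n ℚ.+ coeff r n             ≡⟨ cong (ℚ._+ _) (coeff-+ p q n) ⟩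
    coeff p n ℚ.+ coeff q n ℚ.+ coeff r n     ≡⟨ ℚ.+-assoc (coeff p n) (coeff q n) (coeff r n) ⟩
    coeff p n ℚ.+ (coeff q n ℚ.+ coeff r n)   ≡⟨ cong (coeff p n ℚ.+_) (coeff-+ q r n) ⟨
    coeff p n ℚ.+ coeff (q + r) n             ≡⟨ coeff-+ p (q + r) n ⟨
    coeff (p + (q + r)) n                     ∎
    where open ≡.≡-Reasoning

  +-identityʳ : ∀ p → p + [] ≈ p
  +-identityʳ p = +-comm p []

  -‿cong : ∀ {p q} → p ≈ q → - p ≈ - q
  -‿cong {p} {q} e .at n =
    ≡.trans (coeff-- p n) (≡.trans (cong ℚ.-_ (e .at n)) (≡.sym (coeff-- q n)))

  -‿inverseˡ : ∀ p → - p + p ≈ []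
  -‿inverseˡ p .at n = ≡.trans (coeff-+ (- p) p n)
    (≡.trans (cong (ℚ._+ coeff p n) (coeff-- p n)) (ℚ.+-inverseˡ (coeff p n)))

  -‿inverseʳ : ∀ p → p + - p ≈ []
  -‿inverseʳ p = ≈-trans (+-comm p (- p)) (-‿inverseˡ p)

  ·-cong : ∀ {a b p q} → a ≡ b → p ≈ q → a · p ≈ b · q
  ·-cong {a} {b} {p} {q} e f .at n = ≡.trans (coeff-· a p n)
    (≡.trans (cong₂ ℚ._*_ e (f .at n)) (≡.sym (coeff-· b q n)))

  ·-zeroˡ : ∀ p → 0ℚ · p ≈ []
  ·-zeroˡ p .at n = ≡.trans (coeff-· 0ℚ p n) (ℚ.*-zeroˡ (coeff p n))

  ·-identityˡ : ∀ p → 1ℚ · p ≈ p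
  ·-identityˡ p .at n = ≡.trans (coeff-· 1ℚ p n) (ℚ.*-identityˡ (coeff p n))

  ·-distribˡ : ∀ c p q → c · (p + q) ≈ c · p + c · q
  ·-distribˡ c p q .at n = begin
    coeff (c · (p + q)) n                       ≡⟨ coeff-· c (p + q) n ⟩
    c ℚ.* coeff (p + q) n                       ≡⟨ cong (c ℚ.*_) (coeff-+ p q n) ⟩
    c ℚ.* (coeff p n ℚ.+ coeff q n)             ≡⟨ ℚ.*-distribˡ-+ c (coeff p n) (coeff q n) ⟩
    c ℚ.* coeff p n ℚ.+ c ℚ.* coeff q n         ≡⟨ cong₂ ℚ._+_ (coeff-· c p n) (coeff-· c q n) ⟨
    coeff (c · p) n ℚ.+ coeff (c · q) n         ≡⟨ coeff-+ (c · p) (c · q) n ⟨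
    coeff (c · p + c · q) n                     ∎
    where open ≡.≡-Reasoning

  ·-distribʳ : ∀ c d p → (c ℚ.+ d) · p ≈ c · p + d · p
  ·-distribʳ c d p .at n = begin
    coeff ((c ℚ.+ d) · p) n                     ≡⟨ coeff-· (c ℚ.+ d) p n ⟩
    (c ℚ.+ d) ℚ.* coeff p n                     ≡⟨ ℚ.*-distribʳ-+ (coeff p n) c d ⟩
    c ℚ.* coeff p n ℚ.+ d ℚ.* coeff p n         ≡⟨ cong₂ ℚ._+_ (coeff-· c p n) (coeff-· d p n) ⟨
    coeff (c · p) n ℚ.+ coeff (d · p) n         ≡⟨ coeff-+ (c · p) (d · p) n ⟨
    coeff (c · p + d · p) n                     ∎
    where open ≡.≡-Reasoning

  ·-assoc : ∀ c d p → (c ℚ.* d) · p ≈ c · (d · p)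
  ·-assoc c d p .at n = begin
    coeff ((c ℚ.* d) · p) n     ≡⟨ coeff-· (c ℚ.* d) p n ⟩
    c ℚ.* d ℚ.* coeff p n       ≡⟨ ℚ.*-assoc c d (coeff p n) ⟩
    c ℚ.* (d ℚ.* coeff p n)     ≡⟨ cong (c ℚ.*_) (coeff-· d p n) ⟨
    c ℚ.* coeff (d · p) n       ≡⟨ coeff-· c (d · p) n ⟨
    coeff (c · (d · p)) n       ∎
    where open ≡.≡-Reasoning

  polySetoid : Setoid 0ℓ 0ℓ
  polySetoid = record
    { Carrier = Poly ; _≈_ = _≈_
    ; isEquivalence = record { refl = ≈-refl ; sym = ≈-sym ; trans = ≈-trans } }

  private
    module R = SetoidReasoning polySetoid

  interchange : ∀ p q r s → (p + q) + (r + s) ≈ (p + r) + (q + s)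
  interchange p q r s = begin
    (p + q) + (r + s)   ≈⟨ +-assoc p q (r + s) ⟩
    p + (q + (r + s))   ≈⟨ +-cong (≈-refl {p}) (+-assoc q r s) ⟨
    p + ((q + r) + s)   ≈⟨ +-cong (≈-refl {p}) (+-cong (+-comm q r) ≈-refl) ⟩
    p + ((r + q) + s)   ≈⟨ +-cong (≈-refl {p}) (+-assoc r q s) ⟩
    p + (r + (q + s))   ≈⟨ +-assoc p r (q + s) ⟨
    (p + r) + (q + s)   ∎
    where open R

  *-congʳ : ∀ p {q q′} → q ≈ q′ → p * q ≈ p * q′
  *-congʳ []      e = ≈-refl
  *-congʳ (a ∷ p) e = +-cong (·-cong {a} ≡.refl e) (∷-cong ≡.refl (*-congʳ p e))

  *-≈0 : ∀ {p} → p ≈ [] → ∀ q → p * q ≈ []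
  *-≈0 {[]}    e q = ≈-refl
  *-≈0 {a ∷ p} e q with ≡.refl , f ← ∷-zero⁻ e =
    +-cong {0ℚ · q} {[]} {_} {[]} (·-zeroˡ q) (∷-zero ≡.refl (*-≈0 f q))

  *-congˡ : ∀ {p p′} → p ≈ p′ → ∀ q → p * q ≈ p′ * q
  *-congˡ {[]}    {p′}     e q = ≈-sym (*-≈0 (≈-sym e) q)
  *-congˡ {a ∷ p} {[]}     e q = *-≈0 e q
  *-congˡ {a ∷ p} {b ∷ p′} e q =
    +-cong (·-cong (e .at zero) ≈-refl) (∷-cong ≡.refl (*-congˡ (tail-≈ e) q))

  *-cong : ∀ {p p′ q q′} → p ≈ p′ → q ≈ q′ → p * q ≈ p′ * q′
  *-cong {p} {p′} {q} {q′} e f = ≈-trans (*-congʳ p f) (*-congˡ e q′)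

  *-distribˡ : ∀ p q r → p * (q + r) ≈ p * q + p * r
  *-distribˡ []      q r = ≈-refl
  *-distribˡ (a ∷ p) q r = begin
    a · (q + r) + (0ℚ ∷ p * (q + r))                 ≈⟨ +-cong (·-distribˡ a q r) (∷-cong (≡.sym (ℚ.+-identityˡ 0ℚ)) (*-distribˡ p q r)) ⟩
    (a · q + a · r) + ((0ℚ ∷ p * q) + (0ℚ ∷ p * r))  ≈⟨ interchange (a · q) _ _ _ ⟩
    (a · q + (0ℚ ∷ p * q)) + (a · r + (0ℚ ∷ p * r))  ∎
    where open R

  *-zeroʳ : ∀ p → p * [] ≈ []
  *-zeroʳ []      = ≈-refl
  *-zeroʳ (a ∷ p) = ∷-zero ≡.refl (*-zeroʳ p)

  *-∷ʳ : ∀ p b q → p * (b ∷ q) ≈ b · p + (0ℚ ∷ p * q)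
  *-∷ʳ []      b q = ≈-sym (∷-zero ≡.refl ≈-refl)
  *-∷ʳ (a ∷ p) b q = ∷-cong (cong (ℚ._+ 0ℚ) (ℚ.*-comm a b)) (begin
    a · q + p * (b ∷ q)              ≈⟨ +-cong (≈-refl {a · q}) (*-∷ʳ p b q) ⟩
    a · q + (b · p + (0ℚ ∷ p * q))   ≈⟨ +-assoc (a · q) (b · p) _ ⟨
    (a · q + b · p) + (0ℚ ∷ p * q)   ≈⟨ +-cong (+-comm (a · q) (b · p)) ≈-refl ⟩
    (b · p + a · q) + (0ℚ ∷ p * q)   ≈⟨ +-assoc (b · p) (a · q) _ ⟩
    b · p + (a · q + (0ℚ ∷ p * q))   ∎)
    where open R

  *-comm : ∀ p q → p * q ≈ q * p
  *-comm []      q = ≈-sym (*-zeroʳ q)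
  *-comm (a ∷ p) q = ≈-trans
    (+-cong (≈-refl {a · q}) (∷-cong ≡.refl (*-comm p q))) (≈-sym (*-∷ʳ q a p))

  *-distribʳ : ∀ r p q → (p + q) * r ≈ p * r + q * r
  *-distribʳ r p q = ≈-trans (*-comm (p + q) r)
    (≈-trans (*-distribˡ r p q) (+-cong (*-comm r p) (*-comm r q)))

  ·-*-assoc : ∀ c p q → (c · p) * q ≈ c · (p * q)
  ·-*-assoc c []      q = ≈-refl
  ·-*-assoc c (a ∷ p) q = begin
    (c ℚ.* a) · q + (0ℚ ∷ (c · p) * q)          ≈⟨ +-cong (·-assoc c a q) (∷-cong (≡.sym (ℚ.*-zeroʳ c)) (·-*-assoc c p q)) ⟩
    c · (a · q) + c · (0ℚ ∷ p * q)              ≈⟨ ·-distribˡ c (a · q) _ ⟨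
    c · (a · q + (0ℚ ∷ p * q))                  ∎
    where open R

  0∷-* : ∀ p q → (0ℚ ∷ p) * q ≈ 0ℚ ∷ p * q
  0∷-* p q = +-cong {0ℚ · q} {[]} (·-zeroˡ q) ≈-refl

  *-assoc : ∀ p q r → (p * q) * r ≈ p * (q * r)
  *-assoc []      q r = ≈-refl
  *-assoc (a ∷ p) q r = begin
    (a · q + (0ℚ ∷ p * q)) * r             ≈⟨ *-distribʳ r (a · q) (0ℚ ∷ p * q) ⟩
    (a · q) * r + (0ℚ ∷ p * q) * r         ≈⟨ +-cong (·-*-assoc a q r) (0∷-* (p * q) r) ⟩
    a · (q * r) + (0ℚ ∷ (p * q) * r)       ≈⟨ +-cong (≈-refl {a · (q * r)}) (∷-cong ≡.refl (*-assoc p q r)) ⟩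
    a · (q * r) + (0ℚ ∷ p * (q * r))       ∎
    where open R

  *-identityˡ : ∀ p → 1P * p ≈ p
  *-identityˡ p = ≈-trans (+-cong (·-identityˡ p) (∷-zero ≡.refl ≈-refl)) (+-identityʳ p)

  *-identityʳ : ∀ p → p * 1P ≈ p
  *-identityʳ p = ≈-trans (*-comm p 1P) (*-identityˡ p)

  isCommutativeRing : IsCommutativeRing _≈_ _+_ _*_ -_ 0P 1P
  isCommutativeRing = record
    { isRing = record
      { +-isAbelianGroup = record
        { isGroup = record
          { isMonoid = record
            { isSemigroup = record
              { isMagma = record
                { isEquivalence = record { refl = ≈-refl ; sym = ≈-sym ; trans = ≈-trans }
                ; ∙-cong = +-cong }
              ; assoc = +-assoc }
            ; identity = (λ p → ≈-refl) , +-identityʳ }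
          ; inverse = -‿inverseˡ , -‿inverseʳ
          ; ⁻¹-cong = -‿cong }
        ; comm = +-comm }
      ; *-cong = *-cong
      ; *-assoc = *-assoc
      ; *-identity = *-identityˡ , *-identityʳ
      ; distrib = *-distribˡ , *-distribʳ }
    ; *-comm = *-comm }

  ℚ[α] : CommutativeRing 0ℓ 0ℓ
  ℚ[α] = record { isCommutativeRing = isCommutativeRing }

  ℚ-integral : ∀ a b → a ≢ 0ℚ → a ℚ.* b ≡ 0ℚ → b ≡ 0ℚ
  ℚ-integral a b a≢0 ab≡0 = begin
    b                        ≡⟨ ℚ.*-identityˡ b ⟨
    1ℚ ℚ.* b                 ≡⟨ cong (ℚ._* b) (ℚ.*-inverseˡ a) ⟨
    ℚ.1/ a ℚ.* a ℚ.* b       ≡⟨ ℚ.*-assoc (ℚ.1/ a) a b ⟩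
    ℚ.1/ a ℚ.* (a ℚ.* b)     ≡⟨ cong (ℚ.1/ a ℚ.*_) ab≡0 ⟩
    ℚ.1/ a ℚ.* 0ℚ            ≡⟨ ℚ.*-zeroʳ (ℚ.1/ a) ⟩
    0ℚ                       ∎
    where
    open ≡.≡-Reasoning
    instance _ = ℚ.≢-nonZero a≢0

  integral : ∀ p q → p * q ≈ [] → p ≈ [] ⊎ q ≈ []
  integral []      q       e = inj₁ ≈-refl
  integral (a ∷ p) q       e with a ℚ.≟ 0ℚ
  integral (a ∷ p) q       e | yes ≡.refl =
    [ (λ f → inj₁ (∷-zero ≡.refl f)) , inj₂ ]′
      (integral p q (proj₂ (∷-zero⁻ (≈-trans (≈-sym (0∷-* p q)) e))))
  integral (a ∷ p) []      e | no a≢0 = inj₂ ≈-refl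
  integral (a ∷ p) (b ∷ q) e | no a≢0
    with ≡.refl ← ℚ-integral a b a≢0
                  (≡.trans (≡.sym (ℚ.+-identityʳ (a ℚ.* b))) (e .at zero)) =
    [ inj₁ , (λ f → inj₂ (∷-zero ≡.refl f)) ]′ (integral (a ∷ p) q
      (proj₂ (∷-zero⁻ (≈-trans (≈-sym
        (≈-trans (*-∷ʳ (a ∷ p) 0ℚ q) (+-cong {0ℚ · (a ∷ p)} {[]} (·-zeroˡ (a ∷ p)) ≈-refl))) e))))

module RationalFunctions where

  open Polynomials using (Poly; ℚ[α]; integral)
  open CommutativeRing ℚ[α] hiding (Carrier; ring; isCommutativeRing)
  private
    module P = CommutativeRing ℚ[α]
    module R = SetoidReasoning P.setoid

    ring : ACR.AlmostCommutativeRing 0ℓ 0ℓ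
    ring = ACR.fromCommutativeRing ℚ[α] (λ _ → nothing)
  open import Algebra.Properties.Ring P.ring using (-‿distribˡ-*; -‿distribʳ-*)
  open import Algebra.Properties.Group P.+-group using (x∙y⁻¹≈ε⇒x≈y)

  open import Tactic.RingSolver.NonReflective ring using (solve; _⊜_; _⊕_; _⊗_)

  record ℚ⟨α⟩ : Set where
    no-eta-equality; pattern
    constructor mk
    field
      num   : Poly
      den   : Poly
      den≉0 : ¬ den ≈ 0#
  open ℚ⟨α⟩ public

  infix 4 _≃_
  record _≃_ (f g : ℚ⟨α⟩) : Set where
    constructor mk≃
    field cross : num f * den g ≈ num g * den f
  open _≃_ public

  *-≉0 : ∀ {p q} → ¬ p ≈ 0# → ¬ q ≈ 0# → ¬ p * q ≈ 0#
  *-≉0 {p} {q} p≉0 q≉0 e = [ p≉0 , q≉0 ]′ (integral p q e)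

  1≉0 : ¬ 1# ≈ 0#
  1≉0 e with () ← e .Polynomials.at 0

  cancelˡ : ∀ p {q r} → ¬ p ≈ 0# → p * q ≈ p * r → q ≈ r
  cancelˡ p {q} {r} p≉0 e =
    [ (λ p≈0 → contradiction p≈0 p≉0) , x∙y⁻¹≈ε⇒x≈y q r ]′ (integral p (q + - r) (begin
      p * (q + - r)        ≈⟨ distribˡ p q (- r) ⟩
      p * q + p * - r      ≈⟨ +-cong e (sym (-‿distribʳ-* p r)) ⟩
      p * r + - (p * r)    ≈⟨ -‿inverseʳ (p * r) ⟩
      0#                   ∎))
    where open R

  infixl 6 _+ᶠ_
  infixl 7 _*ᶠ_
  infix  8 -ᶠ_

  _+ᶠ_ _*ᶠ_ : ℚ⟨α⟩ → ℚ⟨α⟩ → ℚ⟨α⟩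
  mk a b b≉0 +ᶠ mk c d d≉0 = mk (a * d + c * b) (b * d) (*-≉0 b≉0 d≉0)
  mk a b b≉0 *ᶠ mk c d d≉0 = mk (a * c) (b * d) (*-≉0 b≉0 d≉0)

  -ᶠ_ : ℚ⟨α⟩ → ℚ⟨α⟩
  -ᶠ mk a b b≉0 = mk (- a) b b≉0

  ⌜_⌝ : Poly → ℚ⟨α⟩
  ⌜ p ⌝ = mk p 1# 1≉0

  ≃-refl : ∀ {f} → f ≃ f
  ≃-refl .cross = refl

  ≃-sym : ∀ {f g} → f ≃ g → g ≃ f
  ≃-sym e .cross = sym (e .cross)

  ≃-trans : ∀ {f g h} → f ≃ g → g ≃ h → f ≃ h
  ≃-trans {mk a b _} {mk c d d≉0} {mk e f _} p q .cross = cancelˡ d d≉0 (begin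
    d * (a * f)   ≈⟨ solve 3 (λ x y z → x ⊗ (y ⊗ z) ⊜ (y ⊗ x) ⊗ z) refl d a f ⟩
    (a * d) * f   ≈⟨ *-congʳ (p .cross) ⟩
    (c * b) * f   ≈⟨ solve 3 (λ x y z → (x ⊗ y) ⊗ z ⊜ (x ⊗ z) ⊗ y) refl c b f ⟩
    (c * f) * b   ≈⟨ *-congʳ (q .cross) ⟩
    (e * d) * b   ≈⟨ solve 3 (λ x y z → (x ⊗ y) ⊗ z ⊜ y ⊗ (x ⊗ z)) refl e d b ⟩
    d * (e * b)   ∎)
    where open R

  +ᶠ-cong : ∀ {f f′ g g′} → f ≃ f′ → g ≃ g′ → f +ᶠ g ≃ f′ +ᶠ g′
  +ᶠ-cong {mk a b _} {mk a′ b′ _} {mk c d _} {mk c′ d′ _} p q .cross = begin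
    (a * d + c * b) * (b′ * d′)
      ≈⟨ solve 6 (λ a b c d b′ d′ → (a ⊗ d ⊕ c ⊗ b) ⊗ (b′ ⊗ d′) ⊜ ((a ⊗ b′) ⊗ (d ⊗ d′) ⊕ (c ⊗ d′) ⊗ (b ⊗ b′))) refl a b c d b′ d′ ⟩
    (a * b′) * (d * d′) + (c * d′) * (b * b′)
      ≈⟨ +-cong (*-congʳ (p .cross)) (*-congʳ (q .cross)) ⟩
    (a′ * b) * (d * d′) + (c′ * d) * (b * b′)
      ≈⟨ solve 6 (λ a′ b c′ d b′ d′ → ((a′ ⊗ b) ⊗ (d ⊗ d′) ⊕ (c′ ⊗ d) ⊗ (b ⊗ b′)) ⊜ (a′ ⊗ d′ ⊕ c′ ⊗ b′) ⊗ (b ⊗ d)) refl a′ b c′ d b′ d′ ⟩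
    (a′ * d′ + c′ * b′) * (b * d) ∎
    where open R

  *ᶠ-cong : ∀ {f f′ g g′} → f ≃ f′ → g ≃ g′ → f *ᶠ g ≃ f′ *ᶠ g′
  *ᶠ-cong {mk a b _} {mk a′ b′ _} {mk c d _} {mk c′ d′ _} p q .cross = begin
    (a * c) * (b′ * d′)     ≈⟨ solve 4 (λ a c b′ d′ → (a ⊗ c) ⊗ (b′ ⊗ d′) ⊜ (a ⊗ b′) ⊗ (c ⊗ d′)) refl a c b′ d′ ⟩
    (a * b′) * (c * d′)     ≈⟨ *-cong (p .cross) (q .cross) ⟩
    (a′ * b) * (c′ * d)     ≈⟨ solve 4 (λ a c b′ d′ → (a ⊗ b′) ⊗ (c ⊗ d′) ⊜ (a ⊗ c) ⊗ (b′ ⊗ d′)) refl a′ c′ b d ⟩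
    (a′ * c′) * (b * d)     ∎
    where open R

  -ᶠ‿cong : ∀ {f g} → f ≃ g → -ᶠ f ≃ -ᶠ g
  -ᶠ‿cong {mk a b _} {mk c d _} p .cross = begin
    - a * d     ≈⟨ -‿distribˡ-* a d ⟨
    - (a * d)   ≈⟨ -‿cong (p .cross) ⟩
    - (c * b)   ≈⟨ -‿distribˡ-* c b ⟩
    - c * b     ∎
    where open R

  -ᶠ‿inverseˡ : ∀ f → -ᶠ f +ᶠ f ≃ ⌜ 0# ⌝
  -ᶠ‿inverseˡ (mk a b _) .cross = begin
    (- a * b + a * b) * 1#  ≈⟨ *-identityʳ _ ⟩
    - a * b + a * b         ≈⟨ distribʳ b (- a) a ⟨
    (- a + a) * b           ≈⟨ *-congʳ (-‿inverseˡ a) ⟩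
    0# * b                  ≈⟨ zeroˡ b ⟩
    0#                      ≈⟨ zeroˡ (b * b) ⟨
    0# * (b * b)            ∎
    where open R

  +ᶠ-comm : ∀ f g → f +ᶠ g ≃ g +ᶠ f
  +ᶠ-comm (mk a b _) (mk c d _) .cross = solve 4
    (λ a b c d → (a ⊗ d ⊕ c ⊗ b) ⊗ (d ⊗ b) ⊜ (c ⊗ b ⊕ a ⊗ d) ⊗ (b ⊗ d)) refl a b c d

  +ᶠ-assoc : ∀ f g h → (f +ᶠ g) +ᶠ h ≃ f +ᶠ (g +ᶠ h)
  +ᶠ-assoc (mk a b _) (mk c d _) (mk e f _) .cross = solve 6
    (λ a b c d e f → ((a ⊗ d ⊕ c ⊗ b) ⊗ f ⊕ e ⊗ (b ⊗ d)) ⊗ (b ⊗ (d ⊗ f))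
                   ⊜ (a ⊗ (d ⊗ f) ⊕ (c ⊗ f ⊕ e ⊗ d) ⊗ b) ⊗ ((b ⊗ d) ⊗ f)) refl a b c d e f

  +ᶠ-identityˡ : ∀ f → ⌜ 0# ⌝ +ᶠ f ≃ f
  +ᶠ-identityˡ (mk a b _) .cross = begin
    (0# * b + a * 1#) * b   ≈⟨ *-congʳ (+-cong (zeroˡ b) (*-identityʳ a)) ⟩
    (0# + a) * b            ≈⟨ *-cong (+-identityˡ a) (sym (*-identityˡ b)) ⟩
    a * (1# * b)            ∎
    where open R

  *ᶠ-comm : ∀ f g → f *ᶠ g ≃ g *ᶠ f
  *ᶠ-comm (mk a b _) (mk c d _) .cross = *-cong (*-comm a c) (*-comm d b)

  *ᶠ-assoc : ∀ f g h → (f *ᶠ g) *ᶠ h ≃ f *ᶠ (g *ᶠ h)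
  *ᶠ-assoc (mk a b _) (mk c d _) (mk e f _) .cross =
    *-cong (*-assoc a c e) (sym (*-assoc b d f))

  *ᶠ-identityˡ : ∀ f → ⌜ 1# ⌝ *ᶠ f ≃ f
  *ᶠ-identityˡ (mk a b _) .cross = *-cong (*-identityˡ a) (sym (*-identityˡ b))

  distribᶠˡ : ∀ f g h → f *ᶠ (g +ᶠ h) ≃ f *ᶠ g +ᶠ f *ᶠ h
  distribᶠˡ (mk a b _) (mk c d _) (mk e f _) .cross = solve 6
    (λ a b c d e f → (a ⊗ (c ⊗ f ⊕ e ⊗ d)) ⊗ ((b ⊗ d) ⊗ (b ⊗ f))
                   ⊜ ((a ⊗ c) ⊗ (b ⊗ f) ⊕ (a ⊗ e) ⊗ (b ⊗ d)) ⊗ (b ⊗ (d ⊗ f))) refl a b c d e f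

  isCommutativeRing : IsCommutativeRing _≃_ _+ᶠ_ _*ᶠ_ -ᶠ_ ⌜ 0# ⌝ ⌜ 1# ⌝
  isCommutativeRing = record
    { isRing = record
      { +-isAbelianGroup = record
        { isGroup = record
          { isMonoid = record
            { isSemigroup = record
              { isMagma = record
                { isEquivalence = record { refl = ≃-refl ; sym = ≃-sym ; trans = ≃-trans }
                ; ∙-cong = +ᶠ-cong }
              ; assoc = +ᶠ-assoc }
            ; identity = +ᶠ-identityˡ , λ f → ≃-trans (+ᶠ-comm f ⌜ 0# ⌝) (+ᶠ-identityˡ f) }
          ; inverse = -ᶠ‿inverseˡ , λ f → ≃-trans (+ᶠ-comm f (-ᶠ f)) (-ᶠ‿inverseˡ f)
          ; ⁻¹-cong = -ᶠ‿cong }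
        ; comm = +ᶠ-comm }
      ; *-cong = *ᶠ-cong
      ; *-assoc = *ᶠ-assoc
      ; *-identity = *ᶠ-identityˡ , λ f → ≃-trans (*ᶠ-comm f ⌜ 1# ⌝) (*ᶠ-identityˡ f)
      ; distrib = distribᶠˡ , λ h f g → ≃-trans (*ᶠ-comm (f +ᶠ g) h)
          (≃-trans (distribᶠˡ h f g) (+ᶠ-cong (*ᶠ-comm h f) (*ᶠ-comm h g))) }
    ; *-comm = *ᶠ-comm }

  ℚ⟨α⟩-commutativeRing : CommutativeRing 0ℓ 0ℓ
  ℚ⟨α⟩-commutativeRing = record { isCommutativeRing = isCommutativeRing }

record Partition : Set where
  constructor mkPartition
  field
    parts      : List ℕ
    decreasing : Linked _≥_ parts
    positive   : All (1 ≤_) parts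
open Partition public

parts-injective : ∀ {lam μ} → parts lam ≡ parts μ → lam ≡ μ
parts-injective {mkPartition a d p} {mkPartition .a e q} ≡.refl =
  cong₂ (mkPartition a) (Linked.irrelevant ℕ.≤-irrelevant d e) (All.irrelevant ℕ.≤-irrelevant p q)

-- Rows and columns are numbered from 1; the entry at index 0 is a dummy.
entry : List ℕ → ℕ → ℕ
entry []      _             = 0
entry (a ∷ _) zero          = 0
entry (a ∷ _) (suc zero)    = a
entry (_ ∷ a) (suc (suc i)) = entry a (suc i)

infixl 9 _[_] _ᵗ[_]

_[_] : Partition → ℕ → ℕ
lam [ i ] = entry (parts lam) i

-- lam ᵗ[ j ] is the j-th part of the transposed partition: #{ i | lam [ i ] ≥ j }.
_ᵗ[_] : Partition → ℕ → ℕ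
lam ᵗ[ j ] = length (filter (j ℕ.≤?_) (parts lam))

ℓ : Partition → ℕ
ℓ lam = length (parts lam)

size : Partition → ℕ
size lam = sum (parts lam)

1⋯ : ℕ → List ℕ
1⋯ n = applyUpTo suc n

diagram : Partition → List (ℕ × ℕ)
diagram lam = concatMap (λ i → map (i ,_) (1⋯ (lam [ i ]))) (1⋯ (ℓ lam))

infix 4 _⊂_ _⊴_

_⊂_ : Partition → Partition → Set
μ ⊂ lam = diagram μ ⊆ diagram lam

_⊴_ : Partition → Partition → Set
μ ⊴ lam = size μ ≡ size lam × (∀ k → sum (take k (parts μ)) ≤ sum (take k (parts lam)))

infixr 6 _∪_

_∪_ : Partition → Partition → Partition
(μ ∪ ν) .parts      = merge (λ a b → b ℕ.≤? a) (parts μ) (parts ν)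
(μ ∪ ν) .decreasing = Sorted.merge⁺ ≥-decTotalOrder (decreasing μ) (decreasing ν)
(μ ∪ ν) .positive   = Perm.All-resp-↭ (↭-sym (Perm.merge-↭ _ (parts μ) (parts ν)))
                        (All.++⁺ (positive μ) (positive ν))

1^ : ℕ → Partition
1^ n .parts      = replicate n 1
1^ n .decreasing = go n
  where
  go : ∀ n → Linked _≥_ (replicate n 1)
  go zero          = []
  go (suc zero)    = [-]
  go (suc (suc n)) = ℕ.≤-refl ∷ go (suc n)
1^ n .positive   = All.replicate⁺ n ℕ.≤-refl

multiplicity : ℕ → Partition → ℕ
multiplicity i lam = length (filter (i ℕ.≟_) (parts lam))

-- No part exceeds the size, so all factors with i > size are 1.
z u : Partition → ℕ
z lam = product (map (λ i → i ℕ.^ multiplicity i lam ℕ.* multiplicity i lam !) (1⋯ (size lam)))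
u lam = product (map (λ i → multiplicity i lam !) (1⋯ (size lam)))

u≢0 : ∀ lam → NonZero (u lam)
u≢0 lam = product≢0 (All.map⁺ (All.universal (λ i → multiplicity i lam ℕ.!≢0) (1⋯ (size lam))))

nonzeros : List ℕ → List ℕ
nonzeros = filter (1 ℕ.≤?_)

-- The partition obtained by sorting the nonzero exponents of a monomial.
shape : List ℕ → Partition
shape a = record
  { parts      = sort (nonzeros a)
  ; decreasing = sort-↗ (nonzeros a)
  ; positive   = Perm.All-resp-↭ (↭-sym (sort-↭ (nonzeros a))) (All.all-filter (1 ℕ.≤?_) a)
  }
  where open Sort.SortingAlgorithm (InsertionSort.insertionSort ≥-decTotalOrder)

open RationalFunctions public using (ℚ⟨α⟩; ⌜_⌝; ℚ⟨α⟩-commutativeRing)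
open CommutativeRing ℚ⟨α⟩-commutativeRing public using (_≈_; _+_; _*_; 0#; 1#)
open import Algebra.Properties.Semiring.Exp (CommutativeRing.semiring ℚ⟨α⟩-commutativeRing) public using (_^_)
private
  module K = CommutativeRing ℚ⟨α⟩-commutativeRing

  module R = SetoidReasoning K.setoid

ℕ→ℚ : ℕ → ℚ
ℕ→ℚ n = ℤ.+ n ℚ./ 1

const : ℚ → ℚ⟨α⟩
const c = ⌜ c ∷ [] ⌝

fromℕ : ℕ → ℚ⟨α⟩
fromℕ n = const (ℕ→ℚ n)

α : ℚ⟨α⟩
α = ⌜ 0ℚ ∷ 1ℚ ∷ [] ⌝

∑ ∏ : {A : Set} → List A → (A → ℚ⟨α⟩) → ℚ⟨α⟩
∑ xs f = foldr (λ x s → f x + s) 0# xs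
∏ xs f = foldr (λ x s → f x * s) 1# xs

indicator : {P : Set} → Dec P → ℚ⟨α⟩
indicator d = if does d then 1# else 0#

∑-cong : ∀ {A : Set} (xs : List A) {f g : A → ℚ⟨α⟩} → (∀ x → f x ≈ g x) → ∑ xs f ≈ ∑ xs g
∑-cong []       e = K.refl
∑-cong (x ∷ xs) e = K.+-cong (e x) (∑-cong xs e)

∑-zero : ∀ {A : Set} (xs : List A) {f : A → ℚ⟨α⟩} → (∀ {x} → x ∈ xs → f x ≈ 0#) → ∑ xs f ≈ 0#
∑-zero []       e = K.refl
∑-zero (x ∷ xs) e =
  K.trans (K.+-cong (e (here ≡.refl)) (∑-zero xs (λ m → e (there m)))) (K.+-identityˡ 0#)

∑-+ : ∀ {A : Set} (xs : List A) (f g : A → ℚ⟨α⟩) → ∑ xs f + ∑ xs g ≈ ∑ xs (λ x → f x + g x)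
∑-+ []       f g = K.+-identityˡ 0#
∑-+ (x ∷ xs) f g = begin
  (f x + ∑ xs f) + (g x + ∑ xs g)      ≈⟨ interchange (f x) (∑ xs f) (g x) (∑ xs g) ⟩
  (f x + g x) + (∑ xs f + ∑ xs g)      ≈⟨ K.+-congˡ {f x + g x} (∑-+ xs f g) ⟩
  (f x + g x) + ∑ xs (λ x → f x + g x) ∎
  where
  open R
  open import Algebra.Properties.CommutativeSemigroup K.+-commutativeSemigroup using (interchange)

∑-swap : ∀ {A B : Set} (xs : List A) (ys : List B) (f : A → B → ℚ⟨α⟩) →
         ∑ xs (λ x → ∑ ys (f x)) ≈ ∑ ys (λ y → ∑ xs (λ x → f x y))
∑-swap []       ys f = K.sym (∑-zero ys (λ _ → K.refl))
∑-swap (x ∷ xs) ys f = K.trans (K.+-congˡ {∑ ys (f x)} (∑-swap xs ys f))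
  (∑-+ ys (f x) (λ y → ∑ xs (λ x → f x y)))

indicator-⇔ : ∀ {P Q : Set} (d : Dec P) (e : Dec Q) → (P → Q) → (Q → P) → indicator d ≈ indicator e
indicator-⇔ (yes p) (yes q) f g = K.refl
indicator-⇔ (yes p) (no ¬q) f g = contradiction (f p) ¬q
indicator-⇔ (no ¬p) (yes q) f g = contradiction (g q) ¬p
indicator-⇔ (no ¬p) (no ¬q) f g = K.refl

indicator-¬ : ∀ {P : Set} (d : Dec P) → ¬ P → indicator d ≈ 0#
indicator-¬ (yes p) ¬p = contradiction p ¬p
indicator-¬ (no _)  ¬p = K.refl

indicator-yes : ∀ {P : Set} (d : Dec P) → P → indicator d ≈ 1#
indicator-yes (yes _) p = K.refl
indicator-yes (no ¬p) p = contradiction p ¬p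

-- A formal power series in x₁, x₂, … of bounded degree, invariant under
-- permuting the variables.  The list a₁ ∷ … ∷ aₖ stands for the monomial
-- x₁^a₁ ⋯ xₖ^aₖ, so lists differing by trailing zeros are the same monomial.
record Λ : Set where
  field
    coeff     : List ℕ → ℚ⟨α⟩
    pad       : ∀ a → coeff (a ∷ʳ 0) ≈ coeff a
    symmetric : ∀ {a b} → a ↭ b → coeff a ≈ coeff b
    bounded   : ∃ λ d → ∀ a → d < sum a → coeff a ≈ 0#
open Λ public

infix 4 _≈Λ_
_≈Λ_ : Λ → Λ → Set
f ≈Λ g = ∀ a → coeff f a ≈ coeff g a

infixl 6 _+Λ_
infixl 7 _*Λ_ _·_

_+Λ_ : Λ → Λ → Λ
(f +Λ g) .coeff a     = coeff f a + coeff g a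
(f +Λ g) .pad a       = K.+-cong (pad f a) (pad g a)
(f +Λ g) .symmetric p = K.+-cong (symmetric f p) (symmetric g p)
(f +Λ g) .bounded with bounded f | bounded g
... | d , p | e , q = d ℕ.⊔ e , λ a l →
  K.trans (K.+-cong (p a (ℕ.≤-<-trans (ℕ.m≤m⊔n d e) l)) (q a (ℕ.≤-<-trans (ℕ.m≤n⊔m d e) l)))
          (K.+-identityˡ 0#)

_·_ : ℚ⟨α⟩ → Λ → Λ
(c · f) .coeff a     = c * coeff f a
(c · f) .pad a       = K.*-congˡ {c} (pad f a)
(c · f) .symmetric p = K.*-congˡ {c} (symmetric f p)
(c · f) .bounded with bounded f
... | d , p = d , λ a l → K.trans (K.*-congˡ {c} (p a l)) (K.zeroʳ c)

-- The coefficient of x^a in the product of two series: Σ F b * G c over all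
-- exponent vectors b, c with b + c = a.
convolve : (F G : List ℕ → ℚ⟨α⟩) → List ℕ → ℚ⟨α⟩
convolve F G []      = F [] * G []
convolve F G (n ∷ a) = ∑ (upTo (suc n)) λ i → convolve (F ∘ (i ∷_)) (G ∘ (n ∸ i ∷_)) a

convolve-cong : ∀ {F F′ G G′} → (∀ a → F a ≈ F′ a) → (∀ a → G a ≈ G′ a) →
                ∀ a → convolve F G a ≈ convolve F′ G′ a
convolve-cong e f []      = K.*-cong (e []) (f [])
convolve-cong e f (n ∷ a) = ∑-cong (upTo (suc n)) λ i →
  convolve-cong (e ∘ (i ∷_)) (f ∘ (n ∸ i ∷_)) a

Symmetric : (List ℕ → ℚ⟨α⟩) → Set
Symmetric F = ∀ {a b} → a ↭ b → F a ≈ F b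

convolve-↭ : ∀ {F G} → Symmetric F → Symmetric G → Symmetric (convolve F G)
convolve-↭ s t Perm.refl = K.refl
convolve-↭ s t (Perm.prep x p) = ∑-cong (upTo (suc x)) λ i →
  convolve-↭ (s ∘ Perm.prep i) (t ∘ Perm.prep (x ∸ i)) p
convolve-↭ {F} {G} s t (Perm.swap {xs} x y p) = K.trans
  (∑-swap (upTo (suc x)) (upTo (suc y))
    (λ i j → convolve (λ b → F (i ∷ j ∷ b)) (λ b → G (x ∸ i ∷ y ∸ j ∷ b)) xs))
  (∑-cong (upTo (suc y)) λ j → ∑-cong (upTo (suc x)) λ i → K.trans
    (convolve-cong (λ b → s (Perm.swap i j Perm.refl)) (λ b → t (Perm.swap (x ∸ i) (y ∸ j) Perm.refl)) xs)
    (convolve-↭ (λ q → s (Perm.prep j (Perm.prep i q)))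
                (λ q → t (Perm.prep (y ∸ j) (Perm.prep (x ∸ i) q))) p))
convolve-↭ s t (Perm.trans p q) = K.trans (convolve-↭ s t p) (convolve-↭ s t q)

convolve-pad : ∀ {F G} → (∀ a → F (a ∷ʳ 0) ≈ F a) → (∀ a → G (a ∷ʳ 0) ≈ G a) →
               ∀ a → convolve F G (a ∷ʳ 0) ≈ convolve F G a
convolve-pad {F} {G} s t []      = K.trans (K.+-identityʳ (F (0 ∷ []) * G (0 ∷ []))) (K.*-cong (s []) (t []))
convolve-pad s t (n ∷ a) = ∑-cong (upTo (suc n)) λ i →
  convolve-pad (s ∘ (i ∷_)) (t ∘ (n ∸ i ∷_)) a

convolve-zero : ∀ {F G} a → (∀ b c → sum b ℕ.+ sum c ≡ sum a → F b * G c ≈ 0#) →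
                convolve F G a ≈ 0#
convolve-zero []      e = e [] [] ≡.refl
convolve-zero (n ∷ a) e = ∑-zero (upTo (suc n)) λ {i} m →
  convolve-zero a λ b c eq → e (i ∷ b) (n ∸ i ∷ c) (begin
    (i ℕ.+ sum b) ℕ.+ (n ∸ i ℕ.+ sum c)   ≡⟨ interchange i (sum b) (n ∸ i) (sum c) ⟩
    (i ℕ.+ (n ∸ i)) ℕ.+ (sum b ℕ.+ sum c) ≡⟨ cong₂ ℕ._+_ (ℕ.m+[n∸m]≡n (ℕ.≤-pred (∈-upTo⁻ m))) eq ⟩
    n ℕ.+ sum a                           ∎)
  where
  open ≡.≡-Reasoning
  open import Algebra.Properties.CommutativeSemigroup ℕ.+-commutativeSemigroup using (interchange)

_*Λ_ : Λ → Λ → Λ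
(f *Λ g) .coeff     = convolve (coeff f) (coeff g)
(f *Λ g) .pad       = convolve-pad (pad f) (pad g)
(f *Λ g) .symmetric = convolve-↭ (symmetric f) (symmetric g)
(f *Λ g) .bounded with bounded f | bounded g
... | d , p | e , q = d ℕ.+ e , λ a l → convolve-zero a λ b c eq → vanish b c (≡.subst (d ℕ.+ e <_) (≡.sym eq) l)
  where
  vanish : ∀ b c → d ℕ.+ e < sum b ℕ.+ sum c → coeff f b * coeff g c ≈ 0#
  vanish b c l with d ℕ.<? sum b
  ... | yes d<b = K.trans (K.*-congʳ {coeff g c} (p b d<b)) (K.zeroˡ (coeff g c))
  ... | no  d≮b with e ℕ.<? sum c
  ...   | yes e<c = K.trans (K.*-congˡ {coeff f b} (q c e<c)) (K.zeroʳ (coeff f b))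
  ...   | no  e≮c = contradiction (ℕ.+-mono-≤ (ℕ.≮⇒≥ d≮b) (ℕ.≮⇒≥ e≮c)) (ℕ.<⇒≱ l)

nonzeros-pad : ∀ a → nonzeros (a ∷ʳ 0) ≡ nonzeros a
nonzeros-pad a = ≡.trans (List.filter-++ (1 ℕ.≤?_) a (0 ∷ [])) (List.++-identityʳ (nonzeros a))

sum-nonzeros : ∀ a → sum (nonzeros a) ≡ sum a
sum-nonzeros []          = ≡.refl
sum-nonzeros (zero  ∷ a) = sum-nonzeros a
sum-nonzeros (suc n ∷ a) = cong (suc n ℕ.+_) (sum-nonzeros a)

_≟ᴸ_ : (a b : List ℕ) → Dec (a ≡ b)
_≟ᴸ_ = List.≡-dec ℕ._≟_

open Sort.SortingAlgorithm (InsertionSort.insertionSort ≥-decTotalOrder)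

sorted-unique : ∀ lam μ → parts lam ↭ parts μ → parts lam ≡ parts μ
sorted-unique lam μ p =
  Pointwise-≡⇒≡ (Sorted.↗↭↗⇒≋ ≥-totalOrder (decreasing lam) (decreasing μ) (↭⇒↭ₛ p))

shape-↭ : ∀ {a b} → a ↭ b → parts (shape a) ≡ parts (shape b)
shape-↭ {a} {b} p = sorted-unique (shape a) (shape b) (↭-trans (sort-↭ (nonzeros a))
  (↭-trans (Perm.filter-↭ (1 ℕ.≤?_) p) (↭-sym (sort-↭ (nonzeros b)))))

-- m μ is the sum of all distinct monomials whose nonzero exponents are, up to
-- order, the parts of μ.
m : Partition → Λ
m μ .coeff a = indicator (parts (shape a) ≟ᴸ parts μ)
m μ .pad a = K.reflexive (cong (λ b → indicator (sort b ≟ᴸ parts μ)) (nonzeros-pad a))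
m μ .symmetric p = K.reflexive (cong (λ b → indicator (b ≟ᴸ parts μ)) (shape-↭ p))
m μ .bounded = size μ , λ a l → indicator-¬ (parts (shape a) ≟ᴸ parts μ) λ eq →
  ℕ.<-irrefl (≡.trans (cong sum (≡.sym eq)) (≡.trans (sum-↭ (sort-↭ (nonzeros a))) (sum-nonzeros a))) l

-- The power sum Σᵢ xᵢ^r, for r ≥ 1 (power 0 is the zero series and is never used).
power : ℕ → Λ
power r .coeff a = indicator (nonzeros a ≟ᴸ (r ∷ []))
power r .pad a = K.reflexive (cong (λ b → indicator (b ≟ᴸ (r ∷ []))) (nonzeros-pad a))
power r .symmetric {a} {b} p = indicator-⇔ (nonzeros a ≟ᴸ (r ∷ [])) (nonzeros b ≟ᴸ (r ∷ []))
  (λ eq → Perm.↭-singleton-inv (↭-trans (↭-sym (Perm.filter-↭ (1 ℕ.≤?_) p)) (Perm.↭-reflexive eq)))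
  (λ eq → Perm.↭-singleton-inv (↭-trans (Perm.filter-↭ (1 ℕ.≤?_) p) (Perm.↭-reflexive eq)))
power r .bounded = r , λ a l → indicator-¬ (nonzeros a ≟ᴸ (r ∷ [])) λ eq →
  ℕ.<-irrefl (≡.trans (≡.trans (≡.sym (ℕ.+-identityʳ r)) (cong sum (≡.sym eq))) (sum-nonzeros a)) l

1Λ : Λ
1Λ = m (1^ 0)

p : Partition → Λ
p lam = foldr (λ r f → power r *Λ f) 1Λ (parts lam)

-- The coefficient of m μ in f, i.e. the coefficient of the monomial x^μ;
-- see m-expansion.
[m_]_ : Partition → Λ → ℚ⟨α⟩
[m μ ] f = coeff f (parts μ)

coeff-nonzeros : ∀ (F : List ℕ → ℚ⟨α⟩) → (∀ a → F (a ∷ʳ 0) ≈ F a) → Symmetric F → ∀ a → F a ≈ F (nonzeros a)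
coeff-nonzeros F s t []          = K.refl
coeff-nonzeros F s t (zero  ∷ a) = K.trans (t (Perm.∷↭∷ʳ 0 a)) (K.trans (s a) (coeff-nonzeros F s t a))
coeff-nonzeros F s t (suc n ∷ a) =
  coeff-nonzeros (F ∘ (suc n ∷_)) (s ∘ (suc n ∷_)) (t ∘ Perm.prep (suc n)) a

coeff-shape : ∀ f a → coeff f a ≈ [m shape a ] f
coeff-shape f a = K.trans (coeff-nonzeros (coeff f) (pad f) (symmetric f) a)
  (symmetric f (↭-sym (sort-↭ (nonzeros a))))

∑-∈ : ∀ (L : List Partition) → Unique L → ∀ (c : Partition → ℚ⟨α⟩) ν → ν ∈ L →
      ∑ L (λ μ → c μ * indicator (parts ν ≟ᴸ parts μ)) ≈ c ν
∑-∈ (μ ∷ L) (μ∉ ∷ U) c ν (here ≡.refl) = begin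
  c μ * indicator (parts μ ≟ᴸ parts μ) + ∑ L (term μ) ≈⟨ K.+-cong (K.*-congˡ {c μ} (indicator-yes (parts μ ≟ᴸ parts μ) ≡.refl))
      (∑-zero L (λ {κ} κ∈ → K.trans (K.*-congˡ {c κ} (indicator-¬ (parts μ ≟ᴸ parts κ)
        λ eq → All.lookup μ∉ κ∈ (parts-injective eq))) (K.zeroʳ (c κ)))) ⟩
  c μ * 1# + 0#                                 ≈⟨ K.+-identityʳ (c μ * 1#) ⟩
  c μ * 1#                                      ≈⟨ K.*-identityʳ (c μ) ⟩
  c μ                                           ∎
  where
  open R
  term : Partition → Partition → ℚ⟨α⟩
  term ν κ = c κ * indicator (parts ν ≟ᴸ parts κ)
∑-∈ (μ ∷ L) (μ∉ ∷ U) c ν (there ν∈) = begin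
  c μ * indicator (parts ν ≟ᴸ parts μ) + ∑ L (term ν) ≈⟨ K.+-cong (K.trans (K.*-congˡ {c μ} (indicator-¬ (parts ν ≟ᴸ parts μ)
        λ eq → All.lookup μ∉ ν∈ (parts-injective (≡.sym eq)))) (K.zeroʳ (c μ))) (∑-∈ L U c ν ν∈) ⟩
  0# + c ν                                      ≈⟨ K.+-identityˡ (c ν) ⟩
  c ν                                           ∎
  where
  open R
  term : Partition → Partition → ℚ⟨α⟩
  term ν κ = c κ * indicator (parts ν ≟ᴸ parts κ)

m-expansion : ∀ f (L : List Partition) → Unique L → (∀ μ → μ ∈ L ⊎ [m μ ] f ≈ 0#) →
              ∀ a → coeff f a ≈ ∑ L (λ μ → [m μ ] f * coeff (m μ) a)
m-expansion f L U cover a with cover (shape a)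
... | inj₁ s∈ = K.trans (coeff-shape f a) (K.sym (∑-∈ L U (λ μ → [m μ ] f) (shape a) s∈))
... | inj₂ v0 = K.trans (K.trans (coeff-shape f a) v0) (K.sym (∑-zero L λ {κ} _ → zero-term κ))
  where
  zero-term : ∀ κ → [m κ ] f * indicator (parts (shape a) ≟ᴸ parts κ) ≈ 0#
  zero-term κ with parts (shape a) ≟ᴸ parts κ
  ... | yes eq = K.trans (K.*-identityʳ ([m κ ] f)) (≡.subst (λ b → coeff f b ≈ 0#) eq v0)
  ... | no  _  = K.zeroʳ ([m κ ] f)

-- The p lam form a basis of Λ, so these laws determine the form.
record JackScalarProduct : Set where
  field
    ⟨_,_⟩      : Λ → Λ → ℚ⟨α⟩
    ⟨⟩-cong    : ∀ {f f′ g g′} → f ≈Λ f′ → g ≈Λ g′ → ⟨ f , g ⟩ ≈ ⟨ f′ , g′ ⟩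
    ⟨⟩-comm    : ∀ f g → ⟨ f , g ⟩ ≈ ⟨ g , f ⟩
    linear-+   : ∀ f g h → ⟨ f +Λ g , h ⟩ ≈ ⟨ f , h ⟩ + ⟨ g , h ⟩
    linear-·   : ∀ c f g → ⟨ c · f , g ⟩ ≈ c * ⟨ f , g ⟩
    orthogonal : ∀ {lam μ} → lam ≢ μ → ⟨ p lam , p μ ⟩ ≈ 0#
    norm       : ∀ lam → ⟨ p lam , p lam ⟩ ≈ fromℕ (z lam) * α ^ ℓ lam

-- These conditions determine J uniquely.  triangular says that J lam is a linear
-- combination of the m μ with μ ⊴ lam.
record JackFunctions (S : JackScalarProduct) : Set where
  open JackScalarProduct S using (⟨_,_⟩)
  field
    J          : Partition → Λ
    orthogonal : ∀ {lam μ} → lam ≢ μ → ⟨ J lam , J μ ⟩ ≈ 0#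
    triangular : ∀ {lam μ} → ¬ μ ⊴ lam → [m μ ] J lam ≈ 0#
    normalized : ∀ lam → [m 1^ (size lam) ] J lam ≈ fromℕ (size lam !)

  v : Partition → Partition → ℚ⟨α⟩
  v lam μ = [m μ ] J lam

  -- The scalar product is nondegenerate, so at most one f satisfies this.
  IsSkewJack : Partition → Partition → Λ → Set
  IsSkewJack lam μ f = ∀ ν → ⟨ f , J ν ⟩ ≈ ⟨ J lam , J μ *Λ J ν ⟩

[m̃_]_ : Partition → Λ → ℚ⟨α⟩
[m̃ ν ] f = const (ℚ._/_ (ℤ.+ 1) (u ν) {{u≢0 ν}}) * ([m ν ] f)

-- Truncated subtraction is exact for boxes of the diagram.
arm leg : Partition → ℕ × ℕ → ℕ
arm μ (i , j) = μ [ i ] ∸ j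
leg μ (i , j) = μ ᵗ[ j ] ∸ i

c′ : Partition → ℚ⟨α⟩
c′ μ = ∏ (diagram μ) λ s → fromℕ (suc (arm μ s)) * α + fromℕ (leg μ s)

IsNonnegativeIntegerPolynomial : ℚ⟨α⟩ → Set
IsNonnegativeIntegerPolynomial f = ∃ λ (P : List ℕ) → f ≈ ⌜ map ℕ→ℚ P ⌝

{-# OPTIONS --safe #-}
module Submission where

-- The Knop–Sahi recursion defines functions f_λ as sums over fillings of the diagram of λ.  Summed
-- over the labels of the empty rows, f_λ becomes a sum of vectors on which the Dunkl operators U_r
-- act triangularly, so f_λ is an eigenvector of D = Σ_r U_r².  Written with power sums and their
-- adjoints, D is self-adjoint, and its eigenvalues separate partitions comparable in dominance
-- order; with the triangularity of f_λ and the positivity of the form this gives J_λ = f_λ.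
--
-- Multiplication by the n-th complete function is adjoint to taking the coefficient of x₁^n, so the
-- coefficient of m_ν in J_{λ/μ} is the product of J_μ with Σ_ρ v_{λ,ρ∪ν} m_ρ.  Only ρ above μ
-- matters, and the hypothesis on the rows of μ then forces ρ = μ; what remains is v_{λ,μ∪ν} C_μ with
-- C_μ = ⟨m_μ , J_μ⟩.  For C_μ = c'_μ remove the first column: in ℓ(μ) variables J_μ is a multiple of
-- e_{ℓ(μ)} times the Jack function of the remaining diagram, and the ratio of the constants is found
-- by pairing with e_{ℓ(μ)} p₁^k.  Since pairing with e_m amounts to evaluation at −α variables, this
-- is a statement on the total weight of fillings, which factors over the rows.
--
-- Integrality: fillings using unused labels of equal exponent have equal weight, which produces the
-- factor u_ρ of v_{λ,ρ}; and u_ν divides u_{μ∪ν}.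

open import Algebra.Bundles using (CommutativeRing; RawRing)
import Algebra.Properties.CommutativeSemigroup as CommutativeSemigroup
import Algebra.Solver.Ring
import Algebra.Solver.Ring.AlmostCommutativeRing as ACR
open import Data.Bool.Base using (Bool; true; false; if_then_else_; not; _∧_; _∨_)
import Data.Bool.Properties as Bool
open import Data.Fin.Base using (Fin; zero; suc; toℕ)
import Data.Fin.Permutation as FinPerm
open import Data.Fin.Permutation.Components using (transpose; transpose-inverse)
import Data.Fin.Properties as Fin
import Data.Integer.Base as ℤ
import Data.Integer.Properties as ℤ
open import Data.List.Base using (List; []; _∷_; _∷ʳ_; _++_; _ʳ++_; map; foldr; filter; length; take; drop; reverse; replicate; concatMap; upTo; applyUpTo)
open import Data.List.Membership.DecPropositional using () renaming (_∈?_ to mem?)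
open import Data.List.Membership.Propositional using (_∈_)
import Data.List.Membership.Propositional.Properties as Mem
import Data.List.Properties as List
open import Data.List.Relation.Binary.Permutation.Propositional as Perm using (_↭_; ↭-sym; ↭-trans)
import Data.List.Relation.Binary.Permutation.Propositional.Properties as Perm
open import Data.List.Relation.Unary.All as All using (All; []; _∷_)
import Data.List.Relation.Unary.All.Properties as All
open import Data.List.Relation.Unary.Any as Any using (here; there)
open import Data.List.Relation.Unary.Linked as Linked using (Linked; []; [-]; _∷_)
import Data.List.Relation.Unary.Linked.Properties as Linked
open import Data.List.Sort.Base using (module SortingAlgorithm)
open import Data.List.Sort.InsertionSort using (insertionSort)
open import Data.Maybe.Base as Maybe using (Maybe; just; nothing)
open import Data.Nat.Base as ℕ using (ℕ; zero; suc; _∸_; _≤_; _<_; _≥_; _!; pred)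
open import Data.Nat.Divisibility using (_∣_; divides; ∣-refl; *-pres-∣; m≤n⇒m!∣n!)
open import Data.Nat.Induction using (<-rec)
open import Data.Nat.ListAction using (product) renaming (sum to sumᴸ)
open import Data.Nat.ListAction.Properties using (sum-↭; sum-++; product≢0)
import Data.Nat.Properties as ℕ
open import Data.Nat.Solver using (module +-*-Solver)
open import Data.Product.Base as Prod using (_×_; _,_; ∃; Σ; proj₁; proj₂)
open import Data.Rational.Base as ℚ using (ℚ; 0ℚ; 1ℚ)
import Data.Rational.Properties as ℚ
import Data.Rational.Unnormalised.Base as ℚᵘ
import Data.Rational.Unnormalised.Properties as ℚᵘ
open import Data.Sum.Base using (_⊎_; inj₁; inj₂; [_,_]′)
open import Data.Unit.Base using (⊤; tt)
open import Data.Vec.Base as Vec using (Vec; []; _∷_; lookup; _[_]≔_; tabulate; fromList; toList)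
import Data.Vec.Properties as Vec
open import Function.Base using (_∘_; id)
open import Level using (0ℓ)
open import Relation.Binary.Definitions using (tri<; tri≈; tri>)
open import Relation.Binary.Properties.DecTotalOrder ℕ.≤-decTotalOrder using (≥-decTotalOrder)
open import Relation.Binary.PropositionalEquality as ≡ using (_≡_; _≢_; cong; cong₂; subst; subst₂)
import Relation.Binary.Reasoning.Setoid as SetoidReasoning
open import Relation.Nullary using (¬_; Dec; yes; no; does; contradiction)
open import Relation.Nullary.Decidable using (dec-true; dec-false; decidable-stable; _×-dec_)

open SortingAlgorithm (insertionSort ≥-decTotalOrder) using (sort; sort-↭)
private
  module ℕ+ = CommutativeSemigroup ℕ.+-commutativeSemigroup

-- The sum of the U_r acts on symmetric functions of degree n as the scalar α n and separates
-- nothing; the sum of the squares is the first symmetric combination that does. Its eigenvalues can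
-- still coincide for incomparable partitions, so the f_λ are shown orthogonal only for comparable
-- pairs. This is enough because the J_λ are given with their orthogonality: J_λ minus a multiple of
-- f_λ lies in the span of the lower f_μ and is orthogonal to all of them. Positivity refers to an
-- ordering of ℚ(α) in which α is a positive infinitesimal; it also shows that leading coefficients
-- and averaging constants do not vanish. Labels are put on empty rows as well, as if there were a
-- column 0. All rows then obey the same rule, and the labelled functions become joint eigenvectors
-- of Cherednik operators. The value -α has its origin in p_k^⊥ e_n = (-1)^(k-1) α e_(n-k), to be
-- compared with the value N of p_k at N ones. Since the total weights are polynomials in N, an
-- identity at all natural N may be read at -α, and there the weight factors.

infixr 5 _⊙_
_⊙_ : ∀ {A : Set} {x y z : A} → x ≡ y → y ≡ z → x ≡ z
_⊙_ = ≡.trans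

-- The Boolean test behind `≤?` treats a first argument zero separately, so the two sides agree only
-- after a case split.
≤?-suc : ∀ k l → does (k ℕ.≤? l) ≡ does (suc k ℕ.≤? suc l)
≤?-suc zero    l = ≡.refl
≤?-suc (suc k) l = ≡.refl

vec-ext : ∀ {A : Set} {n} {a b : Vec A n} → (∀ k → lookup a k ≡ lookup b k) → a ≡ b
vec-ext {a = []}    {[]}    e = ≡.refl
vec-ext {a = x ∷ a} {y ∷ b} e = cong₂ _∷_ (e zero) (vec-ext (e ∘ suc))

lookup-≔ : ∀ {A : Set} {n} (a : Vec A n) i x k →
           lookup (a [ i ]≔ x) k ≡ (if does (k Fin.≟ i) then x else lookup a k)
lookup-≔ a i x k with k Fin.≟ i
... | yes ≡.refl = Vec.lookup∘update i a x
... | no  k≢i    = Vec.lookup∘update′ k≢i a x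

-- Transpositions of indices and of vector entries

module _ {n : ℕ} (i j : Fin n) where

  transpose-left : transpose i j i ≡ j
  transpose-left rewrite dec-true (i Fin.≟ i) ≡.refl = ≡.refl

  transpose-right : transpose i j j ≡ i
  transpose-right with j Fin.≟ i
  ... | yes ≡.refl = ≡.refl
  ... | no  _ rewrite dec-true (j Fin.≟ j) ≡.refl = ≡.refl

  transpose-other : ∀ {k} → k ≢ i → k ≢ j → transpose i j k ≡ k
  transpose-other {k} k≢i k≢j
    rewrite dec-false (k Fin.≟ i) k≢i | dec-false (k Fin.≟ j) k≢j = ≡.refl

transpose-sym : ∀ {n} (i j k : Fin n) → transpose i j k ≡ transpose j i k
transpose-sym i j k = go (k Fin.≟ i) (k Fin.≟ j)
  where
  go : Dec (k ≡ i) → Dec (k ≡ j) → transpose i j k ≡ transpose j i k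
  go (yes ≡.refl) _            = transpose-left i j ⊙ ≡.sym (transpose-right j i)
  go (no  _)      (yes ≡.refl) = transpose-right i j ⊙ ≡.sym (transpose-left j i)
  go (no  k≢i)    (no  k≢j)    = transpose-other i j k≢i k≢j ⊙ ≡.sym (transpose-other j i k≢j k≢i)

transpose-involutive : ∀ {n} (i j k : Fin n) → transpose i j (transpose i j k) ≡ k
transpose-involutive i j k =
  cong (transpose i j) (transpose-sym i j k) ⊙ transpose-inverse i j

transpose-injective : ∀ {n} (i j : Fin n) {k l} → transpose i j k ≡ transpose i j l → k ≡ l
transpose-injective i j {k} {l} e = ≡.sym (transpose-involutive i j k) ⊙
  cong (transpose i j) e ⊙ transpose-involutive i j l

swapᵛ : ∀ {A : Set} {n} → Fin n → Fin n → Vec A n → Vec A n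
swapᵛ i j a = tabulate (lookup a ∘ transpose i j)

lookup-swapᵛ : ∀ {A : Set} {n} (i j : Fin n) (a : Vec A n) k →
               lookup (swapᵛ i j a) k ≡ lookup a (transpose i j k)
lookup-swapᵛ i j a = Vec.lookup∘tabulate (lookup a ∘ transpose i j)

swapᵛ-≔ : ∀ {A : Set} {n} (i j k : Fin n) (a : Vec A n) x →
          swapᵛ i j (a [ k ]≔ x) ≡ swapᵛ i j a [ transpose i j k ]≔ x
swapᵛ-≔ i j k a x = vec-ext λ l → lookup-swapᵛ i j (a [ k ]≔ x) l ⊙
  lookup-≔ a k x (transpose i j l) ⊙ ≡.sym (lookup-≔ (swapᵛ i j a) (transpose i j k) x l ⊙
  cong₂ (λ b y → if b then x else y) (same l) (lookup-swapᵛ i j a l))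
  where
  same : ∀ l → does (l Fin.≟ transpose i j k) ≡ does (transpose i j l Fin.≟ k)
  same l with l Fin.≟ transpose i j k | transpose i j l Fin.≟ k
  ... | yes _ | yes _ = ≡.refl
  ... | no  _ | no  _ = ≡.refl
  ... | yes p | no  q = contradiction (cong (transpose i j) p ⊙ transpose-involutive i j k) q
  ... | no  p | yes q = contradiction (≡.sym (transpose-involutive i j l) ⊙ cong (transpose i j) q) p

-- Ring identities and finite sums

module Ring (R : CommutativeRing 0ℓ 0ℓ) where
  open CommutativeRing R hiding (zero)
  private
    module ≈R = SetoidReasoning setoid
  private
    import Algebra.Properties.Semiring.Sum as SemiringSum
    module Sums = SemiringSum semiring
  open import Algebra.Properties.Semiring.Mult semiring using (×-homo-+; ×1-homo-*) renaming (_×_ to _times_)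
  open import Algebra.Properties.Ring ring using (-‿distribˡ-*; -‿distribʳ-*; -0#≈0#; -‿involutive)
  open import Algebra.Properties.AbelianGroup +-abelianGroup using (⁻¹-∙-comm)
  open import Algebra.Properties.CommutativeSemigroup +-commutativeSemigroup using (interchange)

  infixr 5 _∙_
  _∙_ : ∀ {x y z} → x ≈ y → y ≈ z → x ≈ z
  _∙_ = trans

  cong-≈ : ∀ {A : Set} (f : A → Carrier) {x y} → x ≡ y → f x ≈ f y
  cong-≈ f e = reflexive (cong f e)

  ν : ℕ → Carrier
  ν n = n times 1#

  ν-+ : ∀ m n → ν (m ℕ.+ n) ≈ ν m + ν n
  ν-+ m n = ×-homo-+ 1# m n

  ν-* : ∀ m n → ν (m ℕ.* n) ≈ ν m * ν n
  ν-* = ×1-homo-*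

  private
    normal : ℕ → ℕ → ℕ × ℕ
    normal (suc a) (suc b) = normal a b
    normal a       b       = a , b

    differences : RawRing 0ℓ 0ℓ
    differences = record
      { Carrier = ℕ × ℕ
      ; _≈_ = _≡_
      ; _+_ = λ { (a , b) (c , d) → normal (a ℕ.+ c) (b ℕ.+ d) }
      ; _*_ = λ { (a , b) (c , d) → normal (a ℕ.* c ℕ.+ b ℕ.* d) (a ℕ.* d ℕ.+ b ℕ.* c) }
      ; -_  = λ { (a , b) → b , a }
      ; 0#  = 0 , 0
      ; 1#  = 1 , 0
      }

    module D = RawRing differences

    -- Solver coefficients are integers given as differences. `⟦_⟧` returns `0#` and `1#` themselves
    -- on the two constants, so that goals written with them match by computation.
    ⟦_⟧ᵈ ⟦_⟧ : D.Carrier → Carrier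
    ⟦ a , b ⟧ᵈ = ν a - ν b

    ⟦ 0 , 0 ⟧ = 0#
    ⟦ 1 , 0 ⟧ = 1#
    ⟦ c     ⟧ = ⟦ c ⟧ᵈ

    ⟦⟧≈ : ∀ c → ⟦ c ⟧ ≈ ⟦ c ⟧ᵈ
    ⟦⟧≈ (0 , 0)           = sym (-‿inverseʳ 0#)
    ⟦⟧≈ (0 , suc b)       = refl
    ⟦⟧≈ (1 , 0)           = sym (+-cong (+-identityʳ 1#) -0#≈0# ∙ +-identityʳ 1#)
    ⟦⟧≈ (1 , suc b)       = refl
    ⟦⟧≈ (suc (suc a) , b) = refl

    ⟦normal⟧ : ∀ a b → ⟦ normal a b ⟧ᵈ ≈ ν a - ν b
    ⟦normal⟧ zero    b       = refl
    ⟦normal⟧ (suc a) zero    = refl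
    ⟦normal⟧ (suc a) (suc b) = begin
      ⟦ normal a b ⟧ᵈ  ≈⟨ ⟦normal⟧ a b ⟩
      ν a - ν b  ≈⟨ +-identityˡ _ ⟨
      0# + (ν a - ν b)  ≈⟨ +-congʳ (-‿inverseʳ 1#) ⟨
      (1# - 1#) + (ν a - ν b)  ≈⟨ interchange 1# (- 1#) (ν a) (- ν b) ⟩
      (1# + ν a) + (- 1# - ν b)  ≈⟨ +-congˡ (⁻¹-∙-comm 1# (ν b)) ⟩
      ν (suc a) - ν (suc b)  ∎
      where open ≈R

    +-homoᵈ : ∀ c d → ⟦ c D.+ d ⟧ᵈ ≈ ⟦ c ⟧ᵈ + ⟦ d ⟧ᵈ
    +-homoᵈ (a , b) (c , d) = ⟦normal⟧ (a ℕ.+ c) (b ℕ.+ d) ∙ (begin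
      ν (a ℕ.+ c) - ν (b ℕ.+ d)  ≈⟨ +-cong (ν-+ a c) (-‿cong (ν-+ b d)) ⟩
      (ν a + ν c) - (ν b + ν d)  ≈⟨ +-congˡ (⁻¹-∙-comm (ν b) (ν d)) ⟨
      (ν a + ν c) + (- ν b + - ν d)  ≈⟨ interchange (ν a) (ν c) (- ν b) (- ν d) ⟩
      (ν a - ν b) + (ν c - ν d)  ∎)
      where open ≈R

    *-homoᵈ : ∀ c d → ⟦ c D.* d ⟧ᵈ ≈ ⟦ c ⟧ᵈ * ⟦ d ⟧ᵈ
    *-homoᵈ (a , b) (c , d) = ⟦normal⟧ (a ℕ.* c ℕ.+ b ℕ.* d) (a ℕ.* d ℕ.+ b ℕ.* c) ∙ sym (begin
      (x - y) * (z - w)  ≈⟨ distribˡ (x - y) z (- w) ⟩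
      (x - y) * z + (x - y) * - w  ≈⟨ +-cong (distribʳ z x (- y)) (distribʳ (- w) x (- y)) ⟩
      (x * z + - y * z) + (x * - w + - y * - w)  ≈⟨ +-cong (+-congˡ (sym (-‿distribˡ-* y z))) (+-cong (sym (-‿distribʳ-* x w)) neg²) ⟩
      (x * z + - (y * z)) + (- (x * w) + y * w)  ≈⟨ +-congˡ (+-comm _ _) ⟩
      (x * z + - (y * z)) + (y * w + - (x * w))  ≈⟨ interchange _ _ _ _ ⟩
      (x * z + y * w) + (- (y * z) + - (x * w))  ≈⟨ +-congˡ (+-comm _ _) ⟩
      (x * z + y * w) + (- (x * w) + - (y * z))  ≈⟨ +-congˡ (⁻¹-∙-comm _ _) ⟩
      (x * z + y * w) - (x * w + y * z)  ≈⟨ +-cong (hom a c b d) (-‿cong (hom a d b c)) ⟨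
      ν (a ℕ.* c ℕ.+ b ℕ.* d) - ν (a ℕ.* d ℕ.+ b ℕ.* c) ∎)
      where
      open ≈R
      x = ν a
      y = ν b
      z = ν c
      w = ν d
      neg² : - y * - w ≈ y * w
      neg² = sym (-‿distribˡ-* y (- w)) ∙ -‿cong (sym (-‿distribʳ-* y w)) ∙ -‿involutive (y * w)
      hom : ∀ a c b d → ν (a ℕ.* c ℕ.+ b ℕ.* d) ≈ ν a * ν c + ν b * ν d
      hom a c b d = ν-+ (a ℕ.* c) (b ℕ.* d) ∙ +-cong (ν-* a c) (ν-* b d)

    -‿homoᵈ : ∀ c → ⟦ D.- c ⟧ᵈ ≈ - ⟦ c ⟧ᵈ
    -‿homoᵈ (a , b) = +-comm (ν b) (- ν a) ∙
      +-congˡ (sym (-‿involutive (ν b))) ∙ ⁻¹-∙-comm (ν a) (- ν b)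

    morphism : differences ACR.-Raw-AlmostCommutative⟶ ACR.fromCommutativeRing R
    morphism = record
      { ⟦_⟧    = ⟦_⟧
      ; +-homo = λ c d → (⟦⟧≈ (c D.+ d)) ∙ +-homoᵈ c d ∙ sym (+-cong (⟦⟧≈ c) (⟦⟧≈ d))
      ; *-homo = λ c d → (⟦⟧≈ (c D.* d)) ∙ *-homoᵈ c d ∙ sym (*-cong (⟦⟧≈ c) (⟦⟧≈ d))
      ; -‿homo = λ c → (⟦⟧≈ (D.- c)) ∙ -‿homoᵈ c ∙ sym (-‿cong (⟦⟧≈ c))
      ; 0-homo = refl
      ; 1-homo = refl
      }

    decide : ∀ c d → Maybe (⟦ c ⟧ ≈ ⟦ d ⟧)
    decide (a , b) (c , d) with a ℕ.+ d ℕ.≟ c ℕ.+ b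
    ... | no  _ = nothing
    ... | yes e = just ((⟦⟧≈ (a , b)) ∙ diff ∙ sym (⟦⟧≈ (c , d)))
      where
      open ≈R
      diff : ν a - ν b ≈ ν c - ν d
      diff = begin
        ν a - ν b  ≈⟨ +-identityʳ _ ⟨
        (ν a - ν b) + 0#  ≈⟨ +-congˡ (-‿inverseʳ (ν d)) ⟨
        (ν a - ν b) + (ν d - ν d)  ≈⟨ interchange _ _ _ _ ⟩
        (ν a + ν d) + (- ν b - ν d)  ≈⟨ +-congʳ (sym (ν-+ a d) ∙ cong-≈ ν e ∙ ν-+ c b) ⟩
        (ν c + ν b) + (- ν b - ν d)  ≈⟨ +-congˡ (+-comm _ _) ⟩
        (ν c + ν b) + (- ν d - ν b)  ≈⟨ interchange _ _ _ _ ⟩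
        (ν c - ν d) + (ν b - ν b)  ≈⟨ +-congˡ (-‿inverseʳ (ν b)) ⟩
        (ν c - ν d) + 0#  ≈⟨ +-identityʳ _ ⟩
        ν c - ν d  ∎

  open Algebra.Solver.Ring differences (ACR.fromCommutativeRing R) morphism decide public
    using (solve; _:=_; _:+_; _:*_; _:-_; :-_; con; Polynomial)

  :0 :1 : ∀ {n} → Polynomial n
  :0 = con (0 , 0)
  :1 = con (1 , 0)

  when unless : Bool → Carrier → Carrier
  when   b x = if b then x else 0#
  unless b x = if b then 0# else x

  unless-cong : ∀ b {x y} → x ≈ y → unless b x ≈ unless b y
  unless-cong false e = e
  unless-cong true  e = refl

  -- Opaque, so that unification can compare summands.
  opaque

    sum : ∀ {n} → (Fin n → Carrier) → Carrier
    sum = Sums.sum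

    sum-0 : ∀ (f : Fin 0 → Carrier) → sum f ≈ 0#
    sum-0 f = refl

    sum-suc : ∀ {n} (f : Fin (suc n) → Carrier) → sum f ≈ f zero + sum (f ∘ suc)
    sum-suc f = refl

    sum-cong : ∀ {n} {f g : Fin n → Carrier} → (∀ i → f i ≈ g i) → sum f ≈ sum g
    sum-cong {n} e = Sums.sum-cong-≋ {n} e

    sum-zero : ∀ {n} {f : Fin n → Carrier} → (∀ i → f i ≈ 0#) → sum f ≈ 0#
    sum-zero {n} e = Sums.sum-cong-≋ {n} e ∙ Sums.sum-replicate-zero n

    ∑-distrib-+ : ∀ {n} (f g : Fin n → Carrier) → sum (λ i → f i + g i) ≈ sum f + sum g
    ∑-distrib-+ {n} f g = Sums.∑-distrib-+ {n} f g

    ∑-comm : ∀ {m n} (f : Fin m → Fin n → Carrier) →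
             sum (λ i → sum (λ j → f i j)) ≈ sum (λ j → sum (λ i → f i j))
    ∑-comm {m} {n} f = Sums.∑-comm {m} {n} f

    *-distribˡ-sum : ∀ {n} x (f : Fin n → Carrier) → x * sum f ≈ sum (λ i → x * f i)
    *-distribˡ-sum {n} x f = Sums.*-distribˡ-sum {n} x f

    sum-transpose : ∀ {n} (i j : Fin n) (f : Fin n → Carrier) → sum f ≈ sum (f ∘ transpose i j)
    sum-transpose i j f = Sums.sum-permute f (FinPerm.transpose i j)

  sum-neg : ∀ {n} (f : Fin n → Carrier) → sum (λ i → - f i) ≈ - sum f
  sum-neg {zero}  f = sum-0 _ ∙ sym -0#≈0# ∙ -‿cong (sym (sum-0 f))
  sum-neg {suc n} f = sum-suc _ ∙ +-congˡ (sum-neg (f ∘ suc)) ∙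
    ⁻¹-∙-comm (f zero) _ ∙ -‿cong (sym (sum-suc f))

  sum-const : ∀ n x → sum {n} (λ _ → x) ≈ ν n * x
  sum-const zero    x = sum-0 _ ∙ sym (zeroˡ x)
  sum-const (suc n) x = sum-suc _ ∙ +-cong (sym (*-identityˡ x)) (sum-const n x) ∙ sym (distribʳ x 1# (ν n))

  sum-when-unless : ∀ {n} (b : Fin n → Bool) (f : Fin n → Carrier) →
                    sum f ≈ sum (λ i → when (b i) (f i)) + sum (λ i → unless (b i) (f i))
  sum-when-unless b f = (sum-cong λ i → split (b i) (f i)) ∙
    ∑-distrib-+ (λ i → when (b i) (f i)) (λ i → unless (b i) (f i))
    where
    split : ∀ b x → x ≈ when b x + unless b x
    split false x = sym (+-identityˡ x)
    split true  x = sym (+-identityʳ x)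

  sum-δ : ∀ {n} (i : Fin n) (f : Fin n → Carrier) → sum (λ k → when (does (k Fin.≟ i)) (f k)) ≈ f i
  sum-δ {suc n} zero    f = sum-suc _ ∙ +-congˡ (sum-zero {n} λ _ → refl) ∙ +-identityʳ (f zero)
  sum-δ         (suc i) f = sum-suc _ ∙ +-identityˡ _ ∙
    sum-δ i (f ∘ suc)

  sum-unless-δ : ∀ {n} (i : Fin n) (f : Fin n → Carrier) →
                 sum (λ k → unless (does (k Fin.≟ i)) (f k)) ≈ sum f - f i
  sum-unless-δ i f = begin
    rest  ≈⟨ solve 2 (λ x y → x := (y :+ x) :- y) refl rest (f i) ⟩
    (f i + rest) - f i  ≈⟨ +-congʳ (+-congʳ (sym (sum-δ i f)) ∙ sym (sum-when-unless (λ k → does (k Fin.≟ i)) f)) ⟩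
    sum f - f i  ∎
    where
    open ≈R
    rest = sum (λ k → unless (does (k Fin.≟ i)) (f k))

swapᵛ-updated : ∀ {A : Set} {n} {i k : Fin n} → i ≢ k → ∀ (a : Vec A n) x →
                swapᵛ i k (a [ i ]≔ x) ≡ (a [ i ]≔ lookup a k) [ k ]≔ x
swapᵛ-updated {i = i} {k} i≢k a x = vec-ext λ l → go l (l Fin.≟ i) (l Fin.≟ k)
  where
  go : ∀ l → Dec (l ≡ i) → Dec (l ≡ k) →
       lookup (swapᵛ i k (a [ i ]≔ x)) l ≡ lookup ((a [ i ]≔ lookup a k) [ k ]≔ x) l
  go l d e = lookup-swapᵛ i k (a [ i ]≔ x) l ⊙ case d e
    where
    case : Dec (l ≡ i) → Dec (l ≡ k) →
           lookup (a [ i ]≔ x) (transpose i k l) ≡ lookup ((a [ i ]≔ lookup a k) [ k ]≔ x) l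
    case (yes ≡.refl) _ = cong (lookup (a [ i ]≔ x)) (transpose-left i k) ⊙
      Vec.lookup∘update′ (i≢k ∘ ≡.sym) a x ⊙
      ≡.sym (Vec.lookup∘update′ i≢k (a [ i ]≔ lookup a k) x ⊙ Vec.lookup∘update i a (lookup a k))
    case (no _) (yes ≡.refl) = cong (lookup (a [ i ]≔ x)) (transpose-right i k) ⊙
      Vec.lookup∘update i a x ⊙ ≡.sym (Vec.lookup∘update k (a [ i ]≔ lookup a k) x)
    case (no l≢i) (no l≢k) = cong (lookup (a [ i ]≔ x)) (transpose-other i k l≢i l≢k) ⊙
      Vec.lookup∘update′ l≢i a x ⊙
      ≡.sym (Vec.lookup∘update′ l≢k (a [ i ]≔ lookup a k) x ⊙ Vec.lookup∘update′ l≢i a (lookup a k))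

-- Series in finitely many variables and Dunkl operators

module Series (R : CommutativeRing 0ℓ 0ℓ) (α : CommutativeRing.Carrier R) where
  open CommutativeRing R hiding (zero)
  open Ring R
  private
    module ≈R = SetoidReasoning setoid

  Ser : ℕ → Set
  Ser N = Vec ℕ N → Carrier

  infix 4 _≐_
  _≐_ : ∀ {N} → Ser N → Ser N → Set
  f ≐ g = ∀ a → f a ≈ g a

  -- Models multiplication by a variable: a monomial without that variable gets coefficient zero.
  onPred : ℕ → (ℕ → Carrier) → Carrier
  onPred zero    φ = 0#
  onPred (suc n) φ = φ n

  onPred-cong : ∀ n {φ ψ : ℕ → Carrier} → (∀ k → φ k ≈ ψ k) → onPred n φ ≈ onPred n ψ
  onPred-cong zero    e = refl
  onPred-cong (suc n) e = e n

  onPred-≡ : ∀ {m n} → m ≡ n → {φ ψ : ℕ → Carrier} → (∀ k → φ k ≈ ψ k) → onPred m φ ≈ onPred n ψ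
  onPred-≡ {m} ≡.refl e = onPred-cong m e

  X : ∀ {N} → Fin N → Ser N → Ser N
  X k f a = onPred (lookup a k) (λ n → f (a [ k ]≔ n))

  S : ∀ {N} → Fin N → Fin N → Ser N → Ser N
  S i j f a = f (swapᵛ i j a)

  -- The coefficient of x^p y^q in (x / (x - y)) (φ(x , y) - φ(y , x)).
  divdiff : ℕ → ℕ → (ℕ → ℕ → Carrier) → Carrier
  divdiff zero    q       φ = 0#
  divdiff (suc p) zero    φ = φ (suc p) 0 - φ 0 (suc p)
  divdiff (suc p) (suc q) φ =
    (φ (2 ℕ.+ (p ℕ.+ q)) 0 - φ 0 (2 ℕ.+ (p ℕ.+ q))) + divdiff p q (λ x y → φ (suc x) (suc y))

  divdiff-cong : ∀ p q {φ ψ : ℕ → ℕ → Carrier} → (∀ x y → φ x y ≈ ψ x y) → divdiff p q φ ≈ divdiff p q ψ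
  divdiff-cong zero    q       e = refl
  divdiff-cong (suc p) zero    e = +-cong (e (suc p) 0) (-‿cong (e 0 (suc p)))
  divdiff-cong (suc p) (suc q) e = +-cong (+-cong (e (2 ℕ.+ (p ℕ.+ q)) 0) (-‿cong (e 0 (2 ℕ.+ (p ℕ.+ q)))))
    (divdiff-cong p q (λ x y → e (suc x) (suc y)))

  divdiff-symmetric : ∀ p q {φ : ℕ → ℕ → Carrier} → (∀ x y → φ x y ≈ φ y x) → divdiff p q φ ≈ 0#
  divdiff-symmetric zero    q       e = refl
  divdiff-symmetric (suc p) zero    e = +-congʳ (e (suc p) 0) ∙ -‿inverseʳ _
  divdiff-symmetric (suc p) (suc q) {φ} e = +-cong
    (+-congʳ (e (2 ℕ.+ (p ℕ.+ q)) 0) ∙ -‿inverseʳ _)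
    (divdiff-symmetric p q (λ x y → e (suc x) (suc y))) ∙ +-identityˡ 0#

  divdiff-+ : ∀ p q (φ ψ : ℕ → ℕ → Carrier) →
              divdiff p q (λ x y → φ x y + ψ x y) ≈ divdiff p q φ + divdiff p q ψ
  divdiff-+ zero    q       φ ψ = sym (+-identityˡ 0#)
  divdiff-+ (suc p) zero    φ ψ = solve 4 (λ a b c d → (a :+ b) :- (c :+ d) := (a :- c) :+ (b :- d)) refl
    (φ (suc p) 0) (ψ (suc p) 0) (φ 0 (suc p)) (ψ 0 (suc p))
  divdiff-+ (suc p) (suc q) φ ψ = +-congˡ (divdiff-+ p q _ _) ∙
    solve 6 (λ a b c d e f → ((a :+ b) :- (c :+ d)) :+ (e :+ f) := ((a :- c) :+ e) :+ ((b :- d) :+ f)) refl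
      (φ n 0) (ψ n 0) (φ 0 n) (ψ 0 n) _ _
    where n = 2 ℕ.+ (p ℕ.+ q)

  divdiff-* : ∀ p q c (φ : ℕ → ℕ → Carrier) → divdiff p q (λ x y → c * φ x y) ≈ c * divdiff p q φ
  divdiff-* zero    q       c φ = sym (zeroʳ c)
  divdiff-* (suc p) zero    c φ = solve 3 (λ c x y → (c :* x) :- (c :* y) := c :* (x :- y)) refl c _ _
  divdiff-* (suc p) (suc q) c φ = +-congˡ (divdiff-* p q c _) ∙
    solve 4 (λ c x y z → ((c :* x) :- (c :* y)) :+ (c :* z) := c :* ((x :- y) :+ z)) refl c _ _ _

  -- For g = x / (x - y) (φ - sφ), with s exchanging x and y, this compares the coefficients of
  -- x^(p+1) y^(q+1) in (x - y) g = x (φ - sφ).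
  divdiff-step : ∀ p q (φ : ℕ → ℕ → Carrier) →
                 divdiff (suc p) q φ ≈ divdiff p (suc q) φ + (φ (suc q) p - φ p (suc q))
  divdiff-step zero    zero    φ = sym (+-identityˡ _)
  divdiff-step zero    (suc q) φ = +-comm _ 0#
  divdiff-step (suc p) zero    φ rewrite ℕ.+-identityʳ p = sym (+-assoc _ _ _ ∙ +-congˡ (cancel p) ∙ +-identityʳ _)
    where
    cancel : ∀ p → divdiff p 0 (λ x y → φ (suc x) (suc y)) + (φ 1 (suc p) - φ (suc p) 1) ≈ 0#
    cancel zero    = +-identityˡ _ ∙ -‿inverseʳ _
    cancel (suc p) = solve 2 (λ x y → (x :- y) :+ (y :- x) := :0) refl (φ (2 ℕ.+ p) 1) (φ 1 (2 ℕ.+ p))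
  divdiff-step (suc p) (suc q) φ rewrite ℕ.+-suc p q =
    +-congˡ (divdiff-step p q (λ x y → φ (suc x) (suc y))) ∙ sym (+-assoc _ _ _)

  -- x / (x - y) (x φ - y sφ) = x · x / (x - y) (φ - sφ) + x sφ, with s the exchange of x and y.
  divdiff-xˡ : ∀ p q (φ : ℕ → ℕ → Carrier) →
               divdiff p q (λ x y → onPred x (λ x′ → φ x′ y)) ≈
               onPred p (λ p′ → divdiff p′ q φ) + onPred p (λ p′ → φ q p′)
  divdiff-xˡ zero    q φ = sym (+-identityˡ 0#)
  divdiff-xˡ (suc zero) q φ = divdiff-step zero q _ ∙ solve 1 (λ x → :0 :+ (x :- :0) := :0 :+ x) refl (φ q 0)
  divdiff-xˡ (suc (suc p)) q φ = begin
    divdiff (suc (suc p)) q (λ x y → onPred x (λ x′ → φ x′ y))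
      ≈⟨ divdiff-step (suc p) q _ ⟩
    divdiff (suc p) (suc q) (λ x y → onPred x (λ x′ → φ x′ y)) + (φ q (suc p) - φ p (suc q))
      ≈⟨ +-congʳ (divdiff-xˡ (suc p) (suc q) φ) ⟩
    (divdiff p (suc q) φ + φ (suc q) p) + (φ q (suc p) - φ p (suc q))
      ≈⟨ solve 4 (λ a b c d → (a :+ b) :+ (c :- d) := (a :+ (b :- d)) :+ c) refl _ _ _ _ ⟩
    (divdiff p (suc q) φ + (φ (suc q) p - φ p (suc q))) + φ q (suc p)
      ≈⟨ +-congʳ (divdiff-step p q φ) ⟨
    divdiff (suc p) q φ + φ q (suc p) ∎
    where open ≈R

  -- x / (x - y) (y φ - x sφ) = y · x / (x - y) (φ - sφ) - x sφ, with s the exchange of x and y.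
  divdiff-xʳ : ∀ p q (φ : ℕ → ℕ → Carrier) →
               divdiff p q (λ x y → onPred y (λ y′ → φ x y′)) ≈
               onPred q (λ q′ → divdiff p q′ φ) - onPred p (λ p′ → φ q p′)
  divdiff-xʳ zero    zero    φ = sym (-‿inverseʳ 0#)
  divdiff-xʳ zero    (suc q) φ = sym (-‿inverseʳ 0#)
  divdiff-xʳ (suc p) q       φ = (begin
    divdiff (suc p) q (λ x y → onPred y (λ y′ → φ x y′))
      ≈⟨ divdiff-step p q _ ⟩
    divdiff p (suc q) (λ x y → onPred y (λ y′ → φ x y′)) + (onPred p (λ y′ → φ (suc q) y′) - φ p q)
      ≈⟨ +-congʳ (divdiff-xʳ p (suc q) φ) ⟩
    (divdiff p q φ - onPred p (λ p′ → φ (suc q) p′)) + (onPred p (λ y′ → φ (suc q) y′) - φ p q)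
      ≈⟨ solve 3 (λ a b c → (a :- b) :+ (b :- c) := a :- c) refl _ _ _ ⟩
    divdiff p q φ - φ p q ∎) ∙ last p q
    where
    open ≈R
    last : ∀ p q → divdiff p q φ - φ p q ≈ onPred q (λ q′ → divdiff (suc p) q′ φ) - φ q p
    last zero    zero    = refl
    last (suc p) zero    = solve 2 (λ x y → (x :- y) :- x := :0 :- y) refl _ _
    last p       (suc q) = sym (+-congʳ (divdiff-step p q φ) ∙
      solve 3 (λ a b c → (a :+ (b :- c)) :- b := a :- c) refl _ _ _)

  divdiff-onPred : ∀ p q m (ψ : ℕ → ℕ → ℕ → Carrier) →
                   divdiff p q (λ x y → onPred m (λ n → ψ n x y)) ≈ onPred m (λ n → divdiff p q (ψ n))
  divdiff-onPred p q zero    ψ = divdiff-symmetric p q (λ _ _ → refl)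
  divdiff-onPred p q (suc n) ψ = refl

  module _ {N : ℕ} where

    slice : Fin N → Fin N → Ser N → Vec ℕ N → ℕ → ℕ → Carrier
    slice i j f a p q = f ((a [ i ]≔ p) [ j ]≔ q)

    -- x_i / (x_i - x_j) (1 - s_ij)
    Δ : Fin N → Fin N → Ser N → Ser N
    Δ i j f a = divdiff (lookup a i) (lookup a j) (slice i j f a)

    -- The Dunkl operator α x_i ∂/∂x_i + Σ_j x_i / (x_i - x_j) (1 - s_ij); the derivative acts on a
    -- monomial by its exponent.
    U : Fin N → Ser N → Ser N
    U i f a = α * ν (lookup a i) * f a + sum (λ j → unless (does (j Fin.≟ i)) (Δ i j f a))

    X-cong : ∀ k {f g : Ser N} → f ≐ g → X k f ≐ X k g
    X-cong k e a = onPred-cong (lookup a k) (λ n → e (a [ k ]≔ n))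

    X-+ : ∀ k (f g : Ser N) a → X k (λ b → f b + g b) a ≈ X k f a + X k g a
    X-+ k f g a with lookup a k
    ... | zero  = sym (+-identityˡ 0#)
    ... | suc n = refl

    X-* : ∀ k c (f : Ser N) a → X k (λ b → c * f b) a ≈ c * X k f a
    X-* k c f a with lookup a k
    ... | zero  = sym (zeroʳ c)
    ... | suc n = refl

    X-zero : ∀ (k : Fin N) a → X k (λ _ → 0#) a ≈ 0#
    X-zero k a with lookup a k
    ... | zero  = refl
    ... | suc n = refl

    X-sum : ∀ k {m} (f : Fin m → Ser N) a → X k (λ b → sum (λ j → f j b)) a ≈ sum (λ j → X k (f j) a)
    X-sum k f a with lookup a k
    ... | zero  = sym (sum-zero λ _ → refl)
    ... | suc n = refl

    X-unless : ∀ k b (f : Ser N) a → X k (λ c → unless b (f c)) a ≈ unless b (X k f a)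
    X-unless k true  f a = X-zero k a
    X-unless k false f a = refl

    X-S : ∀ i j k (f : Ser N) → S i j (X k f) ≐ X (transpose i j k) (S i j f)
    X-S i j k f a = onPred-≡ (lookup-swapᵛ i j a k) λ n → reflexive (cong f
      (cong (swapᵛ i j a [_]≔ n) (≡.sym (transpose-involutive i j k)) ⊙
               ≡.sym (swapᵛ-≔ i j (transpose i j k) a n)))

    S-cong : ∀ i j {f g : Ser N} → f ≐ g → S i j f ≐ S i j g
    S-cong i j e a = e (swapᵛ i j a)

    U-cong : ∀ i {f g : Ser N} → f ≐ g → U i f ≐ U i g
    U-cong i e a = +-cong (*-congˡ (e a)) (sum-cong λ j → unless-cong (does (j Fin.≟ i))
      (divdiff-cong (lookup a i) (lookup a j) (λ p q → e ((a [ i ]≔ p) [ j ]≔ q))))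

    U-+ : ∀ i (f g : Ser N) a → U i (λ b → f b + g b) a ≈ U i f a + U i g a
    U-+ i f g a = begin
      αa * (f a + g a) + sum (λ j → unless (d j) (Δ i j (λ b → f b + g b) a))
        ≈⟨ +-cong (distribˡ αa (f a) (g a)) ((sum-cong λ j → each (d j) j) ∙ ∑-distrib-+ _ _) ⟩
      (αa * f a + αa * g a) + (sum (λ j → unless (d j) (Δ i j f a)) + sum (λ j → unless (d j) (Δ i j g a)))
        ≈⟨ solve 4 (λ x y z w → (x :+ y) :+ (z :+ w) := (x :+ z) :+ (y :+ w)) refl _ _ _ _ ⟩
      U i f a + U i g a ∎
      where
      open ≈R
      αa = α * ν (lookup a i)
      d : Fin N → Bool
      d j = does (j Fin.≟ i)
      each : ∀ b j → unless b (Δ i j (λ b → f b + g b) a) ≈ unless b (Δ i j f a) + unless b (Δ i j g a)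
      each true  j = sym (+-identityˡ 0#)
      each false j = divdiff-+ (lookup a i) (lookup a j) (slice i j f a) (slice i j g a)

    U-* : ∀ i c (f : Ser N) a → U i (λ b → c * f b) a ≈ c * U i f a
    U-* i c f a = begin
      αa * (c * f a) + sum (λ j → unless (d j) (Δ i j (λ b → c * f b) a))
        ≈⟨ +-cong (solve 3 (λ x y z → x :* (y :* z) := y :* (x :* z)) refl αa c (f a))
             ((sum-cong λ j → each (d j) j) ∙ sym (*-distribˡ-sum c (λ j → unless (d j) (Δ i j f a)))) ⟩
      c * (αa * f a) + c * sum (λ j → unless (d j) (Δ i j f a))
        ≈⟨ distribˡ c _ _ ⟨
      c * U i f a ∎
      where
      open ≈R
      αa = α * ν (lookup a i)
      d : Fin N → Bool
      d j = does (j Fin.≟ i)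
      each : ∀ b j → unless b (Δ i j (λ b → c * f b) a) ≈ c * unless b (Δ i j f a)
      each true  j = sym (zeroʳ c)
      each false j = divdiff-* (lookup a i) (lookup a j) c (slice i j f a)

    U-zero : ∀ (i : Fin N) a → U i (λ _ → 0#) a ≈ 0#
    U-zero i a = U-cong i (λ _ → sym (zeroˡ 0#)) a ∙ U-* i 0# (λ _ → 0#) a ∙ zeroˡ _

    U-sum : ∀ i {m} (f : Fin m → Ser N) a → U i (λ b → sum (λ j → f j b)) a ≈ sum (λ j → U i (f j) a)
    U-sum i {zero}  f a = U-cong i (λ b → sum-0 (λ j → f j b)) a ∙ U-zero i a ∙ sym (sum-0 _)
    U-sum i {suc m} f a = U-cong i (λ b → sum-suc (λ j → f j b)) a ∙
      U-+ i (f zero) (λ b → sum (λ j → f (suc j) b)) a ∙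
      +-congˡ (U-sum i (f ∘ suc) a) ∙ sym (sum-suc _)

    X-ν : ∀ {i k} → i ≢ k → ∀ (f : Ser N) a →
          X k (λ b → α * ν (lookup b i) * f b) a ≈ α * ν (lookup a i) * X k f a
    X-ν {i} {k} i≢k f a = trans
      (onPred-cong (lookup a k) (λ n → *-congʳ (*-congˡ (cong-≈ ν (Vec.lookup∘update′ i≢k a n)))))
      (X-* k (α * ν (lookup a i)) f a)

    Δ-X : ∀ {i j k} → k ≢ i → k ≢ j → ∀ (f : Ser N) → Δ i j (X k f) ≐ X k (Δ i j f)
    Δ-X {i} {j} {k} k≢i k≢j f a = begin
      divdiff (lookup a i) (lookup a j) (slice i j (X k f) a)
        ≈⟨ divdiff-cong (lookup a i) (lookup a j) (λ p q → onPred-≡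
             (Vec.lookup∘update′ k≢j (a [ i ]≔ p) q ⊙ Vec.lookup∘update′ k≢i a p)
             λ n → cong-≈ f (commute p q n)) ⟩
      divdiff (lookup a i) (lookup a j) (λ p q → onPred (lookup a k) (λ n → slice i j f (a [ k ]≔ n) p q))
        ≈⟨ divdiff-onPred (lookup a i) (lookup a j) (lookup a k) (λ n → slice i j f (a [ k ]≔ n)) ⟩
      onPred (lookup a k) (λ n → divdiff (lookup a i) (lookup a j) (slice i j f (a [ k ]≔ n)))
        ≈⟨ onPred-cong (lookup a k) (λ n → reflexive (cong₂ (λ p q → divdiff p q (slice i j f (a [ k ]≔ n)))
             (≡.sym (Vec.lookup∘update′ (k≢i ∘ ≡.sym) a n)) (≡.sym (Vec.lookup∘update′ (k≢j ∘ ≡.sym) a n)))) ⟩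
      X k (Δ i j f) a ∎
      where
      open ≈R
      commute : ∀ p q n → ((a [ i ]≔ p) [ j ]≔ q) [ k ]≔ n ≡ ((a [ k ]≔ n) [ i ]≔ p) [ j ]≔ q
      commute p q n = Vec.[]≔-commutes (a [ i ]≔ p) j k (k≢j ∘ ≡.sym) ⊙
        cong (_[ j ]≔ q) (Vec.[]≔-commutes a i k (k≢i ∘ ≡.sym))

    Δ-Xʳ : ∀ {i k} → i ≢ k → ∀ (f : Ser N) a → Δ i k (X k f) a ≈ X k (Δ i k f) a - X i (S i k f) a
    Δ-Xʳ {i} {k} i≢k f a = begin
      divdiff p₀ q₀ (slice i k (X k f) a)
        ≈⟨ divdiff-cong p₀ q₀ (λ p q → onPred-≡ (Vec.lookup∘update k (a [ i ]≔ p) q)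
             λ n → cong-≈ f (Vec.[]≔-idempotent (a [ i ]≔ p) k)) ⟩
      divdiff p₀ q₀ (λ p q → onPred q (λ q′ → slice i k f a p q′))
        ≈⟨ divdiff-xʳ p₀ q₀ (slice i k f a) ⟩
      onPred q₀ (λ q′ → divdiff p₀ q′ (slice i k f a)) - onPred p₀ (λ p′ → slice i k f a q₀ p′)
        ≈⟨ +-cong (onPred-cong q₀ λ n → divdiff-cong p₀ n (λ p q → cong-≈ f (overwrite p q n)) ∙
             reflexive (cong₂ (λ p q → divdiff p q (slice i k f (a [ k ]≔ n)))
               (≡.sym (Vec.lookup∘update′ i≢k a n)) (≡.sym (Vec.lookup∘update k a n))))
           (-‿cong (onPred-cong p₀ λ n → cong-≈ f (≡.sym (swapᵛ-updated i≢k a n)))) ⟩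
      X k (Δ i k f) a - X i (S i k f) a ∎
      where
      open ≈R
      p₀ = lookup a i
      q₀ = lookup a k
      overwrite : ∀ p q n → (a [ i ]≔ p) [ k ]≔ q ≡ ((a [ k ]≔ n) [ i ]≔ p) [ k ]≔ q
      overwrite p q n = ≡.sym (cong (_[ k ]≔ q) (Vec.[]≔-commutes a k i (i≢k ∘ ≡.sym)) ⊙
        Vec.[]≔-idempotent (a [ i ]≔ p) k)

    Δ-Xˡ : ∀ {i j} → i ≢ j → ∀ (f : Ser N) a → Δ i j (X i f) a ≈ X i (Δ i j f) a + X i (S i j f) a
    Δ-Xˡ {i} {j} i≢j f a = begin
      divdiff p₀ q₀ (slice i j (X i f) a)
        ≈⟨ divdiff-cong p₀ q₀ (λ p q → onPred-≡
             (Vec.lookup∘update′ i≢j (a [ i ]≔ p) q ⊙ Vec.lookup∘update i a p)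
             λ n → cong-≈ f (first p q n)) ⟩
      divdiff p₀ q₀ (λ p q → onPred p (λ p′ → slice i j f a p′ q))
        ≈⟨ divdiff-xˡ p₀ q₀ (slice i j f a) ⟩
      onPred p₀ (λ p′ → divdiff p′ q₀ (slice i j f a)) + onPred p₀ (λ p′ → slice i j f a q₀ p′)
        ≈⟨ +-cong (onPred-cong p₀ λ n → divdiff-cong n q₀ (λ p q → cong-≈ (λ v → f (v [ j ]≔ q)) (≡.sym (Vec.[]≔-idempotent a i))) ∙
             reflexive (cong₂ (λ p q → divdiff p q (slice i j f (a [ i ]≔ n)))
               (≡.sym (Vec.lookup∘update i a n)) (≡.sym (Vec.lookup∘update′ (i≢j ∘ ≡.sym) a n))))
           (onPred-cong p₀ λ n → cong-≈ f (≡.sym (swapᵛ-updated i≢j a n))) ⟩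
      X i (Δ i j f) a + X i (S i j f) a ∎
      where
      open ≈R
      p₀ = lookup a i
      q₀ = lookup a j
      first : ∀ p q n → ((a [ i ]≔ p) [ j ]≔ q) [ i ]≔ n ≡ (a [ i ]≔ n) [ j ]≔ q
      first p q n = Vec.[]≔-commutes (a [ i ]≔ p) j i (i≢j ∘ ≡.sym) ⊙
        cong (_[ j ]≔ q) (Vec.[]≔-idempotent a i)

    -- Only the summand j = k of U_i fails to commute with x_k, and by `Δ-Xʳ` it leaves - x_i s_ik.
    U-X : ∀ {i k} → k ≢ i → ∀ (f : Ser N) a → U i (X k f) a ≈ X k (U i f) a - X i (S i k f) a
    U-X {i} {k} k≢i f a = sym (begin
      X k (U i f) a - s
        ≈⟨ +-congʳ (X-+ k (λ b → α * ν (lookup b i) * f b) (λ b → sum (λ j → unless (d j) (Δ i j f b))) a ∙ +-cong (X-ν (k≢i ∘ ≡.sym) f a)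
             (X-sum k (λ j b → unless (d j) (Δ i j f b)) a ∙ (sum-cong λ j → X-unless k (d j) (Δ i j f) a))) ⟩
      (αX + sum (λ j → unless (d j) (X k (Δ i j f) a))) - s
        ≈⟨ solve 3 (λ x y z → (x :+ y) :- z := x :+ (y :- z)) refl _ _ _ ⟩
      αX + (sum (λ j → unless (d j) (X k (Δ i j f) a)) - s)
        ≈⟨ +-congˡ (+-congˡ (sum-δ k (λ _ → - s))) ⟨
      αX + (sum (λ j → unless (d j) (X k (Δ i j f) a)) + sum (λ j → when (does (j Fin.≟ k)) (- s)))
        ≈⟨ +-congˡ (∑-distrib-+ _ _) ⟨
      αX + sum (λ j → unless (d j) (X k (Δ i j f) a) + when (does (j Fin.≟ k)) (- s))
        ≈⟨ +-congˡ (sum-cong each) ⟩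
      U i (X k f) a ∎)
      where
      open ≈R
      s = X i (S i k f) a
      αX = α * ν (lookup a i) * X k f a
      d : Fin N → Bool
      d j = does (j Fin.≟ i)
      each : ∀ j → unless (does (j Fin.≟ i)) (X k (Δ i j f) a) + when (does (j Fin.≟ k)) (- s) ≈
                   unless (does (j Fin.≟ i)) (Δ i j (X k f) a)
      each j with j Fin.≟ i | j Fin.≟ k
      ... | yes ≡.refl | yes ≡.refl = contradiction ≡.refl k≢i
      ... | yes _      | no  _      = +-identityˡ 0#
      ... | no  _      | yes ≡.refl = sym (Δ-Xʳ (k≢i ∘ ≡.sym) f a)
      ... | no  _      | no  j≢k    = +-identityʳ _ ∙ sym (Δ-X k≢i (j≢k ∘ ≡.sym) f a)

    -- No summand commutes with x_i: the derivative leaves α x_i, and each j ≠ i leaves x_i s_ij.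
    U-X-self : ∀ i (f : Ser N) a → U i (X i f) a ≈
               X i (U i f) a + (α * X i f a + sum (λ j → unless (does (j Fin.≟ i)) (X i (S i j f) a)))
    U-X-self i f a = begin
      α * ν (lookup a i) * X i f a + sum (λ j → unless (d j) (Δ i j (X i f) a))
        ≈⟨ +-cong degree (sum-cong each ∙ ∑-distrib-+ _ _) ⟩
      (X i (λ b → α * ν (lookup b i) * f b) a + α * X i f a) +
      (sum (λ j → unless (d j) (X i (Δ i j f) a)) + sum (λ j → unless (d j) (X i (S i j f) a)))
        ≈⟨ solve 4 (λ x y z w → (x :+ y) :+ (z :+ w) := (x :+ z) :+ (y :+ w)) refl _ _ _ _ ⟩
      (X i (λ b → α * ν (lookup b i) * f b) a + sum (λ j → unless (d j) (X i (Δ i j f) a))) +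
      (α * X i f a + sum (λ j → unless (d j) (X i (S i j f) a)))
        ≈⟨ +-congʳ (X-+ i (λ b → α * ν (lookup b i) * f b) (λ b → sum (λ j → unless (d j) (Δ i j f b))) a ∙ +-congˡ
             (X-sum i (λ j b → unless (d j) (Δ i j f b)) a ∙ (sum-cong λ j → X-unless i (d j) (Δ i j f) a))) ⟨
      X i (U i f) a + (α * X i f a + sum (λ j → unless (d j) (X i (S i j f) a))) ∎
      where
      open ≈R
      d : Fin N → Bool
      d j = does (j Fin.≟ i)
      degree : α * ν (lookup a i) * X i f a ≈ X i (λ b → α * ν (lookup b i) * f b) a + α * X i f a
      degree with lookup a i
      ... | zero  = solve 1 (λ x → x :* :0 :* :0 := :0 :+ x :* :0) refl α
      ... | suc n = solve 3 (λ x y z → x :* (:1 :+ y) :* z := x :* y :* z :+ x :* z) refl α (ν n) (f (a [ i ]≔ n)) ∙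
        +-congʳ (*-congʳ (*-congˡ (cong-≈ ν (≡.sym (Vec.lookup∘update i a n)))))
      each : ∀ j → unless (does (j Fin.≟ i)) (Δ i j (X i f) a) ≈
                   unless (does (j Fin.≟ i)) (X i (Δ i j f) a) + unless (does (j Fin.≟ i)) (X i (S i j f) a)
      each j with j Fin.≟ i
      ... | yes _  = sym (+-identityˡ 0#)
      ... | no j≢i = Δ-Xˡ (j≢i ∘ ≡.sym) f a

    Symmetricˢ : Ser N → Set
    Symmetricˢ f = ∀ i j → S i j f ≐ f

    Δ-symmetric : ∀ {i j} → i ≢ j → ∀ {f : Ser N} → Symmetricˢ f → ∀ a → Δ i j f a ≈ 0#
    Δ-symmetric {i} {j} i≢j {f} s a = divdiff-symmetric (lookup a i) (lookup a j) λ p q →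
      sym (s i j ((a [ i ]≔ p) [ j ]≔ q)) ∙ cong-≈ f (swapped p q)
      where
      swapped : ∀ p q → swapᵛ i j ((a [ i ]≔ p) [ j ]≔ q) ≡ (a [ i ]≔ q) [ j ]≔ p
      swapped p q = cong (swapᵛ i j) (Vec.[]≔-commutes a i j i≢j) ⊙
        swapᵛ-updated i≢j (a [ j ]≔ q) p ⊙
        cong (λ x → ((a [ j ]≔ q) [ i ]≔ x) [ j ]≔ p) (Vec.lookup∘update j a q) ⊙
        cong (_[ j ]≔ p) (Vec.[]≔-commutes a j i (i≢j ∘ ≡.sym)) ⊙ Vec.[]≔-idempotent (a [ i ]≔ q) j

    -- All divided differences of a symmetric series vanish; the derivative remains.
    U-symmetric : ∀ i {f : Ser N} → Symmetricˢ f → ∀ a → U i f a ≈ α * ν (lookup a i) * f a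
    U-symmetric i {f} s a = +-congˡ (sum-zero each) ∙ +-identityʳ _
      where
      each : ∀ j → unless (does (j Fin.≟ i)) (Δ i j f a) ≈ 0#
      each j with j Fin.≟ i
      ... | yes _  = refl
      ... | no j≢i = Δ-symmetric (j≢i ∘ ≡.sym) s a

-- Queues and their labels

isZero : ∀ {n} → Vec ℕ n → Bool
isZero []          = true
isZero (zero  ∷ a) = isZero a
isZero (suc _ ∷ a) = false

isZero-lookup : ∀ {n} (a : Vec ℕ n) → isZero a ≡ true → ∀ k → lookup a k ≡ 0
isZero-lookup (zero ∷ a) e zero    = ≡.refl
isZero-lookup (zero ∷ a) e (suc k) = isZero-lookup a e k

lookup-isZero : ∀ {n} (a : Vec ℕ n) → (∀ k → lookup a k ≡ 0) → isZero a ≡ true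
lookup-isZero []          e = ≡.refl
lookup-isZero (zero  ∷ a) e = lookup-isZero a (e ∘ suc)
lookup-isZero (suc _ ∷ a) e with () ← e zero

bool-⇔ : ∀ {b c} → (b ≡ true → c ≡ true) → (c ≡ true → b ≡ true) → b ≡ c
bool-⇔ {false} {false} f g = ≡.refl
bool-⇔ {false} {true}  f g = g ≡.refl
bool-⇔ {true}  {c}     f g = ≡.sym (f ≡.refl)

∨-false : ∀ {b c} → b ∨ c ≡ false → b ≡ false × c ≡ false
∨-false {false} {false} e = ≡.refl , ≡.refl

isZero-swapᵛ : ∀ {n} (i j : Fin n) (a : Vec ℕ n) → isZero (swapᵛ i j a) ≡ isZero a
isZero-swapᵛ i j a = bool-⇔
  (λ e → lookup-isZero a λ k → cong (lookup a) (≡.sym (transpose-involutive i j k)) ⊙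
    ≡.sym (lookup-swapᵛ i j a (transpose i j k)) ⊙ isZero-lookup (swapᵛ i j a) e (transpose i j k))
  (λ e → lookup-isZero (swapᵛ i j a) λ k → lookup-swapᵛ i j a k ⊙ isZero-lookup a e (transpose i j k))

bit : Bool → ℕ
bit b = if b then 1 else 0

shorterᴸ longerᴸ : ℕ → List ℕ → ℕ
shorterᴸ l []       = 0
shorterᴸ l (l′ ∷ Q) = bit (does (l′ ℕ.≤? l)) ℕ.+ shorterᴸ l Q
longerᴸ  l []       = 0
longerᴸ  l (l′ ∷ Q) = bit (does (l ℕ.≤? l′)) ℕ.+ longerᴸ l Q

≤-bits : ∀ {a b} (d : Dec (suc a ≤ b)) (e : Dec (b ≤ a)) → bit (does d) ℕ.+ bit (does e) ≡ 1
≤-bits (yes p) (yes q) = contradiction (ℕ.≤-trans p q) (ℕ.<-irrefl ≡.refl)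
≤-bits (yes p) (no  q) = ≡.refl
≤-bits (no  p) (yes q) = ≡.refl
≤-bits (no  p) (no  q) = contradiction (ℕ.≰⇒> q) p

longerᴸ+shorterᴸ : ∀ l ls → longerᴸ (suc l) ls ℕ.+ shorterᴸ l ls ≡ length ls
longerᴸ+shorterᴸ l []        = ≡.refl
longerᴸ+shorterᴸ l (l′ ∷ ls) = ℕ+.interchange (bit (does (suc l ℕ.≤? l′))) (longerᴸ (suc l) ls) (bit (does (l′ ℕ.≤? l))) (shorterᴸ l ls) ⊙
  (cong₂ ℕ._+_ (≤-bits (suc l ℕ.≤? l′) (l′ ℕ.≤? l)) (longerᴸ+shorterᴸ l ls))

-- A queue lists the rows of a partially filled diagram, lowest row first, each with the number
-- of boxes that are still to be filled and the label of its last filled box, if there is one.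
Queue : ℕ → Set
Queue N = List (ℕ × Maybe (Fin N))

lengths : ∀ {N} → Queue N → List ℕ
lengths = map proj₁

module _ {N : ℕ} where

  has : Fin N → Queue N → Bool
  has k []                  = false
  has k ((_ , nothing) ∷ Q) = has k Q
  has k ((_ , just b)  ∷ Q) = does (k Fin.≟ b) ∨ has k Q

  shorter longer : ℕ → Queue N → ℕ
  shorter l Q = shorterᴸ l (lengths Q)
  longer  l Q = longerᴸ l (lengths Q)

  longer+shorter : ∀ l Q → longer (suc l) Q ℕ.+ shorter l Q ≡ length Q
  longer+shorter l Q = longerᴸ+shorterᴸ l (lengths Q) ⊙ List.length-map proj₁ Q

  longer-∷ʳ : ∀ l Q l′ b → longer l (Q ∷ʳ (l′ , b)) ≡ longer l Q ℕ.+ (bit (does (l ℕ.≤? l′)))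
  longer-∷ʳ l []            l′ b = ℕ.+-identityʳ _
  longer-∷ʳ l ((m , _) ∷ Q) l′ b = cong (x ℕ.+_) (longer-∷ʳ l Q l′ b) ⊙ ≡.sym (ℕ.+-assoc x _ _)
    where x = bit (does (l ℕ.≤? m))

  has-++ : ∀ k P Q → has k (P ++ Q) ≡ has k P ∨ has k Q
  has-++ k []                  Q = ≡.refl
  has-++ k ((_ , nothing) ∷ P) Q = has-++ k P Q
  has-++ k ((_ , just b)  ∷ P) Q = cong (does (k Fin.≟ b) ∨_) (has-++ k P Q) ⊙
    ≡.sym (Bool.∨-assoc (does (k Fin.≟ b)) _ _)

  has-∷ʳ : ∀ k Q l b → has k (Q ∷ʳ (l , just b)) ≡ has k Q ∨ does (k Fin.≟ b)
  has-∷ʳ k Q l b = has-++ k Q _ ⊙ cong (has k Q ∨_) (Bool.∨-identityʳ _)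

  has-∷ʳ-false : ∀ {k b} Q l → has k Q ≡ false → k ≢ b → has k (Q ∷ʳ (l , just b)) ≡ false
  has-∷ʳ-false {k} {b} Q l p q = has-∷ʳ k Q l b ⊙ (cong₂ _∨_ p (dec-false (k Fin.≟ b) q))

  -- Every row has a last label, and no two agree. A step of the recursion preserves this, because
  -- the new label avoids all other rows.
  data Good : Queue N → Set where
    []  : Good []
    _∷_ : ∀ {l b Q} → has b Q ≡ false → Good Q → Good ((l , just b) ∷ Q)

  good-∷ʳ : ∀ {Q l k} → Good Q → has k Q ≡ false → Good (Q ∷ʳ (l , just k))
  good-∷ʳ []                        h = ≡.refl ∷ []
  good-∷ʳ {k = k} (_∷_ {b = b} {Q} p g) h with k Fin.≟ b
  ... | no k≢b = has-∷ʳ-false Q _ p (k≢b ∘ ≡.sym) ∷ good-∷ʳ g h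

  relabel : Fin N → Fin N → Queue N → Queue N
  relabel i j = map (Prod.map₂ (Maybe.map (transpose i j)))

  transpose-≟ : ∀ (i j k l : Fin N) → does (transpose i j k Fin.≟ transpose i j l) ≡ does (k Fin.≟ l)
  transpose-≟ i j k l = ≡.sym (go (k Fin.≟ l))
    where
    go : (d : Dec (k ≡ l)) → does d ≡ does (transpose i j k Fin.≟ transpose i j l)
    go (yes ≡.refl) = ≡.sym (dec-true (transpose i j k Fin.≟ transpose i j k) ≡.refl)
    go (no k≢l)     = ≡.sym (dec-false (transpose i j k Fin.≟ transpose i j l) (k≢l ∘ transpose-injective i j))

  has-relabel : ∀ i j k Q → has (transpose i j k) (relabel i j Q) ≡ has k Q
  has-relabel i j k []                  = ≡.refl
  has-relabel i j k ((_ , nothing) ∷ Q) = has-relabel i j k Q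
  has-relabel i j k ((_ , just b)  ∷ Q) = cong₂ _∨_ (transpose-≟ i j k b) (has-relabel i j k Q)

  shorter-relabel : ∀ i j l Q → shorter l (relabel i j Q) ≡ shorter l Q
  shorter-relabel i j l []             = ≡.refl
  shorter-relabel i j l ((l′ , _) ∷ Q) = cong (bit (does (l′ ℕ.≤? l)) ℕ.+_) (shorter-relabel i j l Q)

  ≟-false : ∀ {k b : Fin N} → does (k Fin.≟ b) ≡ false → k ≢ b
  ≟-false {k} {b} e p with k Fin.≟ b
  ≟-false () p | yes _
  ... | no k≢b = k≢b p

  relabel-fresh : ∀ {i j} Q → has i Q ≡ false → has j Q ≡ false → relabel i j Q ≡ Q
  relabel-fresh []                  p q = ≡.refl
  relabel-fresh ((l , nothing) ∷ Q) p q = cong ((l , nothing) ∷_) (relabel-fresh Q p q)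
  relabel-fresh {i} {j} ((l , just b) ∷ Q) p q with ∨-false {does (i Fin.≟ b)} p | ∨-false {does (j Fin.≟ b)} q
  ... | i≢b , p′ | j≢b , q′ = cong₂ (λ b Q → (l , just b) ∷ Q)
    (transpose-other i j (≟-false i≢b ∘ ≡.sym) (≟-false j≢b ∘ ≡.sym)) (relabel-fresh Q p′ q′)

  relabel-∷ʳ : ∀ i j Q l k → relabel i j (Q ∷ʳ (l , just k)) ≡ relabel i j Q ∷ʳ (l , just (transpose i j k))
  relabel-∷ʳ i j Q l k = List.map-++ _ Q _

-- Labelled fillings as joint eigenfunctions

module Fillings (R : CommutativeRing 0ℓ 0ℓ) (α : CommutativeRing.Carrier R) where
  open CommutativeRing R hiding (zero)
  open Ring R
  open Series R α
  private
    module ≈R = SetoidReasoning setoid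

  module _ {N : ℕ} where

    -- In a queue that started from a diagram, `l` is the arm of the box being filled and
    -- `shorter l Q` its leg, so 1 + κ is the factor α (a + 1) + ℓ + 1 of the Knop-Sahi formula.
    κ : ℕ → Queue N → Carrier
    κ l Q = α * ν (suc l) + ν (shorter l Q)

    onLabel : Maybe (Fin N) → (Fin N → Carrier) → Carrier
    onLabel nothing  φ = 0#
    onLabel (just k) φ = φ k

    𝟙 : Ser N
    𝟙 a = when (isZero a) 1#

    -- The generating function of the admissible ways to complete a queue, where a box that
    -- repeats the label to its left has weight 1 + κ.
    F : ℕ → Queue N → Ser N
    F n       []                a = 𝟙 a
    F n       ((zero  , b) ∷ Q) a = F n Q a
    -- The first argument is fuel, one unit per box; this value is met only if the fuel falls short
    -- of the boxes.
    F zero    ((suc l , b) ∷ Q) a = 0#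
    F (suc n) ((suc l , b) ∷ Q) a =
      sum (λ k → unless (has k Q) (X k (F n (Q ∷ʳ (l , just k))) a)) +
      κ l Q * onLabel b (λ k → X k (F n (Q ∷ʳ (l , just k))) a)

    -- Weights depend only on coincidences of labels and on row lengths, so permuting the variables
    -- amounts to renaming the labels.
    F-relabel : ∀ n Q i j → S i j (F n Q) ≐ F n (relabel i j Q)
    F-relabel n       []                i j a = cong-≈ (λ b → when b 1#) (isZero-swapᵛ i j a)
    F-relabel n       ((zero  , b) ∷ Q) i j a = F-relabel n Q i j a
    F-relabel zero    ((suc l , b) ∷ Q) i j a = refl
    F-relabel (suc n) ((suc l , b) ∷ Q) i j a = +-cong
      ((sum-cong λ k → unless-cong (has k Q) (each k) ∙
          cong-≈ (λ b → unless b (H (transpose i j k))) (≡.sym (has-relabel i j k Q))) ∙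
        sym (sum-transpose i j (λ k → unless (has k (relabel i j Q)) (H k))))
      (*-cong (+-congˡ (cong-≈ ν (≡.sym (shorter-relabel i j l Q)))) (marked b))
      where
      H : Fin N → Carrier
      H k = X k (F n (relabel i j Q ∷ʳ (l , just k))) a
      each : ∀ k → X k (F n (Q ∷ʳ (l , just k))) (swapᵛ i j a) ≈ H (transpose i j k)
      each k = X-S i j k (F n (Q ∷ʳ (l , just k))) a ∙ X-cong (transpose i j k)
        (λ a → F-relabel n (Q ∷ʳ (l , just k)) i j a ∙
          cong-≈ (λ Q → F n Q a) (relabel-∷ʳ i j Q l k)) a
      marked : ∀ b → onLabel b (λ k → X k (F n (Q ∷ʳ (l , just k))) (swapᵛ i j a)) ≈
                     onLabel (Maybe.map (transpose i j) b) H
      marked nothing  = refl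
      marked (just k) = each k

    sum-unless-∷ : ∀ b Q → has b Q ≡ false → (φ : Fin N → Carrier) →
      sum (λ k → unless (does (k Fin.≟ b) ∨ has k Q) (φ k)) ≈ sum (λ k → unless (has k Q) (φ k)) - φ b
    sum-unless-∷ b Q h φ = (sum-cong λ k → reflexive (unless-∨ (does (k Fin.≟ b)) (has k Q) (φ k))) ∙
      sum-unless-δ b (λ k → unless (has k Q) (φ k)) ∙
        +-congˡ (-‿cong (cong-≈ (λ c → unless c (φ b)) h))
      where
      unless-∨ : ∀ b c x → unless (b ∨ c) x ≡ unless b (unless c x)
      unless-∨ false c x = ≡.refl
      unless-∨ true  c x = ≡.refl

    sum-fresh : ∀ {Q} → Good Q → ∀ x → sum (λ k → unless (has k Q) x) ≈ (ν N - ν (length Q)) * x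
    sum-fresh [] x = sum-const N x ∙ solve 2 (λ n x → n :* x := (n :- :0) :* x) refl (ν N) x
    sum-fresh (_∷_ {b = b} {Q} h g) x = sum-unless-∷ b Q h (λ _ → x) ∙ +-congʳ (sum-fresh g x) ∙
      solve 3 (λ n q x → (n :- q) :* x :- x := (n :- (:1 :+ q)) :* x) refl (ν N) (ν (length Q)) x

    -- The Cherednik operator attached to the label b when the rows below it carry the labels not in T.
    Ξ : Fin N → Queue N → Ser N → Ser N
    Ξ b T f a = U b f a + sum (λ j → unless (does (j Fin.≟ b) ∨ has j T) (S b j f a))

    Ξ-cong : ∀ b T {f g : Ser N} → f ≐ g → Ξ b T f ≐ Ξ b T g
    Ξ-cong b T e a = +-cong (U-cong b e a) (sum-cong λ j → unless-cong (does (j Fin.≟ b) ∨ has j T) (S-cong b j e a))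

    Ξ-+ : ∀ b T (f g : Ser N) a → Ξ b T (λ c → f c + g c) a ≈ Ξ b T f a + Ξ b T g a
    Ξ-+ b T f g a = +-cong (U-+ b f g a) ((sum-cong λ j → unless-+ (d j) _ _) ∙ ∑-distrib-+ _ _) ∙
      solve 4 (λ x y z w → (x :+ y) :+ (z :+ w) := (x :+ z) :+ (y :+ w)) refl _ _ _ _
      where
      d : Fin N → Bool
      d j = does (j Fin.≟ b) ∨ has j T
      unless-+ : ∀ b x y → unless b (x + y) ≈ unless b x + unless b y
      unless-+ true  x y = sym (+-identityˡ 0#)
      unless-+ false x y = refl

    Ξ-* : ∀ b T c (f : Ser N) a → Ξ b T (λ d → c * f d) a ≈ c * Ξ b T f a
    Ξ-* b T c f a = +-cong (U-* b c f a)
      ((sum-cong λ j → unless-* (d j) _) ∙ sym (*-distribˡ-sum c (λ j → unless (d j) (S b j f a)))) ∙ sym (distribˡ c _ _)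
      where
      d : Fin N → Bool
      d j = does (j Fin.≟ b) ∨ has j T
      unless-* : ∀ b x → unless b (c * x) ≈ c * unless b x
      unless-* true  x = sym (zeroʳ c)
      unless-* false x = refl

    Ξ-zero : ∀ b T a → Ξ b T (λ _ → 0#) a ≈ 0#
    Ξ-zero b T a = +-cong (U-zero b a) (sum-zero λ j → unless-zero (does (j Fin.≟ b) ∨ has j T)) ∙ +-identityˡ 0#
      where
      unless-zero : ∀ b → unless b 0# ≈ 0#
      unless-zero true  = refl
      unless-zero false = refl

    Ξ-sum : ∀ b T {m} (f : Fin m → Ser N) a → Ξ b T (λ c → sum (λ j → f j c)) a ≈ sum (λ j → Ξ b T (f j) a)
    Ξ-sum b T {zero}  f a = Ξ-cong b T (λ c → sum-0 (λ j → f j c)) a ∙ Ξ-zero b T a ∙ sym (sum-0 _)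
    Ξ-sum b T {suc m} f a = Ξ-cong b T (λ c → sum-suc (λ j → f j c)) a ∙
      Ξ-+ b T (f zero) (λ c → sum (λ j → f (suc j) c)) a ∙
      +-congˡ (Ξ-sum b T (f ∘ suc) a) ∙ sym (sum-suc _)

    -- Moving x_k to the left of U_b costs - x_b s_bk, which cancels the summand j = k; the loss of
    -- that summand is the effect of adding k to T.
    Ξ-X : ∀ b T {k} l → k ≢ b → has k T ≡ false → ∀ (g : Ser N) a →
          Ξ b T (X k g) a ≈ X k (Ξ b (T ∷ʳ (l , just k)) g) a
    Ξ-X b T {k} l k≢b k∉T g a = begin
      U b (X k g) a + sum (λ j → unless (does (j Fin.≟ b) ∨ has j T) (S b j (X k g) a))
        ≈⟨ +-cong (U-X k≢b g a) (sum-cong each ∙ ∑-distrib-+ _ _ ∙ +-congʳ (sum-δ k (λ _ → s))) ⟩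
      (X k (U b g) a - s) + (s + sum (λ j → unless (d j) (X k (S b j g) a)))
        ≈⟨ solve 3 (λ x y z → (x :- y) :+ (y :+ z) := x :+ z) refl _ _ _ ⟩
      X k (U b g) a + sum (λ j → unless (d j) (X k (S b j g) a))
        ≈⟨ +-congˡ (X-sum k (λ j c → unless (d j) (S b j g c)) a ∙ (sum-cong λ j → X-unless k (d j) (S b j g) a)) ⟨
      X k (U b g) a + X k (λ c → sum (λ j → unless (d j) (S b j g c))) a
        ≈⟨ X-+ k (U b g) (λ c → sum (λ j → unless (d j) (S b j g c))) a ⟨
      X k (Ξ b (T ∷ʳ (l , just k)) g) a ∎
      where
      open ≈R
      s = X b (S b k g) a
      d : Fin N → Bool
      d j = does (j Fin.≟ b) ∨ has j (T ∷ʳ (l , just k))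
      each : ∀ j → unless (does (j Fin.≟ b) ∨ has j T) (S b j (X k g) a) ≈
                   when (does (j Fin.≟ k)) s + unless (does (j Fin.≟ b) ∨ has j (T ∷ʳ (l , just k))) (X k (S b j g) a)
      each j rewrite has-∷ʳ j T l k with j Fin.≟ b | j Fin.≟ k
      ... | yes ≡.refl | yes ≡.refl = contradiction ≡.refl k≢b
      ... | yes _      | no  _      = sym (+-identityˡ 0#)
      ... | no  _      | yes ≡.refl rewrite k∉T = X-S b j j g a ∙
        cong-≈ (λ i → X i (S b j g) a) (transpose-right b j) ∙ sym (+-identityʳ _)
      ... | no  _      | no  j≢k rewrite Bool.∨-identityʳ (has j T) = trans
        (unless-cong (has j T) (X-S b j k g a ∙
          cong-≈ (λ i → X i (S b j g) a) (transpose-other b j k≢b (j≢k ∘ ≡.sym))))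
        (sym (+-identityˡ _))

    eigenvalue : Queue N → ℕ → Queue N → Carrier
    eigenvalue E l T = α * ν l + (((ν N - 1#) - ν (longer l T)) - ν (longer (suc l) E))

    U-𝟙 : ∀ i a → U i 𝟙 a ≈ 0#
    U-𝟙 i a = U-symmetric i (λ i j a → cong-≈ (λ b → when b 1#) (isZero-swapᵛ i j a)) a ∙ vanish
      where
      vanish : α * ν (lookup a i) * 𝟙 a ≈ 0#
      vanish with isZero a in eq
      ... | false = zeroʳ _
      ... | true rewrite isZero-lookup a eq i = solve 1 (λ x → x :* :0 :* :1 := :0) refl α

    annihilated : ∀ n {Q} → Good Q → ∀ {r} → has r Q ≡ false → ∀ a → U r (F n Q) a ≈ 0#
    eigen : ∀ n {Q} → Good Q → ∀ E {l b} T → Q ≡ E ++ (l , just b) ∷ T → ∀ a →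
            Ξ b T (F n Q) a ≈ eigenvalue E l T * F n Q a

    module Step (n : ℕ) {l : ℕ} {Q : Queue N} (g : Good Q) where

      G : Fin N → Ser N
      G k = F n (Q ∷ʳ (l , just k))

      B : Ser N
      B a = sum (λ k → unless (has k Q) (X k (G k) a))

      ε : Carrier
      ε = eigenvalue Q l [] + α

      -- The rows counted by `longer (suc l) Q` and by `shorter l Q` make up all of Q, which turns
      -- the rank into κ.
      ε≈ : ε ≈ (ν N - ν (length Q)) + κ l Q - 1#
      ε≈ = begin
        (α * ν l + (((ν N - 1#) - 0#) - ν (longer (suc l) Q))) + α
          ≈⟨ solve 5 (λ α l n x y → (α :* l :+ (((n :- :1) :- :0) :- x)) :+ α :=
               (n :- (x :+ y)) :+ (α :* (:1 :+ l) :+ y) :- :1) refl α (ν l) (ν N) (ν (longer (suc l) Q)) (ν (shorter l Q)) ⟩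
        (ν N - (ν (longer (suc l) Q) + ν (shorter l Q))) + κ l Q - 1#
          ≈⟨ +-congʳ (+-congʳ (+-congˡ (-‿cong (sym (ν-+ (longer (suc l) Q) (shorter l Q)) ∙
               cong-≈ ν (longer+shorter l Q))))) ⟩
        (ν N - ν (length Q)) + κ l Q - 1# ∎
        where open ≈R

      S-G : ∀ {r k} → has r Q ≡ false → has k Q ≡ false → S r k (G k) ≐ G r
      S-G {r} {k} r∉ k∉ a = F-relabel n (Q ∷ʳ (l , just k)) r k a ∙ reflexive (cong (λ P → F n P a)
        (relabel-∷ʳ r k Q l k ⊙ cong₂ (λ P b → P ∷ʳ (l , just b)) (relabel-fresh Q r∉ k∉) (transpose-right r k)))

      -- x_k U_r G_k vanishes by induction; what survives is the commutator - x_r s_rk, and s_rk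
      -- turns G_k into G_r.
      U-other : ∀ {r k} → has r Q ≡ false → has k Q ≡ false → k ≢ r → ∀ a →
                U r (X k (G k)) a ≈ - X r (G r) a
      U-other {r} {k} r∉ k∉ k≢r a = U-X k≢r (G k) a ∙ +-cong
        (X-cong k (annihilated n (good-∷ʳ g k∉) (has-∷ʳ-false Q l r∉ (k≢r ∘ ≡.sym))) a ∙ X-zero k a)
        (-‿cong (X-cong r (S-G r∉ k∉) a)) ∙ +-identityˡ _

      -- The commutator of U_r with x_r supplies α and all the s_rj, which complete U_r to the
      -- operator Ξ of the last row.
      U-same : ∀ {r} → has r Q ≡ false → ∀ a → U r (X r (G r)) a ≈ ε * X r (G r) a
      U-same {r} r∉ a = begin
        U r (X r (G r)) a
          ≈⟨ U-X-self r (G r) a ⟩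
        X r (U r (G r)) a + (α * x + sum (λ j → unless (does (j Fin.≟ r)) (X r (S r j (G r)) a)))
          ≈⟨ solve 3 (λ u v w → u :+ (v :+ w) := (u :+ w) :+ v) refl _ _ _ ⟩
        (X r (U r (G r)) a + sum (λ j → unless (does (j Fin.≟ r)) (X r (S r j (G r)) a))) + α * x
          ≈⟨ +-congʳ (+-congˡ (X-sum r (λ j c → unless (does (j Fin.≟ r)) (S r j (G r) c)) a ∙
               (sum-cong λ j → X-unless r (does (j Fin.≟ r)) (S r j (G r)) a))) ⟨
        (X r (U r (G r)) a + X r (λ c → sum (λ j → unless (does (j Fin.≟ r)) (S r j (G r) c))) a) + α * x
          ≈⟨ +-congʳ (X-+ r (U r (G r)) (λ c → sum (λ j → unless (does (j Fin.≟ r)) (S r j (G r) c))) a) ⟨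
        X r (λ c → U r (G r) c + sum (λ j → unless (does (j Fin.≟ r)) (S r j (G r) c))) a + α * x
          ≈⟨ +-congʳ (X-cong r (λ c → +-congˡ {U r (G r) c} (sum-cong λ j → reflexive (cong (λ b → unless b (S r j (G r) c))
               (≡.sym (Bool.∨-identityʳ _))))) a) ⟩
        X r (Ξ r [] (G r)) a + α * x
          ≈⟨ +-congʳ (X-cong r (eigen n (good-∷ʳ g r∉) Q [] ≡.refl) a ∙ X-* r (eigenvalue Q l []) (G r) a) ⟩
        eigenvalue Q l [] * x + α * x
          ≈⟨ distribʳ x _ α ⟨
        ε * x ∎
        where
        open ≈R
        x = X r (G r) a

      U-B : ∀ {r} → has r Q ≡ false → ∀ a → U r B a ≈ κ l Q * X r (G r) a
      U-B {r} r∉ a = begin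
        U r B a
          ≈⟨ U-sum r (λ k c → unless (has k Q) (X k (G k) c)) a ⟩
        sum (λ k → U r (λ c → unless (has k Q) (X k (G k) c)) a)
          ≈⟨ sum-cong each ⟩
        sum (λ k → when (does (k Fin.≟ r)) ((ε + 1#) * x) + unless (has k Q) (- x))
          ≈⟨ ∑-distrib-+ _ _ ∙ +-cong (sum-δ r (λ _ → (ε + 1#) * x)) (sum-fresh g (- x)) ⟩
        (ε + 1#) * x + (ν N - ν (length Q)) * - x
          ≈⟨ +-congʳ (*-congʳ (+-congʳ ε≈)) ⟩
        (((ν N - ν (length Q)) + κ l Q - 1#) + 1#) * x + (ν N - ν (length Q)) * - x
          ≈⟨ solve 3 (λ n k x → ((n :+ k :- :1) :+ :1) :* x :+ n :* (:- x) := k :* x) refl (ν N - ν (length Q)) (κ l Q) x ⟩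
        κ l Q * x ∎
        where
        open ≈R
        x = X r (G r) a
        each : ∀ k → U r (λ c → unless (has k Q) (X k (G k) c)) a ≈
                     when (does (k Fin.≟ r)) ((ε + 1#) * x) + unless (has k Q) (- x)
        each k with has k Q in k∉ | k Fin.≟ r
        ... | true  | yes ≡.refl with () ← ≡.trans (≡.sym k∉) r∉
        ... | true  | no  k≢r    = U-zero r a ∙ sym (+-identityˡ 0#)
        ... | false | yes ≡.refl = U-same k∉ a ∙ solve 2 (λ e x → e :* x := (e :+ :1) :* x :+ (:- x)) refl ε x
        ... | false | no  k≢r    = U-other r∉ k∉ k≢r a ∙ sym (+-identityˡ _)

    annihilated n       {[]}                    []      {r} h a = U-𝟙 r a
    annihilated n       {(zero  , just b) ∷ Q} (p ∷ g) {r} h a = annihilated n g (proj₂ (∨-false {does (r Fin.≟ b)} h)) a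
    annihilated zero    {(suc l , just b) ∷ Q} (p ∷ g) {r} h a = U-zero r a
    annihilated (suc n) {(suc l , just b) ∷ Q} (p ∷ g) {r} h a with ∨-false {does (r Fin.≟ b)} h
    ... | r≢b , r∉ = begin
      U r (λ c → B c + κ l Q * X b (G b) c) a
        ≈⟨ U-+ r B (λ c → κ l Q * X b (G b) c) a ⟩
      U r B a + U r (λ c → κ l Q * X b (G b) c) a
        ≈⟨ +-cong (U-B r∉ a) (U-* r (κ l Q) (X b (G b)) a ∙ *-congˡ (U-other r∉ p (≟-false r≢b ∘ ≡.sym) a)) ⟩
      κ l Q * X r (G r) a + κ l Q * - X r (G r) a
        ≈⟨ solve 2 (λ k x → k :* x :+ k :* (:- x) := :0) refl _ _ ⟩
      0# ∎
      where
      open ≈R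
      open Step n {l} g

    eigen n       {[]}                    []      (_ ∷ E) T () a
    eigen n       {[]}                    []      []      T () a
    eigen n       {(zero  , just b) ∷ Q} (p ∷ g) []      T ≡.refl a = begin
      U b (F n Q) a + sum (λ j → unless (does (j Fin.≟ b) ∨ has j Q) (S b j (F n Q) a))
        ≈⟨ +-cong (annihilated n g p a) (sum-cong each ∙ sum-fresh {Q = (0 , just b) ∷ Q} (p ∷ g) (F n Q a)) ⟩
      0# + (ν N - ν (suc (length Q))) * F n Q a
        ≈⟨ solve 4 (λ n q x α → :0 :+ (n :- (:1 :+ q)) :* x := (α :* :0 :+ (((n :- :1) :- q) :- :0)) :* x) refl
             (ν N) (ν (length Q)) (F n Q a) α ⟩
      (α * 0# + (((ν N - 1#) - ν (length Q)) - 0#)) * F n Q a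
        ≈⟨ *-congʳ (+-congˡ (+-congʳ (+-congˡ (-‿cong (cong-≈ ν (≡.sym (longer-0 Q))))))) ⟩
      eigenvalue [] 0 Q * F n Q a ∎
      where
      open ≈R
      longer-0 : ∀ (Q : Queue N) → longer 0 Q ≡ length Q
      longer-0 []      = ≡.refl
      longer-0 (_ ∷ Q) = cong suc (longer-0 Q)
      each : ∀ j → unless (does (j Fin.≟ b) ∨ has j Q) (S b j (F n Q) a) ≈
                   unless (does (j Fin.≟ b) ∨ has j Q) (F n Q a)
      each j with does (j Fin.≟ b) | has j Q in j∉
      ... | true  | _     = refl
      ... | false | true  = refl
      ... | false | false = F-relabel n Q b j a ∙ cong-≈ (λ P → F n P a) (relabel-fresh Q p j∉)
    eigen n       {(zero  , just b) ∷ Q} (p ∷ g) (_ ∷ E) T ≡.refl a = eigen n g E T ≡.refl a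
    eigen zero    {(suc l , just b) ∷ Q} (p ∷ g) E {b = b′} T e a = Ξ-zero b′ T a ∙ sym (zeroʳ _)
    eigen (suc n) {(suc l , just b) ∷ Q} (p ∷ g) []      T ≡.refl a = begin
      U b FQ a + sum (λ j → unless (d j) (S b j FQ a))
        ≈⟨ +-cong (U-+ b B (λ c → κ l Q * X b (G b) c) a ∙
             +-cong (U-B p a) (U-* b (κ l Q) (X b (G b)) a ∙ *-congˡ (U-same p a))) others ⟩
      (κ l Q * h + κ l Q * (ε * h)) + ((((ν N - ν (length Q)) * B a) - B a) + κ l Q * (B a - h))
        ≈⟨ solve 5 (λ n k e h b → (k :* h :+ k :* (e :* h)) :+ ((n :* b :- b) :+ k :* (b :- h)) :=
             (n :+ k :- :1) :* b :+ e :* (k :* h)) refl (ν N - ν (length Q)) (κ l Q) ε h (B a) ⟩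
      ((ν N - ν (length Q)) + κ l Q - 1#) * B a + ε * (κ l Q * h)
        ≈⟨ +-congʳ (*-congʳ ε≈) ⟨
      ε * B a + ε * (κ l Q * h)
        ≈⟨ distribˡ ε _ _ ⟨
      ε * FQ a
        ≈⟨ *-congʳ (solve 4 (λ α l n x → (α :* l :+ (((n :- :1) :- :0) :- x)) :+ α := α :* (:1 :+ l) :+ (((n :- :1) :- x) :- :0))
             refl α (ν l) (ν N) (ν (longer (suc l) Q))) ⟩
      eigenvalue [] (suc l) Q * FQ a ∎
      where
      open ≈R
      open Step n {l} g
      FQ : Ser N
      FQ = F (suc n) ((suc l , just b) ∷ Q)
      h = X b (G b) a
      d : Fin N → Bool
      d j = does (j Fin.≟ b) ∨ has j Q
      each : ∀ j → unless (does (j Fin.≟ b) ∨ has j Q) (S b j FQ a) ≈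
                   unless (does (j Fin.≟ b) ∨ has j Q) (B a) +
                   κ l Q * unless (does (j Fin.≟ b) ∨ has j Q) (X j (G j) a)
      each j with does (j Fin.≟ b) | has j Q in j∉
      ... | true  | _     = solve 1 (λ k → :0 := :0 :+ k :* :0) refl (κ l Q)
      ... | false | true  = solve 1 (λ k → :0 := :0 :+ k :* :0) refl (κ l Q)
      ... | false | false = F-relabel (suc n) ((suc l , just b) ∷ Q) b j a ∙ reflexive (cong₂
        (λ P i → F (suc n) ((suc l , just i) ∷ P) a) (relabel-fresh Q p j∉) (transpose-left b j))
      others : sum (λ j → unless (d j) (S b j FQ a)) ≈ (((ν N - ν (length Q)) * B a) - B a) + κ l Q * (B a - h)
      others = sum-cong each ∙ ∑-distrib-+ _ _ ∙ +-cong
        (sum-unless-∷ b Q p (λ _ → B a) ∙ +-congʳ (sum-fresh g (B a)))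
        (sym (*-distribˡ-sum (κ l Q) (λ j → unless (d j) (X j (G j) a))) ∙
          *-congˡ (sum-unless-∷ b Q p (λ j → X j (G j) a)))
    eigen (suc n) {(suc l₀ , just b₀) ∷ Q} (p ∷ g) (_ ∷ E) {l} {b} T ≡.refl a = begin
      Ξ b T (λ c → B c + κ l₀ Q * X b₀ (G b₀) c) a
        ≈⟨ Ξ-+ b T B (λ c → κ l₀ Q * X b₀ (G b₀) c) a ⟩
      Ξ b T B a + Ξ b T (λ c → κ l₀ Q * X b₀ (G b₀) c) a
        ≈⟨ +-cong (Ξ-sum b T (λ k c → unless (has k Q) (X k (G k) c)) a ∙
             sum-cong each ∙ sym (*-distribˡ-sum e (λ k → unless (has k Q) (X k (G k) a))))
           (Ξ-* b T (κ l₀ Q) (X b₀ (G b₀)) a ∙ *-congˡ (one p)) ⟩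
      e * B a + κ l₀ Q * (e * X b₀ (G b₀) a)
        ≈⟨ solve 4 (λ e b k h → e :* b :+ k :* (e :* h) := e :* (b :+ k :* h)) refl _ _ _ _ ⟩
      e * (B a + κ l₀ Q * X b₀ (G b₀) a) ∎
      where
      open ≈R
      open Step n {l₀} g
      e = eigenvalue ((suc l₀ , just b₀) ∷ E) l T
      fresh : ∀ {k} → has k Q ≡ false → k ≢ b × has k T ≡ false
      fresh {k} k∉ with ∨-false {has k E} (≡.sym (has-++ k E ((l , just b) ∷ T)) ⊙ k∉)
      ... | _ , q with ∨-false {does (k Fin.≟ b)} q
      ...   | k≢b , k∉T = ≟-false k≢b , k∉T
      -- The head row has l₀ + 1 boxes before the step and l₀ after it, so the strict comparison in
      -- E and the weak one in T give the same answer.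
      value : ∀ k → eigenvalue E l (T ∷ʳ (l₀ , just k)) ≈ e
      value k = begin
        α * ν l + (((ν N - 1#) - ν (longer l (T ∷ʳ (l₀ , just k)))) - ν (longer (suc l) E))
          ≈⟨ +-congˡ (+-congʳ (+-congˡ (-‿cong (cong-≈ ν (longer-∷ʳ l T l₀ (just k)) ∙ ν-+ (longer l T) c)))) ⟩
        α * ν l + (((ν N - 1#) - (ν (longer l T) + ν c)) - ν (longer (suc l) E))
          ≈⟨ +-congˡ (solve 4 (λ n x y z → (n :- (x :+ y)) :- z := (n :- x) :- (y :+ z)) refl _ _ _ _) ⟩
        α * ν l + (((ν N - 1#) - ν (longer l T)) - (ν c + ν (longer (suc l) E)))
          ≈⟨ +-congˡ (+-congˡ (-‿cong (sym (ν-+ c (longer (suc l) E)) ∙ cong-≈ (λ b → ν ((if b then 1 else 0) ℕ.+ longer (suc l) E)) (≤?-suc l l₀)))) ⟩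
        e ∎
        where
        c = bit (does (l ℕ.≤? l₀))
      one : ∀ {k} → has k Q ≡ false → Ξ b T (X k (G k)) a ≈ e * X k (G k) a
      one {k} k∉ with k≢b , k∉T ← fresh k∉ = Ξ-X b T l₀ k≢b k∉T (G k) a ∙
        X-cong k (λ c → eigen n (good-∷ʳ g k∉) E (T ∷ʳ (l₀ , just k)) (List.++-assoc E _ _) c ∙ *-congʳ (value k)) a ∙
          X-* k e (G k) a
      each : ∀ k → Ξ b T (λ c → unless (has k Q) (X k (G k) c)) a ≈ e * unless (has k Q) (X k (G k) a)
      each k with has k Q in k∉
      ... | true  = Ξ-zero b T a ∙ sym (zeroʳ e)
      ... | false = one k∉

empties : ∀ {N} → List ℕ → Queue N
empties = map (_, nothing)

module _ {N : ℕ} where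

  lengths-length : ∀ (Q : Queue N) {ls} → lengths Q ≡ ls → length Q ≡ length ls
  lengths-length Q e = ≡.sym (List.length-map proj₁ Q) ⊙ cong length e

  has-empties : ∀ k td (D : Queue N) → has k (empties td ++ D) ≡ has k D
  has-empties k []       D = ≡.refl
  has-empties k (_ ∷ td) D = has-empties k td D

-- Summation over the labels of the rows

module Labellings (R : CommutativeRing 0ℓ 0ℓ) (α : CommutativeRing.Carrier R) where
  open CommutativeRing R hiding (zero)
  open Ring R
  open Series R α
  open Fillings R α
  private
    module ≈R = SetoidReasoning setoid

  unless-+ : ∀ b x y → unless b (x + y) ≈ unless b x + unless b y
  unless-+ true  x y = sym (+-identityˡ 0#)
  unless-+ false x y = refl

  unless-* : ∀ b c x → unless b (c * x) ≈ c * unless b x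
  unless-* true  c x = sym (zeroʳ c)
  unless-* false c x = refl

  unless-sum : ∀ b {n} (f : Fin n → Carrier) → unless b (sum f) ≈ sum (λ i → unless b (f i))
  unless-sum true  f = sym (sum-zero λ _ → refl)
  unless-sum false f = refl

  unless-zero : ∀ b → unless b 0# ≈ 0#
  unless-zero true  = refl
  unless-zero false = refl

  unless-comm : ∀ b c x → unless b (unless c x) ≡ unless c (unless b x)
  unless-comm true  true  x = ≡.refl
  unless-comm true  false x = ≡.refl
  unless-comm false true  x = ≡.refl
  unless-comm false false x = ≡.refl

  module _ {N : ℕ} where

    -- The sum over all ways to put distinct labels, not used in D, on rows of lengths td above D.
    sumQ : List ℕ → Queue N → (Queue N → Carrier) → Carrier
    sumQ []       D Φ = Φ D
    sumQ (l ∷ td) D Φ = sumQ td D (λ P → sum (λ k → unless (has k P) (Φ ((l , just k) ∷ P))))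

    sumQ-cong : ∀ td {D} → Good D → {Φ Ψ : Queue N → Carrier} →
                (∀ P → Good P → lengths P ≡ td ++ lengths D → Φ P ≈ Ψ P) → sumQ td D Φ ≈ sumQ td D Ψ
    sumQ-cong []       {D} g e = e D g ≡.refl
    sumQ-cong (l ∷ td) {D} g {Φ} {Ψ} e = sumQ-cong td g λ P p q → sum-cong λ k → each P p q k
      where
      each : ∀ P → Good P → lengths P ≡ td ++ lengths D → ∀ k →
             unless (has k P) (Φ ((l , just k) ∷ P)) ≈ unless (has k P) (Ψ ((l , just k) ∷ P))
      each P p q k with has k P in k∉
      ... | true  = refl
      ... | false = e _ (k∉ ∷ p) (cong (l ∷_) q)

    sumQ-cong′ : ∀ td D {Φ Ψ : Queue N → Carrier} → (∀ P → Φ P ≈ Ψ P) → sumQ td D Φ ≈ sumQ td D Ψ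
    sumQ-cong′ []       D e = e D
    sumQ-cong′ (l ∷ td) D e = sumQ-cong′ td D λ P → sum-cong λ k → unless-cong (has k P) (e _)

    sumQ-+ : ∀ td D (Φ Ψ : Queue N → Carrier) → sumQ td D (λ P → Φ P + Ψ P) ≈ sumQ td D Φ + sumQ td D Ψ
    sumQ-+ []       D Φ Ψ = refl
    sumQ-+ (l ∷ td) D Φ Ψ = (sumQ-cong′ td D λ P → (sum-cong λ k → unless-+ (has k P) _ _) ∙ ∑-distrib-+ _ _) ∙
      sumQ-+ td D _ _

    sumQ-* : ∀ td D c (Φ : Queue N → Carrier) → sumQ td D (λ P → c * Φ P) ≈ c * sumQ td D Φ
    sumQ-* []       D c Φ = refl
    sumQ-* (l ∷ td) D c Φ = (sumQ-cong′ td D λ P → (sum-cong λ k → unless-* (has k P) c _) ∙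
      sym (*-distribˡ-sum c _)) ∙ sumQ-* td D c _

    sumQ-sum : ∀ td D {m} (Φ : Fin m → Queue N → Carrier) →
               sumQ td D (λ P → sum (λ i → Φ i P)) ≈ sum (λ i → sumQ td D (Φ i))
    sumQ-sum []       D Φ = refl
    sumQ-sum (l ∷ td) D Φ = (sumQ-cong′ td D λ P → (sum-cong λ k → unless-sum (has k P) _) ∙ ∑-comm _) ∙
      sumQ-sum td D _

    sumQ-zero : ∀ td D → sumQ td D (λ _ → 0#) ≈ 0#
    sumQ-zero td D = sumQ-cong′ td D (λ _ → sym (zeroˡ 0#)) ∙ sumQ-* td D 0# _ ∙ zeroˡ _

    record Linear (O : Ser N → Ser N) : Set where
      field
        O-cong : ∀ {f g} → f ≐ g → O f ≐ O g
        O-zero : ∀ a → O (λ _ → 0#) a ≈ 0#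
        O-sum  : ∀ {m} (f : Fin m → Ser N) a → O (λ b → sum (λ j → f j b)) a ≈ sum (λ j → O (f j) a)

      O-unless : ∀ b (f : Ser N) a → O (λ c → unless b (f c)) a ≈ unless b (O f a)
      O-unless true  f a = O-zero a
      O-unless false f a = refl

      O-sumQ : ∀ td D (Φ : Queue N → Ser N) a →
               O (λ c → sumQ td D (λ P → Φ P c)) a ≈ sumQ td D (λ P → O (Φ P) a)
      O-sumQ []       D Φ a = refl
      O-sumQ (l ∷ td) D Φ a = trans
        (O-sumQ td D (λ P c → sum (λ k → unless (has k P) (Φ ((l , just k) ∷ P) c))) a)
        (sumQ-cong′ td D λ P → O-sum (λ k c → unless (has k P) (Φ ((l , just k) ∷ P) c)) a ∙
          (sum-cong λ k → O-unless (has k P) (Φ ((l , just k) ∷ P)) a))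

    X-linear : ∀ k → Linear (X k)
    X-linear k = record { O-cong = X-cong k ; O-zero = X-zero k ; O-sum = X-sum k }

    U-linear : ∀ i → Linear (U i)
    U-linear i = record { O-cong = U-cong i ; O-zero = U-zero i ; O-sum = U-sum i }

    -- Distinct labels can be chosen in any order, in particular that of the appended row first
    -- instead of last.
    sumQ-exchange : ∀ td D l (Ψ : Fin N → Queue N → Carrier) →
      sumQ td D (λ P → sum (λ k → unless (has k P) (Ψ k (P ∷ʳ (l , just k))))) ≈
      sum (λ k → unless (has k D) (sumQ td (D ∷ʳ (l , just k)) (Ψ k)))
    sumQ-exchange []        D l Ψ = refl
    sumQ-exchange (l′ ∷ td) D l Ψ = trans
      (sumQ-cong′ td D λ P → (sum-cong λ j → unless-sum (has j P) _) ∙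
        ∑-comm _ ∙ (sum-cong λ k → (sum-cong λ j → reflexive (both j k P)) ∙ sym (unless-sum (has k P) _)))
      (sumQ-exchange td D l (λ k P → sum (λ j → unless (has j P) (Ψ k ((l′ , just j) ∷ P)))))
      where
      shuffle : ∀ a b c x → unless a (unless (b ∨ c) x) ≡ unless c (unless (a ∨ b) x)
      shuffle true  true  true  x = ≡.refl
      shuffle true  true  false x = ≡.refl
      shuffle true  false true  x = ≡.refl
      shuffle true  false false x = ≡.refl
      shuffle false true  true  x = ≡.refl
      shuffle false true  false x = ≡.refl
      shuffle false false true  x = ≡.refl
      shuffle false false false x = ≡.refl
      ≟-comm : ∀ (i j : Fin N) → does (i Fin.≟ j) ≡ does (j Fin.≟ i)
      ≟-comm i j with i Fin.≟ j | j Fin.≟ i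
      ... | yes _ | yes _ = ≡.refl
      ... | no  _ | no  _ = ≡.refl
      ... | yes p | no  q = contradiction (≡.sym p) q
      ... | no  p | yes q = contradiction (≡.sym q) p
      both : ∀ j k P → unless (has j P) (unless (does (k Fin.≟ j) ∨ has k P) (Ψ k ((l′ , just j) ∷ P ∷ʳ (l , just k)))) ≡
                       unless (has k P) (unless (has j (P ∷ʳ (l , just k))) (Ψ k ((l′ , just j) ∷ P ∷ʳ (l , just k))))
      both j k P = shuffle (has j P) (does (k Fin.≟ j)) (has k P) _ ⊙
        cong (λ b → unless (has k P) (unless b (Ψ k ((l′ , just j) ∷ P ∷ʳ (l , just k)))))
          (cong (has j P ∨_) (≟-comm k j) ⊙ ≡.sym (has-∷ʳ j P l k))

    sumQ-relabel : ∀ td D i j (Φ : Queue N → Carrier) → sumQ td D (Φ ∘ relabel i j) ≈ sumQ td (relabel i j D) Φ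
    sumQ-relabel []       D i j Φ = refl
    sumQ-relabel (l ∷ td) D i j Φ = (sumQ-cong′ td D λ P → trans
        (sum-cong λ k → reflexive (cong (λ b → unless b (Φ ((l , just (transpose i j k)) ∷ relabel i j P)))
          (≡.sym (has-relabel i j k P))))
        (sym (sum-transpose i j (λ k → unless (has k (relabel i j P)) (Φ ((l , just k) ∷ relabel i j P)))))) ∙
      sumQ-relabel td D i j (λ P → sum (λ k → unless (has k P) (Φ ((l , just k) ∷ P))))

    sumQ-++ : ∀ td te D (Φ : Queue N → Carrier) → sumQ (td ++ te) D Φ ≡ sumQ te D (λ T → sumQ td T Φ)
    sumQ-++ []       te D Φ = ≡.refl
    sumQ-++ (l ∷ td) te D Φ = sumQ-++ td te D _

    choices : ℕ → List ℕ → Carrier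
    choices zero    ls = ν N - ν (length ls)
    choices (suc l) ls = (ν N - ν (length ls)) + (α * ν (suc l) + ν (shorterᴸ l ls))

    multiplicityᴸ : List ℕ → List ℕ → Carrier
    multiplicityᴸ []            ds = 1#
    multiplicityᴸ (zero  ∷ td) ds = choices zero (td ++ ds) * multiplicityᴸ td ds
    multiplicityᴸ (suc l ∷ td) ds = choices (suc l) (td ++ ds) * multiplicityᴸ td (ds ∷ʳ l)

    -- Averaging over the labels of empty rows only changes the constant.
    sumQ-F : ∀ n td {D} → Good D → ∀ a →
             sumQ td D (λ P → F n P a) ≈ multiplicityᴸ td (lengths D) * F n (empties td ++ D) a
    sumQ-F n       []            {D} g a = sym (*-identityˡ _)
    sumQ-F n       (zero ∷ td)  {D} g a = begin
      sumQ td D (λ P → sum (λ k → unless (has k P) (F n P a)))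
        ≈⟨ sumQ-cong td g (λ P p q → sum-fresh p (F n P a) ∙
             *-congʳ (+-congˡ (-‿cong (cong-≈ ν (lengths-length P q))))) ⟩
      sumQ td D (λ P → choices 0 (td ++ lengths D) * F n P a)
        ≈⟨ sumQ-* td D _ _ ⟩
      choices 0 (td ++ lengths D) * sumQ td D (λ P → F n P a)
        ≈⟨ *-congˡ (sumQ-F n td g a) ⟩
      choices 0 (td ++ lengths D) * (multiplicityᴸ td (lengths D) * F n (empties td ++ D) a)
        ≈⟨ *-assoc _ _ _ ⟨
      choices 0 (td ++ lengths D) * multiplicityᴸ td (lengths D) * F n (empties td ++ D) a ∎
      where open ≈R
    sumQ-F zero    (suc l ∷ td) {D} g a = trans
      (sumQ-cong′ td D λ P → sum-zero λ k → unless-zero (has k P))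
      (sumQ-zero td D ∙ sym (zeroʳ _))
    sumQ-F (suc n) (suc l ∷ td) {D} g a = begin
      sumQ td D (λ P → sum (λ k → unless (has k P) (F (suc n) ((suc l , just k) ∷ P) a)))
        ≈⟨ sumQ-cong td g inner ⟩
      sumQ td D (λ P → c * B P)
        ≈⟨ sumQ-* td D c B ⟩
      c * sumQ td D B
        ≈⟨ *-congˡ (sumQ-exchange td D l (λ k P → X k (F n P) a)) ⟩
      c * sum (λ k → unless (has k D) (sumQ td (D ∷ʳ (l , just k)) (λ P → X k (F n P) a)))
        ≈⟨ *-congˡ (sum-cong each) ⟩
      c * sum (λ k → m * unless (has k D) (X k (F n (empties td ++ D ∷ʳ (l , just k))) a))
        ≈⟨ *-congˡ (*-distribˡ-sum m _) ⟨
      c * (m * sum (λ k → unless (has k D) (X k (F n (empties td ++ D ∷ʳ (l , just k))) a)))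
        ≈⟨ *-assoc _ _ _ ⟨
      c * m * sum (λ k → unless (has k D) (X k (F n (empties td ++ D ∷ʳ (l , just k))) a))
        ≈⟨ *-congˡ ((sum-cong λ k → reflexive (cong₂ (λ b Q → unless b (X k (F n Q) a))
             (≡.sym (has-empties k td D)) (≡.sym (List.++-assoc (empties td) D _)))) ∙
             sym (+-congˡ (zeroʳ _) ∙ +-identityʳ _)) ⟩
      c * m * F (suc n) (empties (suc l ∷ td) ++ D) a ∎
      where
      open ≈R
      c = choices (suc l) (td ++ lengths D)
      m = multiplicityᴸ td (lengths D ∷ʳ l)
      B : Queue N → Carrier
      B P = sum (λ k → unless (has k P) (X k (F n (P ∷ʳ (l , just k))) a))
      inner : ∀ P → Good P → lengths P ≡ td ++ lengths D →
              sum (λ k → unless (has k P) (F (suc n) ((suc l , just k) ∷ P) a)) ≈ c * B P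
      inner P p q = begin
        sum (λ k → unless (has k P) (B P + κ l P * X k (F n (P ∷ʳ (l , just k))) a))
          ≈⟨ (sum-cong λ k → unless-+ (has k P) _ _ ∙ +-congˡ (unless-* (has k P) (κ l P) _)) ∙ ∑-distrib-+ _ _ ⟩
        sum (λ k → unless (has k P) (B P)) + sum (λ k → κ l P * unless (has k P) (X k (F n (P ∷ʳ (l , just k))) a))
          ≈⟨ +-cong (sum-fresh p (B P)) (sym (*-distribˡ-sum (κ l P) _)) ⟩
        (ν N - ν (length P)) * B P + κ l P * B P
          ≈⟨ distribʳ (B P) _ _ ⟨
        ((ν N - ν (length P)) + κ l P) * B P
          ≈⟨ *-congʳ (+-cong (+-congˡ (-‿cong (cong-≈ ν (lengths-length P q))))
               (+-congˡ (cong-≈ ν (cong (shorterᴸ l) q)))) ⟩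
        c * B P ∎
      each : ∀ k → unless (has k D) (sumQ td (D ∷ʳ (l , just k)) (λ P → X k (F n P) a)) ≈
                   m * unless (has k D) (X k (F n (empties td ++ D ∷ʳ (l , just k))) a)
      each k with has k D in k∉
      ... | true  = sym (zeroʳ m)
      ... | false = sym (Linear.O-sumQ (X-linear k) td _ (F n) a) ∙
        X-cong k (λ b → sumQ-F n td (good-∷ʳ g k∉) b ∙
          *-congʳ (cong-≈ (multiplicityᴸ td) (List.map-++ proj₁ D _))) a ∙ X-* k m (F n (empties td ++ D ∷ʳ (l , just k))) a

    -- Triangular action of the Dunkl operators

    module Spectrum (n : ℕ) where

      eigenvalueᴸ : List ℕ → ℕ → List ℕ → Carrier
      eigenvalueᴸ le l lt = α * ν l + (((ν N - 1#) - ν (longerᴸ l lt)) - ν (longerᴸ (suc l) le))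

      -- The sum of all labelled fillings in which r labels none of the last rows lt; the other
      -- rows are listed in reverse order.
      V : List ℕ → List ℕ → Fin N → Ser N
      V re lt r a = sumQ lt [] (λ T → unless (has r T) (sumQ (reverse re) T (λ Q → F n Q a)))

      A : List ℕ → ℕ → List ℕ → Fin N → Ser N
      A re l lt r a = sumQ lt [] (λ T → unless (has r T) (sumQ (reverse re) ((l , just r) ∷ T) (λ Q → F n Q a)))

      sumQ-reverse-∷ : ∀ l re T (Φ : Queue N → Carrier) →
        sumQ (reverse (l ∷ re)) T Φ ≡ sum (λ k → unless (has k T) (sumQ (reverse re) ((l , just k) ∷ T) Φ))
      sumQ-reverse-∷ l re T Φ = cong (λ ls → sumQ ls T Φ) (List.unfold-reverse l re) ⊙
        sumQ-++ (reverse re) (l ∷ []) T Φ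

      V-split : ∀ l re lt r a → V (l ∷ re) lt r a ≈ A re l lt r a + V re (l ∷ lt) r a
      V-split l re lt r a = (sumQ-cong lt [] λ T t _ → pointwise T t) ∙ sumQ-+ lt [] _ _
        where
        G : Queue N → Carrier
        G T = sumQ (reverse re) T (λ Q → F n Q a)
        pointwise : ∀ T → Good T → unless (has r T) (sumQ (reverse (l ∷ re)) T (λ Q → F n Q a)) ≈
          unless (has r T) (G ((l , just r) ∷ T)) +
          sum (λ k → unless (has k T) (unless (does (r Fin.≟ k) ∨ has r T) (G ((l , just k) ∷ T))))
        pointwise T t with has r T in r∉
        ... | true  = sym (+-identityˡ _ ∙ (sum-zero λ k → trans
          (cong-≈ (λ b → unless (has k T) (unless b (G ((l , just k) ∷ T)))) (Bool.∨-zeroʳ _))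
          (unless-zero (has k T))))
        ... | false = reflexive (sumQ-reverse-∷ l re T _) ∙ trans
          (sum-when-unless (λ k → does (k Fin.≟ r)) _) (+-cong
            (sum-δ r (λ k → unless (has k T) (G ((l , just k) ∷ T))) ∙
              cong-≈ (λ b → unless b (G ((l , just r) ∷ T))) r∉)
            (sum-cong λ k → reflexive (unless-comm (does (k Fin.≟ r)) (has k T) _ ⊙
              cong (λ b → unless (has k T) (unless b (G ((l , just k) ∷ T)))) (≟-comm k r ⊙ ≡.sym (Bool.∨-identityʳ _)))))
          where
          ≟-comm : ∀ (i j : Fin N) → does (i Fin.≟ j) ≡ does (j Fin.≟ i)
          ≟-comm i j with i Fin.≟ j | j Fin.≟ i
          ... | yes _ | yes _ = ≡.refl
          ... | no  _ | no  _ = ≡.refl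
          ... | yes p | no  q = contradiction (≡.sym p) q
          ... | no  p | yes q = contradiction (≡.sym q) p

      -- U_r is Ξ minus exchanges s_rj. Each s_rj puts another label on the row l, and the results
      -- are exactly the fillings in which r labels none of the rows `l ∷ lt`.
      U-A : ∀ re l lt r a →
            U r (A re l lt r) a ≈ eigenvalueᴸ (reverse re) l lt * A re l lt r a - V re (l ∷ lt) r a
      U-A re l lt r a = begin
        U r (A re l lt r) a
          ≈⟨ Linear.O-sumQ (U-linear r) lt [] (λ T c → unless (has r T) (sumQ (reverse re) ((l , just r) ∷ T) (λ Q → F n Q c))) a ∙
               (sumQ-cong′ lt [] λ T → Linear.O-unless (U-linear r) (has r T) (λ c → sumQ (reverse re) ((l , just r) ∷ T) (λ Q → F n Q c)) a ∙
                 unless-cong (has r T) (Linear.O-sumQ (U-linear r) (reverse re) ((l , just r) ∷ T) (F n) a)) ⟩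
        sumQ lt [] (λ T → unless (has r T) (sumQ (reverse re) ((l , just r) ∷ T) (λ Q → U r (F n Q) a)))
          ≈⟨ sumQ-cong lt [] pointwise ⟩
        sumQ lt [] (λ T → e * unless (has r T) (G ((l , just r) ∷ T)) + - sum (λ k → unless (has k T) (unless (does (r Fin.≟ k) ∨ has r T) (G ((l , just k) ∷ T)))))
          ≈⟨ sumQ-+ lt [] _ _ ∙ +-cong (sumQ-* lt [] e _) negate ⟩
        e * A re l lt r a - V re (l ∷ lt) r a ∎
        where
        open ≈R
        e = eigenvalueᴸ (reverse re) l lt
        G : Queue N → Carrier
        G T = sumQ (reverse re) T (λ Q → F n Q a)
        negate : sumQ lt [] (λ T → - sum (λ k → unless (has k T) (unless (does (r Fin.≟ k) ∨ has r T) (G ((l , just k) ∷ T))))) ≈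
                 - V re (l ∷ lt) r a
        negate = (sumQ-cong′ lt [] λ T → solve 1 (λ x → :- x := (:- :1) :* x) refl _) ∙
          sumQ-* lt [] (- 1#) _ ∙ solve 1 (λ x → (:- :1) :* x := :- x) refl _
        -- A congruence that keeps the rows above D as a separate list, since `eigen` needs the
        -- queue split at the row labelled r.
        rows : ∀ td D (Φ Ψ : Queue N → Carrier) → Good D →
               (∀ E → Good (E ++ D) → lengths E ≡ td → Φ (E ++ D) ≈ Ψ (E ++ D)) → sumQ td D Φ ≈ sumQ td D Ψ
        rows []       D Φ Ψ g h = h [] g ≡.refl
        rows (l ∷ td) D Φ Ψ g h = rows td D _ _ g λ E p q → sum-cong λ k → each E p q k
          where
          each : ∀ E → Good (E ++ D) → lengths E ≡ td → ∀ k →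
                 unless (has k (E ++ D)) (Φ ((l , just k) ∷ E ++ D)) ≈ unless (has k (E ++ D)) (Ψ ((l , just k) ∷ E ++ D))
          each E p q k with has k (E ++ D) in k∉
          ... | true  = refl
          ... | false = h ((l , just k) ∷ E) (k∉ ∷ p) (cong (l ∷_) q)
        pointwise : ∀ T → Good T → lengths T ≡ lt ++ [] →
          unless (has r T) (sumQ (reverse re) ((l , just r) ∷ T) (λ Q → U r (F n Q) a)) ≈
          e * unless (has r T) (G ((l , just r) ∷ T)) +
          - sum (λ k → unless (has k T) (unless (does (r Fin.≟ k) ∨ has r T) (G ((l , just k) ∷ T))))
        pointwise T t w with has r T in r∉
        ... | true  = sym (+-cong (zeroʳ e) (-‿cong (sum-zero λ k → trans
          (cong-≈ (λ b → unless (has k T) (unless b (G ((l , just k) ∷ T)))) (Bool.∨-zeroʳ _))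
          (unless-zero (has k T)))) ∙ solve 0 (:0 :+ (:- :0) := :0) refl)
        ... | false = begin
          sumQ (reverse re) ((l , just r) ∷ T) (λ Q → U r (F n Q) a)
            ≈⟨ rows (reverse re) ((l , just r) ∷ T) _ _ (r∉ ∷ t) (λ E p q → value E p q) ⟩
          sumQ (reverse re) ((l , just r) ∷ T) (λ Q → e * F n Q a + - sum (λ j → unless (does (j Fin.≟ r) ∨ has j T) (F n (relabel r j Q) a)))
            ≈⟨ sumQ-+ (reverse re) _ _ _ ∙ +-cong (sumQ-* (reverse re) _ e _)
                 ((sumQ-cong′ (reverse re) _ λ T → solve 1 (λ x → :- x := (:- :1) :* x) refl _) ∙
                 sumQ-* (reverse re) _ (- 1#) _ ∙ *-congˡ (sumQ-sum (reverse re) _ _) ∙ solve 1 (λ x → (:- :1) :* x := :- x) refl _) ⟩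
          e * G ((l , just r) ∷ T) + - sum (λ j → sumQ (reverse re) ((l , just r) ∷ T) (λ Q → unless (does (j Fin.≟ r) ∨ has j T) (F n (relabel r j Q) a)))
            ≈⟨ +-congˡ (-‿cong (sum-cong each)) ⟩
          e * G ((l , just r) ∷ T) + - sum (λ k → unless (has k T) (unless (does (r Fin.≟ k) ∨ false) (G ((l , just k) ∷ T)))) ∎
          where
          value : ∀ E → Good (E ++ (l , just r) ∷ T) → lengths E ≡ reverse re →
                  U r (F n (E ++ (l , just r) ∷ T)) a ≈
                  e * F n (E ++ (l , just r) ∷ T) a + - sum (λ j → unless (does (j Fin.≟ r) ∨ has j T) (F n (relabel r j (E ++ (l , just r) ∷ T)) a))
          value E p q = begin
            U r FQ a
              ≈⟨ solve 2 (λ x y → x := (x :+ y) :- y) refl _ (sum (λ j → unless (does (j Fin.≟ r) ∨ has j T) (S r j FQ a))) ⟩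
            Ξ r T FQ a - sum (λ j → unless (does (j Fin.≟ r) ∨ has j T) (S r j FQ a))
              ≈⟨ +-cong (eigen n p E T ≡.refl a ∙ *-congʳ (+-congˡ (+-cong
                   (+-congˡ (-‿cong (cong-≈ ν (cong (longerᴸ l) (w ⊙ List.++-identityʳ lt)))))
                   (-‿cong (cong-≈ ν (cong (longerᴸ (suc l)) q))))))
                 (-‿cong (sum-cong λ j → unless-cong (does (j Fin.≟ r) ∨ has j T) (F-relabel n (E ++ (l , just r) ∷ T) r j a))) ⟩
            e * FQ a + - sum (λ j → unless (does (j Fin.≟ r) ∨ has j T) (F n (relabel r j (E ++ (l , just r) ∷ T)) a)) ∎
            where
            FQ : Ser N
            FQ = F n (E ++ (l , just r) ∷ T)
          each : ∀ j → sumQ (reverse re) ((l , just r) ∷ T) (λ Q → unless (does (j Fin.≟ r) ∨ has j T) (F n (relabel r j Q) a)) ≈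
                       unless (has j T) (unless (does (r Fin.≟ j) ∨ false) (G ((l , just j) ∷ T)))
          each j with j Fin.≟ r | r Fin.≟ j | has j T in j∉
          ... | yes p | no q  | _     = contradiction (≡.sym p) q
          ... | no p  | yes q | _     = contradiction (≡.sym q) p
          ... | yes _ | yes _ | true  = sumQ-zero (reverse re) _
          ... | yes _ | yes _ | false = sumQ-zero (reverse re) _
          ... | no _  | no _  | true  = sumQ-zero (reverse re) _
          ... | no _  | no _  | false = sumQ-relabel (reverse re) ((l , just r) ∷ T) r j (λ Q → F n Q a) ∙
            reflexive (cong₂ (λ i P → G ((l , just i) ∷ P)) (transpose-left r j) (relabel-fresh T r∉ j∉))

      Ω : List ℕ → Ser N
      Ω ls a = sumQ ls [] (λ Q → F n Q a)

      sum-V : ∀ re lt a → sum (λ r → V re lt r a) ≈ (ν N - ν (length lt)) * Ω (re ʳ++ lt) a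
      sum-V re lt a = begin
        sum (λ r → V re lt r a)
          ≈⟨ sumQ-sum lt [] _ ⟨
        sumQ lt [] (λ T → sum (λ r → unless (has r T) (sumQ (reverse re) T (λ Q → F n Q a))))
          ≈⟨ sumQ-cong lt [] (λ T t w → sum-fresh t _ ∙ *-congʳ (+-congˡ (-‿cong (reflexive (cong ν
               (lengths-length T w ⊙ cong length (List.++-identityʳ lt))))))) ⟩
        sumQ lt [] (λ T → (ν N - ν (length lt)) * sumQ (reverse re) T (λ Q → F n Q a))
          ≈⟨ sumQ-* lt [] _ _ ⟩
        (ν N - ν (length lt)) * sumQ lt [] (λ T → sumQ (reverse re) T (λ Q → F n Q a))
          ≈⟨ *-congˡ (reflexive (≡.sym (sumQ-++ (reverse re) lt [] _) ⊙ cong (λ ls → Ω ls a) (≡.sym (List.ʳ++-defn re)))) ⟩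
        (ν N - ν (length lt)) * Ω (re ʳ++ lt) a ∎
        where open ≈R

      -- For lt = [] these are the eigenvalues of Σ_r U_r and Σ_r U_r² on Ω; after summation over r,
      -- each A and V becomes a multiple of the same Ω.
      first second : List ℕ → List ℕ → Carrier
      first []       lt = 0#
      first (l ∷ re) lt = (eigenvalueᴸ (reverse re) l lt - (ν N - ν (suc (length lt)))) + first re (l ∷ lt)
      second []       lt = 0#
      second (l ∷ re) lt = (eigenvalueᴸ (reverse re) l lt * (eigenvalueᴸ (reverse re) l lt - (ν N - ν (suc (length lt)))) - first re (l ∷ lt))
        + second re (l ∷ lt)

      U-V-[] : ∀ lt r a → U r (V [] lt r) a ≈ 0#
      U-V-[] lt r a = Linear.O-sumQ (U-linear r) lt [] (λ T c → unless (has r T) (F n T c)) a ∙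
        sumQ-cong lt [] pointwise ∙ sumQ-zero lt []
        where
        pointwise : ∀ T → Good T → lengths T ≡ lt ++ [] → U r (λ c → unless (has r T) (F n T c)) a ≈ 0#
        pointwise T t _ with has r T in r∉
        ... | true  = U-zero r a
        ... | false = annihilated n t r∉ a

      sum-A : ∀ re l lt a → sum (λ r → A re l lt r a) ≈ Ω (re ʳ++ (l ∷ lt)) a
      sum-A re l lt a = begin
        sum (λ r → A re l lt r a)
          ≈⟨ sumQ-sum lt [] _ ⟨
        sumQ lt [] (λ T → sum (λ r → unless (has r T) (sumQ (reverse re) ((l , just r) ∷ T) (λ Q → F n Q a))))
          ≡⟨⟩
        sumQ (l ∷ lt) [] (λ T → sumQ (reverse re) T (λ Q → F n Q a))
          ≈⟨ reflexive (≡.sym (sumQ-++ (reverse re) (l ∷ lt) [] _) ⊙ cong (λ ls → Ω ls a) (≡.sym (List.ʳ++-defn re))) ⟩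
        Ω (re ʳ++ (l ∷ lt)) a ∎
        where open ≈R

      sum-U-V : ∀ re lt a → sum (λ r → U r (V re lt r) a) ≈ first re lt * Ω (re ʳ++ lt) a
      sum-U-V []       lt a = (sum-zero λ r → U-V-[] lt r a) ∙ sym (zeroˡ _)
      sum-U-V (l ∷ re) lt a = begin
        sum (λ r → U r (V (l ∷ re) lt r) a)
          ≈⟨ (sum-cong λ r → U-cong r (V-split l re lt r) a ∙ U-+ r (A re l lt r) (V re (l ∷ lt) r) a ∙ +-congʳ (U-A re l lt r a)) ∙ ∑-distrib-+ _ _ ⟩
        sum (λ r → e * A re l lt r a - V re (l ∷ lt) r a) + sum (λ r → U r (V re (l ∷ lt) r) a)
          ≈⟨ +-cong (∑-distrib-+ _ _ ∙ +-cong (sym (*-distribˡ-sum e _) ∙ *-congˡ (sum-A re l lt a))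
               (sum-neg _ ∙ -‿cong (sum-V re (l ∷ lt) a))) (sum-U-V re (l ∷ lt) a) ⟩
        (e * P - c * P) + first re (l ∷ lt) * P
          ≈⟨ solve 4 (λ e c f p → (e :* p :- c :* p) :+ f :* p := ((e :- c) :+ f) :* p) refl e c (first re (l ∷ lt)) P ⟩
        first (l ∷ re) lt * P ∎
        where
        open ≈R
        e = eigenvalueᴸ (reverse re) l lt
        c = ν N - ν (suc (length lt))
        P = Ω (re ʳ++ (l ∷ lt)) a

      sum-U²-V : ∀ re lt a → sum (λ r → U r (U r (V re lt r)) a) ≈ second re lt * Ω (re ʳ++ lt) a
      sum-U²-V []       lt a = (sum-zero λ r → U-cong r (U-V-[] lt r) a ∙ U-zero r a) ∙ sym (zeroˡ _)
      sum-U²-V (l ∷ re) lt a = begin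
        sum (λ r → U r (U r (V (l ∷ re) lt r)) a)
          ≈⟨ sum-cong twice ∙ ∑-distrib-+ _ _ ⟩
        sum (λ r → e * (e * A re l lt r a - V re (l ∷ lt) r a) - U r (V re (l ∷ lt) r) a) + sum (λ r → U r (U r (V re (l ∷ lt) r)) a)
          ≈⟨ +-cong (∑-distrib-+ _ _ ∙ +-cong
               (sym (*-distribˡ-sum e _) ∙ *-congˡ (∑-distrib-+ _ _ ∙ +-cong (sym (*-distribˡ-sum e _) ∙ *-congˡ (sum-A re l lt a))
                 (sum-neg _ ∙ -‿cong (sum-V re (l ∷ lt) a))))
               (sum-neg _ ∙ -‿cong (sum-U-V re (l ∷ lt) a))) (sum-U²-V re (l ∷ lt) a) ⟩
        (e * (e * P - c * P) - first re (l ∷ lt) * P) + second re (l ∷ lt) * P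
          ≈⟨ solve 5 (λ e c f s p → (e :* (e :* p :- c :* p) :- f :* p) :+ s :* p := ((e :* (e :- c) :- f) :+ s) :* p) refl
               e c (first re (l ∷ lt)) (second re (l ∷ lt)) P ⟩
        second (l ∷ re) lt * P ∎
        where
        open ≈R
        e = eigenvalueᴸ (reverse re) l lt
        c = ν N - ν (suc (length lt))
        P = Ω (re ʳ++ (l ∷ lt)) a
        twice : ∀ r → U r (U r (V (l ∷ re) lt r)) a ≈
                (e * (e * A re l lt r a - V re (l ∷ lt) r a) - U r (V re (l ∷ lt) r) a) + U r (U r (V re (l ∷ lt) r)) a
        twice r = begin
          U r (U r (V (l ∷ re) lt r)) a
            ≈⟨ U-cong r (λ b → U-cong r (V-split l re lt r) b ∙ U-+ r (A re l lt r) v b ∙ +-congʳ (U-A re l lt r b)) a ⟩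
          U r (λ b → (e * A re l lt r b - v b) + U r v b) a
            ≈⟨ U-+ r (λ b → e * A re l lt r b - v b) (U r v) a ∙ +-congʳ (U-+ r (λ b → e * A re l lt r b) (λ b → - v b) a ∙
                 +-cong (U-* r e (A re l lt r) a ∙ *-congˡ (U-A re l lt r a))
                   (U-cong r (λ b → solve 1 (λ x → :- x := (:- :1) :* x) refl (v b)) a ∙
                     U-* r (- 1#) v a ∙ solve 1 (λ x → (:- :1) :* x := :- x) refl _)) ⟩
          (e * (e * A re l lt r a - v a) - U r v a) + U r (U r v) a ∎
          where
          v : Ser N
          v = V re (l ∷ lt) r

      sum-U²-Ω : ∀ ls a → sum (λ r → U r (U r (Ω ls)) a) ≈ second (reverse ls) [] * Ω ls a
      sum-U²-Ω ls a = (sum-cong λ r → U-cong r (U-cong r (λ b → cong-≈ (λ ks → Ω ks b) (≡.sym (List.reverse-involutive ls)))) a) ∙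
        sum-U²-V (reverse ls) [] a ∙ *-congˡ (reflexive (cong (λ ks → Ω ks a)
          (List.ʳ++-defn (reverse ls) ⊙ List.++-identityʳ _ ⊙ List.reverse-involutive ls)))

-- A variable contributes its exponent 0, its exponent 1, or all of its exponents.
data Kind : Set where
  spent single general : Kind

isGeneral : Kind → Bool
isGeneral general = true
isGeneral _       = false

singles generals : ∀ {N} → Vec Kind N → ℕ
singles []             = 0
singles (single ∷ ty)  = suc (singles ty)
singles (spent ∷ ty)   = singles ty
singles (general ∷ ty) = singles ty
generals []             = 0
generals (single ∷ ty)  = generals ty
generals (spent ∷ ty)   = generals ty
generals (general ∷ ty) = suc (generals ty)

singles-≔ : ∀ {N} (ty : Vec Kind N) k → lookup ty k ≡ single → singles ty ≡ suc (singles (ty [ k ]≔ spent))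
singles-≔ (.single ∷ ty) zero    ≡.refl = ≡.refl
singles-≔ (single  ∷ ty) (suc k) e = cong suc (singles-≔ ty k e)
singles-≔ (spent   ∷ ty) (suc k) e = singles-≔ ty k e
singles-≔ (general ∷ ty) (suc k) e = singles-≔ ty k e

generals-≔ : ∀ {N} (ty : Vec Kind N) k → lookup ty k ≡ single → generals (ty [ k ]≔ spent) ≡ generals ty
generals-≔ (.single ∷ ty) zero    ≡.refl = ≡.refl
generals-≔ (single  ∷ ty) (suc k) e = generals-≔ ty k e
generals-≔ (spent   ∷ ty) (suc k) e = generals-≔ ty k e
generals-≔ (general ∷ ty) (suc k) e = cong suc (generals-≔ ty k e)

-- What the total weight depends on: the boxes left in each row, and whether its last label is
-- general.
State : Set
State = List (ℕ × Bool)

status : ∀ {N} → Vec Kind N → Maybe (Fin N) → Bool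
status ty nothing  = false
status ty (just k) = isGeneral (lookup ty k)

state : ∀ {N} → Vec Kind N → Queue N → State
state ty = map (Prod.map₂ (status ty))

marks open′ : State → ℕ
marks []            = 0
marks ((_ , s) ∷ Q) = bit s ℕ.+ marks Q
open′ []            = 0
open′ ((_ , s) ∷ Q) = bit (not s) ℕ.+ open′ Q

boxesˢ : State → ℕ
boxesˢ Q = sumᴸ (map proj₁ Q)

boxesˢ-∷ʳ : ∀ Q l s → boxesˢ (Q ∷ʳ (l , s)) ≡ l ℕ.+ boxesˢ Q
boxesˢ-∷ʳ Q l s = cong sumᴸ (List.map-++ proj₁ Q _) ⊙ sum-++ (map proj₁ Q) _ ⊙
  cong (boxesˢ Q ℕ.+_) (ℕ.+-identityʳ l) ⊙ ℕ.+-comm (boxesˢ Q) l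

lengths-state : ∀ {N} (ty : Vec Kind N) Q → map proj₁ (state ty Q) ≡ lengths Q
lengths-state ty []      = ≡.refl
lengths-state ty (x ∷ Q) = cong (proj₁ x ∷_) (lengths-state ty Q)

-- No box is waiting behind a label that may not be used again.
data Settled {N} (ty : Vec Kind N) : Queue N → Set where
  []   : Settled ty []
  skip : ∀ {l Q} → Settled ty Q → Settled ty ((l , nothing) ∷ Q)
  keep : ∀ {l b Q} → has b Q ≡ false → lookup ty b ≢ single → Settled ty Q → Settled ty ((l , just b) ∷ Q)

settled-∷ʳ : ∀ {N} {ty : Vec Kind N} {Q l k} → Settled ty Q → has k Q ≡ false → lookup ty k ≢ single → Settled ty (Q ∷ʳ (l , just k))
settled-∷ʳ []       h e = keep ≡.refl e []
settled-∷ʳ (skip s) h e = skip (settled-∷ʳ s h e)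
settled-∷ʳ {k = k} (keep {b = b} {Q} p q s) h e with k Fin.≟ b
... | no k≢b = keep (has-∷ʳ-false Q _ p (k≢b ∘ ≡.sym)) q (settled-∷ʳ s h e)

settled-spend : ∀ {N} {ty : Vec Kind N} {Q} k → lookup ty k ≡ single → Settled ty Q → Settled (ty [ k ]≔ spent) Q
settled-spend k e []       = []
settled-spend k e (skip s) = skip (settled-spend k e s)
settled-spend {ty = ty} k e (keep {b = b} p q s) = keep p (λ r → q (≡.sym (Vec.lookup∘update′ (λ { ≡.refl → q e }) ty spent) ⊙ r)) (settled-spend k e s)

state-spend : ∀ {N} {ty : Vec Kind N} {Q} k → lookup ty k ≡ single → Settled ty Q → state (ty [ k ]≔ spent) Q ≡ state ty Q
state-spend k e []       = ≡.refl
state-spend k e (skip {l} s) = cong ((l , false) ∷_) (state-spend k e s)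
state-spend {ty = ty} k e (keep {l} {b} p q s) = cong₂ (λ x P → (l , isGeneral x) ∷ P) (Vec.lookup∘update′ (λ { ≡.refl → q e }) ty spent) (state-spend k e s)

settled-tail : ∀ {N} {ty : Vec Kind N} {x Q} → Settled ty (x ∷ Q) → Settled ty Q
settled-tail (skip s)    = s
settled-tail (keep _ _ s) = s

-- Total weights of fillings

module Evaluation (R : CommutativeRing 0ℓ 0ℓ) (α : CommutativeRing.Carrier R) where
  open CommutativeRing R hiding (zero)
  open Ring R
  open Series R α
  open Fillings R α
  open Labellings R α using (unless-zero; unless-sum)
  private
    module ≈R = SetoidReasoning setoid

  upto : ℕ → (ℕ → ℕ → Carrier) → Carrier
  upto zero    φ = φ 0 0
  upto (suc r) φ = φ 0 (suc r) + upto r (λ i j → φ (suc i) j)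

  upto-cong : ∀ r {φ ψ : ℕ → ℕ → Carrier} → (∀ i j → φ i j ≈ ψ i j) → upto r φ ≈ upto r ψ
  upto-cong zero    e = e 0 0
  upto-cong (suc r) e = +-cong (e 0 (suc r)) (upto-cong r (λ i j → e (suc i) j))

  upto-+ : ∀ r (φ ψ : ℕ → ℕ → Carrier) → upto r (λ i j → φ i j + ψ i j) ≈ upto r φ + upto r ψ
  upto-+ zero    φ ψ = refl
  upto-+ (suc r) φ ψ = +-congˡ (upto-+ r _ _) ∙ solve 4 (λ a b c d → (a :+ b) :+ (c :+ d) := (a :+ c) :+ (b :+ d)) refl _ _ _ _

  upto-* : ∀ r c (φ : ℕ → ℕ → Carrier) → upto r (λ i j → c * φ i j) ≈ c * upto r φ
  upto-* zero    c φ = refl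
  upto-* (suc r) c φ = +-congˡ (upto-* r c _) ∙ sym (distribˡ c _ _)

  upto-zero : ∀ r → upto r (λ _ _ → 0#) ≈ 0#
  upto-zero zero    = refl
  upto-zero (suc r) = +-identityˡ _ ∙ upto-zero r

  upto-onPred : ∀ r (φ : ℕ → ℕ → Carrier) → upto r (λ i j → onPred j (φ i)) ≈ onPred r (λ r′ → upto r′ φ)
  upto-onPred zero          φ = refl
  upto-onPred (suc zero)    φ = +-identityʳ _
  upto-onPred (suc (suc r)) φ = +-congˡ (upto-onPred (suc r) (φ ∘ suc))

  -- `r` is the joint degree in the general variables, all of which are set to one.
  Θ : ∀ {N} → Vec Kind N → ℕ → Ser N → Carrier
  Θ []             zero    f = f []
  Θ []             (suc r) f = 0#
  Θ (spent   ∷ ty) r       f = Θ ty r (f ∘ (0 ∷_))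
  Θ (single  ∷ ty) r       f = Θ ty r (f ∘ (1 ∷_))
  Θ (general ∷ ty) r       f = upto r (λ i j → Θ ty j (f ∘ (i ∷_)))

  Θ-cong : ∀ {N} (ty : Vec Kind N) r {f g : Ser N} → f ≐ g → Θ ty r f ≈ Θ ty r g
  Θ-cong []             zero    e = e []
  Θ-cong []             (suc r) e = refl
  Θ-cong (spent   ∷ ty) r       e = Θ-cong ty r (e ∘ (0 ∷_))
  Θ-cong (single  ∷ ty) r       e = Θ-cong ty r (e ∘ (1 ∷_))
  Θ-cong (general ∷ ty) r       e = upto-cong r (λ i j → Θ-cong ty j (e ∘ (i ∷_)))

  Θ-+ : ∀ {N} (ty : Vec Kind N) r (f g : Ser N) → Θ ty r (λ a → f a + g a) ≈ Θ ty r f + Θ ty r g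
  Θ-+ []             zero    f g = refl
  Θ-+ []             (suc r) f g = sym (+-identityˡ 0#)
  Θ-+ (spent   ∷ ty) r       f g = Θ-+ ty r _ _
  Θ-+ (single  ∷ ty) r       f g = Θ-+ ty r _ _
  Θ-+ (general ∷ ty) r       f g = upto-cong r (λ i j → Θ-+ ty j _ _) ∙ upto-+ r _ _

  Θ-* : ∀ {N} (ty : Vec Kind N) r c (f : Ser N) → Θ ty r (λ a → c * f a) ≈ c * Θ ty r f
  Θ-* []             zero    c f = refl
  Θ-* []             (suc r) c f = sym (zeroʳ c)
  Θ-* (spent   ∷ ty) r       c f = Θ-* ty r c _
  Θ-* (single  ∷ ty) r       c f = Θ-* ty r c _
  Θ-* (general ∷ ty) r       c f = upto-cong r (λ i j → Θ-* ty j c _) ∙ upto-* r c _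

  Θ-zero : ∀ {N} (ty : Vec Kind N) r → Θ ty r (λ _ → 0#) ≈ 0#
  Θ-zero ty r = Θ-cong ty r (λ _ → sym (zeroˡ 0#)) ∙ Θ-* ty r 0# (λ _ → 0#) ∙ zeroˡ _

  Θ-sum : ∀ {N} (ty : Vec Kind N) r {m} (f : Fin m → Ser N) → Θ ty r (λ a → sum (λ k → f k a)) ≈ sum (λ k → Θ ty r (f k))
  Θ-sum ty r {zero}  f = Θ-cong ty r (λ a → sum-0 (λ k → f k a)) ∙ Θ-zero ty r ∙ sym (sum-0 _)
  Θ-sum ty r {suc m} f = Θ-cong ty r (λ a → sum-suc (λ k → f k a)) ∙
    Θ-+ ty r (f zero) (λ a → sum (λ k → f (suc k) a)) ∙ +-congˡ (Θ-sum ty r (f ∘ suc)) ∙ sym (sum-suc _)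

  Θ-unless : ∀ {N} (ty : Vec Kind N) r b (f : Ser N) → Θ ty r (λ a → unless b (f a)) ≈ unless b (Θ ty r f)
  Θ-unless ty r true  f = Θ-zero ty r
  Θ-unless ty r false f = refl

  Θ-X-general : ∀ {N} (ty : Vec Kind N) r k (f : Ser N) → lookup ty k ≡ general → Θ ty r (X k f) ≈ onPred r (λ r′ → Θ ty r′ f)
  Θ-X-general (.general ∷ ty) zero    zero f ≡.refl = Θ-zero ty 0
  Θ-X-general (.general ∷ ty) (suc r) zero f ≡.refl = +-congʳ (Θ-zero ty (suc r)) ∙ +-identityˡ _
  Θ-X-general (spent   ∷ ty) r (suc k) f e = Θ-X-general ty r k (f ∘ (0 ∷_)) e
  Θ-X-general (single  ∷ ty) r (suc k) f e = Θ-X-general ty r k (f ∘ (1 ∷_)) e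
  Θ-X-general (general ∷ ty) r (suc k) f e = upto-cong r (λ i j → Θ-X-general ty j k (f ∘ (i ∷_)) e) ∙
    upto-onPred r (λ i j → Θ ty j (f ∘ (i ∷_)))

  Θ-X-single : ∀ {N} (ty : Vec Kind N) r k (f : Ser N) → lookup ty k ≡ single → Θ ty r (X k f) ≈ Θ (ty [ k ]≔ spent) r f
  Θ-X-single (.single ∷ ty) r zero f ≡.refl = refl
  Θ-X-single (spent   ∷ ty) r (suc k) f e = Θ-X-single ty r k (f ∘ (0 ∷_)) e
  Θ-X-single (single  ∷ ty) r (suc k) f e = Θ-X-single ty r k (f ∘ (1 ∷_)) e
  Θ-X-single (general ∷ ty) r (suc k) f e = upto-cong r (λ i j → Θ-X-single ty j k (f ∘ (i ∷_)) e)

  Θ-X-spent : ∀ {N} (ty : Vec Kind N) r k (f : Ser N) → lookup ty k ≡ spent → Θ ty r (X k f) ≈ 0#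
  Θ-X-spent (.spent ∷ ty) r zero f ≡.refl = Θ-zero ty r
  Θ-X-spent (spent   ∷ ty) r (suc k) f e = Θ-X-spent ty r k (f ∘ (0 ∷_)) e
  Θ-X-spent (single  ∷ ty) r (suc k) f e = Θ-X-spent ty r k (f ∘ (1 ∷_)) e
  Θ-X-spent (general ∷ ty) r (suc k) f e = upto-cong r (λ i j → Θ-X-spent ty j k (f ∘ (i ∷_)) e) ∙ upto-zero r

  byKind : Kind → Carrier → Carrier → Carrier
  byKind spent   s g = 0#
  byKind single  s g = s
  byKind general s g = g

  sum-byKind : ∀ {N} (ty : Vec Kind N) s g → sum (λ k → byKind (lookup ty k) s g) ≈ ν (singles ty) * s + ν (generals ty) * g
  sum-byKind []             s g = sum-0 _ ∙ solve 2 (λ s g → :0 := :0 :* s :+ :0 :* g) refl s g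
  sum-byKind (spent   ∷ ty) s g = sum-suc _ ∙ +-identityˡ _ ∙ sum-byKind ty s g
  sum-byKind (single  ∷ ty) s g = sum-suc _ ∙ +-congˡ (sum-byKind ty s g) ∙
    solve 4 (λ a b s g → s :+ (a :* s :+ b :* g) := (:1 :+ a) :* s :+ b :* g) refl (ν (singles ty)) (ν (generals ty)) s g
  sum-byKind (general ∷ ty) s g = sum-suc _ ∙ +-congˡ (sum-byKind ty s g) ∙
    solve 4 (λ a b s g → g :+ (a :* s :+ b :* g) := a :* s :+ (:1 :+ b) :* g) refl (ν (singles ty)) (ν (generals ty)) s g

  sum-fresh-byKind : ∀ {N} {ty : Vec Kind N} {Q} → Settled ty Q → ∀ s g →
    sum (λ k → unless (has k Q) (byKind (lookup ty k) s g)) ≈ ν (singles ty) * s + (ν (generals ty) - ν (marks (state ty Q))) * g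
  sum-fresh-byKind {ty = ty} [] s g = sum-byKind ty s g ∙
    solve 4 (λ a b s g → a :* s :+ b :* g := a :* s :+ (b :- :0) :* g) refl (ν (singles ty)) (ν (generals ty)) s g
  sum-fresh-byKind (skip h) s g = sum-fresh-byKind h s g
  sum-fresh-byKind {ty = ty} (keep {b = b} {Q} p q h) s g = sum-unless-∷ b Q p (λ k → byKind (lookup ty k) s g) ∙
    +-congʳ (sum-fresh-byKind h s g) ∙ remove (lookup ty b) q
    where
    x = ν (singles ty)
    y = ν (generals ty)
    z = ν (marks (state ty Q))
    remove : ∀ t → t ≢ single → (x * s + (y - z) * g) - byKind t s g ≈ x * s + (y - ν (bit (isGeneral t) ℕ.+ marks (state ty Q))) * g
    remove spent   _ = solve 5 (λ x y z s g → (x :* s :+ (y :- z) :* g) :- :0 := x :* s :+ (y :- z) :* g) refl x y z s g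
    remove single  h = contradiction ≡.refl h
    remove general _ = solve 5 (λ x y z s g → (x :* s :+ (y :- z) :* g) :- g := x :* s :+ (y :- (:1 :+ z)) :* g) refl x y z s g

  sgn : ℕ → Carrier
  sgn zero    = 1#
  sgn (suc r) = - sgn r

  module _ (A : Carrier) where

    markWeight : ℕ → Bool → State → Carrier
    markWeight l s Q = (A + ν (marks Q)) - when s (α * ν (suc l) + ν (shorterᴸ l (map proj₁ Q)))

    -- E n Q r sums over the ways to mark r of the remaining boxes.
    E : ℕ → State → ℕ → Carrier
    E n       []                zero    = 1#
    E n       []                (suc r) = 0#
    E n       ((zero  , s) ∷ Q) r       = E n Q r
    E zero    ((suc l , s) ∷ Q) r       = 0#
    E (suc n) ((suc l , s) ∷ Q) r       = E n (Q ∷ʳ (l , false)) r + onPred r (λ r′ → markWeight l s Q * E n (Q ∷ʳ (l , true)) r′)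

    E-vanish : ∀ n Q r → boxesˢ Q < r → E n Q r ≈ 0#
    E-vanish n       []                (suc r) h = refl
    E-vanish n       ((zero  , s) ∷ Q) r       h = E-vanish n Q r h
    E-vanish zero    ((suc l , s) ∷ Q) r       h = refl
    E-vanish (suc n) ((suc l , s) ∷ Q) (suc r) h = +-cong
      (E-vanish n (Q ∷ʳ (l , false)) (suc r) (subst (_< suc r) (≡.sym (boxesˢ-∷ʳ Q l false)) (ℕ.<-trans (ℕ.n<1+n _) h)))
      (*-congˡ (E-vanish n (Q ∷ʳ (l , true)) r (subst (_< r) (≡.sym (boxesˢ-∷ʳ Q l true)) (ℕ.s<s⁻¹ h))) ∙ zeroʳ _) ∙ +-identityˡ 0#

    E-0 : ∀ n Q → boxesˢ Q ≡ n → E n Q 0 ≈ 1#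
    E-0 n       []                e = refl
    E-0 n       ((zero  , s) ∷ Q) e = E-0 n Q e
    E-0 (suc n) ((suc l , s) ∷ Q) e = +-identityʳ _ ∙ E-0 n (Q ∷ʳ (l , false)) (boxesˢ-∷ʳ Q l false ⊙ ℕ.suc-injective e)

  Θ-𝟙 : ∀ {N} (ty : Vec Kind N) → singles ty ≡ 0 → Θ ty 0 𝟙 ≈ 1#
  Θ-𝟙 []             e = refl
  Θ-𝟙 (spent   ∷ ty) e = Θ-𝟙 ty e
  Θ-𝟙 (general ∷ ty) e = Θ-𝟙 ty e

  -- The weight depends only on which boxes carry general labels. The others use up the singles, in
  -- o! orders; each general box contributes `markWeight` up to sign.
  Θ-F : ∀ n {N} (ty : Vec Kind N) Q r → Settled ty Q → boxesˢ (state ty Q) ≡ n → n ≡ singles ty ℕ.+ r →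
        Θ ty r (F n Q) ≈ ν (singles ty !) * (sgn r * E (- ν (generals ty)) n (state ty Q) r)
  Θ-F .0 ty [] zero s ≡.refl e = Θ-𝟙 ty o≡0 ∙ sym (*-congʳ (cong-≈ (λ o → ν (o !)) o≡0) ∙
    solve 0 ((:1 :+ :0) :* (:1 :* :1) := :1) refl)
    where
    o≡0 : singles ty ≡ 0
    o≡0 = ≡.sym (e ⊙ ℕ.+-identityʳ _)
  Θ-F .0 ty [] (suc r) s ≡.refl e = contradiction (e ⊙ ℕ.+-suc _ r) λ ()
  Θ-F n ty ((zero , b) ∷ Q) r s h e = Θ-F n ty Q r (settled-tail s) h e
  Θ-F (suc n) {N} ty ((suc l , b) ∷ Q) r s h e = begin
    Θ ty r (F (suc n) ((suc l , b) ∷ Q))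
      ≈⟨ Θ-+ ty r (λ a → sum (λ k → unless (has k Q) (X k (G k) a))) (λ a → κ l Q * onLabel b (λ k → X k (G k) a)) ⟩
    Θ ty r (λ a → sum (λ k → unless (has k Q) (X k (G k) a))) + Θ ty r (λ a → κ l Q * onLabel b (λ k → X k (G k) a))
      ≈⟨ +-cong (Θ-sum ty r (λ k a → unless (has k Q) (X k (G k) a)) ∙
           (sum-cong λ k → Θ-unless ty r (has k Q) (X k (G k)) ∙ each k) ∙ sum-fresh-byKind tail S₁ G₁)
           (Θ-* ty r (κ l Q) (λ a → onLabel b (λ k → X k (G k) a)) ∙ *-congˡ (marked b s)) ⟩
    (ν o * S₁ + (ν g - ν q) * G₁) + κ l Q * when (status ty b) G₁
      ≈⟨ +-congʳ (+-congʳ unspent) ⟩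
    (ν (o !) * (sgn r * e₁) + (ν g - ν q) * G₁) + κ l Q * when (status ty b) G₁
      ≈⟨ finish r (status ty b) ⟩
    ν (o !) * (sgn r * (e₁ + onPred r (λ r′ → markWeight (- ν g) l (status ty b) Qˢ * E (- ν g) n (Qˢ ∷ʳ (l , true)) r′))) ∎
    where
    open ≈R
    tail = settled-tail s
    o = singles ty
    g = generals ty
    Qˢ = state ty Q
    q = marks Qˢ
    G : Fin N → Ser N
    G k = F n (Q ∷ʳ (l , just k))
    e₁ = E (- ν g) n (Qˢ ∷ʳ (l , false)) r
    S₁ = ν (ℕ.pred o !) * (sgn r * e₁)
    G₁ = onPred r (λ r′ → ν (o !) * (sgn r′ * E (- ν g) n (Qˢ ∷ʳ (l , true)) r′))
    boxes-next : ∀ {Pˢ} c → Pˢ ≡ Qˢ ∷ʳ (l , c) → boxesˢ Pˢ ≡ n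
    boxes-next c ≡.refl = boxesˢ-∷ʳ Qˢ l c ⊙ ℕ.suc-injective h
    state-next : ∀ ty′ k c → state ty′ Q ≡ Qˢ → isGeneral (lookup ty′ k) ≡ c → state ty′ (Q ∷ʳ (l , just k)) ≡ Qˢ ∷ʳ (l , c)
    state-next ty′ k c e₁ e₂ = List.map-++ _ Q _ ⊙ cong₂ (λ P x → P ∷ʳ (l , x)) e₁ e₂
    term-general : ∀ k → has k Q ≡ false → lookup ty k ≡ general → Θ ty r (X k (G k)) ≈ G₁
    term-general k k∉ t = Θ-X-general ty r k (G k) t ∙ go r e
      where
      next = state-next ty k true ≡.refl (cong isGeneral t)
      go : ∀ r → suc n ≡ o ℕ.+ r → onPred r (λ r′ → Θ ty r′ (G k)) ≈ onPred r (λ r′ → ν (o !) * (sgn r′ * E (- ν g) n (Qˢ ∷ʳ (l , true)) r′))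
      go zero    e = refl
      go (suc r) e = Θ-F n ty (Q ∷ʳ (l , just k)) r (settled-∷ʳ tail k∉ (λ t′ → contradiction (≡.sym t ⊙ t′) λ ()))
          (boxes-next true next) (ℕ.suc-injective (e ⊙ ℕ.+-suc o r)) ∙
        *-congˡ (*-congˡ (cong-≈ (λ P → E (- ν g) n P r) next))
    term-single : ∀ k → has k Q ≡ false → lookup ty k ≡ single → Θ ty r (X k (G k)) ≈ S₁
    term-single k k∉ t = Θ-X-single ty r k (G k) t ∙ trans
        (Θ-F n (ty [ k ]≔ spent) (Q ∷ʳ (l , just k)) r (settled-∷ʳ (settled-spend k t tail) k∉ (λ t′ → contradiction (≡.sym (Vec.lookup∘update k ty spent) ⊙ t′) λ ()))
          (boxes-next false next) (ℕ.suc-injective (e ⊙ cong (ℕ._+ r) (singles-≔ ty k t))))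
        (*-cong (cong-≈ (λ x → ν (ℕ.pred x !)) (≡.sym (singles-≔ ty k t)))
          (*-congˡ (reflexive (cong₂ (λ x P → E (- ν x) n P r) (generals-≔ ty k t) next))))
      where
      next = state-next (ty [ k ]≔ spent) k false (state-spend k t tail) (cong isGeneral (Vec.lookup∘update k ty spent))
    each : ∀ k → unless (has k Q) (Θ ty r (X k (G k))) ≈ unless (has k Q) (byKind (lookup ty k) S₁ G₁)
    each k with has k Q in k∉ | lookup ty k in t
    ... | true  | _       = refl
    ... | false | spent   = Θ-X-spent ty r k (G k) t
    ... | false | single  = term-single k k∉ t
    ... | false | general = term-general k k∉ t
    marked : ∀ b → Settled ty ((suc l , b) ∷ Q) → Θ ty r (λ a → onLabel b (λ k → X k (G k) a)) ≈ when (status ty b) G₁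
    marked nothing  s = Θ-zero ty r
    marked (just k) (keep k∉ t∉ s) with lookup ty k in t
    ... | spent   = Θ-X-spent ty r k (G k) t
    ... | single  = contradiction ≡.refl t∉
    ... | general = term-general k k∉ t
    -- With no single left, the next state would need one mark more than it has boxes, so both sides
    -- vanish.
    unspent′ : ∀ o′ → o ≡ o′ → ν o′ * (ν (ℕ.pred o′ !) * (sgn r * e₁)) ≈ ν (o′ !) * (sgn r * e₁)
    unspent′ zero     eq = zeroˡ _ ∙ sym (*-congˡ (*-congˡ (E-vanish (- ν g) n (Qˢ ∷ʳ (l , false)) r
      (subst (_< r) (≡.sym (boxes-next false ≡.refl)) (ℕ.≤-reflexive (e ⊙ cong (ℕ._+ r) eq)))) ∙ zeroʳ _) ∙ zeroʳ _)
    unspent′ (suc o′) eq = sym (*-assoc (ν (suc o′)) (ν (o′ !)) _) ∙ *-congʳ (sym (ν-* (suc o′) (o′ !)))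
    unspent : ν o * S₁ ≈ ν (o !) * (sgn r * e₁)
    unspent = unspent′ o ≡.refl
    finish : ∀ r c → (ν (o !) * (sgn r * E (- ν g) n (Qˢ ∷ʳ (l , false)) r) + (ν g - ν q) * onPred r (λ r′ → ν (o !) * (sgn r′ * E (- ν g) n (Qˢ ∷ʳ (l , true)) r′)))
        + κ l Q * when c (onPred r (λ r′ → ν (o !) * (sgn r′ * E (- ν g) n (Qˢ ∷ʳ (l , true)) r′))) ≈
      ν (o !) * (sgn r * (E (- ν g) n (Qˢ ∷ʳ (l , false)) r + onPred r (λ r′ → markWeight (- ν g) l c Qˢ * E (- ν g) n (Qˢ ∷ʳ (l , true)) r′)))
    finish zero    true  = solve 5 (λ f e n q k → (f :* (:1 :* e) :+ (n :- q) :* :0) :+ k :* :0 := f :* (:1 :* (e :+ :0))) refl (ν (o !)) (E (- ν g) n (Qˢ ∷ʳ (l , false)) 0) (ν g) (ν q) (κ l Q)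
    finish zero    false = solve 5 (λ f e n q k → (f :* (:1 :* e) :+ (n :- q) :* :0) :+ k :* :0 := f :* (:1 :* (e :+ :0))) refl (ν (o !)) (E (- ν g) n (Qˢ ∷ʳ (l , false)) 0) (ν g) (ν q) (κ l Q)
    finish (suc r) true  = solve 7 (λ f e n q k s t → (f :* (:- s :* e) :+ (n :- q) :* (f :* (s :* t))) :+ k :* (f :* (s :* t)) :=
        f :* (:- s :* (e :+ ((:- n :+ q) :- k) :* t))) refl (ν (o !)) (E (- ν g) n (Qˢ ∷ʳ (l , false)) (suc r)) (ν g) (ν q) (κ l Q) (sgn r) (E (- ν g) n (Qˢ ∷ʳ (l , true)) r) ∙
      *-congˡ (*-congˡ (+-congˡ (*-congʳ (+-congˡ (-‿cong (+-congˡ (cong-≈ ν (cong (shorterᴸ l) (≡.sym (lengths-state ty Q))))))))))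
    finish (suc r) false = solve 7 (λ f e n q k s t → (f :* (:- s :* e) :+ (n :- q) :* (f :* (s :* t))) :+ k :* :0 :=
        f :* (:- s :* (e :+ ((:- n :+ q) :- :0) :* t))) refl (ν (o !)) (E (- ν g) n (Qˢ ∷ʳ (l , false)) (suc r)) (ν g) (ν q) (κ l Q) (sgn r) (E (- ν g) n (Qˢ ∷ʳ (l , true)) r)

-- Factorisation of the total weight over the rows

shorterᴸ-∷ʳ : ∀ l ls l′ → shorterᴸ l (ls ∷ʳ l′) ≡ bit (does (l′ ℕ.≤? l)) ℕ.+ shorterᴸ l ls
shorterᴸ-∷ʳ l []       l′ = ≡.refl
shorterᴸ-∷ʳ l (k ∷ ls) l′ = cong (bit (does (k ℕ.≤? l)) ℕ.+_) (shorterᴸ-∷ʳ l ls l′) ⊙ ℕ+.x∙yz≈y∙xz (bit (does (k ℕ.≤? l))) (bit (does (l′ ℕ.≤? l))) _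

open′-∷ʳ : ∀ T l s → open′ (T ∷ʳ (l , s)) ≡ bit (not s) ℕ.+ open′ T
open′-∷ʳ []            l s = ≡.refl
open′-∷ʳ ((_ , t) ∷ T) l s = cong (bit (not t) ℕ.+_) (open′-∷ʳ T l s) ⊙ ℕ+.x∙yz≈y∙xz (bit (not t)) (bit (not s)) _

open+marks : ∀ T → open′ T ℕ.+ marks T ≡ length T
open+marks []            = ≡.refl
open+marks ((_ , s) ∷ T) = ℕ+.interchange (bit (not s)) (open′ T) (bit s) (marks T) ⊙ (cong₂ ℕ._+_ (one s) (open+marks T))
  where
  one : ∀ s → bit (not s) ℕ.+ bit s ≡ 1
  one true  = ≡.refl
  one false = ≡.refl

below above : ℕ → State → ℕ
below zero    T = 0
below (suc l) T = shorterᴸ l (map proj₁ T)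
above l E = longerᴸ (suc l) (map proj₁ E)

unmarked : List ℕ → State
unmarked = map (_, false)

lengths-unmarked : ∀ ls → map proj₁ (unmarked ls) ≡ ls
lengths-unmarked []       = ≡.refl
lengths-unmarked (l ∷ ls) = cong (l ∷_) (lengths-unmarked ls)

open-unmarked : ∀ ls → open′ (unmarked ls) ≡ length ls
open-unmarked []       = ≡.refl
open-unmarked (l ∷ ls) = cong suc (open-unmarked ls)

longerᴸ-none : ∀ {l ls} → All (_≤ l) ls → longerᴸ (suc l) ls ≡ 0
longerᴸ-none []       = ≡.refl
longerᴸ-none {l} {k ∷ ls} (h ∷ a) = cong₂ ℕ._+_ (cong bit (dec-false (suc l ℕ.≤? k) (ℕ.≤⇒≯ h))) (longerᴸ-none a)

module Spectral (R : CommutativeRing 0ℓ 0ℓ) (α : CommutativeRing.Carrier R) where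
  open CommutativeRing R hiding (zero)
  open Ring R
  open Series R α using (onPred; onPred-cong)
  open Evaluation R α
  private
    module ≈R = SetoidReasoning setoid

  -- The rising factorial.
  rise : Carrier → ℕ → Carrier
  rise x zero    = 1#
  rise x (suc k) = x * rise (x + 1#) k

  -- - θ is the root contributed by an unmarked row. The counts are arranged so that one turn of the
  -- queue shifts all roots by the same amount.
  θ : State → ℕ → State → Carrier
  θ P l T = α * ν l + ((ν (below l T) - ν (above l P)) + ν (open′ P))

  -- The product of x + θ over the unmarked rows of T, when the rows P come first.
  prodθ : State → State → Carrier → Carrier
  prodθ P []            x = 1#
  prodθ P ((l , s) ∷ T) x = (if s then 1# else x + θ P l T) * prodθ (P ∷ʳ (l , s)) T x

  prodθ-cong : ∀ P T {x y} → x ≈ y → prodθ P T x ≈ prodθ P T y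
  prodθ-cong P []                e = refl
  prodθ-cong P ((l , true)  ∷ T) e = *-congˡ (prodθ-cong _ T e)
  prodθ-cong P ((l , false) ∷ T) e = *-cong (+-congʳ e) (prodθ-cong _ T e)

  -- The moved row changes sides: its comparison passes from `above` to `below`, which differ by one
  -- by `≤-bits`, and it leaves `open′` if it was unmarked. The sum of both effects is the mark s.
  θ-rotate : ∀ P l s T l′ s′ x → x + θ P l′ (T ∷ʳ (l , s′)) ≈ (x + ν (bit s)) + θ ((suc l , s) ∷ P) l′ T
  θ-rotate P l s T zero s′ x = begin
    x + (α * 0# + ((0# - ν u) + ν o))
      ≈⟨ solve 4 (λ x α u o → x :+ (α :* :0 :+ ((:0 :- u) :+ o)) := (x :+ :1) :+ (α :* :0 :+ ((:0 :- (:1 :+ u)) :+ o))) refl x α (ν u) (ν o) ⟩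
    (x + 1#) + (α * 0# + ((0# - ν (suc u)) + ν o))
      ≈⟨ bits s ⟩
    (x + ν (bit s)) + (α * 0# + ((0# - ν (suc u)) + ν (bit (not s) ℕ.+ o))) ∎
    where
    open ≈R
    u = above 0 P
    o = open′ P
    bits : ∀ s → (x + 1#) + (α * 0# + ((0# - ν (suc u)) + ν o)) ≈ (x + ν (bit s)) + (α * 0# + ((0# - ν (suc u)) + ν (bit (not s) ℕ.+ o)))
    bits true  = +-congʳ (+-congˡ (sym (+-identityʳ 1#)))
    bits false = solve 4 (λ x α u o → (x :+ :1) :+ (α :* :0 :+ ((:0 :- u) :+ o)) := (x :+ :0) :+ (α :* :0 :+ ((:0 :- u) :+ (:1 :+ o)))) refl x α (ν (suc u)) (ν o)
  θ-rotate P l s T (suc k) s′ x = begin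
    x + (α * ν (suc k) + ((ν (shorterᴸ k (map proj₁ (T ∷ʳ (l , s′)))) - ν u) + ν o))
      ≈⟨ +-congˡ (+-congˡ (+-congʳ (+-congʳ (cong-≈ ν (cong (shorterᴸ k) (List.map-++ proj₁ T _) ⊙ shorterᴸ-∷ʳ k (map proj₁ T) l) ∙ ν-+ b d)))) ⟩
    x + (α * ν (suc k) + (((ν b + ν d) - ν u) + ν o))
      ≈⟨ +-congˡ (+-congˡ (+-congʳ (+-congʳ (+-congʳ one)))) ⟩
    x + (α * ν (suc k) + ((((1# - ν c) + ν d) - ν u) + ν o))
      ≈⟨ bits s ⟩
    (x + ν (bit s)) + (α * ν (suc k) + ((ν d - (ν c + ν u)) + ν (bit (not s) ℕ.+ o)))
      ≈⟨ +-congˡ (+-congˡ (+-congʳ (+-congˡ (-‿cong (sym (ν-+ c u)))))) ⟩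
    (x + ν (bit s)) + (α * ν (suc k) + ((ν d - ν (c ℕ.+ u)) + ν (bit (not s) ℕ.+ o))) ∎
    where
    open ≈R
    u = above (suc k) P
    o = open′ P
    b = bit (does (l ℕ.≤? k))
    c = bit (does (suc (suc k) ℕ.≤? suc l))
    d = shorterᴸ k (map proj₁ T)
    one : ν b ≈ 1# - ν c
    one = solve 2 (λ b c → b := (c :+ b) :- c) refl (ν b) (ν c) ∙ +-congʳ (sym (ν-+ c b) ∙ reflexive (cong ν
      (≤-bits (suc k ℕ.≤? l) (l ℕ.≤? k))) ∙ +-identityʳ 1#)
    bits : ∀ s → x + (α * ν (suc k) + ((((1# - ν c) + ν d) - ν u) + ν o)) ≈ (x + ν (bit s)) + (α * ν (suc k) + ((ν d - (ν c + ν u)) + ν (bit (not s) ℕ.+ o)))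
    bits true  = solve 6 (λ x y c d u o → x :+ (y :+ ((((:1 :- c) :+ d) :- u) :+ o)) := (x :+ (:1 :+ :0)) :+ (y :+ ((d :- (c :+ u)) :+ o))) refl x (α * ν (suc k)) (ν c) (ν d) (ν u) (ν o)
    bits false = solve 6 (λ x y c d u o → x :+ (y :+ ((((:1 :- c) :+ d) :- u) :+ o)) := (x :+ :0) :+ (y :+ ((d :- (c :+ u)) :+ (:1 :+ o)))) refl x (α * ν (suc k)) (ν c) (ν d) (ν u) (ν o)

  prodθ-rotate : ∀ P l s T s′ x →
    prodθ P (T ∷ʳ (l , s′)) x ≈ prodθ ((suc l , s) ∷ P) T (x + ν (bit s)) * (if s′ then 1# else x + θ (P ++ T) l [])
  prodθ-rotate P l s []             s′ x = *-identityʳ _ ∙ sym (*-identityˡ _ ∙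
    cong-≈ (λ P → if s′ then 1# else x + θ P l []) (List.++-identityʳ P))
  prodθ-rotate P l s ((l′ , t) ∷ T) s′ x = *-cong (factor t) (prodθ-rotate (P ∷ʳ (l′ , t)) l s T s′ x ∙
      *-congˡ (cong-≈ (λ P → if s′ then 1# else x + θ P l []) (List.++-assoc P _ T))) ∙ sym (*-assoc _ _ _)
    where
    factor : ∀ t → (if t then 1# else x + θ P l′ (T ∷ʳ (l , s′))) ≈ (if t then 1# else (x + ν (bit s)) + θ ((suc l , s) ∷ P) l′ T)
    factor true  = refl
    factor false = θ-rotate P l s T l′ s′ x

  prodθ-drop : ∀ P s T x → prodθ ((0 , s) ∷ P) T x ≈ prodθ P T (x + ν (bit (not s)))
  prodθ-drop P s []            x = refl
  prodθ-drop P s ((l , t) ∷ T) x = *-cong (factor t) (prodθ-drop (P ∷ʳ (l , t)) s T x)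
    where
    factor : ∀ t → (if t then 1# else x + θ ((0 , s) ∷ P) l T) ≈ (if t then 1# else (x + ν (bit (not s))) + θ P l T)
    factor true  = refl
    factor false = +-congˡ (+-congˡ (+-congˡ (ν-+ (bit (not s)) (open′ P)))) ∙
      solve 5 (λ x y z b o → x :+ (y :+ (z :+ (b :+ o))) := (x :+ b) :+ (y :+ (z :+ o))) refl x (α * ν l) (ν (below l T) - ν (above l P)) (ν (bit (not s))) (ν (open′ P))

  rise-cong : ∀ i {x y} → x ≈ y → rise x i ≈ rise y i
  rise-cong zero    e = refl
  rise-cong (suc i) e = *-cong e (rise-cong i (+-congʳ e))

  upto-rise : ∀ k x (e : ℕ → Carrier) → upto (suc k) (λ r i → e r * rise x i) ≈ x * upto k (λ r i → e r * rise (x + 1#) i) + e (suc k)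
  upto-rise zero    x e = solve 3 (λ x a b → a :* (x :* :1) :+ b :* :1 := x :* (a :* :1) :+ b) refl x (e 0) (e 1)
  upto-rise (suc k) x e = +-congˡ (upto-rise k x (e ∘ suc)) ∙
    solve 5 (λ x a y u b → a :* (x :* y) :+ (x :* u :+ b) := x :* (a :* y :+ u) :+ b) refl x (e 0) (rise (x + 1#) (suc k)) _ (e (suc (suc k)))

  upto-onPred-1 : ∀ k c x (e : ℕ → Carrier) → upto (suc k) (λ r i → onPred r (λ r′ → c * e r′) * rise x i) ≈ c * upto k (λ r i → e r * rise x i)
  upto-onPred-1 k c x e = +-congʳ (zeroˡ _) ∙ +-identityˡ _ ∙ (upto-cong k λ r i → *-assoc c (e r) (rise x i)) ∙ upto-* k c (λ r i → e r * rise x i)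

  module _ (cancel : ∀ j {y z} → ν (suc j) * y ≈ ν (suc j) * z → y ≈ z) where

    private
      e : ℕ → State → ℕ → Carrier
      e = E α

    Vanishes Factors : ℕ → State → Set
    Vanishes n Q = ∀ r → open′ Q < r → e n Q r ≈ 0#
    Factors  n Q = ∀ j → upto (open′ Q) (λ r i → e n Q r * rise (- ν j) i) ≈ prodθ [] Q (- ν j)

    -ν-suc : ∀ j → - ν (suc j) + 1# ≈ - ν j
    -ν-suc j = solve 1 (λ x → :- (:1 :+ x) :+ :1 := :- x) refl (ν j)

    -- The identity is tested only at the points - j. A marked head row requires division by x,
    -- carried out by passing from - (j + 1) to - j with `cancel`; at x = 0 the same relation makes
    -- the top coefficient vanish.
    factors : ∀ n Q → boxesˢ Q ≡ n → Vanishes n Q × Factors n Q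
    factors n [] h = (λ { (suc r) _ → refl }) , λ j → *-identityʳ 1#
    factors n ((zero , s) ∷ Q) h = vanish s , factor s
      where
      ih = factors n Q h
      vanish : ∀ s r → bit (not s) ℕ.+ open′ Q < r → e n Q r ≈ 0#
      vanish true  r l = proj₁ ih r l
      vanish false r l = proj₁ ih r (ℕ.<-trans (ℕ.n<1+n _) l)
      factor : ∀ s j → upto (bit (not s) ℕ.+ open′ Q) (λ r i → e n Q r * rise (- ν j) i) ≈
                       (if s then 1# else - ν j + θ [] 0 Q) * prodθ ((0 , s) ∷ []) Q (- ν j)
      factor true j = proj₂ ih j ∙ sym (*-identityˡ _ ∙ prodθ-drop [] true Q (- ν j) ∙ prodθ-cong [] Q (+-identityʳ _))
      factor false j = begin
        upto (suc (open′ Q)) (λ r i → e n Q r * rise x i)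
          ≈⟨ upto-rise (open′ Q) x (e n Q) ∙ +-congˡ (proj₁ ih (suc (open′ Q)) (ℕ.n<1+n _)) ∙ +-identityʳ _ ⟩
        x * upto (open′ Q) (λ r i → e n Q r * rise (x + 1#) i)
          ≈⟨ shifted j ⟩
        x * prodθ [] Q (x + 1#)
          ≈⟨ *-cong (solve 2 (λ x α → x := x :+ (α :* :0 :+ ((:0 :- :0) :+ :0))) refl x α) (sym (prodθ-drop [] false Q x ∙ prodθ-cong [] Q (+-congˡ (+-identityʳ 1#)))) ⟩
        (x + θ [] 0 Q) * prodθ ((0 , false) ∷ []) Q x ∎
        where
        open ≈R
        x = - ν j
        -- At j = 0 the point x + 1 = 1 is not among those tested, but the factor x = 0 annihilates
        -- both sides.
        shifted : ∀ j → - ν j * upto (open′ Q) (λ r i → e n Q r * rise (- ν j + 1#) i) ≈ - ν j * prodθ [] Q (- ν j + 1#)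
        shifted zero    = zero-neg _ ∙ sym (zero-neg _)
          where
          zero-neg : ∀ y → - 0# * y ≈ 0#
          zero-neg y = solve 1 (λ y → :- :0 :* y := :0) refl y
        shifted (suc j) = *-congˡ ((upto-cong (open′ Q) λ r i → *-congˡ (rise-cong i (-ν-suc j))) ∙
          proj₂ ih j ∙ prodθ-cong [] Q (sym (-ν-suc j)))
    factors (suc n) ((suc l , s) ∷ T) h = vanish s , factor s
      where
      open ≈R
      M = open′ T
      Q₁ = T ∷ʳ (l , false)
      Q₂ = T ∷ʳ (l , true)
      ih₁ = factors n Q₁ (boxesˢ-∷ʳ T l false ⊙ ℕ.suc-injective h)
      ih₂ = factors n Q₂ (boxesˢ-∷ʳ T l true ⊙ ℕ.suc-injective h)
      κ′ = α * ν (suc l) + ν (shorterᴸ l (map proj₁ T))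
      eQ : Bool → ℕ → Carrier
      eQ s r = e n Q₁ r + onPred r (λ r′ → markWeight α l s T * e n Q₂ r′)
      P : Bool → Carrier → Carrier
      P s = prodθ ((suc l , s) ∷ []) T
      -- Here A has to be α. As a result the combined last factor is x for a marked head row, and x
      -- + κ′, the factor of that row, for an unmarked one.
      balance : θ T l [] + (α + ν (marks T)) ≈ κ′
      balance = begin
        (α * ν l + ((ν (below l []) - ν u) + ν (open′ T))) + (α + ν (marks T))
          ≈⟨ +-congʳ (+-congˡ (+-congʳ (+-congʳ (below-[] l)))) ⟩
        (α * ν l + ((0# - ν u) + ν (open′ T))) + (α + ν (marks T))
          ≈⟨ solve 5 (λ α l u o m → (α :* l :+ ((:0 :- u) :+ o)) :+ (α :+ m) := α :* (:1 :+ l) :+ ((o :+ m) :- u)) refl α (ν l) (ν u) (ν (open′ T)) (ν (marks T)) ⟩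
        α * ν (suc l) + ((ν (open′ T) + ν (marks T)) - ν u)
          ≈⟨ +-congˡ (+-congʳ (sym (ν-+ (open′ T) (marks T)) ∙ cong-≈ ν (open+marks T ⊙ ≡.sym (longerᴸ+shorterᴸ l (map proj₁ T) ⊙ List.length-map proj₁ T)) ∙ ν-+ u (shorterᴸ l (map proj₁ T)))) ⟩
        α * ν (suc l) + ((ν u + ν (shorterᴸ l (map proj₁ T))) - ν u)
          ≈⟨ +-congˡ (solve 2 (λ u v → (u :+ v) :- u := v) refl (ν u) (ν (shorterᴸ l (map proj₁ T)))) ⟩
        κ′ ∎
        where
        u = above l T
        below-[] : ∀ l → ν (below l []) ≈ 0#
        below-[] zero    = refl
        below-[] (suc l) = refl
      combined : ∀ s j → upto (suc M) (λ r i → eQ s r * rise (- ν j) i) ≈ P s (- ν j + ν (bit s)) * ((- ν j + θ T l []) + markWeight α l s T)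
      combined s j = begin
        upto (suc M) (λ r i → eQ s r * rise x i)
          ≈⟨ (upto-cong (suc M) λ r i → distribʳ (rise x i) (e n Q₁ r) (onPred r (λ r′ → w * e n Q₂ r′))) ∙
               upto-+ (suc M) (λ r i → e n Q₁ r * rise x i) (λ r i → onPred r (λ r′ → w * e n Q₂ r′) * rise x i) ⟩
        upto (suc M) (λ r i → e n Q₁ r * rise x i) + upto (suc M) (λ r i → onPred r (λ r′ → w * e n Q₂ r′) * rise x i)
          ≈⟨ +-cong (cong-≈ (λ m → upto m (λ r i → e n Q₁ r * rise x i)) (≡.sym (open′-∷ʳ T l false)) ∙ proj₂ ih₁ j ∙ prodθ-rotate [] l s T false x)
               (upto-onPred-1 M w x (e n Q₂) ∙ *-congˡ (cong-≈ (λ m → upto m (λ r i → e n Q₂ r * rise x i)) (≡.sym (open′-∷ʳ T l true)) ∙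
                 proj₂ ih₂ j ∙ prodθ-rotate [] l s T true x ∙ *-identityʳ _)) ⟩
        P s (x + ν (bit s)) * (x + θ T l []) + w * P s (x + ν (bit s))
          ≈⟨ solve 3 (λ p y w → p :* y :+ w :* p := p :* (y :+ w)) refl _ _ _ ⟩
        P s (x + ν (bit s)) * ((x + θ T l []) + w) ∎
        where
        x = - ν j
        w = markWeight α l s T
      top : eQ true (suc M) ≈ 0#
      top = begin
        eQ true (suc M)
          ≈⟨ +-congʳ (solve 1 (λ y → :- :0 :* y := :0) refl _) ∙ +-identityˡ _ ⟨
        - 0# * upto M (λ r i → eQ true r * rise (- 0# + 1#) i) + eQ true (suc M)
          ≈⟨ upto-rise M (- 0#) (eQ true) ⟨
        upto (suc M) (λ r i → eQ true r * rise (- ν 0) i)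
          ≈⟨ combined true 0 ⟩
        P true (- ν 0 + ν 1) * ((- 0# + θ T l []) + ((α + ν (marks T)) - κ′))
          ≈⟨ *-congˡ (solve 3 (λ t c k → (:- :0 :+ t) :+ (c :- k) := (t :+ c) :- k) refl _ _ _ ∙ +-congʳ balance ∙ -‿inverseʳ κ′) ⟩
        P true (- ν 0 + ν 1) * 0#
          ≈⟨ zeroʳ _ ⟩
        0# ∎
      beyond : ∀ s r → suc M < r → eQ s r ≈ 0#
      beyond s (suc r) l< = +-cong (proj₁ ih₁ (suc r) (subst (_< suc r) (≡.sym (open′-∷ʳ T l false)) l<))
        (*-congˡ (proj₁ ih₂ r (subst (_< r) (≡.sym (open′-∷ʳ T l true)) (ℕ.s<s⁻¹ l<))) ∙ zeroʳ _) ∙ +-identityˡ 0#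
      vanish : ∀ s r → bit (not s) ℕ.+ M < r → eQ s r ≈ 0#
      vanish false r l< = beyond false r l<
      vanish true  r l< with ℕ.m≤n⇒m<n∨m≡n l<
      ... | inj₁ l<<    = beyond true r l<<
      ... | inj₂ ≡.refl = top
      factor : ∀ s j → upto (bit (not s) ℕ.+ M) (λ r i → eQ s r * rise (- ν j) i) ≈ (if s then 1# else - ν j + θ [] (suc l) T) * P s (- ν j)
      factor false j = begin
        upto (suc M) (λ r i → eQ false r * rise x i)
          ≈⟨ combined false j ⟩
        P false (x + 0#) * ((x + θ T l []) + ((α + ν (marks T)) - 0#))
          ≈⟨ *-cong (prodθ-cong _ T (+-identityʳ x)) (solve 3 (λ x t c → (x :+ t) :+ (c :- :0) := x :+ (t :+ c)) refl x _ _ ∙ +-congˡ balance) ⟩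
        P false x * (x + κ′)
          ≈⟨ *-comm _ _ ∙ *-congʳ (+-congˡ (+-congˡ (solve 1 (λ y → y := (y :- :0) :+ :0) refl (ν (shorterᴸ l (map proj₁ T)))))) ⟩
        (x + θ [] (suc l) T) * P false x ∎
        where x = - ν j
      factor true j = cancel j (begin
        ν (suc j) * upto M (λ r i → eQ true r * rise (- ν j) i)
          ≈⟨ *-congˡ (upto-cong M λ r i → *-congˡ (rise-cong i (sym (-ν-suc j)))) ⟩
        ν (suc j) * upto M (λ r i → eQ true r * rise (x + 1#) i)
          ≈⟨ solve 2 (λ n u → n :* u := :- (:- n :* u)) refl (ν (suc j)) _ ⟩
        - (x * upto M (λ r i → eQ true r * rise (x + 1#) i))
          ≈⟨ -‿cong (sym (+-congˡ top ∙ +-identityʳ _) ∙ sym (upto-rise M x (eQ true))) ⟩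
        - upto (suc M) (λ r i → eQ true r * rise x i)
          ≈⟨ -‿cong (combined true (suc j)) ⟩
        - (P true (x + ν 1) * ((x + θ T l []) + ((α + ν (marks T)) - κ′)))
          ≈⟨ -‿cong (*-congˡ (solve 4 (λ x t c k → (x :+ t) :+ (c :- k) := x :+ ((t :+ c) :- k)) refl x _ _ _ ∙
               +-congˡ (+-congʳ balance ∙ -‿inverseʳ κ′) ∙ +-identityʳ x)) ⟩
        - (P true (x + ν 1) * x)
          ≈⟨ solve 2 (λ p n → :- (p :* :- n) := n :* p) refl _ (ν (suc j)) ⟩
        ν (suc j) * P true (x + ν 1)
          ≈⟨ *-congˡ (prodθ-cong _ T (+-congˡ (+-identityʳ 1#) ∙ -ν-suc j)) ⟩
        ν (suc j) * P true (- ν j) ∎) ∙ sym (*-identityˡ _)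
        where
        x = - ν (suc j)

    -- Only the term without a factor x survives at x = 0.
    E-top : ∀ n Q → boxesˢ Q ≡ n → E α n Q (open′ Q) ≈ prodθ [] Q (- 0#)
    E-top n Q h = sym (at-zero (open′ Q) (E α n Q)) ∙ proj₂ (factors n Q h) 0
      where
      at-zero : ∀ k (f : ℕ → Carrier) → upto k (λ r i → f r * rise (- 0#) i) ≈ f k
      at-zero zero    f = *-identityʳ _
      at-zero (suc k) f = upto-rise k (- 0#) f ∙ +-congʳ (solve 1 (λ y → :- :0 :* y := :0) refl _) ∙ +-identityˡ _

  -- For c = 0 and the rows of a diagram listed from the bottom: the product of α (a + 1) + ℓ over
  -- the boxes of the first column.
  columnProduct : ℕ → List ℕ → Carrier
  columnProduct c []       = 1#
  columnProduct c (l ∷ ls) = (α * ν l + ν c) * columnProduct (suc c) ls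

  -- In ascending order no later row is shorter and no earlier one longer, so θ is α l plus the
  -- number of rows already passed.
  prodθ-ascending : ∀ ps ls → All (λ l → All (_≤ l) ps) ls → Linked _≤_ ls →
                    prodθ (unmarked ps) (unmarked ls) (- 0#) ≈ columnProduct (length ps) ls
  prodθ-ascending ps []       b s = refl
  prodθ-ascending ps (l ∷ ls) (b ∷ bs) s = *-cong factor (cong-≈ (λ P → prodθ P (unmarked ls) (- 0#)) (≡.sym (List.map-++ _ ps (l ∷ []))) ∙
      prodθ-ascending (ps ∷ʳ l) ls (extend bs (above-head s)) (Linked.tail s) ∙ cong-≈ (λ c → columnProduct c ls) (List.length-++ ps ⊙ ℕ.+-comm _ 1))
    where
    above-head : ∀ {l ls} → Linked _≤_ (l ∷ ls) → All (l ≤_) ls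
    above-head [-]     = []
    above-head (p ∷ q) = p ∷ All.map (ℕ.≤-trans p) (above-head q)
    extend : ∀ {ls} → All (λ k → All (_≤ k) ps) ls → All (l ≤_) ls → All (λ k → All (_≤ k) (ps ∷ʳ l)) ls
    extend []       []       = []
    extend (b ∷ bs) (c ∷ cs) = snoc b c ∷ extend bs cs
      where
      snoc : ∀ {ps k} → All (_≤ k) ps → l ≤ k → All (_≤ k) (ps ∷ʳ l)
      snoc []       c = c ∷ []
      snoc (b ∷ bs) c = b ∷ snoc bs c
    no-shorter : ∀ l {ks} → All (l ≤_) ks → below l (unmarked ks) ≡ 0
    no-shorter zero    a = ≡.refl
    no-shorter (suc l) {ks} a = cong (shorterᴸ l) (lengths-unmarked ks) ⊙ go a
      where
      go : ∀ {ks} → All (suc l ≤_) ks → shorterᴸ l ks ≡ 0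
      go []               = ≡.refl
      go {k ∷ ks} (b ∷ a) = cong₂ ℕ._+_ (cong bit (dec-false (k ℕ.≤? l) (ℕ.<⇒≱ b))) (go a)
    factor : - 0# + θ (unmarked ps) l (unmarked ls) ≈ α * ν l + ν (length ps)
    factor = +-congˡ (+-congˡ (+-cong (+-cong (cong-≈ ν (no-shorter l (above-head s)))
        (-‿cong (cong-≈ ν (cong (longerᴸ (suc l)) (lengths-unmarked ps) ⊙ longerᴸ-none b)))) (cong-≈ ν (open-unmarked ps)))) ∙
      solve 2 (λ y c → :- :0 :+ (y :+ ((:0 :- :0) :+ c)) := y :+ c) refl (α * ν l) (ν (length ps))

open import Defs

module K = CommutativeRing ℚ⟨α⟩-commutativeRing
module KR = Ring ℚ⟨α⟩-commutativeRing
open KR using (ν; solve; _:=_; _:+_; _:*_; _:-_; :-_; :0; :1)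
module ≈K = SetoidReasoning K.setoid

-- An ordering of ℚ(α)

module PolyOrder where
  open Polynomials using (Poly; at; ≈-refl; ≈-sym; ≈-trans; ∷-zero; ∷-zero⁻; ∷-cong; tail-≈; ℚ[α]; 0∷-*; *-comm; *-congˡ)
    renaming (_≈_ to _≈ᴾ_; _+_ to _+ᴾ_; _*_ to _*ᴾ_; -_ to -ᴾ_)
  open Ring ℚ[α] using () renaming (solve to solveᴾ; _:=_ to _:=ᴾ_; _:+_ to _:+ᴾ_; _:*_ to _:*ᴾ_; :-_ to :-ᴾ_; :0 to :0ᴾ)

  -- The sign is that of the lowest nonzero coefficient, so α is positive and smaller than every
  -- positive constant.
  data Positive : Poly → Set where
    here  : ∀ {c p} → 0ℚ ℚ.< c → Positive (c ∷ p)
    there : ∀ {c p} → c ≡ 0ℚ → Positive p → Positive (c ∷ p)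

  positive-≉0 : ∀ {p} → Positive p → ¬ p ≈ᴾ []
  positive-≉0 (here 0<c)  e = ℚ.<-irrefl (≡.sym (e .at 0)) 0<c
  positive-≉0 (there _ p) e = positive-≉0 p (proj₂ (∷-zero⁻ e))

  positive-resp : ∀ {p q} → p ≈ᴾ q → Positive p → Positive q
  positive-resp {q = []}    e p           = contradiction e (positive-≉0 p)
  positive-resp {q = d ∷ q} e (here 0<c)  = here (subst (0ℚ ℚ.<_) (e .at 0) 0<c)
  positive-resp {q = d ∷ q} e (there c p) = there (≡.sym (e .at 0) ⊙ c) (positive-resp (tail-≈ e) p)

  positive-+ : ∀ {p q} → Positive p → Positive q → Positive (p +ᴾ q)
  positive-+ (here 0<c)        (here 0<d)         = here (ℚ.+-mono-< 0<c 0<d)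
  positive-+ (here {c} 0<c)    (there ≡.refl q)   = here (subst (0ℚ ℚ.<_) (≡.sym (ℚ.+-identityʳ c)) 0<c)
  positive-+ (there ≡.refl p)  (here {d} 0<d)     = here (subst (0ℚ ℚ.<_) (≡.sym (ℚ.+-identityˡ d)) 0<d)
  positive-+ (there ≡.refl p)  (there ≡.refl q)   = there ≡.refl (positive-+ p q)

  0<* : ∀ {c d} → 0ℚ ℚ.< c → 0ℚ ℚ.< d → 0ℚ ℚ.< c ℚ.* d
  0<* {c} {d} 0<c 0<d = subst (ℚ._< c ℚ.* d) (ℚ.*-zeroˡ d) (ℚ.*-monoˡ-<-pos d {{ℚ.positive 0<d}} 0<c)

  *-0∷ : ∀ p q → p *ᴾ (0ℚ ∷ q) ≈ᴾ 0ℚ ∷ p *ᴾ q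
  *-0∷ p q = ≈-trans (*-comm p (0ℚ ∷ q)) (≈-trans (0∷-* q p) (∷-cong ≡.refl (*-comm q p)))

  positive-* : ∀ {p q} → Positive p → Positive q → Positive (p *ᴾ q)
  positive-* {_ ∷ p} {q} (there ≡.refl P) Q = positive-resp (≈-sym (0∷-* p q)) (there ≡.refl (positive-* P Q))
  positive-* {p} {_ ∷ q} P@(here _) (there ≡.refl Q) = positive-resp (≈-sym (*-0∷ p q)) (there ≡.refl (positive-* P Q))
  positive-* {c ∷ p} {d ∷ q} (here 0<c) (here 0<d) =
    here (subst (0ℚ ℚ.<_) (≡.sym (ℚ.+-identityʳ (c ℚ.* d))) (0<* 0<c 0<d))

  trichotomy : ∀ p → p ≈ᴾ [] ⊎ (Positive p ⊎ Positive (-ᴾ p))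
  trichotomy []      = inj₁ ≈-refl
  trichotomy (c ∷ p) with ℚ.<-cmp 0ℚ c
  ... | tri< 0<c _ _ = inj₂ (inj₁ (here 0<c))
  ... | tri> _ _ c<0 = inj₂ (inj₂ (here (ℚ.neg-antimono-< c<0)))
  ... | tri≈ _ ≡.refl _ with trichotomy p
  ...   | inj₁ e        = inj₁ (∷-zero ≡.refl e)
  ...   | inj₂ (inj₁ q) = inj₂ (inj₁ (there ≡.refl q))
  ...   | inj₂ (inj₂ q) = inj₂ (inj₂ (there ≡.refl q))

  positive-square : ∀ {p} → ¬ p ≈ᴾ [] → Positive (p *ᴾ p)
  positive-square {p} p≉0 with trichotomy p
  ... | inj₁ e        = contradiction e p≉0
  ... | inj₂ (inj₁ q) = positive-* q q
  ... | inj₂ (inj₂ q) = positive-resp (solveᴾ 1 (λ x → :-ᴾ x :*ᴾ :-ᴾ x :=ᴾ x :*ᴾ x) ≈-refl p) (positive-* q q)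

  positive-cancelʳ : ∀ {p q} → Positive (p *ᴾ q) → Positive q → Positive p
  positive-cancelʳ {p} {q} P Q with trichotomy p
  ... | inj₁ e        = contradiction (≈-trans (*-congˡ e q) ≈-refl) (positive-≉0 P)
  ... | inj₂ (inj₁ r) = r
  ... | inj₂ (inj₂ r) = contradiction (solveᴾ 2 (λ x y → x :*ᴾ y :+ᴾ :-ᴾ x :*ᴾ y :=ᴾ :0ᴾ) ≈-refl p q)
                          (positive-≉0 (positive-+ P (positive-* r Q)))

open PolyOrder using (Positive; here; there)

module FieldOrder where
  open Polynomials using (Poly; ℚ[α]; at; mk≈; ∷-zero⁻)
  open RationalFunctions using (mk; num; den; den≉0; mk≃; cross; *-≉0; _≃_)
  open PolyOrder
  open CommutativeRing ℚ[α] using (refl; sym; trans) renaming (_≈_ to _≈ᴾ_; _+_ to _+ᴾ_; _*_ to _*ᴾ_; 0# to 0ᴾ; 1# to 1ᴾ;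
    *-identityʳ to *ᴾ-identityʳ; zeroˡ to zeroᴾˡ; *-congʳ to *ᴾ-congʳ; *-congˡ to *ᴾ-congˡ)
  open Ring ℚ[α] using () renaming (solve to solveᴾ; _:=_ to _:=ᴾ_; _:+_ to _:+ᴾ_; _:*_ to _:*ᴾ_; :1 to :1ᴾ)

  zeroᴾ? : ∀ (p : Poly) → Dec (p ≈ᴾ 0ᴾ)
  zeroᴾ? []      = yes refl
  zeroᴾ? (c ∷ p) with c ℚ.≟ 0ℚ | zeroᴾ? p
  ... | yes e | yes f = yes (Polynomials.∷-zero e f)
  ... | no ¬e | _     = no (¬e ∘ proj₁ ∘ ∷-zero⁻)
  ... | yes _ | no ¬f = no (¬f ∘ proj₂ ∘ ∷-zero⁻)

  num-zero : ∀ x → num x ≈ᴾ 0ᴾ → x ≈ 0#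
  num-zero x e = mk≃ (trans (*ᴾ-identityʳ (num x)) (trans e (sym (zeroᴾˡ (den x)))))

  zero-num : ∀ x → x ≈ 0# → num x ≈ᴾ 0ᴾ
  zero-num x e = trans (sym (*ᴾ-identityʳ (num x))) (trans (cross e) (zeroᴾˡ (den x)))

  zero? : ∀ (x : ℚ⟨α⟩) → Dec (x ≈ 0#)
  zero? x with zeroᴾ? (num x)
  ... | yes e = yes (num-zero x e)
  ... | no ¬e = no (¬e ∘ zero-num x)

  inverse : ∀ x → ¬ x ≈ 0# → ∃ λ y → x * y ≈ 1#
  inverse (mk a b b≉0) x≉0 = mk b a (x≉0 ∘ num-zero (mk a b b≉0)) ,
    mk≃ (solveᴾ 2 (λ a b → (a :*ᴾ b) :*ᴾ :1ᴾ :=ᴾ :1ᴾ :*ᴾ (b :*ᴾ a)) refl a b)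

  -- Multiplication by the square of the denominator reduces the sign of a fraction to that of a
  -- polynomial, whatever the sign of the denominator.
  record Pos (x : ℚ⟨α⟩) : Set where
    constructor pos
    field sign : Positive (num x *ᴾ den x)

  pos-≉0 : ∀ {x} → Pos x → ¬ x ≈ 0#
  pos-≉0 {x} (pos p) e = positive-≉0 p (trans (*ᴾ-congʳ (zero-num x e)) (zeroᴾˡ (den x)))

  pos-resp : ∀ {x y} → x ≈ y → Pos x → Pos y
  pos-resp {mk a b b≉0} {mk c d d≉0} e (pos p) = pos (positive-cancelʳ
    (positive-resp (trans (solveᴾ 3 (λ a b d → (a :*ᴾ b) :*ᴾ (d :*ᴾ d) :=ᴾ (a :*ᴾ d) :*ᴾ (b :*ᴾ d)) refl a b d)
      (trans (*ᴾ-congʳ (cross e)) (solveᴾ 3 (λ b c d → (c :*ᴾ b) :*ᴾ (b :*ᴾ d) :=ᴾ (c :*ᴾ d) :*ᴾ (b :*ᴾ b)) refl b c d)))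
      (positive-* p (positive-square d≉0)))
    (positive-square b≉0))

  pos-+ : ∀ {x y} → Pos x → Pos y → Pos (x + y)
  pos-+ {mk a b b≉0} {mk c d d≉0} (pos p) (pos q) = pos (positive-resp
    (solveᴾ 4 (λ a b c d → (a :*ᴾ b) :*ᴾ (d :*ᴾ d) :+ᴾ (c :*ᴾ d) :*ᴾ (b :*ᴾ b) :=ᴾ (a :*ᴾ d :+ᴾ c :*ᴾ b) :*ᴾ (b :*ᴾ d)) refl a b c d)
    (positive-+ (positive-* p (positive-square d≉0)) (positive-* q (positive-square b≉0))))

  pos-* : ∀ {x y} → Pos x → Pos y → Pos (x * y)
  pos-* {mk a b b≉0} {mk c d d≉0} (pos p) (pos q) = pos (positive-resp
    (solveᴾ 4 (λ a b c d → (a :*ᴾ b) :*ᴾ (c :*ᴾ d) :=ᴾ (a :*ᴾ c) :*ᴾ (b :*ᴾ d)) refl a b c d) (positive-* p q))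

  pos-square : ∀ {x} → ¬ x ≈ 0# → Pos (x * x)
  pos-square {mk a b b≉0} x≉0 = pos (positive-resp
    (solveᴾ 2 (λ a b → (a :*ᴾ a) :*ᴾ (b :*ᴾ b) :=ᴾ (a :*ᴾ a) :*ᴾ (b :*ᴾ b)) refl a b)
    (positive-* (positive-square (x≉0 ∘ num-zero (mk a b b≉0))) (positive-square b≉0)))

  pos-1 : Pos 1#
  pos-1 = pos (positive-square {1ᴾ} RationalFunctions.1≉0)

  pos-α : Pos α
  pos-α = pos (there ≡.refl (here (ℚ.positive⁻¹ (1ℚ ℚ.* 1ℚ ℚ.+ 0ℚ))))

  ⌜⌝-+ : ∀ p q → ⌜ p +ᴾ q ⌝ ≈ ⌜ p ⌝ + ⌜ q ⌝
  ⌜⌝-+ p q = mk≃ (solveᴾ 2 (λ p q → (p :+ᴾ q) :*ᴾ (:1ᴾ :*ᴾ :1ᴾ) :=ᴾ (p :*ᴾ :1ᴾ :+ᴾ q :*ᴾ :1ᴾ) :*ᴾ :1ᴾ) refl p q)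

  ⌜⌝-* : ∀ p q → ⌜ p *ᴾ q ⌝ ≈ ⌜ p ⌝ * ⌜ q ⌝
  ⌜⌝-* p q = mk≃ (solveᴾ 2 (λ p q → (p :*ᴾ q) :*ᴾ (:1ᴾ :*ᴾ :1ᴾ) :=ᴾ (p :*ᴾ q) :*ᴾ :1ᴾ) refl p q)

  ⌜⌝-cong : ∀ {p q} → p ≈ᴾ q → ⌜ p ⌝ ≈ ⌜ q ⌝
  ⌜⌝-cong e = mk≃ (*ᴾ-congʳ e)

  ⌜⌝-injective : ∀ {p q} → ⌜ p ⌝ ≈ ⌜ q ⌝ → p ≈ᴾ q
  ⌜⌝-injective {p} {q} e = trans (sym (*ᴾ-identityʳ p)) (trans (cross e) (*ᴾ-identityʳ q))

open FieldOrder public using (zero?; inverse; Pos; pos-≉0; pos-resp; pos-+; pos-*; pos-square; pos-1; pos-α; ⌜⌝-+; ⌜⌝-*; ⌜⌝-cong; ⌜⌝-injective)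

toℚᵘ-ℕ→ℚ : ∀ n → ℚ.toℚᵘ (ℕ→ℚ n) ℚᵘ.≃ ℚᵘ.mkℚᵘ (ℤ.+ n) 0
toℚᵘ-ℕ→ℚ n = ℚ.toℚᵘ-fromℚᵘ (ℚᵘ.mkℚᵘ (ℤ.+ n) 0)

ℕ→ℚ-+ : ∀ m n → ℕ→ℚ (m ℕ.+ n) ≡ ℕ→ℚ m ℚ.+ ℕ→ℚ n
ℕ→ℚ-+ m n = ℚ.toℚᵘ-injective (ℚᵘ.≃-trans (toℚᵘ-ℕ→ℚ (m ℕ.+ n)) (ℚᵘ.≃-trans (ℚᵘ.*≡* eq)
  (ℚᵘ.≃-sym (ℚᵘ.≃-trans (ℚ.toℚᵘ-homo-+ (ℕ→ℚ m) (ℕ→ℚ n)) (ℚᵘ.+-cong (toℚᵘ-ℕ→ℚ m) (toℚᵘ-ℕ→ℚ n))))))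
  where
  eq : ℤ.+ (m ℕ.+ n) ℤ.* ℤ.+ 1 ≡ (ℤ.+ m ℤ.* ℤ.+ 1 ℤ.+ ℤ.+ n ℤ.* ℤ.+ 1) ℤ.* ℤ.+ 1
  eq = cong (ℤ._* ℤ.+ 1) (cong₂ ℤ._+_ (≡.sym (ℤ.*-identityʳ (ℤ.+ m))) (≡.sym (ℤ.*-identityʳ (ℤ.+ n))))

ℕ→ℚ-* : ∀ m n → ℕ→ℚ (m ℕ.* n) ≡ ℕ→ℚ m ℚ.* ℕ→ℚ n
ℕ→ℚ-* m n = ℚ.toℚᵘ-injective (ℚᵘ.≃-trans (toℚᵘ-ℕ→ℚ (m ℕ.* n)) (ℚᵘ.≃-trans (ℚᵘ.*≡* (cong (ℤ._* ℤ.+ 1) (ℤ.pos-* m n)))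
  (ℚᵘ.≃-sym (ℚᵘ.≃-trans (ℚ.toℚᵘ-homo-* (ℕ→ℚ m) (ℕ→ℚ n)) (ℚᵘ.*-cong (toℚᵘ-ℕ→ℚ m) (toℚᵘ-ℕ→ℚ n))))))

ℕ→ℚ-injective : ∀ {m n} → ℕ→ℚ m ≡ ℕ→ℚ n → m ≡ n
ℕ→ℚ-injective {m} {n} e
  with ℚᵘ.≃-trans (ℚᵘ.≃-sym (toℚᵘ-ℕ→ℚ m)) (ℚᵘ.≃-trans (ℚᵘ.≃-reflexive (cong ℚ.toℚᵘ e)) (toℚᵘ-ℕ→ℚ n))
... | ℚᵘ.*≡* eq = ℤ.+-injective (≡.sym (ℤ.*-identityʳ (ℤ.+ m)) ⊙ eq ⊙ ℤ.*-identityʳ (ℤ.+ n))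

fromℕ≈ν : ∀ n → fromℕ n ≈ ν n
fromℕ≈ν zero    = ⌜⌝-cong (Polynomials.∷-zero ≡.refl Polynomials.≈-refl)
fromℕ≈ν (suc n) = K.trans (⌜⌝-cong (Polynomials.∷-cong (ℕ→ℚ-+ 1 n) Polynomials.≈-refl))
  (K.trans (⌜⌝-+ (1ℚ ∷ []) (ℕ→ℚ n ∷ [])) (K.+-congˡ {1#} (fromℕ≈ν n)))

pos-ν : ∀ n → Pos (ν (suc n))
pos-ν zero    = pos-resp (K.sym (K.+-identityʳ 1#)) pos-1
pos-ν (suc n) = pos-+ pos-1 (pos-ν n)

ν≉0 : ∀ n → .{{ℕ.NonZero n}} → ¬ ν n ≈ 0#
ν≉0 (suc n) = pos-≉0 (pos-ν n)

*-cancelˡ : ∀ x {y z} → ¬ x ≈ 0# → x * y ≈ x * z → y ≈ z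
*-cancelˡ x {y} {z} x≉0 e with inverse x x≉0
... | w , xw≈1 = begin
  y  ≈⟨ K.*-identityˡ y ⟨
  1# * y  ≈⟨ K.*-congʳ {y} xw≈1 ⟨
  (x * w) * y  ≈⟨ solve 3 (λ x w y → (x :* w) :* y := w :* (x :* y)) K.refl x w y ⟩
  w * (x * y)  ≈⟨ K.*-congˡ {w} e ⟩
  w * (x * z)  ≈⟨ solve 3 (λ x w y → w :* (x :* y) := (x :* w) :* y) K.refl x w z ⟩
  (x * w) * z  ≈⟨ K.*-congʳ {z} xw≈1 ⟩
  1# * z  ≈⟨ K.*-identityˡ z ⟩
  z  ∎
  where open ≈K

*-integral : ∀ x {y} → ¬ x ≈ 0# → x * y ≈ 0# → y ≈ 0#
*-integral x x≉0 e = *-cancelˡ x x≉0 (K.trans e (K.sym (K.zeroʳ x)))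

NonNeg : ℚ⟨α⟩ → Set
NonNeg x = x ≈ 0# ⊎ Pos x

nonneg-resp : ∀ {x y} → x ≈ y → NonNeg x → NonNeg y
nonneg-resp e (inj₁ z) = inj₁ (K.trans (K.sym e) z)
nonneg-resp e (inj₂ p) = inj₂ (pos-resp e p)

pos-+-nonneg : ∀ {x y} → Pos x → NonNeg y → Pos (x + y)
pos-+-nonneg {x} p (inj₁ e) = pos-resp (K.sym (K.trans (K.+-congˡ {x} e) (K.+-identityʳ x))) p
pos-+-nonneg p (inj₂ q) = pos-+ p q

nonneg-+-pos : ∀ {x y} → NonNeg x → Pos y → Pos (x + y)
nonneg-+-pos {x} {y} p q = pos-resp (K.+-comm y x) (pos-+-nonneg q p)

nonneg-+ : ∀ {x y} → NonNeg x → NonNeg y → NonNeg (x + y)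
nonneg-+ {x} {y} (inj₁ e) q = nonneg-resp (K.sym (K.trans (K.+-congʳ {y} e) (K.+-identityˡ y))) q
nonneg-+ (inj₂ p) q = inj₂ (pos-+-nonneg p q)

nonneg-* : ∀ {x y} → NonNeg x → NonNeg y → NonNeg (x * y)
nonneg-* {x} {y} (inj₁ e) q = inj₁ (K.trans (K.*-congʳ {y} e) (K.zeroˡ y))
nonneg-* {x} (inj₂ p) (inj₁ e) = inj₁ (K.trans (K.*-congˡ {x} e) (K.zeroʳ x))
nonneg-* (inj₂ p) (inj₂ q) = inj₂ (pos-* p q)

nonneg-ν : ∀ n → NonNeg (ν n)
nonneg-ν zero    = inj₁ K.refl
nonneg-ν (suc n) = inj₂ (pos-ν n)

-- Polynomials with nonnegative integer coefficients

NIP = IsNonnegativeIntegerPolynomial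

nip-resp : ∀ {x y} → x ≈ y → NIP x → NIP y
nip-resp e (P , f) = P , K.trans (K.sym e) f

nip-0 : NIP 0#
nip-0 = [] , K.refl

nip-ν : ∀ n → NIP (ν n)
nip-ν n = n ∷ [] , K.sym (fromℕ≈ν n)

nip-α : NIP α
nip-α = 0 ∷ 1 ∷ [] , K.refl

private
  module P = Polynomials

  infixl 6 _⊕_
  _⊕_ : List ℕ → List ℕ → List ℕ
  []      ⊕ Q       = Q
  (a ∷ P) ⊕ []      = a ∷ P
  (a ∷ P) ⊕ (b ∷ Q) = a ℕ.+ b ∷ P ⊕ Q

  map-⊕ : ∀ P Q → map ℕ→ℚ (P ⊕ Q) ≡ map ℕ→ℚ P P.+ map ℕ→ℚ Q
  map-⊕ []      Q       = ≡.refl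
  map-⊕ (a ∷ P) []      = ≡.refl
  map-⊕ (a ∷ P) (b ∷ Q) = cong₂ _∷_ (ℕ→ℚ-+ a b) (map-⊕ P Q)

  _⊛_ : List ℕ → List ℕ → List ℕ
  []      ⊛ Q = []
  (a ∷ P) ⊛ Q = map (a ℕ.*_) Q ⊕ (0 ∷ P ⊛ Q)

  map-⊛ : ∀ P Q → map ℕ→ℚ (P ⊛ Q) ≡ map ℕ→ℚ P P.* map ℕ→ℚ Q
  map-⊛ []      Q = ≡.refl
  map-⊛ (a ∷ P) Q = map-⊕ (map (a ℕ.*_) Q) _ ⊙ (cong₂ P._+_ (scale Q) (cong (0ℚ ∷_) (map-⊛ P Q)))
    where
    scale : ∀ Q → map ℕ→ℚ (map (a ℕ.*_) Q) ≡ ℕ→ℚ a P.· map ℕ→ℚ Q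
    scale []      = ≡.refl
    scale (b ∷ Q) = cong₂ _∷_ (ℕ→ℚ-* a b) (scale Q)

nip-+ : ∀ {x y} → NIP x → NIP y → NIP (x + y)
nip-+ {x} {y} (P , e) (Q , f) = P ⊕ Q , K.trans (K.+-cong e f)
  (K.sym (K.trans (K.reflexive (cong ⌜_⌝ (map-⊕ P Q))) (⌜⌝-+ (map ℕ→ℚ P) (map ℕ→ℚ Q))))

nip-* : ∀ {x y} → NIP x → NIP y → NIP (x * y)
nip-* {x} {y} (P , e) (Q , f) = P ⊛ Q , K.trans (K.*-cong e f)
  (K.sym (K.trans (K.reflexive (cong ⌜_⌝ (map-⊛ P Q))) (⌜⌝-* (map ℕ→ℚ P) (map ℕ→ℚ Q))))

nip-sum : ∀ {n} {f : _ → ℚ⟨α⟩} → (∀ i → NIP (f i)) → NIP (KR.sum {n} f)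
nip-sum {zero}  h = nip-resp (K.sym (KR.sum-0 _)) nip-0
nip-sum {suc n} h = nip-resp (K.sym (KR.sum-suc _)) (nip-+ (h _) (nip-sum (λ i → h _)))

nip-nonneg : ∀ {x} → NIP x → NonNeg x
nip-nonneg {x} (P , e) = nonneg-resp (K.sym e) (go P)
  where
  go : ∀ P → NonNeg ⌜ map ℕ→ℚ P ⌝
  go []      = inj₁ K.refl
  go (a ∷ P) = nonneg-resp (K.sym (split a P)) (nonneg-+ (nonneg-ν a) (nonneg-* (inj₂ pos-α) (go P)))
    where
    split : ∀ a P → ⌜ map ℕ→ℚ (a ∷ P) ⌝ ≈ ν a + α * ⌜ map ℕ→ℚ P ⌝
    split a P = K.trans (⌜⌝-cong poly) (K.trans (⌜⌝-+ (ℕ→ℚ a ∷ []) ((0ℚ ∷ 1ℚ ∷ []) P.* map ℕ→ℚ P))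
      (K.+-cong (fromℕ≈ν a) (⌜⌝-* (0ℚ ∷ 1ℚ ∷ []) (map ℕ→ℚ P))))
      where
      poly : map ℕ→ℚ (a ∷ P) P.≈ (ℕ→ℚ a ∷ []) P.+ (0ℚ ∷ 1ℚ ∷ []) P.* map ℕ→ℚ P
      poly = P.≈-trans (P.∷-cong (≡.sym (ℚ.+-identityʳ (ℕ→ℚ a))) (P.≈-sym (P.*-identityˡ (map ℕ→ℚ P))))
        (P.+-cong (P.≈-refl {ℕ→ℚ a ∷ []}) (P.≈-sym (P.0∷-* (1ℚ ∷ []) (map ℕ→ℚ P))))

α-linear : ∀ {a b c d} → α * ν a + ν b ≈ α * ν c + ν d → b ≡ d
α-linear {a} {b} {c} {d} e = ℕ→ℚ-injective (⌜⌝-injective (K.trans (K.sym (form a b)) (K.trans e (form c d))) .P.at 0)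
  where
  form : ∀ a b → α * ν a + ν b ≈ ⌜ ℕ→ℚ b ∷ ℕ→ℚ a ∷ [] ⌝
  form a b = K.trans (K.+-cong (K.*-congˡ {α} (K.sym (fromℕ≈ν a))) (K.sym (fromℕ≈ν b)))
    (K.trans (K.+-congʳ {fromℕ b} (K.sym (⌜⌝-* (0ℚ ∷ 1ℚ ∷ []) (ℕ→ℚ a ∷ []))))
    (K.trans (K.sym (⌜⌝-+ ((0ℚ ∷ 1ℚ ∷ []) P.* (ℕ→ℚ a ∷ [])) (ℕ→ℚ b ∷ [])))
      (⌜⌝-cong (P.≈-trans (P.+-cong (P.≈-trans (P.0∷-* (1ℚ ∷ []) (ℕ→ℚ a ∷ [])) (P.∷-cong ≡.refl (P.*-identityˡ (ℕ→ℚ a ∷ [])))) (P.≈-refl {ℕ→ℚ b ∷ []}))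
        (P.∷-cong (ℚ.+-identityˡ (ℕ→ℚ b)) P.≈-refl)))))

open KR using (_∙_; cong-≈; ν-+; ν-*; sum; sum-cong; sum-zero; sum-suc; sum-0; sum-const; sum-unless-δ; ∑-distrib-+; *-distribˡ-sum; when; unless; unless-cong)
open K using (refl; sym; trans; reflexive; +-cong; +-congˡ; +-congʳ; *-cong; *-congˡ; *-congʳ; +-identityˡ; +-identityʳ; *-identityˡ; *-identityʳ; +-assoc; *-assoc; +-comm; *-comm; distribˡ; distribʳ; zeroˡ; zeroʳ; -_; _-_; -‿cong; -‿inverseʳ)
open SetoidReasoning K.setoid

-- Convolution of coefficient functions

Σ< : ℕ → (ℕ → ℚ⟨α⟩) → ℚ⟨α⟩
Σ< zero    f = 0#
Σ< (suc n) f = f 0 + Σ< n (f ∘ suc)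

∑-applyUpTo : ∀ (g : ℕ → ℕ) n (f : ℕ → ℚ⟨α⟩) → ∑ (applyUpTo g n) f ≡ Σ< n (f ∘ g)
∑-applyUpTo g zero    f = ≡.refl
∑-applyUpTo g (suc n) f = cong (f (g 0) +_) (∑-applyUpTo (g ∘ suc) n f)

Σ<-cong : ∀ n {f g : ℕ → ℚ⟨α⟩} → (∀ i → i < n → f i ≈ g i) → Σ< n f ≈ Σ< n g
Σ<-cong zero    e = refl
Σ<-cong (suc n) e = +-cong (e 0 ℕ.z<s) (Σ<-cong n λ i l → e (suc i) (ℕ.s<s l))

Σ<-zero : ∀ n {f : ℕ → ℚ⟨α⟩} → (∀ i → i < n → f i ≈ 0#) → Σ< n f ≈ 0#
Σ<-zero zero    e = refl
Σ<-zero (suc n) e = +-cong (e 0 ℕ.z<s) (Σ<-zero n λ i l → e (suc i) (ℕ.s<s l)) ∙ +-identityˡ 0#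

Σ<-+ : ∀ n (f g : ℕ → ℚ⟨α⟩) → Σ< n (λ i → f i + g i) ≈ Σ< n f + Σ< n g
Σ<-+ zero    f g = sym (+-identityˡ 0#)
Σ<-+ (suc n) f g = +-congˡ {f 0 + g 0} (Σ<-+ n (f ∘ suc) (g ∘ suc)) ∙
  solve 4 (λ a b c d → (a :+ b) :+ (c :+ d) := (a :+ c) :+ (b :+ d)) refl (f 0) (g 0) (Σ< n (f ∘ suc)) (Σ< n (g ∘ suc))

Σ<-* : ∀ n c (f : ℕ → ℚ⟨α⟩) → Σ< n (λ i → c * f i) ≈ c * Σ< n f
Σ<-* zero    c f = sym (zeroʳ c)
Σ<-* (suc n) c f = +-congˡ {c * f 0} (Σ<-* n c (f ∘ suc)) ∙ sym (distribˡ c (f 0) _)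

Σ<-last : ∀ n (f : ℕ → ℚ⟨α⟩) → Σ< (suc n) f ≈ Σ< n f + f n
Σ<-last zero    f = +-comm (f 0) 0#
Σ<-last (suc n) f = +-congˡ {f 0} (Σ<-last n (f ∘ suc)) ∙ sym (+-assoc (f 0) _ _)

Σ<-reverse : ∀ n (f : ℕ → ℚ⟨α⟩) → Σ< (suc n) f ≈ Σ< (suc n) (λ i → f (n ∸ i))
Σ<-reverse zero    f = refl
Σ<-reverse (suc n) f = Σ<-last (suc n) f ∙ +-comm (Σ< (suc n) f) (f (suc n)) ∙
  +-congˡ {f (suc n)} (Σ<-reverse n f)

-- Both sides run over the splittings of n into three parts; this is associativity of convolution in
-- one variable.
Σ<-triangle : ∀ n (φ : ℕ → ℕ → ℕ → ℚ⟨α⟩) →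
  Σ< (suc n) (λ i → Σ< (suc i) (λ j → φ j (i ∸ j) (n ∸ i))) ≈
  Σ< (suc n) (λ j → Σ< (suc (n ∸ j)) (λ k → φ j k (n ∸ j ∸ k)))
Σ<-triangle zero    φ = refl
Σ<-triangle (suc n) φ = trans
  (Σ<-+ (suc (suc n)) (λ i → φ 0 i (suc n ∸ i)) (λ i → Σ< i (λ j → φ (suc j) (i ∸ suc j) (suc n ∸ i))))
  (+-congˡ {Σ< (suc (suc n)) (λ i → φ 0 i (suc n ∸ i))} (+-identityˡ _ ∙ Σ<-triangle n (φ ∘ suc)))

Coeffs : Set
Coeffs = List ℕ → ℚ⟨α⟩

convolve-∷ : ∀ (F G : Coeffs) n a →
  convolve F G (n ∷ a) ≡ Σ< (suc n) (λ i → convolve (F ∘ (i ∷_)) (G ∘ (n ∸ i ∷_)) a)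
convolve-∷ F G n a = ∑-applyUpTo id (suc n) (λ i → convolve (F ∘ (i ∷_)) (G ∘ (n ∸ i ∷_)) a)

convolve-comm : ∀ (F G : Coeffs) a → convolve F G a ≈ convolve G F a
convolve-comm F G []      = *-comm (F []) (G [])
convolve-comm F G (n ∷ a) = begin
  convolve F G (n ∷ a)
    ≡⟨ convolve-∷ F G n a ⟩
  Σ< (suc n) (λ i → convolve (F ∘ (i ∷_)) (G ∘ (n ∸ i ∷_)) a)
    ≈⟨ Σ<-cong (suc n) (λ i _ → convolve-comm (F ∘ (i ∷_)) (G ∘ (n ∸ i ∷_)) a) ⟩
  Σ< (suc n) (λ i → convolve (G ∘ (n ∸ i ∷_)) (F ∘ (i ∷_)) a)
    ≈⟨ Σ<-reverse n (λ i → convolve (G ∘ (n ∸ i ∷_)) (F ∘ (i ∷_)) a) ⟩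
  Σ< (suc n) (λ i → convolve (G ∘ (n ∸ (n ∸ i) ∷_)) (F ∘ (n ∸ i ∷_)) a)
    ≈⟨ Σ<-cong (suc n) (λ i i≤n → cong-≈ (λ j → convolve (G ∘ (j ∷_)) (F ∘ (n ∸ i ∷_)) a) (ℕ.m∸[m∸n]≡n (ℕ.≤-pred i≤n))) ⟩
  Σ< (suc n) (λ i → convolve (G ∘ (i ∷_)) (F ∘ (n ∸ i ∷_)) a)
    ≡⟨ convolve-∷ G F n a ⟨
  convolve G F (n ∷ a) ∎

convolve-+ʳ : ∀ (F G H : Coeffs) a → convolve F (λ b → G b + H b) a ≈ convolve F G a + convolve F H a
convolve-+ʳ F G H []      = distribˡ (F []) (G []) (H [])
convolve-+ʳ F G H (n ∷ a) = reflexive (convolve-∷ F (λ b → G b + H b) n a) ∙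
  (Σ<-cong (suc n) λ i _ → convolve-+ʳ (F ∘ (i ∷_)) (G ∘ (n ∸ i ∷_)) (H ∘ (n ∸ i ∷_)) a) ∙
  Σ<-+ (suc n) (λ i → convolve (F ∘ (i ∷_)) (G ∘ (n ∸ i ∷_)) a) (λ i → convolve (F ∘ (i ∷_)) (H ∘ (n ∸ i ∷_)) a) ∙
  reflexive (≡.sym (cong₂ _+_ (convolve-∷ F G n a) (convolve-∷ F H n a)))

convolve-*ʳ : ∀ (F G : Coeffs) c a → convolve F (λ b → c * G b) a ≈ c * convolve F G a
convolve-*ʳ F G c []      = solve 3 (λ x y z → x :* (y :* z) := y :* (x :* z)) refl (F []) c (G [])
convolve-*ʳ F G c (n ∷ a) = reflexive (convolve-∷ F (λ b → c * G b) n a) ∙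
  (Σ<-cong (suc n) λ i _ → convolve-*ʳ (F ∘ (i ∷_)) (G ∘ (n ∸ i ∷_)) c a) ∙
  Σ<-* (suc n) c (λ i → convolve (F ∘ (i ∷_)) (G ∘ (n ∸ i ∷_)) a) ∙ cong-≈ (c *_) (≡.sym (convolve-∷ F G n a))

convolve-0ʳ : ∀ (F : Coeffs) a → convolve F (λ _ → 0#) a ≈ 0#
convolve-0ʳ F a = convolve-zero a λ b c _ → zeroʳ (F b)

convolve-Σ<ʳ : ∀ (F : Coeffs) m (G : ℕ → Coeffs) a → convolve F (λ b → Σ< m (λ i → G i b)) a ≈ Σ< m (λ i → convolve F (G i) a)
convolve-Σ<ʳ F zero    G a = convolve-0ʳ F a
convolve-Σ<ʳ F (suc m) G a = convolve-+ʳ F (G 0) (λ b → Σ< m (λ i → G (suc i) b)) a ∙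
  +-congˡ {convolve F (G 0) a} (convolve-Σ<ʳ F m (G ∘ suc) a)

convolve-assoc : ∀ (F G H : Coeffs) a → convolve (convolve F G) H a ≈ convolve F (convolve G H) a
convolve-assoc F G H []      = *-assoc (F []) (G []) (H [])
convolve-assoc F G H (n ∷ a) = begin
  convolve (convolve F G) H (n ∷ a)
    ≡⟨ convolve-∷ (convolve F G) H n a ⟩
  Σ< (suc n) (λ i → convolve (convolve F G ∘ (i ∷_)) (H ∘ (n ∸ i ∷_)) a)
    ≈⟨ Σ<-cong (suc n) (λ i _ → left i) ⟩
  Σ< (suc n) (λ i → Σ< (suc i) (λ j → φ j (i ∸ j) (n ∸ i)))
    ≈⟨ Σ<-triangle n φ ⟩
  Σ< (suc n) (λ j → Σ< (suc (n ∸ j)) (λ k → φ j k (n ∸ j ∸ k)))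
    ≈⟨ Σ<-cong (suc n) (λ j _ → right j) ⟨
  Σ< (suc n) (λ j → convolve (F ∘ (j ∷_)) (convolve G H ∘ (n ∸ j ∷_)) a)
    ≡⟨ convolve-∷ F (convolve G H) n a ⟨
  convolve F (convolve G H) (n ∷ a) ∎
  where
  φ : ℕ → ℕ → ℕ → ℚ⟨α⟩
  φ i j k = convolve (F ∘ (i ∷_)) (convolve (G ∘ (j ∷_)) (H ∘ (k ∷_))) a
  left : ∀ i → convolve (convolve F G ∘ (i ∷_)) (H ∘ (n ∸ i ∷_)) a ≈ Σ< (suc i) (λ j → φ j (i ∸ j) (n ∸ i))
  left i = begin
    convolve (convolve F G ∘ (i ∷_)) H′ a
      ≈⟨ convolve-cong (λ b → reflexive (convolve-∷ F G i b)) (λ _ → refl) a ⟩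
    convolve (λ b → Σ< (suc i) (λ j → convolve (F ∘ (j ∷_)) (G ∘ (i ∸ j ∷_)) b)) H′ a
      ≈⟨ convolve-comm _ H′ a ⟩
    convolve H′ (λ b → Σ< (suc i) (λ j → convolve (F ∘ (j ∷_)) (G ∘ (i ∸ j ∷_)) b)) a
      ≈⟨ convolve-Σ<ʳ H′ (suc i) (λ j → convolve (F ∘ (j ∷_)) (G ∘ (i ∸ j ∷_))) a ⟩
    Σ< (suc i) (λ j → convolve H′ (convolve (F ∘ (j ∷_)) (G ∘ (i ∸ j ∷_))) a)
      ≈⟨ Σ<-cong (suc i) (λ j _ → convolve-comm H′ (convolve (F ∘ (j ∷_)) (G ∘ (i ∸ j ∷_))) a ∙ convolve-assoc (F ∘ (j ∷_)) (G ∘ (i ∸ j ∷_)) H′ a) ⟩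
    Σ< (suc i) (λ j → φ j (i ∸ j) (n ∸ i)) ∎
    where
    H′ : Coeffs
    H′ = H ∘ (n ∸ i ∷_)
  right : ∀ j → convolve (F ∘ (j ∷_)) (convolve G H ∘ (n ∸ j ∷_)) a ≈ Σ< (suc (n ∸ j)) (λ k → φ j k (n ∸ j ∸ k))
  right j = convolve-cong (λ _ → refl) (λ b → reflexive (convolve-∷ G H (n ∸ j) b)) a ∙
    convolve-Σ<ʳ (F ∘ (j ∷_)) (suc (n ∸ j)) (λ k → convolve (G ∘ (k ∷_)) (H ∘ (n ∸ j ∸ k ∷_))) a

-- The coefficients of (x₁^r + x₂^r + …) F, for r ≥ 1.
timesPower : ℕ → Coeffs → Coeffs
timesPower r F []      = 0#
timesPower r F (n ∷ a) = (if does (r ℕ.≤? n) then F (n ∸ r ∷ a) else 0#) + timesPower r (F ∘ (n ∷_)) a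

if-cong : ∀ b {x y : ℚ⟨α⟩} → x ≈ y → (if b then x else 0#) ≈ (if b then y else 0#)
if-cong true  e = e
if-cong false e = refl

timesPower-cong : ∀ r {F G : Coeffs} → (∀ b → F b ≈ G b) → ∀ a → timesPower r F a ≈ timesPower r G a
timesPower-cong r e []      = refl
timesPower-cong r e (n ∷ a) = +-cong (if-cong (does (r ℕ.≤? n)) (e (n ∸ r ∷ a))) (timesPower-cong r (e ∘ (n ∷_)) a)

coeff-1Λ-suc : ∀ n a → coeff 1Λ (suc n ∷ a) ≈ 0#
coeff-1Λ-suc n a = indicator-¬ (parts (shape (suc n ∷ a)) ≟ᴸ []) λ e →
  contradiction (≡.sym (Perm.↭-length (sort-↭ (nonzeros (suc n ∷ a)))) ⊙ cong length e) λ ()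

convolve-1 : ∀ (G : Coeffs) a → convolve (coeff 1Λ) G a ≈ G a
convolve-1 G []      = *-identityˡ (G [])
convolve-1 G (n ∷ a) = reflexive (convolve-∷ (coeff 1Λ) G n a) ∙ trans
  (+-cong (convolve-1 (G ∘ (n ∷_)) a) (Σ<-zero n λ i _ → convolve-zero a λ b c _ →
    *-congʳ {G (n ∸ suc i ∷ c)} (coeff-1Λ-suc i b) ∙ zeroˡ _))
  (+-identityʳ (G (n ∷ a)))

Σ<-δ : ∀ n r (f : ℕ → ℚ⟨α⟩) → Σ< n (λ i → if does (i ℕ.≟ r) then f i else 0#) ≈ (if does (suc r ℕ.≤? n) then f r else 0#)
Σ<-δ zero    r       f = refl
Σ<-δ (suc n) zero    f = +-congˡ {f 0} (Σ<-zero n λ _ _ → refl) ∙ +-identityʳ (f 0)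
Σ<-δ (suc n) (suc r) f = +-identityˡ _ ∙ Σ<-δ n r (f ∘ suc)

coeff-power-suc : ∀ r i a → coeff (power (suc r)) (suc i ∷ a) ≈ (if does (i ℕ.≟ r) then coeff 1Λ a else 0#)
coeff-power-suc r i a = indicator-⇔ (nonzeros (suc i ∷ a) ≟ᴸ (suc r ∷ [])) both (λ e → one e) (λ p → two p) ∙ final (i ℕ.≟ r)
  where
  both : Dec ((i ≡ r) × (parts (shape a) ≡ []))
  both = (i ℕ.≟ r) ×-dec (parts (shape a) ≟ᴸ [])
  one : suc i ∷ nonzeros a ≡ suc r ∷ [] → (i ≡ r) × (parts (shape a) ≡ [])
  one e = ℕ.suc-injective (List.∷-injectiveˡ e) , cong sort (List.∷-injectiveʳ e)
  two : (i ≡ r) × (parts (shape a) ≡ []) → suc i ∷ nonzeros a ≡ suc r ∷ []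
  two (e , f) = cong₂ (λ x y → suc x ∷ y) e (Perm.↭-empty-inv (subst (nonzeros a ↭_) f (↭-sym (sort-↭ (nonzeros a)))))
  final : (d : Dec (i ≡ r)) → indicator (d ×-dec (parts (shape a) ≟ᴸ [])) ≈ (if does d then coeff 1Λ a else 0#)
  final (yes _) = refl
  final (no _)  = refl

convolve-power : ∀ r (F : Coeffs) a → convolve (coeff (power (suc r))) F a ≈ timesPower (suc r) F a
convolve-power r F []      = zeroˡ (F [])
convolve-power r F (n ∷ a) = begin
  convolve (coeff (power (suc r))) F (n ∷ a)
    ≡⟨ convolve-∷ (coeff (power (suc r))) F n a ⟩
  convolve (coeff (power (suc r))) (F ∘ (n ∷_)) a +
  Σ< n (λ i → convolve (coeff (power (suc r)) ∘ (suc i ∷_)) (F ∘ (n ∸ suc i ∷_)) a)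
    ≈⟨ +-cong (convolve-power r (F ∘ (n ∷_)) a) (Σ<-cong n λ i _ → term i (i ℕ.≟ r)) ⟩
  timesPower (suc r) (F ∘ (n ∷_)) a + Σ< n (λ i → if does (i ℕ.≟ r) then F (n ∸ suc i ∷ a) else 0#)
    ≈⟨ +-congˡ {timesPower (suc r) (F ∘ (n ∷_)) a} (Σ<-δ n r (λ i → F (n ∸ suc i ∷ a))) ⟩
  timesPower (suc r) (F ∘ (n ∷_)) a + (if does (suc r ℕ.≤? n) then F (n ∸ suc r ∷ a) else 0#)
    ≈⟨ +-comm _ _ ⟩
  timesPower (suc r) F (n ∷ a) ∎
  where
  term : ∀ i (d : Dec (i ≡ r)) → convolve (coeff (power (suc r)) ∘ (suc i ∷_)) (F ∘ (n ∸ suc i ∷_)) a ≈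
         (if does d then F (n ∸ suc i ∷ a) else 0#)
  term i (yes ≡.refl) = convolve-cong (λ b → coeff-power-suc r i b ∙
    cong-≈ (λ d → if d then coeff 1Λ b else 0#) (dec-true (i ℕ.≟ i) ≡.refl)) (λ _ → refl) a ∙ convolve-1 (F ∘ (n ∸ suc i ∷_)) a
  term i (no i≢r) = convolve-zero a λ b c _ → *-congʳ {F (n ∸ suc i ∷ c)} (coeff-power-suc r i b ∙
    cong-≈ (λ d → if d then coeff 1Λ b else 0#) (dec-false (i ℕ.≟ r) i≢r)) ∙ zeroˡ _

-- Power sums span the symmetric functions

≈Λ-sym : ∀ {f g} → f ≈Λ g → g ≈Λ f
≈Λ-sym e a = sym (e a)

0Λ : Λ
0Λ = 0# · 1Λ

coeff-0Λ : ∀ a → coeff 0Λ a ≈ 0#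
coeff-0Λ a = zeroˡ (coeff 1Λ a)

Σ<Λ : ℕ → (ℕ → Λ) → Λ
Σ<Λ zero    f = 0Λ
Σ<Λ (suc n) f = f 0 +Λ Σ<Λ n (f ∘ suc)

coeff-Σ<Λ : ∀ n f a → coeff (Σ<Λ n f) a ≈ Σ< n (λ i → coeff (f i) a)
coeff-Σ<Λ zero    f a = coeff-0Λ a
coeff-Σ<Λ (suc n) f a = +-congˡ {coeff (f 0) a} (coeff-Σ<Λ n (f ∘ suc) a)

shift : ℕ → Λ → Λ
shift n f .coeff a     = coeff f (n ∷ a)
shift n f .pad a       = pad f (n ∷ a)
shift n f .symmetric p = symmetric f (Perm.prep n p)
shift n f .bounded with bounded f
... | d , h = d , λ a l → h (n ∷ a) (ℕ.≤-trans l (ℕ.m≤n+m (sumᴸ a) n))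

-- The letter r stands for the power sum of degree r + 1, so that every list of naturals is
-- admissible.
word : List ℕ → Λ
word = foldr (λ r f → power (suc r) *Λ f) 1Λ

coeff-zero∷ : ∀ f a → coeff f (0 ∷ a) ≈ coeff f a
coeff-zero∷ f a = symmetric f (Perm.∷↭∷ʳ 0 a) ∙ pad f a

infix 4 _∈Span
data _∈Span : Λ → Set where
  ∈word : ∀ w → word w ∈Span
  ∈+    : ∀ {f g} → f ∈Span → g ∈Span → f +Λ g ∈Span
  ∈·    : ∀ c {f} → f ∈Span → c · f ∈Span
  ∈≈    : ∀ {f g} → f ≈Λ g → f ∈Span → g ∈Span

∈Span-power : ∀ r {f} → f ∈Span → power (suc r) *Λ f ∈Span
∈Span-power r (∈word w) = ∈word (r ∷ w)
∈Span-power r (∈+ {f} {g} s t) = ∈≈ (λ a → sym (convolve-+ʳ (coeff (power (suc r))) (coeff f) (coeff g) a)) (∈+ (∈Span-power r s) (∈Span-power r t))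
∈Span-power r (∈· c {f} s) = ∈≈ (λ a → sym (convolve-*ʳ (coeff (power (suc r))) (coeff f) c a)) (∈· c (∈Span-power r s))
∈Span-power r (∈≈ e s) = ∈≈ (convolve-cong (λ _ → refl) e) (∈Span-power r s)

∈Span-Σ<Λ : ∀ n {f : ℕ → Λ} → (∀ i → f i ∈Span) → Σ<Λ n f ∈Span
∈Span-Σ<Λ zero    s = ∈· 0# (∈word [])
∈Span-Σ<Λ (suc n) s = ∈+ (s 0) (∈Span-Σ<Λ n (s ∘ suc))

timesPower-degree : ∀ r (F : Coeffs) a → (∀ b → r ℕ.+ sumᴸ b ≡ sumᴸ a → F b ≈ 0#) → timesPower r F a ≈ 0#
timesPower-degree r F []      h = refl
timesPower-degree r F (n ∷ a) h = +-cong (first (r ℕ.≤? n))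
    (timesPower-degree r (F ∘ (n ∷_)) a λ b e → h (n ∷ b) (ℕ+.x∙yz≈y∙xz r n (sumᴸ b) ⊙ cong (n ℕ.+_) e)) ∙ +-identityˡ 0#
  where
  first : (e : Dec (r ≤ n)) → (if does e then F (n ∸ r ∷ a) else 0#) ≈ 0#
  first (yes l) = h (n ∸ r ∷ a) (≡.sym (ℕ.+-assoc r (n ∸ r) (sumᴸ a)) ⊙ cong (ℕ._+ sumᴸ a) (ℕ.m+[n∸m]≡n l))
  first (no _)  = refl

count : List ℕ → ℕ
count a = length (nonzeros a)

module _ (d : ℕ) where

  -- Unfolded, this is the sum of φ(w) p_w over the words w of length k with letters below d.
  comb : ℕ → Coeffs → Λ
  comb zero    φ = φ [] · 1Λ
  comb (suc k) φ = Σ<Λ d (λ r → power (suc r) *Λ comb k (φ ∘ (r ∷_)))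

  comb-∈Span : ∀ k φ → comb k φ ∈Span
  comb-∈Span zero    φ = ∈· (φ []) (∈word [])
  comb-∈Span (suc k) φ = ∈Span-Σ<Λ d λ r → ∈Span-power r (comb-∈Span k (φ ∘ (r ∷_)))

  coeff-comb-suc : ∀ k φ a → coeff (comb (suc k) φ) a ≈ Σ< d (λ r → timesPower (suc r) (coeff (comb k (φ ∘ (r ∷_)))) a)
  coeff-comb-suc k φ a = coeff-Σ<Λ d (λ r → power (suc r) *Λ comb k (φ ∘ (r ∷_))) a ∙ (Σ<-cong d λ r _ → convolve-power r (coeff (comb k (φ ∘ (r ∷_)))) a)

  -- Dividing a monomial by a power of one variable removes at most one variable from it.
  timesPower-zero : ∀ r (F : Coeffs) a → (∀ b → count a ≤ suc (count b) → F b ≈ 0#) → timesPower (suc r) F a ≈ 0#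
  timesPower-zero r F []      h = refl
  timesPower-zero r F (n ∷ a) h = +-cong (first (suc r ℕ.≤? n)) (timesPower-zero r (F ∘ (n ∷_)) a rest) ∙ +-identityˡ 0#
    where
    lower : ∀ n m a → count (n ∷ a) ≤ suc (count (m ∷ a))
    lower zero    zero    a = ℕ.n≤1+n _
    lower zero    (suc m) a = ℕ.≤-trans (ℕ.n≤1+n _) (ℕ.n≤1+n _)
    lower (suc n) zero    a = ℕ.≤-refl
    lower (suc n) (suc m) a = ℕ.n≤1+n _
    first : (e : Dec (suc r ≤ n)) → (if does e then F (n ∸ suc r ∷ a) else 0#) ≈ 0#
    first (yes _) = h (n ∸ suc r ∷ a) (lower n (n ∸ suc r) a)
    first (no _)  = refl
    grow : ∀ n {a b} → count a ≤ suc (count b) → count (n ∷ a) ≤ suc (count (n ∷ b))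
    grow zero    l = l
    grow (suc n) l = ℕ.s≤s l
    rest : ∀ b → count a ≤ suc (count b) → F (n ∷ b) ≈ 0#
    rest b l = h (n ∷ b) (grow n {a} {b} l)

  comb-zero : ∀ k φ a → k < count a → coeff (comb k φ) a ≈ 0#
  comb-zero zero φ a l = *-congˡ {φ []} (one a l) ∙ zeroʳ (φ [])
    where
    one : ∀ a → 0 < count a → coeff 1Λ a ≈ 0#
    one (zero  ∷ a) l = one a l
    one (suc n ∷ a) l = coeff-1Λ-suc n a
  comb-zero (suc k) φ a l = coeff-comb-suc k φ a ∙ (Σ<-zero d λ r _ →
    timesPower-zero r (coeff (comb k (φ ∘ (r ∷_)))) a λ b m → comb-zero k (φ ∘ (r ∷_)) b (ℕ.≤-pred (ℕ.≤-trans l m)))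

  comb-degree : ∀ k φ a → (∀ w → sumᴸ (map suc w) ≡ sumᴸ a → φ w ≈ 0#) → coeff (comb k φ) a ≈ 0#
  comb-degree zero φ a h = one a h
    where
    one : ∀ a → (∀ w → sumᴸ (map suc w) ≡ sumᴸ a → φ w ≈ 0#) → φ [] * coeff 1Λ a ≈ 0#
    one []          h = *-congʳ {1#} (h [] ≡.refl) ∙ zeroˡ 1#
    one (zero  ∷ a) h = one a h
    one (suc n ∷ a) h = *-congˡ {φ []} (coeff-1Λ-suc n a) ∙ zeroʳ (φ [])
  comb-degree (suc k) φ a h = coeff-comb-suc k φ a ∙ (Σ<-zero d λ r _ →
    timesPower-degree (suc r) (coeff (comb k (φ ∘ (r ∷_)))) a λ b e → comb-degree k (φ ∘ (r ∷_)) b λ w e′ →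
      h (r ∷ w) (cong (suc r ℕ.+_) e′ ⊙ e))

  -- Each variable that occurs contributes x once, through the one r that exhausts its exponent. The
  -- last hypothesis covers exponents out of reach of r < d.
  timesPower-count : ∀ (C : ℕ → Coeffs) x a →
    (∀ pre n post → pre ++ n ∷ post ≡ a → ∀ r → suc r ≤ n → C r (pre ++ n ∸ suc r ∷ post) ≈ (if does (r ℕ.≟ pred n) then x else 0#)) →
    (∀ pre n post → pre ++ n ∷ post ≡ a → d < n → x ≈ 0#) →
    Σ< d (λ r → timesPower (suc r) (C r) a) ≈ ν (count a) * x
  timesPower-count C x []      h z = (Σ<-zero d λ _ _ → refl) ∙ sym (zeroˡ x)
  timesPower-count C x (n ∷ a) h z = Σ<-+ d _ _ ∙ +-cong (head n h z)
      (timesPower-count (λ r → C r ∘ (n ∷_)) x a (λ pre m post e → h (n ∷ pre) m post (cong (n ∷_) e)) (λ pre m post e → z (n ∷ pre) m post (cong (n ∷_) e))) ∙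
      final n
    where
    weight : ℕ → ℚ⟨α⟩
    weight zero    = 0#
    weight (suc _) = x
    final : ∀ n → weight n + ν (count a) * x ≈ ν (count (n ∷ a)) * x
    final zero    = +-identityˡ _
    final (suc n) = solve 2 (λ x c → x :+ c :* x := (:1 :+ c) :* x) refl x (ν (count a))
    head : ∀ n → (∀ pre m post → pre ++ m ∷ post ≡ n ∷ a → ∀ r → suc r ≤ m → C r (pre ++ m ∸ suc r ∷ post) ≈ (if does (r ℕ.≟ pred m) then x else 0#)) →
           (∀ pre m post → pre ++ m ∷ post ≡ n ∷ a → d < m → x ≈ 0#) →
           Σ< d (λ r → if does (suc r ℕ.≤? n) then C r (n ∸ suc r ∷ a) else 0#) ≈ weight n
    head zero    h z = Σ<-zero d λ _ _ → refl
    head (suc n) h z = (Σ<-cong d λ r _ → each r (suc r ℕ.≤? suc n) (r ℕ.≟ n)) ∙ Σ<-δ d n (λ _ → x) ∙ fin (suc n ℕ.≤? d)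
      where
      each : ∀ r (e : Dec (suc r ≤ suc n)) (f : Dec (r ≡ n)) → (if does e then C r (suc n ∸ suc r ∷ a) else 0#) ≈ (if does f then x else 0#)
      each r (yes l) f = h [] (suc n) a ≡.refl r l ∙ cong-≈ (λ b → if b then x else 0#) (same f)
        where
        same : (f : Dec (r ≡ n)) → does (r ℕ.≟ n) ≡ does f
        same (yes e) = dec-true (r ℕ.≟ n) e
        same (no e)  = dec-false (r ℕ.≟ n) e
      each r (no l) (yes ≡.refl) = contradiction ℕ.≤-refl l
      each r (no l) (no _)       = refl
      fin : (e : Dec (suc n ≤ d)) → (if does e then x else 0#) ≈ x
      fin (yes _) = refl
      fin (no l)  = sym (z [] (suc n) a ≡.refl (ℕ.≰⇒> l))

  map-pred-↭ : ∀ pre r post → map pred (nonzeros (pre ++ suc r ∷ post)) ↭ r ∷ map pred (nonzeros (pre ++ 0 ∷ post))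
  map-pred-↭ []            r post = Perm.refl
  map-pred-↭ (zero  ∷ pre) r post = map-pred-↭ pre r post
  map-pred-↭ (suc n ∷ pre) r post = ↭-trans (Perm.prep n (map-pred-↭ pre r post)) (Perm.swap n r Perm.refl)

  count-insert : ∀ pre n post → count (pre ++ suc n ∷ post) ≡ suc (count (pre ++ 0 ∷ post))
  count-insert []            n post = ≡.refl
  count-insert (zero  ∷ pre) n post = count-insert pre n post
  count-insert (suc m ∷ pre) n post = cong suc (count-insert pre n post)

  sum-suc-pred : ∀ a → sumᴸ (map suc (map pred (nonzeros a))) ≡ sumᴸ a
  sum-suc-pred []          = ≡.refl
  sum-suc-pred (zero  ∷ a) = sum-suc-pred a
  sum-suc-pred (suc n ∷ a) = cong (suc n ℕ.+_) (sum-suc-pred a)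

  entry≤sum : ∀ pre n post → n ≤ sumᴸ (pre ++ n ∷ post)
  entry≤sum []        n post = ℕ.m≤m+n n _
  entry≤sum (m ∷ pre) n post = ℕ.≤-trans (entry≤sum pre n post) (ℕ.m≤n+m _ m)

  -- k power sums reach a monomial in k variables only if each takes a different variable entirely;
  -- the k! assignments have equal coefficients because φ is symmetric.
  comb-coeff : ∀ k φ → Symmetric φ → (∀ w → d < sumᴸ (map suc w) → φ w ≈ 0#) →
               ∀ a → count a ≡ k → coeff (comb k φ) a ≈ ν (k !) * φ (map pred (nonzeros a))
  comb-coeff zero φ s v a e = *-congˡ {φ []} (one a e) ∙ *-identityʳ (φ []) ∙
    sym (*-cong (+-identityʳ 1#) (cong-≈ (φ ∘ map pred) (nil a e)) ∙ *-identityˡ (φ []))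
    where
    nil : ∀ a → count a ≡ 0 → nonzeros a ≡ []
    nil []         e = ≡.refl
    nil (zero ∷ a) e = nil a e
    one : ∀ a → count a ≡ 0 → coeff 1Λ a ≈ 1#
    one []         e = refl
    one (zero ∷ a) e = one a e
  comb-coeff (suc k) φ s v a e = begin
    coeff (comb (suc k) φ) a
      ≈⟨ coeff-comb-suc k φ a ⟩
    Σ< d (λ r → timesPower (suc r) (coeff (comb k (φ ∘ (r ∷_)))) a)
      ≈⟨ timesPower-count (λ r → coeff (comb k (φ ∘ (r ∷_)))) x a (λ pre n post q r l → term pre n post q r l (r ℕ.≟ pred n))
           (λ { pre n post ≡.refl l → *-congˡ {ν (k !)} (v _ (subst (d <_) (≡.sym (sum-suc-pred a)) (ℕ.<-≤-trans l (entry≤sum pre n post)))) ∙ zeroʳ _ }) ⟩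
    ν (count a) * x
      ≈⟨ *-congʳ {x} (cong-≈ ν e) ⟩
    ν (suc k) * (ν (k !) * y)
      ≈⟨ *-assoc (ν (suc k)) (ν (k !)) y ⟨
    ν (suc k) * ν (k !) * y
      ≈⟨ *-congʳ {y} (ν-* (suc k) (k !)) ⟨
    ν (suc k !) * y ∎
    where
    y = φ (map pred (nonzeros a))
    x = ν (k !) * y
    term : ∀ pre n post → pre ++ n ∷ post ≡ a → ∀ r → suc r ≤ n → (f : Dec (r ≡ pred n)) →
           coeff (comb k (φ ∘ (r ∷_))) (pre ++ n ∸ suc r ∷ post) ≈ (if does f then x else 0#)
    term pre (suc n) post ≡.refl .n l (yes ≡.refl) rewrite ℕ.n∸n≡0 n = trans
      (comb-coeff k (φ ∘ (n ∷_)) (λ p → s (Perm.prep n p)) (λ w l → v (n ∷ w) (ℕ.<-≤-trans l (ℕ.m≤n+m _ (suc n))))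
        (pre ++ 0 ∷ post) (ℕ.suc-injective (≡.sym (count-insert pre n post) ⊙ e)))
      (*-congˡ {ν (k !)} (s (↭-sym (map-pred-↭ pre n post))))
    term pre (suc n) post ≡.refl r l (no r≢) with n ∸ r in q
    ... | zero  = contradiction (ℕ.≤-antisym (ℕ.≤-pred l) (ℕ.m∸n≡0⇒m≤n q)) r≢
    ... | suc m = comb-zero k (φ ∘ (r ∷_)) (pre ++ suc m ∷ post)
      (ℕ.≤-reflexive (≡.sym e ⊙ count-insert pre n post ⊙ ≡.sym (count-insert pre m post)))

map-suc-pred : ∀ a → map suc (map pred (nonzeros a)) ≡ nonzeros a
map-suc-pred []          = ≡.refl
map-suc-pred (zero  ∷ a) = map-suc-pred a
map-suc-pred (suc n ∷ a) = cong (suc n ∷_) (map-suc-pred a)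

count≤sum : ∀ a → count a ≤ sumᴸ a
count≤sum []          = ℕ.z≤n
count≤sum (zero  ∷ a) = count≤sum a
count≤sum (suc n ∷ a) = ℕ.s≤s (ℕ.≤-trans (count≤sum a) (ℕ.m≤n+m _ n))

-- Subtract the part with the largest number k of variables, using that the sum of φ(w) p_w over
-- all w of length k has the coefficients k! φ there, and fewer variables elsewhere.
spanning : ∀ f → f ∈Span
spanning f with bounded f
... | d , h = go d f h (λ a l → h a (ℕ.<-≤-trans l (count≤sum a)))
  where
  go : ∀ k f → (∀ a → d < sumᴸ a → coeff f a ≈ 0#) → (∀ a → k < count a → coeff f a ≈ 0#) → f ∈Span
  go zero    f h z = ∈≈ (λ a → final a (nonzeros a) ≡.refl) (∈· (coeff f []) (∈word []))
    where
    1Λ-nz : ∀ a → nonzeros a ≡ [] → coeff 1Λ a ≈ 1#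
    1Λ-nz []         e = refl
    1Λ-nz (zero ∷ a) e = 1Λ-nz a e
    1Λ-nz′ : ∀ a → 0 < count a → coeff 1Λ a ≈ 0#
    1Λ-nz′ (zero  ∷ a) l = 1Λ-nz′ a l
    1Λ-nz′ (suc n ∷ a) l = coeff-1Λ-suc n a
    final : ∀ a b → nonzeros a ≡ b → coeff f [] * coeff 1Λ a ≈ coeff f a
    final a []      e = *-congˡ {coeff f []} (1Λ-nz a e) ∙ *-identityʳ _ ∙
      sym (coeff-nonzeros (coeff f) (pad f) (symmetric f) a ∙ cong-≈ (coeff f) e)
    final a (_ ∷ _) e = *-congˡ {coeff f []} (1Λ-nz′ a pos) ∙ zeroʳ _ ∙ sym (z a pos)
      where
      pos : 0 < count a
      pos = subst (λ b → 0 < length b) (≡.sym e) ℕ.z<s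
  go (suc k) f h z with inverse (ν (suc k !)) (ν≉0 (suc k !) {{suc k ℕ.!≢0}})
  ... | y , inv = ∈≈ (λ a → solve 3 (λ x y z → (x :+ (:- y) :* z) :+ y :* z := x) refl (coeff f a) y (coeff c a))
      (∈+ (go k f′ h′ z′) (∈· y (comb-∈Span d (suc k) φ)))
    where
    φ : Coeffs
    φ = coeff f ∘ map suc
    c = comb d (suc k) φ
    f′ = f +Λ (- y) · c
    c-coeff : ∀ a → count a ≡ suc k → coeff c a ≈ ν (suc k !) * coeff f a
    c-coeff a e = comb-coeff d (suc k) φ (λ p → symmetric f (Perm.map⁺ suc p)) (λ w → h (map suc w)) a e ∙
      *-congˡ {ν (suc k !)} (cong-≈ (coeff f) (map-suc-pred a) ∙ sym (coeff-nonzeros (coeff f) (pad f) (symmetric f) a))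
    z′ : ∀ a → k < count a → coeff f′ a ≈ 0#
    z′ a l with ℕ.m≤n⇒m<n∨m≡n l
    ... | inj₁ l′ = +-cong (z a l′) (*-congˡ { - y} (comb-zero d (suc k) φ a l′) ∙ zeroʳ (- y)) ∙ +-identityˡ 0#
    ... | inj₂ e = +-congˡ {coeff f a} (*-congˡ { - y} (c-coeff a (≡.sym e))) ∙
      solve 3 (λ x y n → x :+ (:- y) :* (n :* x) := x :- (n :* y) :* x) refl (coeff f a) y (ν (suc k !)) ∙
      +-congˡ {coeff f a} (-‿cong (*-congʳ {coeff f a} inv)) ∙ solve 1 (λ x → x :- :1 :* x := :0) refl (coeff f a)
    h′ : ∀ a → d < sumᴸ a → coeff f′ a ≈ 0#
    h′ a l = +-cong (h a l) (*-congˡ { - y} (comb-degree d (suc k) φ a λ w e →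
      h (map suc w) (subst (d <_) (≡.sym e) l)) ∙ zeroʳ (- y)) ∙ +-identityˡ 0#

-- Norms of power sums and adjoints of multiplication

Π< : ℕ → (ℕ → ℕ) → ℕ
Π< zero    f = 1
Π< (suc n) f = f 0 ℕ.* Π< n (f ∘ suc)

product-1⋯ : ∀ n (g : ℕ → ℕ) → product (map g (1⋯ n)) ≡ Π< n (g ∘ suc)
product-1⋯ n g = go n suc
  where
  go : ∀ n (h : ℕ → ℕ) → product (map g (applyUpTo h n)) ≡ Π< n (g ∘ h)
  go zero    h = ≡.refl
  go (suc n) h = cong (g (h 0) ℕ.*_) (go n (h ∘ suc))

Π<-cong : ∀ n {f g : ℕ → ℕ} → (∀ i → f i ≡ g i) → Π< n f ≡ Π< n g
Π<-cong zero    e = ≡.refl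
Π<-cong (suc n) e = cong₂ ℕ._*_ (e 0) (Π<-cong n (e ∘ suc))

Π<-change : ∀ n s c {f g : ℕ → ℕ} → s < n → (∀ i → i ≢ s → g i ≡ f i) → g s ≡ c ℕ.* f s → Π< n g ≡ c ℕ.* Π< n f
Π<-change (suc n) zero    c {f} {g} l e h = (cong₂ ℕ._*_ h (Π<-cong n λ i → e (suc i) λ ())) ⊙
  ℕ.*-assoc c (f 0) _
Π<-change (suc n) (suc s) c {f} {g} l e h = (cong₂ ℕ._*_ (e 0 λ ()) (Π<-change n s c (ℕ.s<s⁻¹ l) (λ i i≢s → e (suc i) (i≢s ∘ ℕ.suc-injective)) h)) ⊙
  ℕ*.x∙yz≈y∙xz (f 0) c _
  where import Algebra.Properties.CommutativeSemigroup ℕ.*-commutativeSemigroup as ℕ*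

Π<-extend : ∀ n k {f : ℕ → ℕ} → (∀ i → n ≤ i → f i ≡ 1) → Π< (n ℕ.+ k) f ≡ Π< n f
Π<-extend zero    zero    e = ≡.refl
Π<-extend zero    (suc k) {f} e = (cong₂ ℕ._*_ (e 0 ℕ.z≤n) (Π<-extend zero k (λ i _ → e (suc i) ℕ.z≤n))) ⊙ ≡.refl
Π<-extend (suc n) k {f} e = cong (f 0 ℕ.*_) (Π<-extend n k λ i l → e (suc i) (ℕ.s≤s l))

occurrences : ℕ → List ℕ → ℕ
occurrences i a = length (filter (i ℕ.≟_) a)

occurrences-↭ : ∀ i {a b} → a ↭ b → occurrences i a ≡ occurrences i b
occurrences-↭ i p = Perm.↭-length (Perm.filter-↭ (i ℕ.≟_) p)

occurrences-same : ∀ i a → occurrences i (i ∷ a) ≡ suc (occurrences i a)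
occurrences-same i a rewrite List.filter-accept (i ℕ.≟_) {i} {a} ≡.refl = ≡.refl

occurrences-other : ∀ {i j} a → i ≢ j → occurrences i (j ∷ a) ≡ occurrences i a
occurrences-other {i} {j} a i≢j rewrite List.filter-reject (i ℕ.≟_) {j} {a} i≢j = ≡.refl

occurrences-large : ∀ i a → sumᴸ a < i → occurrences i a ≡ 0
occurrences-large i []      l = ≡.refl
occurrences-large i (n ∷ a) l = ≡.trans
  (occurrences-other a λ { ≡.refl → ℕ.<-irrefl ≡.refl (ℕ.≤-<-trans (ℕ.m≤m+n n (sumᴸ a)) l) })
  (occurrences-large i a (ℕ.≤-<-trans (ℕ.m≤n+m (sumᴸ a) n) l))

toPartition : List ℕ → Partition
toPartition w = shape (map suc w)

nonzeros-map-suc : ∀ w → nonzeros (map suc w) ≡ map suc w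
nonzeros-map-suc []      = ≡.refl
nonzeros-map-suc (r ∷ w) = cong (suc r ∷_) (nonzeros-map-suc w)

parts-toPartition : ∀ w → parts (toPartition w) ↭ map suc w
parts-toPartition w = ↭-trans (sort-↭ (nonzeros (map suc w))) (Perm.↭-reflexive (nonzeros-map-suc w))

map-suc-↭⁻ : ∀ {w w′} → map suc w ↭ map suc w′ → w ↭ w′
map-suc-↭⁻ {w} {w′} p = subst₂ _↭_ (undo w) (undo w′) (Perm.map⁺ pred p)
  where
  undo : ∀ w → map pred (map suc w) ≡ w
  undo w = ≡.sym (List.map-∘ w) ⊙ List.map-id w

toPartition-↭ : ∀ {w w′} → w ↭ w′ → toPartition w ≡ toPartition w′
toPartition-↭ {w} {w′} p = parts-injective (shape-↭ (Perm.map⁺ suc p))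

↭-toPartition : ∀ {w w′} → toPartition w ≡ toPartition w′ → w ↭ w′
↭-toPartition {w} {w′} e = map-suc-↭⁻ (↭-trans (↭-sym (parts-toPartition w))
  (↭-trans (Perm.↭-reflexive (cong parts e)) (parts-toPartition w′)))

_≟ᴾ_ : (lam μ : Partition) → Dec (lam ≡ μ)
lam ≟ᴾ μ with parts lam ≟ᴸ parts μ
... | yes e = yes (parts-injective e)
... | no ¬e = no (¬e ∘ cong parts)

-- A range reaching beyond the size allows z of different partitions to be compared factor by
-- factor.
z-as-Π : ∀ lam N → size lam ≤ N → z lam ≡ Π< N (λ i → suc i ℕ.^ multiplicity (suc i) lam ℕ.* multiplicity (suc i) lam !)
z-as-Π lam N l with N ∸ size lam in e | ℕ.m+[n∸m]≡n l
... | k | ≡.refl = product-1⋯ (size lam) _ ⊙ ≡.sym (cong (λ m → Π< (size lam ℕ.+ m) _) (≡.sym e) ⊙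
  cong (λ m → Π< (size lam ℕ.+ m) _) e ⊙ (Π<-extend (size lam) k λ i s≤i →
    cong (λ m → suc i ℕ.^ m ℕ.* m !) (occurrences-large (suc i) (parts lam) (ℕ.s≤s s≤i))))

-- Only the factor of the inserted part changes. Its change, times α, is what `∂` produces for the
-- new part.
z-insert : ∀ r u → z (toPartition (r ∷ u)) ≡ suc r ℕ.* suc (occurrences (suc r) (map suc u)) ℕ.* z (toPartition u)
z-insert r u = z-as-Π (toPartition (r ∷ u)) N ℕ.≤-refl ⊙ ≡.trans
  (Π<-change N r (suc r ℕ.* suc m₀) r<N other same)
  (cong (suc r ℕ.* suc m₀ ℕ.*_) (≡.sym (z-as-Π (toPartition u) N size≤)))
  where
  N = size (toPartition (r ∷ u))
  m₀ = occurrences (suc r) (map suc u)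
  size-eq : ∀ w → size (toPartition w) ≡ sumᴸ (map suc w)
  size-eq w = sum-↭ (parts-toPartition w)
  r<N : r < N
  r<N = subst (r <_) (≡.sym (size-eq (r ∷ u))) (ℕ.s≤s (ℕ.m≤m+n r _))
  size≤ : size (toPartition u) ≤ N
  size≤ = subst₂ _≤_ (≡.sym (size-eq u)) (≡.sym (size-eq (r ∷ u))) (ℕ.m≤n+m _ (suc r))
  mult : ∀ i w → multiplicity i (toPartition w) ≡ occurrences i (map suc w)
  mult i w = occurrences-↭ i (parts-toPartition w)
  other : ∀ i → i ≢ r → suc i ℕ.^ multiplicity (suc i) (toPartition (r ∷ u)) ℕ.* multiplicity (suc i) (toPartition (r ∷ u)) ! ≡
                        suc i ℕ.^ multiplicity (suc i) (toPartition u) ℕ.* multiplicity (suc i) (toPartition u) !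
  other i i≢r = cong (λ k → suc i ℕ.^ k ℕ.* k !) (mult (suc i) (r ∷ u) ⊙
    occurrences-other (map suc u) (i≢r ∘ ℕ.suc-injective) ⊙ ≡.sym (mult (suc i) u))
  same : suc r ℕ.^ multiplicity (suc r) (toPartition (r ∷ u)) ℕ.* multiplicity (suc r) (toPartition (r ∷ u)) ! ≡
         suc r ℕ.* suc m₀ ℕ.* (suc r ℕ.^ multiplicity (suc r) (toPartition u) ℕ.* multiplicity (suc r) (toPartition u) !)
  same = cong (λ k → suc r ℕ.^ k ℕ.* k !) (mult (suc r) (r ∷ u) ⊙ occurrences-same (suc r) (map suc u)) ⊙
    rearrange (suc r) (suc r ℕ.^ m₀) (suc m₀) (m₀ !) ⊙
      cong (λ k → suc r ℕ.* suc m₀ ℕ.* (suc r ℕ.^ k ℕ.* k !)) (≡.sym (mult (suc r) u))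
    where
    open +-*-Solver using () renaming (solve to solveℕ; _:*_ to _:×_; _:=_ to _:≡_)
    rearrange : ∀ a b c d → a ℕ.* b ℕ.* (c ℕ.* d) ≡ a ℕ.* c ℕ.* (b ℕ.* d)
    rearrange = solveℕ 4 (λ a b c d → a :× b :× (c :× d) :≡ a :× c :× (b :× d)) ≡.refl

word-↭ : ∀ {w w′} → w ↭ w′ → word w ≈Λ word w′
word-↭ Perm.refl a = refl
word-↭ (Perm.prep r p) a = convolve-cong (λ _ → refl) (word-↭ p) a
word-↭ (Perm.swap {w} {w′} r s p) a = begin
  convolve (pw r) (convolve (pw s) (coeff (word w))) a  ≈⟨ convolve-assoc (pw r) (pw s) (coeff (word w)) a ⟨
  convolve (convolve (pw r) (pw s)) (coeff (word w)) a  ≈⟨ convolve-cong (convolve-comm (pw r) (pw s)) (word-↭ p) a ⟩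
  convolve (convolve (pw s) (pw r)) (coeff (word w′)) a  ≈⟨ convolve-assoc (pw s) (pw r) (coeff (word w′)) a ⟩
  convolve (pw s) (convolve (pw r) (coeff (word w′))) a  ∎
  where
  pw : ℕ → Coeffs
  pw r = coeff (power (suc r))
word-↭ (Perm.trans p q) a = word-↭ p a ∙ word-↭ q a

word≈p : ∀ w → word w ≈Λ p (toPartition w)
word≈p w a = word-↭ (map-suc-↭⁻ {w} (↭-trans (↭-sym (parts-toPartition w)) (Perm.↭-reflexive (≡.sym (suc-pred (parts lam) (positive lam)))))) a ∙
  cong-≈ (λ f → coeff f a) (fold (parts lam) (positive lam))
  where
  lam = toPartition w
  suc-pred : ∀ rs → All (1 ≤_) rs → map suc (map pred rs) ≡ rs
  suc-pred []           []       = ≡.refl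
  suc-pred (suc r ∷ rs) (_ ∷ ps) = cong (suc r ∷_) (suc-pred rs ps)
  fold : ∀ rs → All (1 ≤_) rs → word (map pred rs) ≡ foldr (λ r f → power r *Λ f) 1Λ rs
  fold []           []       = ≡.refl
  fold (suc r ∷ rs) (_ ∷ ps) = cong (power (suc r) *Λ_) (fold rs ps)

-- The adjoint of multiplication by the power sum of degree suc r, on a product of power sums.
∂ : ℕ → List ℕ → Λ
∂ r []      = 0Λ
∂ r (s ∷ w) = (if does (s ℕ.≟ r) then α * ν (suc r) else 0#) · word w +Λ power (suc s) *Λ ∂ r w

∂-same : ∀ r w a → coeff (∂ r (r ∷ w)) a ≈ (α * ν (suc r)) * coeff (word w) a + convolve (coeff (power (suc r))) (coeff (∂ r w)) a
∂-same r w a = reflexive (cong (λ b → (if b then α * ν (suc r) else 0#) * coeff (word w) a + convolve (coeff (power (suc r))) (coeff (∂ r w)) a)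
  (dec-true (r ℕ.≟ r) ≡.refl))

∂-other : ∀ {r s} w a → s ≢ r → coeff (∂ r (s ∷ w)) a ≈ convolve (coeff (power (suc s))) (coeff (∂ r w)) a
∂-other {r} {s} w a s≢r = reflexive (cong (λ b → (if b then α * ν (suc r) else 0#) * coeff (word w) a + convolve (coeff (power (suc s))) (coeff (∂ r w)) a)
  (dec-false (s ℕ.≟ r) s≢r)) ∙ +-congʳ {convolve (coeff (power (suc s))) (coeff (∂ r w)) a} (zeroˡ (coeff (word w) a)) ∙ +-identityˡ _

∂-zero : ∀ r w → ¬ r ∈ w → ∂ r w ≈Λ 0Λ
∂-zero r []      r∉ a = refl
∂-zero r (s ∷ w) r∉ a = ∂-other w a (λ { ≡.refl → r∉ (here ≡.refl) }) ∙
  convolve-cong (λ _ → refl) (λ b → ∂-zero r w (r∉ ∘ there) b ∙ coeff-0Λ b) a ∙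
  convolve-0ʳ (coeff (power (suc s))) a ∙ sym (coeff-0Λ a)

-- By the product rule each occurrence of r contributes one copy of the same word.
∂-insert : ∀ r w u → w ↭ r ∷ u → ∂ r w ≈Λ (ν (occurrences r w) * (α * ν (suc r))) · word u
∂-insert r []      u p a = contradiction (Perm.↭-length p) λ ()
∂-insert r (s ∷ w) u p a with s ℕ.≟ r | mem? ℕ._≟_ r w
... | yes ≡.refl | no r∉ = begin
  coeff (∂ r (r ∷ w)) a
    ≈⟨ ∂-same r w a ⟩
  (α * ν (suc r)) * coeff (word w) a + convolve (coeff (power (suc r))) (coeff (∂ r w)) a
    ≈⟨ +-cong (*-congˡ {α * ν (suc r)} (word-↭ w↭u a)) (convolve-cong (λ _ → refl) (λ b → ∂-zero r w r∉ b ∙ coeff-0Λ b) a ∙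
         convolve-0ʳ (coeff (power (suc r))) a) ⟩
  (α * ν (suc r)) * coeff (word u) a + 0#
    ≈⟨ solve 2 (λ x y → x :* y :+ :0 := (:1 :+ :0) :* x :* y) refl (α * ν (suc r)) (coeff (word u) a) ⟩
  (ν 1 * (α * ν (suc r))) * coeff (word u) a
    ≈⟨ *-congʳ {coeff (word u) a} (*-congʳ {α * ν (suc r)} (reflexive (cong ν (≡.sym
         (occurrences-same r w ⊙ cong suc (none w r∉)))))) ⟩
  (ν (occurrences r (r ∷ w)) * (α * ν (suc r))) * coeff (word u) a ∎
  where
  w↭u : w ↭ u
  w↭u = Perm.drop-∷ p
  none : ∀ w → ¬ r ∈ w → occurrences r w ≡ 0
  none []      h = ≡.refl
  none (t ∷ w) h = occurrences-other w (λ { ≡.refl → h (here ≡.refl) }) ⊙ none w (h ∘ there)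
... | yes ≡.refl | yes r∈ with Mem.∈-∃++ r∈
...   | pre , post , ≡.refl = begin
  coeff (∂ r (r ∷ w)) a
    ≈⟨ ∂-same r w a ⟩
  (α * ν (suc r)) * coeff (word w) a + convolve (coeff (power (suc r))) (coeff (∂ r w)) a
    ≈⟨ +-cong (*-congˡ {α * ν (suc r)} (word-↭ w↭u a)) (convolve-cong (λ _ → refl) (∂-insert r w (pre ++ post) (Perm.shift r pre post)) a ∙
         convolve-*ʳ (coeff (power (suc r))) (coeff (word (pre ++ post))) (ν m₀ * (α * ν (suc r))) a) ⟩
  (α * ν (suc r)) * coeff (word u) a + (ν m₀ * (α * ν (suc r))) * coeff (word (r ∷ pre ++ post)) a
    ≈⟨ +-congˡ {(α * ν (suc r)) * coeff (word u) a} (*-congˡ {ν m₀ * (α * ν (suc r))} (word-↭ (↭-trans (↭-sym (Perm.shift r pre post)) w↭u) a)) ⟩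
  (α * ν (suc r)) * coeff (word u) a + (ν m₀ * (α * ν (suc r))) * coeff (word u) a
    ≈⟨ solve 3 (λ x m₀ y → x :* y :+ (m₀ :* x) :* y := ((:1 :+ m₀) :* x) :* y) refl (α * ν (suc r)) (ν m₀) (coeff (word u) a) ⟩
  (ν (suc m₀) * (α * ν (suc r))) * coeff (word u) a
    ≈⟨ *-congʳ {coeff (word u) a} (*-congʳ {α * ν (suc r)} (cong-≈ ν (≡.sym (occurrences-same r w)))) ⟩
  (ν (occurrences r (r ∷ w)) * (α * ν (suc r))) * coeff (word u) a ∎
  where
  m₀ = occurrences r w
  w↭u : w ↭ u
  w↭u = Perm.drop-∷ p
∂-insert r (s ∷ w) u p a | no s≢r | no r∉ = contradiction (Perm.∈-resp-↭ (↭-sym p) (here ≡.refl)) λ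
  { (here e) → s≢r (≡.sym e) ; (there q) → r∉ q }
∂-insert r (s ∷ w) u p a | no s≢r | yes r∈ with Mem.∈-∃++ r∈
... | pre , post , ≡.refl = begin
  coeff (∂ r (s ∷ w)) a
    ≈⟨ ∂-other w a s≢r ⟩
  convolve (coeff (power (suc s))) (coeff (∂ r w)) a
    ≈⟨ convolve-cong (λ _ → refl) (∂-insert r w (pre ++ post) (Perm.shift r pre post)) a ∙
         convolve-*ʳ (coeff (power (suc s))) (coeff (word (pre ++ post))) (ν m₀ * (α * ν (suc r))) a ⟩
  (ν m₀ * (α * ν (suc r))) * coeff (word (s ∷ pre ++ post)) a
    ≈⟨ *-cong (*-congʳ {α * ν (suc r)} (cong-≈ ν (≡.sym (occurrences-other w (s≢r ∘ ≡.sym)))))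
         (word-↭ (Perm.drop-∷ (↭-trans (↭-trans (Perm.swap r s Perm.refl) (Perm.prep s (↭-sym (Perm.shift r pre post)))) p)) a) ⟩
  (ν (occurrences r (s ∷ w)) * (α * ν (suc r))) * coeff (word u) a ∎
  where
  m₀ = occurrences r w

Σ<-restrict : ∀ n m (φ : ℕ → ℚ⟨α⟩) → m ≤ n → Σ< n (λ k → if does (suc k ℕ.≤? m) then φ k else 0#) ≈ Σ< m φ
Σ<-restrict n       zero    φ l = Σ<-zero n λ _ _ → refl
Σ<-restrict (suc n) (suc m) φ l = +-congˡ {φ 0} (Σ<-restrict n m (φ ∘ suc) (ℕ.≤-pred l))

timesPower-Σ< : ∀ r m (F : ℕ → Coeffs) a → timesPower r (λ b → Σ< m (λ i → F i b)) a ≈ Σ< m (λ i → timesPower r (F i) a)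
timesPower-Σ< r m F []      = sym (Σ<-zero m λ _ _ → refl)
timesPower-Σ< r m F (n ∷ a) = +-cong (first (does (r ℕ.≤? n))) (timesPower-Σ< r m (λ i → F i ∘ (n ∷_)) a) ∙
  sym (Σ<-+ m _ _)
  where
  first : ∀ b → (if b then Σ< m (λ i → F i (n ∸ r ∷ a)) else 0#) ≈ Σ< m (λ i → if b then F i (n ∸ r ∷ a) else 0#)
  first true  = refl
  first false = sym (Σ<-zero m λ _ _ → refl)

timesPower-* : ∀ r c (F : Coeffs) a → timesPower r (λ b → c * F b) a ≈ c * timesPower r F a
timesPower-* r c F []      = sym (zeroʳ c)
timesPower-* r c F (n ∷ a) = +-cong (first (does (r ℕ.≤? n))) (timesPower-* r c (F ∘ (n ∷_)) a) ∙ sym (distribˡ c _ _)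
  where
  first : ∀ b → (if b then c * F (n ∸ r ∷ a) else 0#) ≈ c * (if b then F (n ∸ r ∷ a) else 0#)
  first true  = refl
  first false = sym (zeroʳ c)

-- The chain rule for the first variable: x₁ ∂p_r/∂x₁ = r x₁^r gives α x₁ ∂f/∂x₁ = Σ_k x₁^(k+1) d_k,
-- where d_k is the adjoint of p_(k+1) applied to f.
Newton : Λ → (ℕ → Λ) → Set
Newton f d = ∀ n a → α * ν n * coeff f (n ∷ a) ≈ Σ< n (λ k → coeff (d k) (n ∸ suc k ∷ a))

newton-word : ∀ w → Newton (word w) (λ k → ∂ k w)
newton-word []      n       a = vanish n ∙ sym (Σ<-zero n λ k _ → coeff-0Λ (n ∸ suc k ∷ a))
  where
  vanish : ∀ n → α * ν n * coeff 1Λ (n ∷ a) ≈ 0#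
  vanish zero    = solve 2 (λ x y → x :* :0 :* y := :0) refl α (coeff 1Λ a)
  vanish (suc n) = *-congˡ {α * ν (suc n)} (coeff-1Λ-suc n a) ∙ zeroʳ _
newton-word (s ∷ w) n a = begin
  αn * convolve (coeff (power (suc s))) F (n ∷ a)
    ≈⟨ *-congˡ {αn} (convolve-power s F (n ∷ a)) ⟩
  αn * ((if does (suc s ℕ.≤? n) then F (n ∸ suc s ∷ a) else 0#) + rest)
    ≈⟨ distribˡ αn _ rest ⟩
  αn * (if does (suc s ℕ.≤? n) then F (n ∸ suc s ∷ a) else 0#) + αn * rest
    ≈⟨ +-cong (head (suc s ℕ.≤? n)) tail ⟩
  (Σ< n (λ k → (if does (s ℕ.≟ k) then α * ν (suc k) else 0#) * F (n ∸ suc k ∷ a)) +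
   Σ< n (λ k → if does (suc s ℕ.≤? n ∸ suc k) then coeff (∂ k w) (n ∸ suc k ∸ suc s ∷ a) else 0#)) +
   Σ< n (λ k → timesPower (suc s) (coeff (∂ k w) ∘ (n ∸ suc k ∷_)) a)
    ≈⟨ +-assoc (Σ< n A) (Σ< n B) (Σ< n C) ∙ +-congˡ {Σ< n A} (sym (Σ<-+ n B C)) ∙ sym (Σ<-+ n A (λ k → B k + C k)) ⟩
  Σ< n (λ k → A k + timesPower (suc s) (coeff (∂ k w)) (n ∸ suc k ∷ a))
    ≈⟨ Σ<-cong n (λ k _ → +-congˡ {A k} (convolve-power s (coeff (∂ k w)) (n ∸ suc k ∷ a))) ⟨
  Σ< n (λ k → coeff (∂ k (s ∷ w)) (n ∸ suc k ∷ a)) ∎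
  where
  F = coeff (word w)
  αn = α * ν n
  rest = timesPower (suc s) (F ∘ (n ∷_)) a
  A B C : ℕ → ℚ⟨α⟩
  A k = (if does (s ℕ.≟ k) then α * ν (suc k) else 0#) * F (n ∸ suc k ∷ a)
  B k = if does (suc s ℕ.≤? n ∸ suc k) then coeff (∂ k w) (n ∸ suc k ∸ suc s ∷ a) else 0#
  C k = timesPower (suc s) (coeff (∂ k w) ∘ (n ∸ suc k ∷_)) a
  tail : αn * rest ≈ Σ< n C
  tail = sym (timesPower-* (suc s) αn (F ∘ (n ∷_)) a) ∙
    timesPower-cong (suc s) (newton-word w n) a ∙ timesPower-Σ< (suc s) n (λ k b → coeff (∂ k w) (n ∸ suc k ∷ b)) a
  A-sum : Σ< n A ≈ (if does (suc s ℕ.≤? n) then α * ν (suc s) * F (n ∸ suc s ∷ a) else 0#)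
  A-sum = (Σ<-cong n λ k _ → each k (k ℕ.≟ s) (s ℕ.≟ k)) ∙ Σ<-δ n s (λ k → α * ν (suc k) * F (n ∸ suc k ∷ a))
    where
    each : ∀ k (d : Dec (k ≡ s)) (e : Dec (s ≡ k)) →
           (if does e then α * ν (suc k) else 0#) * F (n ∸ suc k ∷ a) ≈ (if does d then α * ν (suc k) * F (n ∸ suc k ∷ a) else 0#)
    each k (yes _) (yes _) = refl
    each k (no _)  (no _)  = zeroˡ _
    each k (yes p) (no q)  = contradiction (≡.sym p) q
    each k (no p)  (yes q) = contradiction (≡.sym q) p
  B-sum : Σ< n B ≈ Σ< (n ∸ suc s) (λ k → coeff (∂ k w) (n ∸ suc s ∸ suc k ∷ a))
  B-sum = (Σ<-cong n λ k k<n → each k k<n (suc s ℕ.≤? n ∸ suc k) (suc k ℕ.≤? n ∸ suc s)) ∙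
    Σ<-restrict n (n ∸ suc s) (λ k → coeff (∂ k w) (n ∸ suc s ∸ suc k ∷ a)) (ℕ.m∸n≤m n (suc s))
    where
    comm : ∀ k → n ∸ suc k ∸ suc s ≡ n ∸ suc s ∸ suc k
    comm k = ℕ.∸-+-assoc n (suc k) (suc s) ⊙ cong (n ∸_) (ℕ.+-comm (suc k) (suc s)) ⊙ ≡.sym (ℕ.∸-+-assoc n (suc s) (suc k))
    flip : ∀ {x y} → suc x ≤ n ∸ suc y → suc y ≤ n ∸ suc x
    flip {x} {y} l = ℕ.m+n≤o⇒m≤o∸n (suc y) (subst₂ _≤_ (ℕ.+-comm (suc x) (suc y)) (ℕ.m∸n+n≡m y<n) (ℕ.+-monoˡ-≤ (suc y) l))
      where
      y<n : suc y ≤ n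
      y<n = ℕ.<⇒≤ (ℕ.m∸n≢0⇒n<m {n} {suc y} λ e → ℕ.n≮0 (subst (suc x ≤_) e l))
    each : ∀ k → k < n → (d : Dec (suc s ≤ n ∸ suc k)) (e : Dec (suc k ≤ n ∸ suc s)) →
           (if does d then coeff (∂ k w) (n ∸ suc k ∸ suc s ∷ a) else 0#) ≈ (if does e then coeff (∂ k w) (n ∸ suc s ∸ suc k ∷ a) else 0#)
    each k _ (yes _) (yes _) = cong-≈ (λ m → coeff (∂ k w) (m ∷ a)) (comm k)
    each k _ (no _)  (no _)  = refl
    each k _ (yes p) (no q)  = contradiction (flip p) q
    each k _ (no p)  (yes q) = contradiction (flip q) p
  head : (d : Dec (suc s ≤ n)) → αn * (if does d then F (n ∸ suc s ∷ a) else 0#) ≈ Σ< n A + Σ< n B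
  head d = go d ∙ sym (+-cong (A-sum ∙ cong-≈ (λ b → if b then α * ν (suc s) * F (n ∸ suc s ∷ a) else 0#) (same d)) B-sum)
    where
    same : (d : Dec (suc s ≤ n)) → does (suc s ℕ.≤? n) ≡ does d
    same (yes l) = dec-true (suc s ℕ.≤? n) l
    same (no l)  = dec-false (suc s ℕ.≤? n) l
    go : (d : Dec (suc s ≤ n)) → αn * (if does d then F (n ∸ suc s ∷ a) else 0#) ≈
         (if does d then α * ν (suc s) * F (n ∸ suc s ∷ a) else 0#) + Σ< (n ∸ suc s) (λ k → coeff (∂ k w) (n ∸ suc s ∸ suc k ∷ a))
    go (yes l) = *-congʳ {F (n ∸ suc s ∷ a)} (*-congˡ {α} (cong-≈ ν (≡.sym (ℕ.m+[n∸m]≡n l)) ∙ ν-+ (suc s) (n ∸ suc s))) ∙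
      solve 4 (λ α x y f → α :* (x :+ y) :* f := α :* x :* f :+ α :* y :* f) refl α (ν (suc s)) (ν (n ∸ suc s)) (F (n ∸ suc s ∷ a)) ∙
        +-congˡ {α * ν (suc s) * F (n ∸ suc s ∷ a)} (newton-word w (n ∸ suc s) a)
    go (no l) rewrite ℕ.m≤n⇒m∸n≡0 (ℕ.≤-trans (ℕ.<⇒≤ (ℕ.≰⇒> l)) ℕ.≤-refl) = solve 1 (λ x → x :* :0 := :0 :+ :0) refl αn

-- At n = k + 1 the last summand is a coefficient of d_k, as its exponent 0 may be dropped, and the
-- earlier summands are known by induction.
newton-unique : ∀ f {d e : ℕ → Λ} → Newton f d → Newton f e → ∀ k → d k ≈Λ e k
newton-unique f {d} {e} nd ne = <-rec _ λ k ih a → begin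
  coeff (d k) a
    ≈⟨ last d k a ⟩
  Σ< (suc k) (λ i → coeff (d i) (suc k ∸ suc i ∷ a)) + - Σ< k (λ i → coeff (d i) (suc k ∸ suc i ∷ a))
    ≈⟨ +-cong (sym (nd (suc k) a) ∙ ne (suc k) a) (-‿cong (Σ<-cong k λ i i<k → ih i<k (suc k ∸ suc i ∷ a))) ⟩
  Σ< (suc k) (λ i → coeff (e i) (suc k ∸ suc i ∷ a)) + - Σ< k (λ i → coeff (e i) (suc k ∸ suc i ∷ a))
    ≈⟨ last e k a ⟨
  coeff (e k) a ∎
  where
  last : ∀ d k a → coeff (d k) a ≈ Σ< (suc k) (λ i → coeff (d i) (suc k ∸ suc i ∷ a)) + - Σ< k (λ i → coeff (d i) (suc k ∸ suc i ∷ a))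
  last d k a = sym (+-congʳ { - Σ< k g} (Σ<-last k g) ∙ solve 2 (λ x y → (x :+ y) :+ (:- x) := y) refl (Σ< k g) (g k) ∙
    cong-≈ (λ m → coeff (d k) (m ∷ a)) (ℕ.n∸n≡0 k) ∙ coeff-zero∷ (d k) a)
    where
    g : ℕ → ℚ⟨α⟩
    g i = coeff (d i) (suc k ∸ suc i ∷ a)

-- Adjoints with respect to the scalar product

module Form (𝒮 : JackScalarProduct) where
  open JackScalarProduct 𝒮 public renaming (⟨_,_⟩ to ⟪_,_⟫)

  linear-+ʳ : ∀ f g h → ⟪ h , f +Λ g ⟫ ≈ ⟪ h , f ⟫ + ⟪ h , g ⟫
  linear-+ʳ f g h = ⟨⟩-comm h (f +Λ g) ∙ linear-+ f g h ∙ +-cong (⟨⟩-comm f h) (⟨⟩-comm g h)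

  linear-·ʳ : ∀ c f h → ⟪ h , c · f ⟫ ≈ c * ⟪ h , f ⟫
  linear-·ʳ c f h = ⟨⟩-comm h (c · f) ∙ linear-· c f h ∙ *-congˡ {c} (⟨⟩-comm f h)

  ⟨⟩-congˡ : ∀ f {g h} → g ≈Λ h → ⟪ f , g ⟫ ≈ ⟪ f , h ⟫
  ⟨⟩-congˡ f {g} {h} e = ⟨⟩-cong {f} {f} {g} {h} (λ _ → refl) e

  ⟨⟩-congʳ : ∀ {f g} h → f ≈Λ g → ⟪ f , h ⟫ ≈ ⟪ g , h ⟫
  ⟨⟩-congʳ {f} {g} h e = ⟨⟩-cong {f} {g} {h} {h} e (λ _ → refl)

  ⟨⟩-0ʳ : ∀ f → ⟪ f , 0Λ ⟫ ≈ 0#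
  ⟨⟩-0ʳ f = linear-·ʳ 0# 1Λ f ∙ zeroˡ _

  ⟨⟩-Σ<ʳ : ∀ h n f → ⟪ h , Σ<Λ n f ⟫ ≈ Σ< n (λ i → ⟪ h , f i ⟫)
  ⟨⟩-Σ<ʳ h zero    f = ⟨⟩-0ʳ h
  ⟨⟩-Σ<ʳ h (suc n) f = linear-+ʳ (f 0) (Σ<Λ n (f ∘ suc)) h ∙ +-congˡ {⟪ h , f 0 ⟫} (⟨⟩-Σ<ʳ h n (f ∘ suc))

  word-orthogonal : ∀ w w′ → ¬ (w ↭ w′) → ⟪ word w , word w′ ⟫ ≈ 0#
  word-orthogonal w w′ ¬p = ⟨⟩-cong {word w} {p (toPartition w)} {word w′} {p (toPartition w′)} (word≈p w) (word≈p w′) ∙ orthogonal (¬p ∘ ↭-toPartition {w} {w′})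

  word-norm : ∀ w → ⟪ word w , word w ⟫ ≈ ν (z (toPartition w)) * α ^ length w
  word-norm w = ⟨⟩-cong {word w} {p (toPartition w)} {word w} {p (toPartition w)} (word≈p w) (word≈p w) ∙ norm (toPartition w) ∙
    *-cong (fromℕ≈ν (z (toPartition w))) (cong-≈ (α ^_) (Perm.↭-length (parts-toPartition w) ⊙ List.length-map suc w))

  _↭?_ : ∀ (w w′ : List ℕ) → Dec (w ↭ w′)
  w ↭? w′ with toPartition w ≟ᴾ toPartition w′
  ... | yes e = yes (↭-toPartition {w} {w′} e)
  ... | no ¬e = no (¬e ∘ toPartition-↭)

  -- Both sides vanish if r does not occur in w′. Otherwise `∂-insert` supplies the factor by which,
  -- according to `z-insert`, the norm grows.
  word-adjoint : ∀ r w w′ → ⟪ word (r ∷ w) , word w′ ⟫ ≈ ⟪ word w , ∂ r w′ ⟫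
  word-adjoint r w w′ with mem? ℕ._≟_ r w′
  ... | no r∉ = word-orthogonal (r ∷ w) w′ (λ q → r∉ (Perm.∈-resp-↭ q (here ≡.refl))) ∙
    sym (⟨⟩-congˡ (word w) {∂ r w′} {0Λ} (∂-zero r w′ r∉) ∙ ⟨⟩-0ʳ (word w))
  ... | yes r∈ with Mem.∈-∃++ r∈
  ...   | pre , post , ≡.refl = sym (begin
    ⟪ word w , ∂ r w′ ⟫
      ≈⟨ ⟨⟩-congˡ (word w) {∂ r w′} {c · word u′} (∂-insert r w′ u′ w′↭) ⟩
    ⟪ word w , c · word u′ ⟫
      ≈⟨ linear-·ʳ c (word u′) (word w) ⟩
    c * ⟪ word w , word u′ ⟫
      ≈⟨ compare (w ↭? u′) ⟩
    ⟪ word (r ∷ w) , word (r ∷ u′) ⟫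
      ≈⟨ ⟨⟩-congˡ (word (r ∷ w)) {word w′} {word (r ∷ u′)} (word-↭ w′↭) ⟨
    ⟪ word (r ∷ w) , word w′ ⟫ ∎)
    where
    u′ = pre ++ post
    w′↭ : w′ ↭ r ∷ u′
    w′↭ = Perm.shift r pre post
    c = ν (occurrences r w′) * (α * ν (suc r))
    occ : occurrences r w′ ≡ suc (occurrences (suc r) (map suc u′))
    occ = occurrences-↭ r w′↭ ⊙ occurrences-same r u′ ⊙ cong suc (shifted u′)
      where
      shifted : ∀ v → occurrences r v ≡ occurrences (suc r) (map suc v)
      shifted []      = ≡.refl
      shifted (s ∷ v) with r ℕ.≟ s
      ... | yes ≡.refl = occurrences-same r v ⊙ cong suc (shifted v) ⊙ ≡.sym (occurrences-same (suc r) (map suc v))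
      ... | no r≢s     = occurrences-other v r≢s ⊙ shifted v ⊙ ≡.sym (occurrences-other (map suc v) (r≢s ∘ ℕ.suc-injective))
    compare : Dec (w ↭ u′) → c * ⟪ word w , word u′ ⟫ ≈ ⟪ word (r ∷ w) , word (r ∷ u′) ⟫
    compare (no ¬q) = *-congˡ {c} (word-orthogonal w u′ ¬q) ∙ zeroʳ c ∙ sym (word-orthogonal (r ∷ w) (r ∷ u′) (¬q ∘ Perm.drop-∷))
    compare (yes q) = begin
      c * ⟪ word w , word u′ ⟫
        ≈⟨ *-congˡ {c} (⟨⟩-congʳ {word w} {word u′} (word u′) (word-↭ q) ∙ word-norm u′) ⟩
      (ν (occurrences r w′) * (α * ν (suc r))) * (ν (z (toPartition u′)) * α ^ length u′)
        ≈⟨ solve 5 (λ o α r z a → (o :* (α :* r)) :* (z :* a) := ((r :* o) :* z) :* (α :* a)) refl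
             (ν (occurrences r w′)) α (ν (suc r)) (ν (z (toPartition u′))) (α ^ length u′) ⟩
      ((ν (suc r) * ν (occurrences r w′)) * ν (z (toPartition u′))) * α ^ length (r ∷ u′)
        ≈⟨ *-congʳ {α ^ length (r ∷ u′)} (*-congʳ {ν (z (toPartition u′))} (sym (ν-* (suc r) (occurrences r w′))) ∙ sym (ν-* (suc r ℕ.* occurrences r w′) (z (toPartition u′)))) ⟩
      ν (suc r ℕ.* occurrences r w′ ℕ.* z (toPartition u′)) * α ^ length (r ∷ u′)
        ≈⟨ *-congʳ {α ^ length (r ∷ u′)} (cong-≈ ν (cong (λ m → suc r ℕ.* m ℕ.* z (toPartition u′)) occ ⊙ ≡.sym (z-insert r u′))) ⟩
      ν (z (toPartition (r ∷ u′))) * α ^ length (r ∷ u′)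
        ≈⟨ word-norm (r ∷ u′) ⟨
      ⟪ word (r ∷ u′) , word (r ∷ u′) ⟫
        ≈⟨ ⟨⟩-congʳ {word (r ∷ w)} {word (r ∷ u′)} (word (r ∷ u′)) (word-↭ (Perm.prep r q)) ⟨
      ⟪ word (r ∷ w) , word (r ∷ u′) ⟫ ∎

  -- Adjoints exist because f can be written in power sums; the Newton relation makes them
  -- independent of the way it is written.
  record Perp (f : Λ) : Set where
    field
      d      : ℕ → Λ
      newton : Newton f d
      adj    : ∀ k h → ⟪ power (suc k) *Λ h , f ⟫ ≈ ⟪ h , d k ⟫

  perp-word : ∀ w → Perp (word w)
  perp-word w = record { d = λ k → ∂ k w ; newton = newton-word w ; adj = λ k h → adj k (spanning h) }
    where
    adj : ∀ k {h} → h ∈Span → ⟪ power (suc k) *Λ h , word w ⟫ ≈ ⟪ h , ∂ k w ⟫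
    adj k (∈word w′) = word-adjoint k w′ w
    adj k (∈+ {f} {g} s t) = ⟨⟩-congʳ {power (suc k) *Λ (f +Λ g)} {power (suc k) *Λ f +Λ power (suc k) *Λ g} (word w)
        (convolve-+ʳ (coeff (power (suc k))) (coeff f) (coeff g)) ∙
      linear-+ (power (suc k) *Λ f) (power (suc k) *Λ g) (word w) ∙ +-cong (adj k s) (adj k t) ∙ sym (linear-+ f g (∂ k w))
    adj k (∈· c {f} s) = ⟨⟩-congʳ {power (suc k) *Λ (c · f)} {c · (power (suc k) *Λ f)} (word w) (convolve-*ʳ (coeff (power (suc k))) (coeff f) c) ∙
      linear-· c (power (suc k) *Λ f) (word w) ∙ *-congˡ {c} (adj k s) ∙ sym (linear-· c f (∂ k w))
    adj k (∈≈ {f} {g} e s) = ⟨⟩-congʳ {power (suc k) *Λ g} {power (suc k) *Λ f} (word w) (convolve-cong (λ _ → refl) (≈Λ-sym {f} {g} e)) ∙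
      adj k s ∙ ⟨⟩-congʳ {f} {g} (∂ k w) e

  perp-span : ∀ {f} → f ∈Span → Perp f
  perp-span (∈word w) = perp-word w
  perp-span (∈+ {f} {g} s t) = record
    { d = λ k → F.d k +Λ G.d k
    ; newton = λ n a → distribˡ (α * ν n) (coeff f (n ∷ a)) (coeff g (n ∷ a)) ∙ +-cong (F.newton n a) (G.newton n a) ∙ sym (Σ<-+ n _ _)
    ; adj = λ k h → linear-+ʳ f g (power (suc k) *Λ h) ∙ +-cong (F.adj k h) (G.adj k h) ∙ sym (linear-+ʳ (F.d k) (G.d k) h) }
    where
    module F = Perp (perp-span s)
    module G = Perp (perp-span t)
  perp-span (∈· c {f} s) = record
    { d = λ k → c · F.d k
    ; newton = λ n a → solve 4 (λ α n c f → α :* n :* (c :* f) := c :* (α :* n :* f)) refl α (ν n) c (coeff f (n ∷ a)) ∙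
        *-congˡ {c} (F.newton n a) ∙ sym (Σ<-* n c _)
    ; adj = λ k h → linear-·ʳ c f (power (suc k) *Λ h) ∙ *-congˡ {c} (F.adj k h) ∙ sym (linear-·ʳ c (F.d k) h) }
    where module F = Perp (perp-span s)
  perp-span (∈≈ {f} {g} e s) = record
    { d = F.d
    ; newton = λ n a → *-congˡ {α * ν n} (sym (e (n ∷ a))) ∙ F.newton n a
    ; adj = λ k h → ⟨⟩-congˡ (power (suc k) *Λ h) {g} {f} (≈Λ-sym {f} {g} e) ∙ F.adj k h }
    where module F = Perp (perp-span s)

  perp : ∀ f → Perp f
  perp f = perp-span (spanning f)

  -- The witness is the n-th complete function of the scalar product.
  complete : ∀ n → Σ Λ λ g → ∀ f h → ⟪ f , g *Λ h ⟫ ≈ ⟪ shift n f , h ⟫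
  complete = <-rec _ step
    where
    step : ∀ n → (∀ {k} → k < n → Σ Λ λ g → ∀ f h → ⟪ f , g *Λ h ⟫ ≈ ⟪ shift k f , h ⟫) → Σ Λ λ g → ∀ f h → ⟪ f , g *Λ h ⟫ ≈ ⟪ shift n f , h ⟫
    step zero ih = 1Λ , λ f h → ⟨⟩-cong {f} {shift 0 f} {1Λ *Λ h} {h} (λ a → sym (coeff-zero∷ f a)) (convolve-1 (coeff h))
    step (suc n) ih with inverse (α * ν (suc n)) (pos-≉0 (pos-* pos-α (pos-ν n)))
    -- Newton's recursion α (n + 1) g_(n+1) = Σ_k p_(k+1) g_(n-k), solved for g_(n+1).
    ... | y , inv = y · Σ<Λ (suc n) term , proof
      where
      lower : ∀ k → suc n ∸ suc k < suc n
      lower k = ℕ.s≤s (ℕ.m∸n≤m n k)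
      g : ∀ k → Λ
      g k = proj₁ (ih (lower k))
      term : ℕ → Λ
      term k = power (suc k) *Λ g k
      proof : ∀ f h → ⟪ f , (y · Σ<Λ (suc n) term) *Λ h ⟫ ≈ ⟪ shift (suc n) f , h ⟫
      proof f h = begin
        ⟪ f , (y · Σ<Λ (suc n) term) *Λ h ⟫
          ≈⟨ ⟨⟩-congˡ f {(y · Σ<Λ (suc n) term) *Λ h} {y · Σ<Λ (suc n) (λ k → power (suc k) *Λ (g k *Λ h))} expand ⟩
        ⟪ f , y · Σ<Λ (suc n) (λ k → power (suc k) *Λ (g k *Λ h)) ⟫
          ≈⟨ linear-·ʳ y (Σ<Λ (suc n) (λ k → power (suc k) *Λ (g k *Λ h))) f ∙ *-congˡ {y} (⟨⟩-Σ<ʳ f (suc n) (λ k → power (suc k) *Λ (g k *Λ h))) ⟩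
        y * Σ< (suc n) (λ k → ⟪ f , power (suc k) *Λ (g k *Λ h) ⟫)
          ≈⟨ *-congˡ {y} (Σ<-cong (suc n) λ k _ → ⟨⟩-comm f (power (suc k) *Λ (g k *Λ h)) ∙ F.adj k (g k *Λ h) ∙
               ⟨⟩-comm (g k *Λ h) (F.d k) ∙ proj₂ (ih (lower k)) (F.d k) h ∙ ⟨⟩-comm (shift (suc n ∸ suc k) (F.d k)) h) ⟩
        y * Σ< (suc n) (λ k → ⟪ h , shift (suc n ∸ suc k) (F.d k) ⟫)
          ≈⟨ *-congˡ {y} (⟨⟩-Σ<ʳ h (suc n) (λ k → shift (suc n ∸ suc k) (F.d k))) ⟨
        y * ⟪ h , Σ<Λ (suc n) (λ k → shift (suc n ∸ suc k) (F.d k)) ⟫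
          ≈⟨ *-congˡ {y} (⟨⟩-congˡ h {Σ<Λ (suc n) (λ k → shift (suc n ∸ suc k) (F.d k))} {(α * ν (suc n)) · shift (suc n) f}
               λ a → coeff-Σ<Λ (suc n) (λ k → shift (suc n ∸ suc k) (F.d k)) a ∙ sym (F.newton (suc n) a)) ⟩
        y * ⟪ h , (α * ν (suc n)) · shift (suc n) f ⟫
          ≈⟨ *-congˡ {y} (linear-·ʳ (α * ν (suc n)) (shift (suc n) f) h) ⟩
        y * ((α * ν (suc n)) * ⟪ h , shift (suc n) f ⟫)
          ≈⟨ solve 3 (λ y x z → y :* (x :* z) := (x :* y) :* z) refl y (α * ν (suc n)) ⟪ h , shift (suc n) f ⟫ ⟩
        ((α * ν (suc n)) * y) * ⟪ h , shift (suc n) f ⟫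
          ≈⟨ *-congʳ {⟪ h , shift (suc n) f ⟫} inv ∙ *-identityˡ _ ⟩
        ⟪ h , shift (suc n) f ⟫
          ≈⟨ ⟨⟩-comm h (shift (suc n) f) ⟩
        ⟪ shift (suc n) f , h ⟫ ∎
        where
        module F = Perp (perp f)
        expand : (y · Σ<Λ (suc n) term) *Λ h ≈Λ y · Σ<Λ (suc n) (λ k → power (suc k) *Λ (g k *Λ h))
        expand a = begin
          convolve (λ b → y * coeff (Σ<Λ (suc n) term) b) (coeff h) a
            ≈⟨ convolve-comm (λ b → y * coeff (Σ<Λ (suc n) term) b) (coeff h) a ⟩
          convolve (coeff h) (λ b → y * coeff (Σ<Λ (suc n) term) b) a
            ≈⟨ convolve-*ʳ (coeff h) (coeff (Σ<Λ (suc n) term)) y a ⟩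
          y * convolve (coeff h) (coeff (Σ<Λ (suc n) term)) a
            ≈⟨ *-congˡ {y} (convolve-cong (λ _ → refl) (coeff-Σ<Λ (suc n) term) a ∙ convolve-Σ<ʳ (coeff h) (suc n) (λ k → coeff (term k)) a) ⟩
          y * Σ< (suc n) (λ k → convolve (coeff h) (coeff (term k)) a)
            ≈⟨ *-congˡ {y} (Σ<-cong (suc n) λ k _ → convolve-comm (coeff h) (coeff (term k)) a ∙ convolve-assoc (coeff (power (suc k))) (coeff (g k)) (coeff h) a) ⟩
          y * Σ< (suc n) (λ k → coeff (power (suc k) *Λ (g k *Λ h)) a)
            ≈⟨ *-congˡ {y} (coeff-Σ<Λ (suc n) (λ k → power (suc k) *Λ (g k *Λ h)) a) ⟨
          y * coeff (Σ<Λ (suc n) (λ k → power (suc k) *Λ (g k *Λ h))) a ∎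

open Series ℚ⟨α⟩-commutativeRing α
open Fillings ℚ⟨α⟩-commutativeRing α

-- The Knop-Sahi function as a symmetric function

liftQ : ∀ {N} → Queue N → Queue (suc N)
liftQ = map (Prod.map₂ (Maybe.map suc))

has-liftQ : ∀ {N} (k : Fin N) Q → has (suc k) (liftQ Q) ≡ has k Q
has-liftQ k []                  = ≡.refl
has-liftQ k ((_ , nothing) ∷ Q) = has-liftQ k Q
has-liftQ k ((_ , just b)  ∷ Q) = cong (does (k Fin.≟ b) ∨_) (has-liftQ k Q)

shorter-liftQ : ∀ {N} l (Q : Queue N) → shorter l (liftQ Q) ≡ shorter l Q
shorter-liftQ l []             = ≡.refl
shorter-liftQ l ((l′ , _) ∷ Q) = cong (bit (does (l′ ℕ.≤? l)) ℕ.+_) (shorter-liftQ l Q)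

-- A variable of exponent zero labels no box and may be left out.
F-lift : ∀ n {N} (Q : Queue N) a → F n (liftQ Q) (0 ∷ a) ≈ F n Q a
F-lift n       []                a = refl
F-lift n       ((zero  , b) ∷ Q) a = F-lift n Q a
F-lift zero    ((suc l , b) ∷ Q) a = refl
F-lift (suc n) ((suc l , b) ∷ Q) a = +-cong
  (sum-suc _ ∙ +-cong (unused (has zero (liftQ Q))) (sum-cong λ k → trans
    (cong-≈ (λ c → unless c (X (suc k) (F n (liftQ Q ∷ʳ (l , just (suc k)))) (0 ∷ a))) (has-liftQ k Q))
    (unless-cong (has k Q) (each k))) ∙ +-identityˡ _)
  (*-cong (+-congˡ {α * ν (suc l)} (cong-≈ ν (shorter-liftQ l Q))) (marked b))
  where
  unused : ∀ c → unless c 0# ≈ 0#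
  unused true  = refl
  unused false = refl
  each : ∀ k → X (suc k) (F n (liftQ Q ∷ʳ (l , just (suc k)))) (0 ∷ a) ≈ X k (F n (Q ∷ʳ (l , just k))) a
  each k = onPred-cong (lookup a k) λ i → trans
    (cong-≈ (λ P → F n P (0 ∷ a [ k ]≔ i)) (≡.sym (List.map-++ _ Q _))) (F-lift n (Q ∷ʳ (l , just k)) (a [ k ]≔ i))
  marked : ∀ b → onLabel (Maybe.map suc b) (λ k → X k (F n (liftQ Q ∷ʳ (l , just k))) (0 ∷ a)) ≈ onLabel b (λ k → X k (F n (Q ∷ʳ (l , just k))) a)
  marked nothing  = refl
  marked (just k) = each k

Family : Set
Family = ∀ n → Vec ℕ n → ℚ⟨α⟩

SymmetricFamily : Family → Set
SymmetricFamily G = ∀ n i j a → G n (swapᵛ i j a) ≈ G n a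

symmetric-∷ : ∀ {G} → SymmetricFamily G → ∀ x → SymmetricFamily (λ n v → G (suc n) (x ∷ v))
symmetric-∷ {G} s x n i j v = cong-≈ (G (suc n)) (vec-ext pointwise) ∙ s (suc n) (suc i) (suc j) (x ∷ v)
  where
  pointwise : ∀ k → lookup (x ∷ swapᵛ i j v) k ≡ lookup (swapᵛ (suc i) (suc j) (x ∷ v)) k
  pointwise zero    = ≡.refl
  pointwise (suc k) = lookup-swapᵛ i j v k ⊙ cong (lookup (x ∷ v)) (shifted (k Fin.≟ i) (k Fin.≟ j)) ⊙
    ≡.sym (lookup-swapᵛ (suc i) (suc j) (x ∷ v) (suc k))
    where
    shifted : Dec (k ≡ i) → Dec (k ≡ j) → suc (transpose i j k) ≡ transpose (suc i) (suc j) (suc k)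
    shifted (yes ≡.refl) _ = cong suc (transpose-left k j) ⊙ ≡.sym (transpose-left (suc k) (suc j))
    shifted (no _) (yes ≡.refl) = cong suc (transpose-right i k) ⊙ ≡.sym (transpose-right (suc i) (suc k))
    shifted (no p) (no q) = cong suc (transpose-other i j p q) ⊙
      ≡.sym (transpose-other (suc i) (suc j) (p ∘ Fin.suc-injective) (q ∘ Fin.suc-injective))

-- A common prefix is absorbed into the family, so only the exchange of the first two entries
-- remains. This is why all numbers of variables are treated at once.
symmetric-family : ∀ {G} → SymmetricFamily G → ∀ {a b} → a ↭ b → G _ (fromList a) ≈ G _ (fromList b)
symmetric-family {G} s Perm.refl = refl
symmetric-family {G} s (Perm.prep x p) = symmetric-family {λ n v → G (suc n) (x ∷ v)} (symmetric-∷ {G} s x) p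
symmetric-family {G} s (Perm.swap {xs} {ys} x y p) = trans
  (sym (s _ zero (suc zero) (x ∷ y ∷ fromList xs)) ∙ cong-≈ (G _) (vec-ext flipped))
  (symmetric-family {λ n v → G (suc (suc n)) (y ∷ x ∷ v)} (symmetric-∷ {λ n v → G (suc n) (y ∷ v)} (symmetric-∷ {G} s y) x) p)
  where
  flipped : ∀ k → lookup (swapᵛ zero (suc zero) (x ∷ y ∷ fromList xs)) k ≡ lookup (y ∷ x ∷ fromList xs) k
  flipped zero          = ≡.refl
  flipped (suc zero)    = ≡.refl
  flipped (suc (suc k)) = lookup-swapᵛ {n = suc (suc (length xs))} zero (suc zero) (x ∷ y ∷ fromList xs) (suc (suc k))
symmetric-family {G} s (Perm.trans p q) = symmetric-family {G} s p ∙ symmetric-family {G} s q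

boxes : ∀ {N} → Queue N → ℕ
boxes Q = sumᴸ (lengths Q)

total : ∀ {N} → Vec ℕ N → ℕ
total []      = 0
total (n ∷ a) = n ℕ.+ total a

total-fromList : ∀ a → total (fromList a) ≡ sumᴸ a
total-fromList []      = ≡.refl
total-fromList (n ∷ a) = cong (n ℕ.+_) (total-fromList a)

total-≔ : ∀ {N} (a : Vec ℕ N) k {i} → lookup a k ≡ suc i → total a ≡ suc (total (a [ k ]≔ i))
total-≔ (.(suc i) ∷ a) zero    {i} ≡.refl = ≡.refl
total-≔ (n ∷ a)        (suc k) e = cong (n ℕ.+_) (total-≔ a k e) ⊙ ℕ.+-suc n _

boxes-∷ʳ : ∀ {N} (Q : Queue N) l b → boxes (Q ∷ʳ (l , b)) ≡ l ℕ.+ boxes Q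
boxes-∷ʳ Q l b = cong sumᴸ (List.map-++ proj₁ Q _) ⊙ sum-++ (lengths Q) _ ⊙
  cong (boxes Q ℕ.+_) (ℕ.+-identityʳ l) ⊙ ℕ.+-comm (boxes Q) l

X-vanish : ∀ {N} k (f : Ser N) a → (∀ i → lookup a k ≡ suc i → f (a [ k ]≔ i) ≈ 0#) → X k f a ≈ 0#
X-vanish k f a h with lookup a k
... | zero  = refl
... | suc i = h i ≡.refl

unless-vanish : ∀ b {x} → (b ≡ false → x ≈ 0#) → unless b x ≈ 0#
unless-vanish true  h = refl
unless-vanish false h = h ≡.refl

F-step-vanish : ∀ n {N} l b (Q : Queue N) a →
  (∀ k → has k Q ≡ false ⊎ b ≡ just k → ∀ i → lookup a k ≡ suc i → F n (Q ∷ʳ (l , just k)) (a [ k ]≔ i) ≈ 0#) →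
  F (suc n) ((suc l , b) ∷ Q) a ≈ 0#
F-step-vanish n l b Q a h = +-cong
  (sum-zero λ k → unless-vanish (has k Q) λ k∉ → X-vanish k (F n (Q ∷ʳ (l , just k))) a (h k (inj₁ k∉)))
  (*-congˡ {κ l Q} (marked b λ k e → h k (inj₂ e)) ∙ zeroʳ (κ l Q)) ∙ +-identityˡ 0#
  where
  marked : ∀ b → (∀ k → b ≡ just k → ∀ i → lookup a k ≡ suc i → F n (Q ∷ʳ (l , just k)) (a [ k ]≔ i) ≈ 0#) →
           onLabel b (λ k → X k (F n (Q ∷ʳ (l , just k))) a) ≈ 0#
  marked nothing  h = refl
  marked (just k) h = X-vanish k (F n (Q ∷ʳ (l , just k))) a (h k ≡.refl)

𝟙-vanish : ∀ {N} (a : Vec ℕ N) → total a ≢ 0 → 𝟙 a ≈ 0#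
𝟙-vanish []          h = contradiction ≡.refl h
𝟙-vanish (zero  ∷ a) h = 𝟙-vanish a h
𝟙-vanish (suc n ∷ a) h = refl

F-homogeneous : ∀ n {N} (Q : Queue N) a → total a ≢ boxes Q → F n Q a ≈ 0#
F-homogeneous n       []                a h = 𝟙-vanish a h
F-homogeneous n       ((zero  , b) ∷ Q) a h = F-homogeneous n Q a h
F-homogeneous zero    ((suc l , b) ∷ Q) a h = refl
F-homogeneous (suc n) ((suc l , b) ∷ Q) a h = F-step-vanish n l b Q a λ k _ i e →
  F-homogeneous n (Q ∷ʳ (l , just k)) (a [ k ]≔ i) λ e′ → h (total-≔ a k e ⊙ cong suc (e′ ⊙ boxes-∷ʳ Q l (just k)))

nip-κ : ∀ {N} l (Q : Queue N) → NIP (κ l Q)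
nip-κ l Q = nip-+ (nip-* nip-α (nip-ν (suc l))) (nip-ν (shorter l Q))

nip-X : ∀ {N} k (f : Ser N) a → (∀ b → NIP (f b)) → NIP (X k f a)
nip-X k f a h with lookup a k
... | zero  = nip-0
... | suc i = h (a [ k ]≔ i)

nip-unless : ∀ b {x} → NIP x → NIP (unless b x)
nip-unless true  h = nip-0
nip-unless false h = h

nip-F : ∀ n {N} (Q : Queue N) a → NIP (F n Q a)
nip-F n       []                a with isZero a
... | true  = nip-resp (+-identityʳ 1#) (nip-ν 1)
... | false = nip-0
nip-F n       ((zero  , b) ∷ Q) a = nip-F n Q a
nip-F zero    ((suc l , b) ∷ Q) a = nip-0
nip-F (suc n) ((suc l , b) ∷ Q) a = nip-+ (nip-sum λ k → nip-unless (has k Q) (each k)) (nip-* (nip-κ l Q) (marked b))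
  where
  each : ∀ k → NIP (X k (F n (Q ∷ʳ (l , just k))) a)
  each k = nip-X k (F n (Q ∷ʳ (l , just k))) a (nip-F n (Q ∷ʳ (l , just k)))
  marked : ∀ b → NIP (onLabel b (λ k → X k (F n (Q ∷ʳ (l , just k))) a))
  marked nothing  = nip-0
  marked (just k) = each k

rows : Partition → List ℕ
rows lam = reverse (parts lam)

relabel-empties : ∀ {N} (i j : Fin N) ls → relabel i j (empties ls) ≡ empties ls
relabel-empties i j []       = ≡.refl
relabel-empties i j (l ∷ ls) = cong ((l , nothing) ∷_) (relabel-empties i j ls)

liftQ-empties : ∀ {N} ls → liftQ {N} (empties ls) ≡ empties ls
liftQ-empties []       = ≡.refl
liftQ-empties (l ∷ ls) = cong ((l , nothing) ∷_) (liftQ-empties ls)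

lengths-empties′ : ∀ {N} ls → lengths {N} (empties ls) ≡ ls
lengths-empties′ []       = ≡.refl
lengths-empties′ (l ∷ ls) = cong (l ∷_) (lengths-empties′ ls)

sum-rows : ∀ lam → sumᴸ (rows lam) ≡ size lam
sum-rows lam = sum-↭ (Perm.↭-reverse (parts lam))

-- The Knop–Sahi formula for the Jack functions.
jackˢ : Partition → ∀ N → Ser N
jackˢ lam N = F (size lam) (empties (rows lam))

jackˢ-symmetric : ∀ lam N → Symmetricˢ (jackˢ lam N)
jackˢ-symmetric lam N i j a = F-relabel (size lam) (empties (rows lam)) i j a ∙
  cong-≈ (λ Q → F (size lam) Q a) (relabel-empties i j (rows lam))

jackˢ-homogeneous : ∀ lam N a → total a ≢ size lam → jackˢ lam N a ≈ 0#
jackˢ-homogeneous lam N a h = F-homogeneous (size lam) (empties (rows lam)) a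
  (h ∘ λ e → e ⊙ cong sumᴸ (lengths-empties′ (rows lam)) ⊙ sum-rows lam)

jack : Partition → Λ
jack lam .coeff a     = jackˢ lam (length a) (fromList a)
jack lam .symmetric   = symmetric-family {jackˢ lam} (jackˢ-symmetric lam)
jack lam .pad a       = symmetric-family {jackˢ lam} (jackˢ-symmetric lam) (↭-sym (Perm.∷↭∷ʳ 0 a)) ∙
  cong-≈ (λ Q → F (size lam) Q (0 ∷ fromList a)) (≡.sym (liftQ-empties (rows lam))) ∙
    F-lift (size lam) (empties (rows lam)) (fromList a)
jack lam .bounded = size lam , λ a l → jackˢ-homogeneous lam (length a) (fromList a)
  (λ e → ℕ.<-irrefl (≡.sym e ⊙ total-fromList a) l)

jack-homogeneous : ∀ lam a → sumᴸ a ≢ size lam → coeff (jack lam) a ≈ 0#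
jack-homogeneous lam a h = jackˢ-homogeneous lam (length a) (fromList a) (h ∘ ≡.trans (≡.sym (total-fromList a)))

-- Triangularity in the dominance order

data Proper {N} : Queue N → Set where
  []   : Proper []
  skip : ∀ {l Q} → Proper Q → Proper ((l , nothing) ∷ Q)
  _∷_  : ∀ {l b Q} → has b Q ≡ false → Proper Q → Proper ((l , just b) ∷ Q)

proper-∷ʳ : ∀ {N} {Q : Queue N} {l k} → Proper Q → has k Q ≡ false → Proper (Q ∷ʳ (l , just k))
proper-∷ʳ []       h = ≡.refl ∷ []
proper-∷ʳ (skip p) h = skip (proper-∷ʳ p h)
proper-∷ʳ {k = k} (_∷_ {b = b} {Q} e p) h with k Fin.≟ b
... | no k≢b = has-∷ʳ-false Q _ e (k≢b ∘ ≡.sym) ∷ proper-∷ʳ p h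

proper-tail : ∀ {N} {x} {Q : Queue N} → Proper (x ∷ Q) → Proper Q
proper-tail (skip p) = p
proper-tail (_ ∷ p)  = p

proper-fresh : ∀ {N} {l b} {Q : Queue N} → Proper ((l , b) ∷ Q) → ∀ k → has k Q ≡ false ⊎ b ≡ just k → has k Q ≡ false
proper-fresh p       k (inj₁ h)      = h
proper-fresh (h ∷ p) k (inj₂ ≡.refl) = h

proper-empties : ∀ {N} ls → Proper {N} (empties ls)
proper-empties []       = []
proper-empties (l ∷ ls) = skip (proper-empties ls)

module Dominance {N : ℕ} (A : Fin N → Bool) where

  used : Queue N → ℕ
  used []                  = 0
  used ((_ , nothing) ∷ Q) = used Q
  used ((_ , just b)  ∷ Q) = bit (A b) ℕ.+ used Q

  used-∷ʳ : ∀ Q l k → used (Q ∷ʳ (l , just k)) ≡ bit (A k) ℕ.+ used Q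
  used-∷ʳ []                  l k = ≡.refl
  used-∷ʳ ((_ , nothing) ∷ Q) l k = used-∷ʳ Q l k
  used-∷ʳ ((_ , just b)  ∷ Q) l k = cong (bit (A b) ℕ.+_) (used-∷ʳ Q l k) ⊙ ℕ+.x∙yz≈y∙xz (bit (A b)) (bit (A k)) (used Q)

weigh : ∀ {N} → (Fin N → Bool) → Vec ℕ N → ℕ
weigh A []      = 0
weigh A (n ∷ a) = (if A zero then n else 0) ℕ.+ weigh (A ∘ suc) a

weigh-≔ : ∀ {N} (A : Fin N → Bool) (a : Vec ℕ N) k {i} → lookup a k ≡ suc i →
          weigh A a ≡ bit (A k) ℕ.+ weigh A (a [ k ]≔ i)
weigh-≔ A (.(suc i) ∷ a) zero {i} ≡.refl with A zero
... | true  = ≡.refl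
... | false = ≡.refl
weigh-≔ A (n ∷ a) (suc k) e = cong ((if A zero then n else 0) ℕ.+_) (weigh-≔ (A ∘ suc) a k e) ⊙
  ℕ+.x∙yz≈y∙xz (if A zero then n else 0) (if A (suc k) then 1 else 0) _

weigh-zero : ∀ {N} (A : Fin N → Bool) (a : Vec ℕ N) → isZero a ≡ true → weigh A a ≡ 0
weigh-zero A []         e = ≡.refl
weigh-zero A (zero ∷ a) e with A zero
... | true  = weigh-zero (A ∘ suc) a e
... | false = weigh-zero (A ∘ suc) a e

card : ∀ {N} → (Fin N → Bool) → ℕ
card {zero}  A = 0
card {suc N} A = bit (A zero) ℕ.+ card (A ∘ suc)

card-cong : ∀ {N} {A B : Fin N → Bool} → (∀ k → A k ≡ B k) → card A ≡ card B
card-cong {zero}  e = ≡.refl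
card-cong {suc N} {A} {B} e = cong₂ ℕ._+_ (cong (λ b → if b then 1 else 0) (e zero))
  (card-cong {A = A ∘ suc} {B ∘ suc} (e ∘ suc))

without : ∀ {N} → (Fin N → Bool) → Fin N → Fin N → Bool
without A b k = if does (k Fin.≟ b) then false else A k

card-without : ∀ {N} (A : Fin N → Bool) b → bit (A b) ℕ.+ card (without A b) ≡ card A
card-without {suc N} A zero    = cong (bit (A zero) ℕ.+_) (card-cong {A = without A zero ∘ suc} {A ∘ suc} λ k → ≡.refl)
card-without {suc N} A (suc b) = ℕ+.x∙yz≈y∙xz (bit (A (suc b))) (bit (A zero)) _ ⊙
  cong (bit (A zero) ℕ.+_) (cong (bit (A (suc b)) ℕ.+_) (card-cong {A = without A (suc b) ∘ suc} {without (A ∘ suc) b} λ k → ≡.refl) ⊙ card-without (A ∘ suc) b)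

open Dominance using (used; used-∷ʳ)

used≤card : ∀ {N} (A : Fin N → Bool) {Q} → Good Q → used A Q ≤ card A
used≤card A []                    = ℕ.z≤n
used≤card A (_∷_ {b = b} {Q} h g) = subst₂ _≤_ (cong (bit (A b) ℕ.+_) (agree Q h)) (card-without A b)
  (ℕ.+-monoʳ-≤ (bit (A b)) (used≤card (without A b) g))
  where
  agree : ∀ Q → has b Q ≡ false → used (without A b) Q ≡ used A Q
  agree []                  h = ≡.refl
  agree ((_ , nothing) ∷ Q) h = agree Q h
  agree ((_ , just c)  ∷ Q) h with ∨-false {does (b Fin.≟ c)} h
  ... | b≢c , h′ = cong₂ ℕ._+_ (cong (λ x → if (if x then false else A c) then 1 else 0) (dec-false (c Fin.≟ b) (≟-false b≢c ∘ ≡.sym))) (agree Q h′)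

used≤length : ∀ {N} (A : Fin N → Bool) Q → used A Q ≤ length Q
used≤length A []                  = ℕ.z≤n
used≤length A ((_ , nothing) ∷ Q) = ℕ.m≤n⇒m≤1+n (used≤length A Q)
used≤length A ((_ , just b)  ∷ Q) with A b
... | true  = ℕ.s≤s (used≤length A Q)
... | false = ℕ.m≤n⇒m≤1+n (used≤length A Q)

-- The lists used here ascend, so the reversed list begins with the longest rows.
top : ℕ → List ℕ → ℕ
top k ls = sumᴸ (take k (reverse ls))

-- A full column adds one box to each of the k longest rows, as far as there are so many.
top-suc : ∀ k ls → top k (map suc ls) ≡ top k ls ℕ.+ (k ℕ.⊓ length ls)
top-suc k ls = cong (sumᴸ ∘ take k) (≡.sym (List.reverse-map suc ls)) ⊙
  go k (reverse ls) ⊙ cong (λ n → top k ls ℕ.+ (k ℕ.⊓ n)) (List.length-reverse ls)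
  where
  go : ∀ k xs → sumᴸ (take k (map suc xs)) ≡ sumᴸ (take k xs) ℕ.+ (k ℕ.⊓ length xs)
  go zero    xs       = ≡.refl
  go (suc k) []       = ≡.refl
  go (suc k) (x ∷ xs) = cong suc (cong (x ℕ.+_) (go k xs) ⊙ ≡.sym (ℕ.+-assoc x _ _)) ⊙ ≡.sym (ℕ.+-suc _ _)

top-zero : ∀ k ls → top k (0 ∷ ls) ≡ top k ls
top-zero k ls = cong (sumᴸ ∘ take k) (List.unfold-reverse 0 ls) ⊙ go k (reverse ls)
  where
  go : ∀ k xs → sumᴸ (take k (xs ∷ʳ 0)) ≡ sumᴸ (take k xs)
  go zero    xs       = ≡.refl
  go (suc k) []       = cong sumᴸ (List.take-[] k)
  go (suc k) (x ∷ xs) = cong (x ℕ.+_) (go k xs)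

linked-positive : ∀ {l ls} → Linked _≤_ (suc l ∷ ls) → All (1 ≤_) ls
linked-positive [-]       = []
linked-positive (p ∷ q) with ℕ.≤-trans ℕ.z<s p
linked-positive {ls = suc l ∷ ls} (p ∷ q) | _ = ℕ.z<s ∷ linked-positive q

module _ {N : ℕ} (A : Fin N → Bool) where

  private
    k₀ = card A
    usd : Queue N → ℕ
    usd = used A

  -- The state before a column. In a column the variables of A occupy at most card A boxes and at
  -- most one per row; over all columns this adds up to the content of the card A longest rows.
  dominance-fresh : ∀ n (Q : Queue N) a → Proper Q → Linked _≤_ (lengths Q) → top k₀ (lengths Q) < weigh A a → F n Q a ≈ 0#
  -- The state within a column, D being the rows already served: `map suc` restores their boxes, and
  -- `usd` counts the labels of A spent on them.
  dominance-mid : ∀ n (td D : Queue N) a → Proper (td ++ D) → Good D → All (1 ≤_) (lengths td) →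
    Linked _≤_ (map suc (lengths D) ++ lengths td) →
    top k₀ (map suc (lengths D) ++ lengths td) < weigh A a ℕ.+ usd D → F n (td ++ D) a ≈ 0#

  dominance-fresh n [] a p s l with isZero a in e
  ... | false = refl
  ... | true  = contradiction (subst (top k₀ [] <_) (weigh-zero A a e) l) ℕ.n≮0
  dominance-fresh n ((zero , b) ∷ Q) a p s l = dominance-fresh n Q a (proper-tail p) (Linked.tail s)
    (subst (_< weigh A a) (top-zero k₀ (lengths Q)) l)
  dominance-fresh zero    ((suc l , b) ∷ Q) a p s h = refl
  dominance-fresh (suc n) ((suc l , b) ∷ Q) a p s h = F-step-vanish n l b Q a λ k c i e →
    dominance-mid n Q ((l , just k) ∷ []) (a [ k ]≔ i) (proper-∷ʳ (proper-tail p) (proper-fresh p k c)) (≡.refl ∷ [])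
      (linked-positive s) s
      (subst (top k₀ (lengths ((suc l , b) ∷ Q)) <_) (weigh-≔ A a k e ⊙ ℕ.+-comm (bit (A k)) _ ⊙
        cong (weigh A (a [ k ]≔ i) ℕ.+_) (≡.sym (ℕ.+-identityʳ _))) h)

  dominance-mid n [] D a p g pos s h = dominance-fresh n D a p
    (Linked.map ℕ.s≤s⁻¹ (Linked.map⁻ (subst (Linked _≤_) (List.++-identityʳ (map suc (lengths D))) s)))
    (ℕ.+-cancelʳ-< (k₀ ℕ.⊓ length D) _ _ (ℕ.<-≤-trans
      (subst (_< weigh A a ℕ.+ usd D) (cong (top k₀) (List.++-identityʳ (map suc (lengths D))) ⊙
        top-suc k₀ (lengths D) ⊙ cong (λ x → top k₀ (lengths D) ℕ.+ (k₀ ℕ.⊓ x)) (List.length-map proj₁ D)) h)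
      (ℕ.+-monoʳ-≤ (weigh A a) (ℕ.⊓-glb (used≤card A g) (used≤length A D)))))
  dominance-mid n       ((zero  , b) ∷ td) D a p g (() ∷ _) s h
  dominance-mid zero    ((suc l , b) ∷ td) D a p g pos s h = refl
  dominance-mid (suc n) ((suc l , b) ∷ td) D a p g (_ ∷ pos) s h = F-step-vanish n l b (td ++ D) a λ k c i e →
    let k∉ = proper-fresh p k c
        k∉D = proj₂ (∨-false {has k td} (≡.sym (has-++ k td D) ⊙ k∉))
        same = cong (λ ls → map suc ls ++ lengths td) (List.map-++ proj₁ D _) ⊙
                 cong (_++ lengths td) (List.map-++ suc (lengths D) (l ∷ [])) ⊙ List.++-assoc (map suc (lengths D)) (suc l ∷ []) (lengths td)
    in trans (cong-≈ (λ Q → F n Q (a [ k ]≔ i)) (List.++-assoc td D _))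
      (dominance-mid n td (D ∷ʳ (l , just k)) (a [ k ]≔ i)
        (subst Proper (List.++-assoc td D _) (proper-∷ʳ (proper-tail p) k∉)) (good-∷ʳ g k∉D) pos
        (subst (Linked _≤_) (≡.sym same) s)
        (subst₂ _<_ (cong (top k₀) (≡.sym same)) (cong (ℕ._+ usd D) (weigh-≔ A a k e) ⊙
          ℕ+.xy∙z≈y∙xz (bit (A k)) _ (usd D) ⊙ cong (weigh A (a [ k ]≔ i) ℕ.+_) (≡.sym (used-∷ʳ A D l k))) h))

initial : ℕ → ∀ {N} → Fin N → Bool
initial c k = does (suc (toℕ k) ℕ.≤? c)

weigh-first : ∀ c a → weigh (initial c) (fromList a) ≡ sumᴸ (take c a)
weigh-first zero    []      = ≡.refl
weigh-first zero    (n ∷ a) = none (fromList a)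
  where
  none : ∀ {N} (a : Vec ℕ N) → weigh (λ _ → false) a ≡ 0
  none []      = ≡.refl
  none (n ∷ a) = none a
weigh-first (suc c) []      = ≡.refl
weigh-first (suc c) (n ∷ a) = cong (n ℕ.+_) (weigh-first c a)

card-first : ∀ c N → card (initial c {N}) ≤ c
card-first zero    zero    = ℕ.z≤n
card-first zero    (suc N) = card-first zero N
card-first (suc c) zero    = ℕ.z≤n
card-first (suc c) (suc N) = ℕ.s≤s (card-first c N)

sum-take-mono : ∀ {k k′} xs → k ≤ k′ → sumᴸ (take k xs) ≤ sumᴸ (take k′ xs)
sum-take-mono xs       ℕ.z≤n     = ℕ.z≤n
sum-take-mono []       (ℕ.s≤s l) = ℕ.z≤n
sum-take-mono (x ∷ xs) (ℕ.s≤s l) = ℕ.+-monoʳ-≤ x (sum-take-mono xs l)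

rows-ascending : ∀ lam → Linked _≤_ (rows lam)
rows-ascending lam = go (parts lam) [] (decreasing lam) [] tt
  where
  Below : List ℕ → List ℕ → Set
  Below _       []      = ⊤
  Below []      (_ ∷ _) = ⊤
  Below (x ∷ _) (y ∷ _) = x ≤ y
  go : ∀ xs ys → Linked _≥_ xs → Linked _≤_ ys → Below xs ys → Linked _≤_ (xs ʳ++ ys)
  go []           ys       s t b = t
  go (x ∷ [])     []       s t b = [-]
  go (x ∷ [])     (y ∷ ys) s t b = b ∷ t
  go (x ∷ z ∷ xs) []       (p ∷ s) t b = go (z ∷ xs) (x ∷ []) s [-] p
  go (x ∷ z ∷ xs) (y ∷ ys) (p ∷ s) t b = go (z ∷ xs) (x ∷ y ∷ ys) s (b ∷ t) p

jack-dominance : ∀ lam a c → sumᴸ (take c (parts lam)) < sumᴸ (take c a) → coeff (jack lam) a ≈ 0#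
jack-dominance lam a c l = dominance-fresh (initial c) (size lam) (empties (rows lam)) (fromList a) (proper-empties (rows lam))
  (subst (Linked _≤_) (≡.sym (lengths-empties′ (rows lam))) (rows-ascending lam))
  (subst₂ _<_ (cong (λ xs → sumᴸ (take c₀ xs)) (≡.sym (cong reverse (lengths-empties′ (rows lam)) ⊙ List.reverse-involutive (parts lam))))
    (≡.sym (weigh-first c a)) (ℕ.≤-<-trans (sum-take-mono (parts lam) (card-first c (length a))) l))
  where c₀ = card (initial c {length a})

-- The filling in which every row carries a single label contributes a positive leading term.
load : ∀ {N} → List (ℕ × Fin N) → Fin N → ℕ
load []             k = 0
load ((l , b) ∷ I) k = (if does (k Fin.≟ b) then l else 0) ℕ.+ load I k

data Matches {N} : Queue N → List (ℕ × Fin N) → Set where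
  []   : Matches [] []
  skip : ∀ {l b Q I} → Matches Q I → Matches ((l , nothing) ∷ Q) ((l , b) ∷ I)
  _∷_  : ∀ {l} b {Q I} → Matches Q I → Matches ((l , just b) ∷ Q) ((l , b) ∷ I)

named : ∀ {N} → List (ℕ × Fin N) → Queue N
named = map (Prod.map₂ just)

matches⁻ : ∀ {N} {l l′ c b} {Q : Queue N} {I} → Matches ((l , c) ∷ Q) ((l′ , b) ∷ I) → l ≡ l′ × Matches Q I × (c ≡ nothing ⊎ c ≡ just b)
matches⁻ (skip h) = ≡.refl , h , inj₁ ≡.refl
matches⁻ (b ∷ h)  = ≡.refl , h , inj₂ ≡.refl

matches-∷ʳ : ∀ {N} {Q : Queue N} {I} l k → Matches Q I → Matches (Q ∷ʳ (l , just k)) (I ∷ʳ (l , k))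
matches-∷ʳ l k []      = k ∷ []
matches-∷ʳ l k (skip h) = skip (matches-∷ʳ l k h)
matches-∷ʳ l k (b ∷ h)  = b ∷ matches-∷ʳ l k h

matches-fresh : ∀ {N} {Q : Queue N} {I} k → Matches Q I → has k (named I) ≡ false → has k Q ≡ false
matches-fresh k []       e = ≡.refl
matches-fresh k (skip {b = b} h) e = matches-fresh k h (proj₂ (∨-false {does (k Fin.≟ b)} e))
matches-fresh k (b ∷ h)  e with ∨-false {does (k Fin.≟ b)} e
... | p , q = cong₂ _∨_ p (matches-fresh k h q)

load-fresh : ∀ {N} (I : List (ℕ × Fin N)) k → has k (named I) ≡ false → load I k ≡ 0
load-fresh []            k e = ≡.refl
load-fresh ((l , b) ∷ I) k e with ∨-false {does (k Fin.≟ b)} e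
... | p , q = cong₂ ℕ._+_ (cong (λ c → if c then l else 0) p) (load-fresh I k q)

load-∷ʳ : ∀ {N} (I : List (ℕ × Fin N)) l b k → load (I ∷ʳ (l , b)) k ≡ (if does (k Fin.≟ b) then l else 0) ℕ.+ load I k
load-∷ʳ []             l b k = ≡.refl
load-∷ʳ ((m′ , c) ∷ I) l b k = cong ((if does (k Fin.≟ c) then m′ else 0) ℕ.+_) (load-∷ʳ I l b k) ⊙
  ℕ+.x∙yz≈y∙xz (if does (k Fin.≟ c) then m′ else 0) (if does (k Fin.≟ b) then l else 0) _

sum-pos : ∀ {n} (f : Fin n → ℚ⟨α⟩) k → (∀ i → NonNeg (f i)) → Pos (f k) → Pos (sum f)
sum-pos f zero    h p = pos-resp (sym (sum-suc f)) (pos-+-nonneg p (all (f ∘ suc) (h ∘ suc)))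
  where
  all : ∀ {n} (f : Fin n → ℚ⟨α⟩) → (∀ i → NonNeg (f i)) → NonNeg (sum f)
  all {zero}  f h = inj₁ (sum-0 f)
  all {suc n} f h = nonneg-resp (sym (sum-suc f)) (nonneg-+ (h zero) (all (f ∘ suc) (h ∘ suc)))
sum-pos f (suc k) h p = pos-resp (sym (sum-suc f)) (nonneg-+-pos (h zero) (sum-pos (f ∘ suc) k (h ∘ suc) p))

-- All other fillings contribute nonnegatively, so nothing can cancel the term of this filling.
leading : ∀ n {N} {Q : Queue N} {I} a → Matches Q I → Good (named I) → boxes Q ≡ n → (∀ k → lookup a k ≡ load I k) → Pos (F n Q a)
leading n {Q = []} a [] g e h rewrite lookup-isZero a h = pos-1
leading n {Q = (zero , c) ∷ Q} {(_ , b) ∷ I} a M (_ ∷ g) e h with matches⁻ M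
... | ≡.refl , M′ , _ = leading n a M′ g e λ k → h k ⊙ dropped k
  where
  dropped : ∀ k → (if does (k Fin.≟ b) then 0 else 0) ℕ.+ load I k ≡ load I k
  dropped k with does (k Fin.≟ b)
  ... | true  = ≡.refl
  ... | false = ≡.refl
leading (suc n) {N} {(suc l , c) ∷ Q} {(_ , b) ∷ I} a M (b∉ ∷ g) e h with matches⁻ M
... | ≡.refl , M′ , which = go which
  where
  exponent : lookup a b ≡ suc l
  exponent = h b ⊙ cong₂ (λ x y → (if x then suc l else 0) ℕ.+ y) (dec-true (b Fin.≟ b) ≡.refl) (load-fresh I b b∉) ⊙ ℕ.+-identityʳ (suc l)
  each : ∀ k → NonNeg (X k (F n (Q ∷ʳ (l , just k))) a)
  each k = nip-nonneg (nip-X k (F n (Q ∷ʳ (l , just k))) a (nip-F n (Q ∷ʳ (l , just k))))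
  terms : ∀ k → NonNeg (unless (has k Q) (X k (F n (Q ∷ʳ (l , just k))) a))
  terms k with has k Q
  ... | true  = inj₁ refl
  ... | false = each k
  next : ∀ k → lookup (a [ b ]≔ l) k ≡ load (I ∷ʳ (l , b)) k
  next k = lookup-≔ a b l k ⊙ ≡.sym (load-∷ʳ I l b k ⊙ cases (k Fin.≟ b))
    where
    cases : (d : Dec (k ≡ b)) → (if does d then l else 0) ℕ.+ load I k ≡ (if does d then l else lookup a k)
    cases (yes ≡.refl) = cong (l ℕ.+_) (load-fresh I b b∉) ⊙ ℕ.+-identityʳ l
    cases (no k≢b) = ≡.sym (h k ⊙ cong (λ x → (if x then suc l else 0) ℕ.+ load I k) (dec-false (k Fin.≟ b) k≢b))
  chosen : Pos (X b (F n (Q ∷ʳ (l , just b))) a)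
  chosen = pos-resp (sym (onPred-≡ exponent (λ i → refl)))
    (leading n (a [ b ]≔ l) (matches-∷ʳ l b M′) (subst Good (≡.sym (List.map-++ _ I _)) (good-∷ʳ g b∉))
      (boxes-∷ʳ Q l (just b) ⊙ ℕ.suc-injective e) next)
  go : c ≡ nothing ⊎ c ≡ just b → Pos (F (suc n) ((suc l , c) ∷ Q) a)
  go (inj₁ ≡.refl) = pos-+-nonneg (sum-pos (λ k → unless (has k Q) (X k (F n (Q ∷ʳ (l , just k))) a)) b terms
      (pos-resp (cong-≈ (λ x → unless x (X b (F n (Q ∷ʳ (l , just b))) a)) (≡.sym (matches-fresh b M′ b∉))) chosen))
    (inj₁ (zeroʳ (κ l Q)))
  go (inj₂ ≡.refl) = nonneg-+-pos (nonneg-sum terms) (pos-* κ-pos chosen)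
    where
    nonneg-sum : ∀ {n} {f : Fin n → ℚ⟨α⟩} → (∀ i → NonNeg (f i)) → NonNeg (sum f)
    nonneg-sum {zero}  h = inj₁ (sum-0 _)
    nonneg-sum {suc n} h = nonneg-resp (sym (sum-suc _)) (nonneg-+ (h zero) (nonneg-sum (h ∘ suc)))
    κ-pos : Pos (κ l Q)
    κ-pos = pos-+-nonneg (pos-* pos-α (pos-ν l)) (nonneg-ν (shorter l Q))

indexed : (xs : List ℕ) → List (ℕ × Fin (length xs))
indexed []       = []
indexed (x ∷ xs) = (x , zero) ∷ map (Prod.map₂ suc) (indexed xs)

jack-leading : ∀ lam → Pos ([m lam ] jack lam)
jack-leading lam = pos-resp (symmetric (jack lam) (Perm.↭-reverse (parts lam)))
  (leading (size lam) (fromList (rows lam)) (matches (rows lam)) (good (rows lam))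
    (cong sumᴸ (lengths-empties′ (rows lam)) ⊙ sum-rows lam) (loads (rows lam)))
  where
  shift-load-zero : ∀ {N} (I : List (ℕ × Fin N)) → load (map (Prod.map₂ suc) I) zero ≡ 0
  shift-load-zero []      = ≡.refl
  shift-load-zero (_ ∷ I) = shift-load-zero I
  shift-load-suc : ∀ {N} (I : List (ℕ × Fin N)) k → load (map (Prod.map₂ suc) I) (suc k) ≡ load I k
  shift-load-suc []            k = ≡.refl
  shift-load-suc ((l , b) ∷ I) k = cong ((if does (k Fin.≟ b) then l else 0) ℕ.+_) (shift-load-suc I k)
  loads : ∀ xs k → lookup (fromList xs) k ≡ load (indexed xs) k
  loads (x ∷ xs) zero    = ≡.sym (cong (x ℕ.+_) (shift-load-zero (indexed xs)) ⊙ ℕ.+-identityʳ x)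
  loads (x ∷ xs) (suc k) = loads xs k ⊙ ≡.sym (shift-load-suc (indexed xs) k)
  named-shift : ∀ {N} (I : List (ℕ × Fin N)) → named (map (Prod.map₂ suc) I) ≡ liftQ (named I)
  named-shift []      = ≡.refl
  named-shift (_ ∷ I) = cong (_ ∷_) (named-shift I)
  zero-fresh : ∀ {N} (I : List (ℕ × Fin N)) → has zero (liftQ (named I)) ≡ false
  zero-fresh []      = ≡.refl
  zero-fresh (_ ∷ I) = zero-fresh I
  good-lift : ∀ {N} (I : List (ℕ × Fin N)) → Good (named I) → Good (liftQ (named I))
  good-lift []            []      = []
  good-lift ((_ , b) ∷ I) (h ∷ g) = ≡.trans (has-liftQ b (named I)) h ∷ good-lift I g
  good : ∀ xs → Good (named (indexed xs))
  good []       = []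
  good (x ∷ xs) = ≡.trans (cong (has zero) (named-shift (indexed xs))) (zero-fresh (indexed xs)) ∷
    subst Good (≡.sym (named-shift (indexed xs))) (good-lift (indexed xs) (good xs))
  matches-lift : ∀ {N} {ls} {I : List (ℕ × Fin N)} → Matches (empties ls) I → Matches (empties ls) (map (Prod.map₂ suc) I)
  matches-lift {ls = []}     []       = []
  matches-lift {ls = l ∷ ls} (skip h) = skip (matches-lift h)
  matches : ∀ xs → Matches (empties xs) (indexed xs)
  matches []       = []
  matches (x ∷ xs) = skip (matches-lift (matches xs))

-- The sum of squares of Dunkl operators in power sums

Xs : ℕ → ∀ {N} → Fin N → Ser N → Ser N
Xs zero    r f = f
Xs (suc k) r f = X r (Xs k r f)

module _ {N : ℕ} where

  Xs-cong : ∀ k r {f g : Ser N} → f ≐ g → Xs k r f ≐ Xs k r g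
  Xs-cong zero    r e = e
  Xs-cong (suc k) r e = X-cong r (Xs-cong k r e)

  Xs-+ : ∀ k l r (f : Ser N) → Xs k r (Xs l r f) ≡ Xs (k ℕ.+ l) r f
  Xs-+ zero    l r f = ≡.refl
  Xs-+ (suc k) l r f = cong (X r) (Xs-+ k l r f)

  Xs-S : ∀ k {i j} {f : Ser N} → Symmetricˢ f → S i j (Xs k i f) ≐ Xs k j f
  Xs-S zero    {i} {j} s a = s i j a
  Xs-S (suc k) {i} {j} {f} s a = X-S i j i (Xs k i f) a ∙ cong-≈ (λ k′ → X k′ (S i j (Xs k i f)) a) (transpose-left i j) ∙
    X-cong j (Xs-S k s) a

  X-Σ< : ∀ r n (f : ℕ → Ser N) a → X r (λ b → Σ< n (λ i → f i b)) a ≈ Σ< n (λ i → X r (f i) a)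
  X-Σ< r zero    f a = X-zero r a
  X-Σ< r (suc n) f a = X-+ r (f 0) (λ b → Σ< n (λ i → f (suc i) b)) a ∙ +-congˡ {X r (f 0) a} (X-Σ< r n (f ∘ suc) a)

  Xs-Σ< : ∀ k r n (f : ℕ → Ser N) a → Xs k r (λ b → Σ< n (λ i → f i b)) a ≈ Σ< n (λ i → Xs k r (f i) a)
  Xs-Σ< zero    r n f a = refl
  Xs-Σ< (suc k) r n f a = X-cong r (Xs-Σ< k r n f) a ∙ X-Σ< r n (λ i → Xs k r (f i)) a

  U-Σ< : ∀ r n (f : ℕ → Ser N) a → U r (λ b → Σ< n (λ i → f i b)) a ≈ Σ< n (λ i → U r (f i) a)
  U-Σ< r zero    f a = U-zero r a
  U-Σ< r (suc n) f a = U-+ r (f 0) (λ b → Σ< n (λ i → f (suc i) b)) a ∙ +-congˡ {U r (f 0) a} (U-Σ< r n (f ∘ suc) a)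

  sum-Σ< : ∀ {m} n (f : Fin m → ℕ → ℚ⟨α⟩) → sum (λ r → Σ< n (f r)) ≈ Σ< n (λ i → sum (λ r → f r i))
  sum-Σ< zero    f = sum-zero λ _ → refl
  sum-Σ< (suc n) f = ∑-distrib-+ (λ r → f r 0) (λ r → Σ< n (f r ∘ suc)) ∙ +-congˡ {sum (λ r → f r 0)} (sum-Σ< n (λ r → f r ∘ suc))

  Xs-explicit : ∀ k r (f : Ser N) a → Xs k r f a ≈ (if does (k ℕ.≤? lookup a r) then f (a [ r ]≔ (lookup a r ∸ k)) else 0#)
  Xs-explicit zero    r f a = cong-≈ f (≡.sym (Vec.[]≔-lookup a r))
  Xs-explicit (suc k) r f a = go (lookup a r) ≡.refl
    where
    go : ∀ m → lookup a r ≡ m → onPred m (λ n → Xs k r f (a [ r ]≔ n)) ≈ (if does (suc k ℕ.≤? m) then f (a [ r ]≔ (m ∸ suc k)) else 0#)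
    go zero    e = refl
    go (suc m) e = Xs-explicit k r f (a [ r ]≔ m) ∙
      reflexive (cong₂ (λ x b → if does (k ℕ.≤? x) then f b else 0#) (Vec.lookup∘update r a m)
        (Vec.[]≔-idempotent a r ⊙ cong (λ x → a [ r ]≔ (x ∸ k)) (Vec.lookup∘update r a m))) ∙
        cong-≈ (λ b → if b then f (a [ r ]≔ (m ∸ k)) else 0#) (≤?-suc k m)

  powers : ℕ → Ser N → Ser N
  powers k g a = sum (λ j → Xs k j g a)

  -- Iterated commutation with x_r. Since g is symmetric, s_rj turns x_r^i g into x_j^i g; the sum
  -- over j ≠ r is p_i g less the term j = r, which lowers α to α - 1, and N is p_0.
  U-Xs : ∀ k r {g : Ser N} → Symmetricˢ g → ∀ a →
    U r (Xs (suc k) r g) a ≈ (Xs (suc k) r (U r g) a + (ν (suc k) * (α - 1#) + ν N) * Xs (suc k) r g a)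
      + Σ< k (λ j → Xs (suc (k ∸ suc j)) r (powers (suc j) g) a)
  U-Xs zero r {g} s a = U-X-self r g a ∙ +-congˡ {X r (U r g) a} (+-congˡ {α * X r g a} others) ∙
    solve 4 (λ u α x n → u :+ (α :* x :+ (n :* x :- x)) := (u :+ ((:1 :+ :0) :* (α :- :1) :+ n) :* x) :+ :0) refl (X r (U r g) a) α (X r g a) (ν N)
    where
    others : sum (λ j → unless (does (j Fin.≟ r)) (X r (S r j g) a)) ≈ ν N * X r g a - X r g a
    others = (sum-cong λ j → unless-cong (does (j Fin.≟ r)) (X-cong r (s r j) a)) ∙ sum-unless-δ r (λ _ → X r g a) ∙ +-congʳ { - X r g a} (sum-const N (X r g a))
  U-Xs (suc k) r {g} s a = begin
    U r (X r G) a
      ≈⟨ U-X-self r G a ⟩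
    X r (U r G) a + (α * X r G a + sum (λ j → unless (does (j Fin.≟ r)) (X r (S r j G) a)))
      ≈⟨ +-cong inner (+-congˡ {α * X r G a} others) ⟩
    ((X r (Xs (suc k) r (U r g)) a + c * X r G a) + Σ< k (λ j → X r (Y j) a)) + (α * X r G a + (X r (powers (suc k) g) a - X r G a))
      ≈⟨ solve 7 (λ u k α n x y z → ((u :+ (k :* (α :- :1) :+ n) :* x) :+ y) :+ (α :* x :+ (z :- x)) := (u :+ ((:1 :+ k) :* (α :- :1) :+ n) :* x) :+ (y :+ z))
           refl (X r (Xs (suc k) r (U r g)) a) (ν (suc k)) α (ν N) (X r G a) (Σ< k (λ j → X r (Y j) a)) (X r (powers (suc k) g) a) ⟩
    (X r (Xs (suc k) r (U r g)) a + (ν (suc (suc k)) * (α - 1#) + ν N) * X r G a) + (Σ< k (λ j → X r (Y j) a) + X r (powers (suc k) g) a)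
      ≈⟨ +-congˡ {X r (Xs (suc k) r (U r g)) a + (ν (suc (suc k)) * (α - 1#) + ν N) * X r G a} tail ⟨
    (X r (Xs (suc k) r (U r g)) a + (ν (suc (suc k)) * (α - 1#) + ν N) * X r G a) + Σ< (suc k) (λ j → Xs (suc (k ∸ j)) r (powers (suc j) g) a) ∎
    where
    G = Xs (suc k) r g
    c = ν (suc k) * (α - 1#) + ν N
    Y : ℕ → Ser N
    Y j = Xs (suc (k ∸ suc j)) r (powers (suc j) g)
    inner : X r (U r G) a ≈ (X r (Xs (suc k) r (U r g)) a + c * X r G a) + Σ< k (λ j → X r (Y j) a)
    inner = X-cong r (U-Xs k r s) a ∙ X-+ r (λ b → Xs (suc k) r (U r g) b + c * G b) (λ b → Σ< k (λ j → Y j b)) a ∙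
      +-cong (X-+ r (Xs (suc k) r (U r g)) (λ b → c * G b) a ∙ +-congˡ {X r (Xs (suc k) r (U r g)) a} (X-* r c G a)) (X-Σ< r k Y a)
    others : sum (λ j → unless (does (j Fin.≟ r)) (X r (S r j G) a)) ≈ X r (powers (suc k) g) a - X r G a
    others = (sum-cong λ j → unless-cong (does (j Fin.≟ r)) (X-cong r (Xs-S (suc k) s) a)) ∙
      sum-unless-δ r (λ j → X r (Xs (suc k) j g) a) ∙ +-congʳ { - X r G a} (sym (X-sum r (λ j → Xs (suc k) j g) a))
    tail : Σ< (suc k) (λ j → Xs (suc (k ∸ j)) r (powers (suc j) g) a) ≈ Σ< k (λ j → X r (Y j) a) + X r (powers (suc k) g) a
    tail = Σ<-last k (λ j → Xs (suc (k ∸ j)) r (powers (suc j) g) a) ∙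
      +-cong (Σ<-cong k λ j j<k → cong-≈ (λ x → Xs (suc x) r (powers (suc j) g) a) (≡.sym (ℕ.suc-pred (k ∸ j) {{ℕ.>-nonZero (ℕ.m<n⇒0<n∸m j<k)}} ⟨≡⟩ cong suc (ℕ.pred[m∸n]≡m∸[1+n] k j))))
                (cong-≈ (λ x → Xs (suc x) r (powers (suc k) g) a) (ℕ.n∸n≡0 k))
      where
      _⟨≡⟩_ : ∀ {x y z : ℕ} → y ≡ x → y ≡ z → z ≡ x
      p ⟨≡⟩ q = ≡.sym q ⊙ p

restrict : Λ → ∀ {N} → Ser N
restrict f a = coeff f (toList a)

rest : ∀ {N} → Vec ℕ N → Fin N → List ℕ
rest (x ∷ a) zero    = toList a
rest (x ∷ a) (suc r) = x ∷ rest a r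

rest-↭ : ∀ {N} (a : Vec ℕ N) r x → toList (a [ r ]≔ x) ↭ x ∷ rest a r
rest-↭ (y ∷ a) zero    x = Perm.refl
rest-↭ (y ∷ a) (suc r) x = Perm.trans (Perm.prep y (rest-↭ a r x)) (Perm.swap y x Perm.refl)

lookup-↭ : ∀ {N} (a : Vec ℕ N) r → toList a ↭ lookup a r ∷ rest a r
lookup-↭ a r = subst (λ b → toList b ↭ lookup a r ∷ rest a r) (Vec.[]≔-lookup a r) (rest-↭ a r (lookup a r))

swapᵛ-↭ : ∀ {N} (i j : Fin N) (a : Vec ℕ N) → toList (swapᵛ i j a) ↭ toList a
swapᵛ-↭ i j a = go (i Fin.≟ j)
  where
  x = lookup a i
  y = lookup a j
  two : ∀ {N} (a : Vec ℕ N) {i j} → i ≢ j → ∃ λ l → ∀ p q → toList ((a [ i ]≔ p) [ j ]≔ q) ↭ p ∷ q ∷ l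
  two (z ∷ a) {zero}  {zero}  h = contradiction ≡.refl h
  two (z ∷ a) {zero}  {suc j} h = rest a j , λ p q → Perm.prep p (rest-↭ a j q)
  two (z ∷ a) {suc i} {zero}  h = rest a i , λ p q → ↭-trans (Perm.prep q (rest-↭ a i p)) (Perm.swap q p Perm.refl)
  two (z ∷ a) {suc i} {suc j} h with two a {i} {j} (h ∘ cong suc)
  ... | l , e = z ∷ l , λ p q → ↭-trans (Perm.prep z (e p q)) (↭-trans (Perm.swap z p Perm.refl) (Perm.prep p (Perm.swap z q Perm.refl)))
  fixed : ∀ k → Dec (k ≡ i) → transpose i i k ≡ k
  fixed k (yes ≡.refl) = transpose-left k k
  fixed k (no k≢i)     = transpose-other i i k≢i k≢i
  go : Dec (i ≡ j) → toList (swapᵛ i j a) ↭ toList a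
  go (yes ≡.refl) = Perm.↭-reflexive (cong toList (vec-ext λ k → lookup-swapᵛ i i a k ⊙ cong (lookup a) (fixed k (k Fin.≟ i))))
  go (no i≢j) = ↭-trans (Perm.↭-reflexive (cong toList (cong (swapᵛ i j) (≡.sym (Vec.[]≔-lookup a i)) ⊙ swapᵛ-updated i≢j a x)))
    (↭-trans (proj₂ (two a i≢j) y x) (↭-trans (Perm.swap y x Perm.refl) (↭-trans (↭-sym (proj₂ (two a i≢j) x y))
      (Perm.↭-reflexive (cong toList (cong (_[ j ]≔ y) (Vec.[]≔-lookup a i) ⊙ Vec.[]≔-lookup a j))))))

restrict-symmetric : ∀ f {N} → Symmetricˢ (restrict f {N})
restrict-symmetric f i j a = symmetric f (swapᵛ-↭ i j a)

timesPower-restrict : ∀ k (F : Coeffs) {N} (a : Vec ℕ N) → sum (λ r → Xs k r (F ∘ toList) a) ≈ timesPower k F (toList a)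
timesPower-restrict k F []      = sum-0 _
timesPower-restrict k F (n ∷ a) = sum-suc _ ∙ +-cong (Xs-explicit k zero (F ∘ toList) (n ∷ a))
  ((sum-cong λ r → Xs-explicit k (suc r) (F ∘ toList) (n ∷ a) ∙ sym (Xs-explicit k r ((F ∘ (n ∷_)) ∘ toList) a)) ∙
    timesPower-restrict k (F ∘ (n ∷_)) a)

powers-restrict : ∀ k h {N} (a : Vec ℕ N) → powers (suc k) (restrict h) a ≈ restrict (power (suc k) *Λ h) a
powers-restrict k h a = timesPower-restrict (suc k) (coeff h) a ∙ sym (convolve-power k (coeff h) (toList a))

Homogeneous : ℕ → Λ → Set
Homogeneous n f = ∀ a → sumᴸ a ≢ n → coeff f a ≈ 0#

newton-degree : ∀ {n f d} → Homogeneous n f → Newton f d → ∀ k a → suc k ℕ.+ sumᴸ a ≢ n → coeff (d k) a ≈ 0#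
newton-degree {n} {f} {d} hom nt = <-rec _ λ k ih a h → begin
  coeff (d k) a
    ≈⟨ cong-≈ (λ m → coeff (d k) (m ∷ a)) (ℕ.n∸n≡0 k) ∙ coeff-zero∷ (d k) a ⟨
  coeff (d k) (k ∸ k ∷ a)
    ≈⟨ +-congʳ {coeff (d k) (k ∸ k ∷ a)} (Σ<-zero k λ i i<k → ih i<k (k ∸ i ∷ a) (h ∘ ≡.trans (cong suc (cong (ℕ._+ sumᴸ a) (≡.sym (ℕ.m+[n∸m]≡n (ℕ.<⇒≤ i<k))) ⊙ ℕ.+-assoc i (k ∸ i) (sumᴸ a))))) ∙ +-identityˡ _ ⟨
  Σ< k (λ i → coeff (d i) (suc k ∸ suc i ∷ a)) + coeff (d k) (k ∸ k ∷ a)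
    ≈⟨ Σ<-last k (λ i → coeff (d i) (suc k ∸ suc i ∷ a)) ⟨
  Σ< (suc k) (λ i → coeff (d i) (suc k ∸ suc i ∷ a))
    ≈⟨ nt (suc k) a ⟨
  α * ν (suc k) * coeff f (suc k ∷ a)
    ≈⟨ *-congˡ {α * ν (suc k)} (hom (suc k ∷ a) h) ∙ zeroʳ _ ⟩
  0# ∎

-- On symmetric functions U_r is α x_r ∂/∂x_r, so this is the Newton relation in the variable x_r;
-- homogeneity bounds the sum.
newton-restrict : ∀ {n f d} → Homogeneous n f → Newton f d → ∀ {N} (r : Fin N) a →
                  U r (restrict f) a ≈ Σ< n (λ k → Xs (suc k) r (restrict (d k)) a)
newton-restrict {n} {f} {d} hom nt r a = U-symmetric r (restrict-symmetric f) a ∙ go (sumᴸ (toList a) ℕ.≟ n)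
  where
  x = lookup a r
  g : ℕ → ℚ⟨α⟩
  g k = coeff (d k) (x ∸ suc k ∷ rest a r)
  sum-rest : x ℕ.+ sumᴸ (rest a r) ≡ sumᴸ (toList a)
  sum-rest = ≡.sym (sum-↭ (lookup-↭ a r))
  go : Dec (sumᴸ (toList a) ≡ n) → α * ν x * coeff f (toList a) ≈ Σ< n (λ k → Xs (suc k) r (restrict (d k)) a)
  go (yes e) = *-congˡ {α * ν x} (symmetric f (lookup-↭ a r)) ∙ nt x (rest a r) ∙
    sym (Σ<-restrict n x g (subst (x ≤_) (sum-rest ⊙ e) (ℕ.m≤m+n x _))) ∙
      (Σ<-cong n λ k _ → if-cong (does (suc k ℕ.≤? x)) (sym (symmetric (d k) (rest-↭ a r (x ∸ suc k)))) ∙ sym (Xs-explicit (suc k) r (restrict (d k)) a))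
  go (no h) = *-congˡ {α * ν x} (hom (toList a) h) ∙ zeroʳ _ ∙ sym (Σ<-zero n λ k _ →
    Xs-explicit (suc k) r (restrict (d k)) a ∙ vanish k (suc k ℕ.≤? x))
    where
    vanish : ∀ k (e : Dec (suc k ≤ x)) → (if does e then restrict (d k) (a [ r ]≔ (x ∸ suc k)) else 0#) ≈ 0#
    vanish k (no _)  = refl
    vanish k (yes p) = newton-degree {n} {f} {d} hom nt k _ (h ∘ ≡.trans (≡.sym sum-rest ⊙ cong (ℕ._+ sumᴸ (rest a r)) (≡.sym (ℕ.m+[n∸m]≡n p)) ⊙
      ℕ.+-assoc (suc k) (x ∸ suc k) _ ⊙ cong (suc k ℕ.+_) (≡.sym (sum-↭ (rest-↭ a r (x ∸ suc k))))))

Σ<-diagonals : ∀ n (φ : ℕ → ℕ → ℚ⟨α⟩) → Σ< n (λ s → Σ< s (λ j → φ j (s ∸ suc j))) ≈ Σ< n (λ k → Σ< (n ∸ suc k) (φ k))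
Σ<-diagonals zero    φ = refl
Σ<-diagonals (suc n) φ = +-identityˡ _ ∙ Σ<-+ n (φ 0) (λ s → Σ< s (λ j → φ (suc j) (s ∸ suc j))) ∙ +-congˡ {Σ< n (φ 0)} (Σ<-diagonals n (φ ∘ suc))

Homogeneous-power : ∀ {n} k {h} → (∀ a → suc k ℕ.+ sumᴸ a ≢ n → coeff h a ≈ 0#) → Homogeneous n (power (suc k) *Λ h)
Homogeneous-power k {h} hom a ne = convolve-power k (coeff h) a ∙ (timesPower-degree (suc k) (coeff h) a λ b e → hom b (ne ∘ ≡.trans (≡.sym e)))

-- For a whole family, `toList` and `fromList` cancel without transport along the length.
expand : ∀ {N} (a : Vec ℕ N) (G : Family) → G (length (toList a)) (fromList (toList a)) ≡ G N a
expand []      G = ≡.refl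
expand (x ∷ a) G = expand a (λ n v → G (suc n) (x ∷ v))

restrict-jack : ∀ lam {N} (a : Vec ℕ N) → restrict (jack lam) a ≡ jackˢ lam N a
restrict-jack lam a = expand a (jackˢ lam)

module Operator (𝒮 : JackScalarProduct) where
  open Form 𝒮

  d : Λ → ℕ → Λ
  d f = Perp.d (perp f)

  coefficient : ℕ → ℕ → ℚ⟨α⟩
  coefficient N k = ν (suc k) * (α - 1#) + ν N

  -- The terms p_(k+l) p_k^⊥ p_l^⊥, p_k p_k^⊥ and p_i p_j p_(i+j)^⊥ of the Laplace-Beltrami
  -- operator, all indices being shifted by one.
  quadratic linear cubic : ℕ → Λ → ℕ → ℕ → Λ
  quadratic N f n k = Σ<Λ (n ∸ suc k) (λ l → power (suc k ℕ.+ suc l) *Λ d (d f k) l)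
  linear    N f n k = coefficient N k · (power (suc k) *Λ d f k)
  cubic     N f n k = Σ<Λ k (λ j → power (suc (k ∸ suc j)) *Λ (power (suc j) *Λ d f k))

  -- The sum of the squares of the Dunkl operators in N variables, on symmetric functions of degree n.
  D : ℕ → ℕ → Λ → Λ
  D N n f = Σ<Λ n λ k → (quadratic N f n k +Λ linear N f n k) +Λ cubic N f n k

  d-homogeneous : ∀ {n f} → Homogeneous n f → ∀ k → k < n → Homogeneous (n ∸ suc k) (d f k)
  d-homogeneous {n} {f} hom k k<n a h = newton-degree {n} {f} {d f} hom (Perp.newton (perp f)) k a
    λ e → h (≡.sym (ℕ.m+n∸m≡n (suc k) (sumᴸ a)) ⊙ cong (_∸ suc k) e)

  -- The inner U_r is expanded by the Newton relation, the outer one is moved past the powers of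
  -- x_r, and the sum over r turns these into power sums.
  D-restrict : ∀ {n f} → Homogeneous n f → ∀ {N} (a : Vec ℕ N) → sum (λ r → U r (U r (restrict f)) a) ≈ restrict (D N n f) a
  D-restrict {n} {f} hom {N} a = begin
    sum (λ r → U r (U r (restrict f)) a)
      ≈⟨ sum-cong (λ r → U-cong r (newton-restrict {n} {f} {d f} hom (Perp.newton (perp f)) r) a ∙ U-Σ< r n (λ k → Xs (suc k) r (restrict (d f k))) a) ⟩
    sum (λ r → Σ< n (λ k → U r (Xs (suc k) r (restrict (d f k))) a))
      ≈⟨ sum-Σ< {N} n (λ r k → U r (Xs (suc k) r (restrict (d f k))) a) ⟩
    Σ< n (λ k → sum (λ r → U r (Xs (suc k) r (restrict (d f k))) a))
      ≈⟨ Σ<-cong n term ⟩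
    Σ< n (λ k → coeff (quadratic N f n k +Λ linear N f n k +Λ cubic N f n k) (toList a))
      ≈⟨ coeff-Σ<Λ n (λ k → quadratic N f n k +Λ linear N f n k +Λ cubic N f n k) (toList a) ⟨
    restrict (D N n f) a ∎
    where
    term : ∀ k → k < n → sum (λ r → U r (Xs (suc k) r (restrict (d f k))) a) ≈ coeff (quadratic N f n k +Λ linear N f n k +Λ cubic N f n k) (toList a)
    term k k<n = begin
      sum (λ r → U r (Xs (suc k) r g) a)
        ≈⟨ sum-cong (λ r → U-Xs k r (restrict-symmetric (d f k)) a) ⟩
      sum (λ r → (Xs (suc k) r (U r g) a + c * Xs (suc k) r g a) + Σ< k (λ j → Xs (suc (k ∸ suc j)) r (powers (suc j) g) a))
        ≈⟨ ∑-distrib-+ (λ r → Xs (suc k) r (U r g) a + c * Xs (suc k) r g a) (λ r → Σ< k (λ j → Xs (suc (k ∸ suc j)) r (powers (suc j) g) a)) ∙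
             +-cong (∑-distrib-+ (λ r → Xs (suc k) r (U r g) a) (λ r → c * Xs (suc k) r g a) ∙ +-cong one two) three ⟩
      coeff (quadratic N f n k +Λ linear N f n k +Λ cubic N f n k) (toList a) ∎
      where
      g : Ser N
      g = restrict (d f k)
      c = coefficient N k
      two : sum (λ r → c * Xs (suc k) r g a) ≈ c * coeff (power (suc k) *Λ d f k) (toList a)
      two = sym (*-distribˡ-sum c (λ r → Xs (suc k) r g a)) ∙ *-congˡ {c} (powers-restrict k (d f k) a)
      three : sum (λ r → Σ< k (λ j → Xs (suc (k ∸ suc j)) r (powers (suc j) g) a)) ≈ coeff (cubic N f n k) (toList a)
      three = sum-Σ< {N} k (λ r j → Xs (suc (k ∸ suc j)) r (powers (suc j) g) a) ∙
        (Σ<-cong k λ j _ → (sum-cong λ r → Xs-cong (suc (k ∸ suc j)) r (powers-restrict j (d f k)) a) ∙ powers-restrict (k ∸ suc j) (power (suc j) *Λ d f k) a) ∙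
          sym (coeff-Σ<Λ k (λ j → power (suc (k ∸ suc j)) *Λ (power (suc j) *Λ d f k)) (toList a))
      one : sum (λ r → Xs (suc k) r (U r g) a) ≈ coeff (quadratic N f n k) (toList a)
      one = begin
        sum (λ r → Xs (suc k) r (U r g) a)
          ≈⟨ sum-cong (λ r → Xs-cong (suc k) r (newton-restrict {n ∸ suc k} {d f k} {d (d f k)} (d-homogeneous {n} {f} hom k k<n) (Perp.newton (perp (d f k))) r) a ∙
               Xs-Σ< (suc k) r (n ∸ suc k) (λ l → Xs (suc l) r (restrict (d (d f k) l))) a) ⟩
        sum (λ r → Σ< (n ∸ suc k) (λ l → Xs (suc k) r (Xs (suc l) r (restrict (d (d f k) l))) a))
          ≈⟨ sum-Σ< {N} (n ∸ suc k) (λ r l → Xs (suc k) r (Xs (suc l) r (restrict (d (d f k) l))) a) ⟩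
        Σ< (n ∸ suc k) (λ l → sum (λ r → Xs (suc k) r (Xs (suc l) r (restrict (d (d f k) l))) a))
          ≈⟨ Σ<-cong (n ∸ suc k) (λ l _ → (sum-cong λ r → cong-≈ (λ s → s a) (Xs-+ (suc k) (suc l) r (restrict (d (d f k) l)))) ∙
               powers-restrict (k ℕ.+ suc l) (d (d f k) l) a) ⟩
        Σ< (n ∸ suc k) (λ l → coeff (power (suc k ℕ.+ suc l) *Λ d (d f k) l) (toList a))
          ≈⟨ coeff-Σ<Λ (n ∸ suc k) (λ l → power (suc k ℕ.+ suc l) *Λ d (d f k) l) (toList a) ⟨
        coeff (quadratic N f n k) (toList a) ∎

  D-homogeneous : ∀ {n f} N → Homogeneous n f → Homogeneous n (D N n f)
  D-homogeneous {n} {f} N hom a h = coeff-Σ<Λ n (λ k → quadratic N f n k +Λ linear N f n k +Λ cubic N f n k) a ∙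
    (Σ<-zero n λ k k<n → zero-+ (zero-+ (quad k k<n) (lin k)) (cub k k<n))
    where
    zero-+ : ∀ {x y} → x ≈ 0# → y ≈ 0# → x + y ≈ 0#
    zero-+ p q = +-cong p q ∙ +-identityˡ 0#
    deg : ∀ k b → suc k ℕ.+ sumᴸ b ≢ n → coeff (d f k) b ≈ 0#
    deg = newton-degree {n} {f} {d f} hom (Perp.newton (perp f))
    quad : ∀ k → k < n → coeff (quadratic N f n k) a ≈ 0#
    quad k k<n = coeff-Σ<Λ (n ∸ suc k) (λ l → power (suc k ℕ.+ suc l) *Λ d (d f k) l) a ∙ (Σ<-zero (n ∸ suc k) λ l _ →
      Homogeneous-power (k ℕ.+ suc l) {d (d f k) l} (λ b e → newton-degree {n ∸ suc k} {d f k} {d (d f k)} (d-homogeneous {n} {f} hom k k<n) (Perp.newton (perp (d f k))) l b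
        λ q → e (cong suc (ℕ.+-assoc k (suc l) (sumᴸ b)) ⊙ cong (suc k ℕ.+_) q ⊙ ℕ.m+[n∸m]≡n k<n)) a h)
    lin : ∀ k → coeff (linear N f n k) a ≈ 0#
    lin k = *-congˡ {coefficient N k} (Homogeneous-power k {d f k} (deg k) a h) ∙ zeroʳ _
    cub : ∀ k → k < n → coeff (cubic N f n k) a ≈ 0#
    cub k k<n = coeff-Σ<Λ k (λ j → power (suc (k ∸ suc j)) *Λ (power (suc j) *Λ d f k)) a ∙ (Σ<-zero k λ j j<k →
      Homogeneous-power (k ∸ suc j) {power (suc j) *Λ d f k} (λ b e → Homogeneous-power {n ∸ suc (k ∸ suc j)} j {d f k}
        (λ c e′ → deg k c λ q → e′ (≡.sym (ℕ.m+n∸m≡n (suc (k ∸ suc j)) _) ⊙ cong (_∸ suc (k ∸ suc j))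
          (≡.sym (ℕ.+-assoc (suc (k ∸ suc j)) (suc j) (sumᴸ c)) ⊙ cong (λ x → suc x ℕ.+ sumᴸ c) (ℕ.m∸n+n≡m j<k) ⊙ q))) b
        λ q → e (cong (suc (k ∸ suc j) ℕ.+_) q ⊙ ℕ.m+[n∸m]≡n (ℕ.≤-trans (ℕ.s≤s (ℕ.m∸n≤m k (suc j))) k<n))) a h)

  adjoint : ∀ k h f → ⟪ power (suc k) *Λ h , f ⟫ ≈ ⟪ h , d f k ⟫
  adjoint k h f = Perp.adj (perp f) k h

  ⟨⟩-Σ<ˡ : ∀ h n f → ⟪ Σ<Λ n f , h ⟫ ≈ Σ< n (λ i → ⟪ f i , h ⟫)
  ⟨⟩-Σ<ˡ h n f = ⟨⟩-comm (Σ<Λ n f) h ∙ ⟨⟩-Σ<ʳ h n f ∙ (Σ<-cong n λ i _ → ⟨⟩-comm h (f i))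

  private
    Q L C : ℕ → ℕ → Λ → Λ → ℚ⟨α⟩
    Q N n f g = Σ< n (λ k → Σ< (n ∸ suc k) (λ l → ⟪ power (suc k ℕ.+ suc l) *Λ d (d f k) l , g ⟫))
    L N n f g = Σ< n (λ k → coefficient N k * ⟪ d f k , d g k ⟫)
    C N n f g = Σ< n (λ k → Σ< k (λ j → ⟪ power (suc (k ∸ suc j)) *Λ (power (suc j) *Λ d f k) , g ⟫))

    D-split : ∀ N n f g → ⟪ D N n f , g ⟫ ≈ (Q N n f g + L N n f g) + C N n f g
    D-split N n f g = ⟨⟩-Σ<ˡ g n (λ k → quadratic N f n k +Λ linear N f n k +Λ cubic N f n k) ∙ (Σ<-cong n λ k _ →
        linear-+ (quadratic N f n k +Λ linear N f n k) (cubic N f n k) g ∙ +-cong (linear-+ (quadratic N f n k) (linear N f n k) g ∙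
          +-cong (⟨⟩-Σ<ˡ g (n ∸ suc k) (λ l → power (suc k ℕ.+ suc l) *Λ d (d f k) l))
            (linear-· (coefficient N k) (power (suc k) *Λ d f k) g ∙ *-congˡ {coefficient N k} (adjoint k (d f k) g)))
          (⟨⟩-Σ<ˡ g k (λ j → power (suc (k ∸ suc j)) *Λ (power (suc j) *Λ d f k)))) ∙
      Σ<-+ n (λ k → Q′ k + L′ k) C′ ∙ +-congʳ {Σ< n C′} (Σ<-+ n Q′ L′)
      where
      Q′ L′ C′ : ℕ → ℚ⟨α⟩
      Q′ k = Σ< (n ∸ suc k) (λ l → ⟪ power (suc k ℕ.+ suc l) *Λ d (d f k) l , g ⟫)
      L′ k = coefficient N k * ⟪ d f k , d g k ⟫
      C′ k = Σ< k (λ j → ⟪ power (suc (k ∸ suc j)) *Λ (power (suc j) *Λ d f k) , g ⟫)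

    -- p_(k+l) p_k^⊥ p_l^⊥ and p_k p_l p_(k+l)^⊥ are adjoint to each other; the rest is reindexing
    -- by the sum of the indices.
    Q≈C : ∀ N n f g → Q N n f g ≈ C N n g f
    Q≈C N n f g = sym ((Σ<-cong n λ k _ → Σ<-cong k λ j j<k → adjoint (k ∸ suc j) (power (suc j) *Λ d g k) f ∙
        adjoint j (d g k) (d f (k ∸ suc j)) ∙ ⟨⟩-comm (d g k) (d (d f (k ∸ suc j)) j) ∙ trans
          (cong-≈ (λ i → ⟪ d (d f (k ∸ suc j)) j , d g i ⟫) (≡.sym (ℕ.m∸n+n≡m j<k))) (sym (adjoint (k ∸ suc j ℕ.+ suc j) (d (d f (k ∸ suc j)) j) g))) ∙
      (Σ<-cong n λ k _ → flip k (λ j i → ⟪ power (suc i ℕ.+ suc j) *Λ d (d f i) j , g ⟫)) ∙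
        Σ<-diagonals n (λ i j → ⟪ power (suc i ℕ.+ suc j) *Λ d (d f i) j , g ⟫))
      where
      flip : ∀ k (φ : ℕ → ℕ → ℚ⟨α⟩) → Σ< k (λ j → φ j (k ∸ suc j)) ≈ Σ< k (λ j → φ (k ∸ suc j) j)
      flip zero    φ = refl
      flip (suc k) φ = Σ<-reverse k (λ j → φ j (k ∸ j)) ∙ (Σ<-cong (suc k) λ j j≤k → cong-≈ (φ (k ∸ j)) (ℕ.m∸[m∸n]≡n (ℕ.s≤s⁻¹ j≤k)))

  D-adjoint : ∀ N n f g → ⟪ D N n f , g ⟫ ≈ ⟪ f , D N n g ⟫
  D-adjoint N n f g = begin
    ⟪ D N n f , g ⟫  ≈⟨ D-split N n f g ⟩
    (Q N n f g + L N n f g) + C N n f g  ≈⟨ +-cong (+-cong (Q≈C N n f g) (Σ<-cong n λ k _ → *-congˡ {coefficient N k} (⟨⟩-comm (d f k) (d g k)))) (sym (Q≈C N n g f)) ⟩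
    (C N n g f + L N n g f) + Q N n g f  ≈⟨ solve 3 (λ x y z → (x :+ y) :+ z := (z :+ y) :+ x) refl (C N n g f) (L N n g f) (Q N n g f) ⟩
    (Q N n g f + L N n g f) + C N n g f  ≈⟨ D-split N n g f ⟨
    ⟪ D N n g , f ⟫  ≈⟨ ⟨⟩-comm (D N n g) f ⟩
    ⟪ f , D N n g ⟫  ∎

padded : ∀ {N} (b : List ℕ) → length b ≤ N → Vec ℕ N
padded {N} []     h           = Vec.replicate N 0
padded    (x ∷ b) (ℕ.s≤s h) = x ∷ padded b h

restrict-padded : ∀ h {N} (b : List ℕ) (l : length b ≤ N) → restrict h (padded b l) ≈ coeff h b
restrict-padded h {zero}  []      l         = refl
restrict-padded h {suc N} []      l         = coeff-zero∷ h (toList (Vec.replicate N 0)) ∙ restrict-padded h {N} [] ℕ.z≤n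
restrict-padded h         (x ∷ b) (ℕ.s≤s l) = restrict-padded (shift x h) b l

-- A monomial of degree n involves at most n variables.
determined : ∀ {n f g} → Homogeneous n f → Homogeneous n g → (∀ (a : Vec ℕ n) → restrict f a ≈ restrict g a) → f ≈Λ g
determined {n} {f} {g} hf hg e a with sumᴸ a ℕ.≟ n
... | no h  = hf a h ∙ sym (hg a h)
... | yes s = at f ∙ e (padded (nonzeros a) len) ∙ sym (at g)
  where
  len : length (nonzeros a) ≤ n
  len = ℕ.≤-trans (count≤sum a) (ℕ.≤-reflexive s)
  at : ∀ h → coeff h a ≈ restrict h (padded (nonzeros a) len)
  at h = coeff-nonzeros (coeff h) (pad h) (symmetric h) a ∙ sym (restrict-padded h (nonzeros a) len)

-- Eigenvalues and the dominance order

open Labellings ℚ⟨α⟩-commutativeRing α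
open Evaluation ℚ⟨α⟩-commutativeRing α

-- Σ i λ_i for λ = λ₁ ∷ λ₂ ∷ …
weight : List ℕ → ℕ
weight []       = 0
weight (x ∷ xs) = sumᴸ (x ∷ xs) ℕ.+ weight xs

-- Dominance is read on the tails because `weight` is the sum of the tail sums.
Dominated : List ℕ → List ℕ → Set
Dominated xs ys = ∀ k → sumᴸ (drop k ys) ≤ sumᴸ (drop k xs)

weight-mono : ∀ xs ys → Dominated xs ys → weight ys ≤ weight xs
weight-mono xs       []       h = ℕ.z≤n
weight-mono []       (y ∷ ys) h = subst (_≤ 0) (≡.sym (zero-weight (y ∷ ys) (ℕ.n≤0⇒n≡0 (h 0)))) ℕ.z≤n
  where
  zero-weight : ∀ ys → sumᴸ ys ≡ 0 → weight ys ≡ 0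
  zero-weight []       e = ≡.refl
  zero-weight (y ∷ ys) e = cong₂ ℕ._+_ e (zero-weight ys (ℕ.m+n≡0⇒n≡0 y e))
weight-mono (x ∷ xs) (y ∷ ys) h = ℕ.+-mono-≤ (h 0) (weight-mono xs ys (h ∘ suc))

-- Equality of the totals forces equality of every tail sum.
weight-strict : ∀ {xs ys} → All (1 ≤_) xs → All (1 ≤_) ys → Dominated xs ys → weight xs ≡ weight ys → xs ≡ ys
weight-strict []      []      h e = ≡.refl
weight-strict []      (ℕ.s≤s _ ∷ q) h e = contradiction e λ ()
weight-strict (ℕ.s≤s _ ∷ p) []      h e = contradiction e λ ()
weight-strict {x ∷ xs} {y ∷ ys} (_ ∷ p) (_ ∷ q) h e = cong₂ _∷_ heads tails
  where
  sums : sumᴸ (y ∷ ys) ≡ sumᴸ (x ∷ xs)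
  sums = ℕ.≤-antisym (h 0) (ℕ.+-cancelʳ-≤ (weight ys) _ _ (ℕ.≤-trans (ℕ.+-monoʳ-≤ (sumᴸ (x ∷ xs)) (weight-mono xs ys (h ∘ suc))) (ℕ.≤-reflexive e)))
  tails : xs ≡ ys
  tails = weight-strict p q (h ∘ suc) (ℕ.+-cancelˡ-≡ (sumᴸ (x ∷ xs)) _ _ (e ⊙ cong (ℕ._+ weight ys) sums))
  heads : x ≡ y
  heads = ℕ.+-cancelʳ-≡ (sumᴸ ys) _ _ (cong (λ l → x ℕ.+ sumᴸ l) (≡.sym tails) ⊙ ≡.sym sums)

take-drop-sum : ∀ k xs → sumᴸ (take k xs) ℕ.+ sumᴸ (drop k xs) ≡ sumᴸ xs
take-drop-sum k xs = ≡.sym (sum-++ (take k xs) (drop k xs)) ⊙ cong sumᴸ (List.take++drop≡id k xs)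

⊴-dominated : ∀ {κ μ} → κ ⊴ μ → Dominated (parts κ) (parts μ)
⊴-dominated {κ} {μ} (s , t) k = ℕ.+-cancelˡ-≤ (sumᴸ (take k (parts κ))) _ _ (ℕ.≤-trans (ℕ.+-monoˡ-≤ _ (t k))
  (ℕ.≤-reflexive (take-drop-sum k (parts μ) ⊙ ≡.sym s ⊙ ≡.sym (take-drop-sum k (parts κ)))))

⊴-weight : ∀ {κ μ} → κ ⊴ μ → weight (parts μ) ≤ weight (parts κ)
⊴-weight {κ} {μ} h = weight-mono (parts κ) (parts μ) (⊴-dominated {κ} {μ} h)

⊴-weight-strict : ∀ {κ μ} → κ ⊴ μ → weight (parts κ) ≡ weight (parts μ) → κ ≡ μ
⊴-weight-strict {κ} {μ} h e = parts-injective (weight-strict (positive κ) (positive μ) (⊴-dominated {κ} {μ} h) e)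

⊴-trans : ∀ {κ μ ν′} → κ ⊴ μ → μ ⊴ ν′ → κ ⊴ ν′
⊴-trans (s , t) (s′ , t′) = s ⊙ s′ , λ k → ℕ.≤-trans (t k) (t′ k)

-- Supports are known only through negated equations; dominance consists of decidable comparisons
-- and survives double negation.
⊴-stable : ∀ {κ μ} → ¬ ¬ κ ⊴ μ → κ ⊴ μ
⊴-stable h = decidable-stable (_ ℕ.≟ _) (λ n → h (n ∘ proj₁)) , λ k → decidable-stable (_ ℕ.≤? _) (λ n → h (λ d → n (proj₂ d k)))

weight-bound : ∀ xs → All (1 ≤_) xs → weight xs ≤ sumᴸ xs ℕ.* sumᴸ xs
weight-bound []       []      = ℕ.z≤n
weight-bound (suc x ∷ xs) (_ ∷ p) = ℕ.+-monoʳ-≤ (suc x ℕ.+ sumᴸ xs) (ℕ.≤-trans (weight-bound xs p) (ℕ.*-mono-≤ (ℕ.m≤n+m (sumᴸ xs) x) (ℕ.m≤n+m (sumᴸ xs) (suc x))))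

squares : List ℕ → ℕ
squares []       = 0
squares (x ∷ xs) = x ℕ.* x ℕ.+ squares xs

module _ {N : ℕ} (n : ℕ) where
  open Spectrum {N} n

  longerᴸ-all : ∀ {l ls} → All (l ≤_) ls → longerᴸ l ls ≡ length ls
  longerᴸ-all []       = ≡.refl
  longerᴸ-all {l} {k ∷ ls} (h ∷ a) = cong₂ ℕ._+_ (cong bit (dec-true (l ℕ.≤? k) h)) (longerᴸ-all a)

  linked-below : ∀ {l ls} → Linked _≥_ (l ∷ ls) → All (_≤ l) ls
  linked-below [-]     = []
  linked-below (h ∷ r) = h ∷ All.map (λ q → ℕ.≤-trans q h) (linked-below r)

  eigenvalue-sorted : ∀ {l re lt} → Linked _≥_ (l ∷ re) → All (l ≤_) lt → eigenvalueᴸ (reverse re) l lt ≈ α * ν l + ((ν N - 1#) - ν (length lt))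
  eigenvalue-sorted {l} {re} {lt} s h = +-congˡ {α * ν l} (+-cong (+-congˡ {ν N - 1#} (-‿cong (cong-≈ ν (longerᴸ-all h))))
    (-‿cong (cong-≈ ν (longerᴸ-none {l} {reverse re} (Perm.All-resp-↭ (↭-sym (Perm.↭-reverse re)) (linked-below s))))) ∙
      solve 1 (λ x → x :- :0 := x) refl ((ν N - 1#) - ν (length lt)))

  first-sorted : ∀ ls lt → Linked _≥_ ls → All (λ l → All (l ≤_) lt) ls → first ls lt ≈ α * ν (sumᴸ ls)
  first-sorted []       lt s h = sym (zeroʳ α)
  first-sorted (l ∷ ls) lt s (h ∷ hs) = +-cong (+-congʳ { - (ν N - ν (suc (length lt)))} (eigenvalue-sorted s h)) (first-sorted ls (l ∷ lt) (Linked.tail s) (All.zipWith (λ (p , q) → p ∷ q) (linked-below s , hs))) ∙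
    solve 5 (λ α l N t s → ((α :* l :+ ((N :- :1) :- t)) :- (N :- (:1 :+ t))) :+ α :* s := α :* (l :+ s)) refl α (ν l) (ν N) (ν (length lt)) (ν (sumᴸ ls)) ∙
      *-congˡ {α} (sym (ν-+ l (sumᴸ ls)))

  -- For lt = [] the eigenvalue is α² Σ λ_i² - 2 α Σ i λ_i + (N + 1) α |λ|; the negative term stands
  -- on the left.
  second-sorted : ∀ ls lt → Linked _≥_ ls → All (λ l → All (l ≤_) lt) ls →
    second ls lt + (α * ν (weight ls) + α * ν (weight ls)) ≈ α * (α * ν (squares ls)) + ((ν N + 1#) - ν (length lt)) * (α * ν (sumᴸ ls))
  second-sorted []       lt s h = solve 3 (λ α N t → :0 :+ (α :* :0 :+ α :* :0) := α :* (α :* :0) :+ ((N :+ :1) :- t) :* (α :* :0)) refl α (ν N) (ν (length lt))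
  second-sorted (l ∷ ls) lt s (h ∷ hs) = begin
    ((e * (e - (ν N - ν (suc t))) - first ls (l ∷ lt)) + second ls (l ∷ lt)) + (α * ν (l ℕ.+ T ℕ.+ W) + α * ν (l ℕ.+ T ℕ.+ W))
      ≈⟨ +-cong (+-congʳ {second ls (l ∷ lt)} (+-cong (*-cong ev (+-congʳ { - (ν N - ν (suc t))} ev)) (-‿cong (first-sorted ls (l ∷ lt) (Linked.tail s) hs′))))
           (+-cong (*-congˡ {α} νw) (*-congˡ {α} νw)) ⟩
    (((e′ * (e′ - (ν N - ν (suc t)))) - α * ν T) + second ls (l ∷ lt)) + (α * ((ν l + ν T) + ν W) + α * ((ν l + ν T) + ν W))
      ≈⟨ solve 7 (λ α l N t T W x → (((((α :* l :+ ((N :- :1) :- t)) :* ((α :* l :+ ((N :- :1) :- t)) :- (N :- (:1 :+ t)))) :- α :* T) :+ x) :+ (α :* ((l :+ T) :+ W) :+ α :* ((l :+ T) :+ W)))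
           := ((x :+ (α :* W :+ α :* W)) :+ (α :* (α :* (l :* l)) :+ (((N :+ :1) :- t) :* (α :* l) :+ α :* T)))) refl α (ν l) (ν N) (ν t) (ν T) (ν W) (second ls (l ∷ lt)) ⟩
    (second ls (l ∷ lt) + (α * ν W + α * ν W)) + (α * (α * (ν l * ν l)) + (((ν N + 1#) - ν t) * (α * ν l) + α * ν T))
      ≈⟨ +-congʳ {α * (α * (ν l * ν l)) + (((ν N + 1#) - ν t) * (α * ν l) + α * ν T)} (second-sorted ls (l ∷ lt) (Linked.tail s) hs′) ⟩
    (α * (α * ν (squares ls)) + ((ν N + 1#) - ν (suc t)) * (α * ν T)) + (α * (α * (ν l * ν l)) + (((ν N + 1#) - ν t) * (α * ν l) + α * ν T))
      ≈⟨ solve 6 (λ α l N t T q → (α :* (α :* q) :+ ((N :+ :1) :- (:1 :+ t)) :* (α :* T)) :+ (α :* (α :* (l :* l)) :+ (((N :+ :1) :- t) :* (α :* l) :+ α :* T))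
           := α :* (α :* (l :* l :+ q)) :+ ((N :+ :1) :- t) :* (α :* (l :+ T))) refl α (ν l) (ν N) (ν t) (ν T) (ν (squares ls)) ⟩
    α * (α * (ν l * ν l + ν (squares ls))) + ((ν N + 1#) - ν t) * (α * (ν l + ν T))
      ≈⟨ +-cong (*-congˡ {α} (*-congˡ {α} (sym (ν-+ (l ℕ.* l) (squares ls) ∙ +-congʳ {ν (squares ls)} (ν-* l l)))))
           (*-congˡ {(ν N + 1#) - ν t} (*-congˡ {α} (sym (ν-+ l T)))) ⟩
    α * (α * ν (l ℕ.* l ℕ.+ squares ls)) + ((ν N + 1#) - ν t) * (α * ν (l ℕ.+ T)) ∎
    where
    T = sumᴸ ls
    W = weight ls
    t = length lt
    e = eigenvalueᴸ (reverse ls) l lt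
    e′ = α * ν l + ((ν N - 1#) - ν t)
    ev : e ≈ e′
    ev = eigenvalue-sorted s h
    hs′ : All (λ k → All (k ≤_) (l ∷ lt)) ls
    hs′ = All.zipWith (λ (p , q) → p ∷ q) (linked-below s , hs)
    νw : ν (l ℕ.+ T ℕ.+ W) ≈ (ν l + ν T) + ν W
    νw = ν-+ (l ℕ.+ T) W ∙ +-congʳ {ν W} (ν-+ l T)

  -- For equal sizes the terms in N agree. Division by α then leaves α Σ λ_i² - 2 Σ i λ_i, and the
  -- constant terms in α are compared.
  separated : ∀ {lam μ} → size lam ≡ size μ → second (parts lam) [] ≈ second (parts μ) [] → weight (parts lam) ≡ weight (parts μ)
  separated {lam} {μ} s e = double (α-linear {squares (parts μ)} {weight (parts lam) ℕ.+ weight (parts lam)} {squares (parts lam)} {weight (parts μ) ℕ.+ weight (parts μ)} (*-cancelˡ α (pos-≉0 pos-α) (begin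
    α * (α * ν q′ + ν (w ℕ.+ w))
      ≈⟨ *-congˡ {α} (+-congˡ {α * ν q′} (ν-+ w w)) ⟩
    α * (α * ν q′ + (ν w + ν w))
      ≈⟨ solve 5 (λ α q w c s → α :* (α :* q :+ (w :+ w)) := ((α :* (α :* q) :+ c :* (α :* s)) :+ (α :* w :+ α :* w)) :- c :* (α :* s)) refl α (ν q′) (ν w) c (ν (size lam)) ⟩
    ((α * (α * ν q′) + c * (α * ν (size lam))) + (α * ν w + α * ν w)) - c * (α * ν (size lam))
      ≈⟨ +-congʳ { - (c * (α * ν (size lam)))} (+-congʳ {α * ν w + α * ν w} (cong-≈ (λ z′ → α * (α * ν q′) + c * (α * ν z′)) s ∙ sym (value μ))) ⟩
    ((second (parts μ) [] + (α * ν w′ + α * ν w′)) + (α * ν w + α * ν w)) - c * (α * ν (size lam))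
      ≈⟨ solve 5 (λ x α w w′ y → ((x :+ (α :* w′ :+ α :* w′)) :+ (α :* w :+ α :* w)) :- y := ((x :+ (α :* w :+ α :* w)) :+ (α :* w′ :+ α :* w′)) :- y) refl (second (parts μ) []) α (ν w) (ν w′) (c * (α * ν (size lam))) ⟩
    ((second (parts μ) [] + (α * ν w + α * ν w)) + (α * ν w′ + α * ν w′)) - c * (α * ν (size lam))
      ≈⟨ +-congʳ { - (c * (α * ν (size lam)))} (+-congʳ {α * ν w′ + α * ν w′} (+-congʳ {α * ν w + α * ν w} (sym e) ∙ value lam)) ⟩
    ((α * (α * ν q) + c * (α * ν (size lam))) + (α * ν w′ + α * ν w′)) - c * (α * ν (size lam))
      ≈⟨ solve 5 (λ α q w c s → α :* (α :* q :+ (w :+ w)) := ((α :* (α :* q) :+ c :* (α :* s)) :+ (α :* w :+ α :* w)) :- c :* (α :* s)) refl α (ν q) (ν w′) c (ν (size lam)) ⟨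
    α * (α * ν q + (ν w′ + ν w′))
      ≈⟨ *-congˡ {α} (+-congˡ {α * ν q} (ν-+ w′ w′)) ⟨
    α * (α * ν q + ν (w′ ℕ.+ w′)) ∎)))
    where
    q = squares (parts lam)
    q′ = squares (parts μ)
    w = weight (parts lam)
    w′ = weight (parts μ)
    c = (ν N + 1#) - ν 0
    value : ∀ κ → second (parts κ) [] + (α * ν (weight (parts κ)) + α * ν (weight (parts κ))) ≈ α * (α * ν (squares (parts κ))) + c * (α * ν (size κ))
    value κ = second-sorted (parts κ) [] (decreasing κ) (All.universal (λ _ → []) (parts κ))
    double : ∀ {a b} → a ℕ.+ a ≡ b ℕ.+ b → a ≡ b
    double {a} {b} e with ℕ.<-cmp a b
    ... | tri< l _ _ = contradiction e (ℕ.<⇒≢ (ℕ.+-mono-< l l))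
    ... | tri≈ _ h _ = h
    ... | tri> _ _ l = contradiction (≡.sym e) (ℕ.<⇒≢ (ℕ.+-mono-< l l))

pos-choices : ∀ {N} l ls → length ls < N → Pos (choices {N} l ls)
pos-choices {N} l ls h = go l
  where
  base : Pos (ν N - ν (length ls))
  base = pos-resp (solve 2 (λ x y → x := (x :+ y) :- y) refl (ν (suc (N ∸ suc (length ls)))) (ν (length ls)) ∙
    +-congʳ { - ν (length ls)} (sym (ν-+ (suc (N ∸ suc (length ls))) (length ls)) ∙
      cong-≈ ν (≡.sym (ℕ.+-suc (N ∸ suc (length ls)) (length ls)) ⊙ ℕ.m∸n+n≡m h))) (pos-ν (N ∸ suc (length ls)))
  go : ∀ l → Pos (choices {N} l ls)
  go zero    = base
  go (suc l) = pos-+ base (pos-+-nonneg (pos-* pos-α (pos-ν l)) (nonneg-ν (shorterᴸ l ls)))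

-- With no more rows than variables every factor is positive, so the averaging constant can be
-- cancelled.
pos-multiplicity : ∀ {N} td ds → length td ℕ.+ length ds ≤ N → Pos (multiplicityᴸ {N} td ds)
pos-multiplicity []           ds h = pos-1
pos-multiplicity {N} (zero  ∷ td) ds h = pos-* (pos-choices {N} 0 (td ++ ds) (subst (_< N) (≡.sym (List.length-++ td)) h)) (pos-multiplicity {N} td ds (ℕ.<⇒≤ h))
pos-multiplicity {N} (suc l ∷ td) ds h = pos-* (pos-choices {N} (suc l) (td ++ ds) (subst (_< N) (≡.sym (List.length-++ td)) h))
  (pos-multiplicity {N} td (ds ∷ʳ l) (subst (_≤ N) (≡.sym (cong (length td ℕ.+_) (List.length-++ ds ⊙ ℕ.+-comm _ 1) ⊙ ℕ.+-suc _ _)) h))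

length≤sum : ∀ xs → All (1 ≤_) xs → length xs ≤ sumᴸ xs
length≤sum []       []      = ℕ.z≤n
length≤sum (x ∷ xs) (h ∷ p) = ℕ.+-mono-≤ h (length≤sum xs p)

jack-eigenvalue : ℕ → Partition → ℚ⟨α⟩
jack-eigenvalue N lam = Spectrum.second {N} (size lam) (parts lam) []

jackˢ-eigen : ∀ lam {N} → ℓ lam ≤ N → ∀ (a : Vec ℕ N) → sum (λ r → U r (U r (jackˢ lam N)) a) ≈ jack-eigenvalue N lam * jackˢ lam N a
jackˢ-eigen lam {N} h a = *-cancelˡ c (pos-≉0 (pos-multiplicity (rows lam) [] (ℕ.≤-trans (ℕ.≤-reflexive (ℕ.+-identityʳ _ ⊙ List.length-reverse (parts lam))) h))) (begin
  c * sum (λ r → U r (U r f) a)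
    ≈⟨ *-distribˡ-sum c (λ r → U r (U r f) a) ⟩
  sum (λ r → c * U r (U r f) a)
    ≈⟨ sum-cong (λ r → sym (U-* r c (U r f) a) ∙ U-cong r (λ b → sym (U-* r c f b)) a) ⟩
  sum (λ r → U r (U r (λ b → c * f b)) a)
    ≈⟨ sum-cong (λ r → U-cong r (U-cong r (λ b → sym (Ω≈ b))) a) ⟩
  sum (λ r → U r (U r (Ω (rows lam))) a)
    ≈⟨ sum-U²-Ω (rows lam) a ⟩
  second (reverse (rows lam)) [] * Ω (rows lam) a
    ≈⟨ *-cong (cong-≈ (λ ls → second ls []) (List.reverse-involutive (parts lam))) (Ω≈ a) ⟩
  jack-eigenvalue N lam * (c * f a)
    ≈⟨ solve 3 (λ e c x → e :* (c :* x) := c :* (e :* x)) refl (jack-eigenvalue N lam) c (f a) ⟩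
  c * (jack-eigenvalue N lam * f a) ∎)
  where
  open Spectrum {N} (size lam)
  f = jackˢ lam N
  c = multiplicityᴸ {N} (rows lam) []
  Ω≈ : ∀ b → Ω (rows lam) b ≈ c * f b
  Ω≈ b = sumQ-F (size lam) (rows lam) [] b ∙ *-congˡ {c} (cong-≈ (λ Q → F (size lam) Q b) (List.++-identityʳ (empties (rows lam))))

jack-triangular : ∀ {lam μ} → ¬ μ ⊴ lam → [m μ ] jack lam ≈ 0#
jack-triangular {lam} {μ} h with zero? ([m μ ] jack lam)
... | yes e = e
... | no ¬e = contradiction (decidable-stable (size μ ℕ.≟ size lam) (λ s → ¬e (jack-homogeneous lam (parts μ) s)) , λ k → ℕ.≮⇒≥ (λ l → ¬e (jack-dominance lam (parts μ) k l))) h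

boxesˢ-empties : ∀ {N} (ty : Vec Kind N) ls → boxesˢ (state ty (empties ls)) ≡ sumᴸ ls
boxesˢ-empties ty ls = cong sumᴸ (lengths-state ty (empties ls) ⊙ lengths-empties′ ls)

settled-empties : ∀ {N} (ty : Vec Kind N) ls → Settled ty (empties ls)
settled-empties ty []       = []
settled-empties ty (l ∷ ls) = skip (settled-empties ty ls)

-- All variables are singles, so no label repeats and every filling has weight one; n! orders of the
-- labels remain.
jack-normalized : ∀ lam → [m 1^ (size lam) ] jack lam ≈ ν (size lam !)
jack-normalized lam = sym (evaluate n _) ∙ Θ-F n (ones n) (empties (rows lam)) 0 (settled-empties (ones n) (rows lam))
    (boxesˢ-empties (ones n) (rows lam) ⊙ sum-rows lam) (≡.sym (ℕ.+-identityʳ _ ⊙ singles-ones n)) ∙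
  *-cong (cong-≈ (λ k → ν (k !)) (singles-ones n)) (*-identityˡ _ ∙ E-0 (- ν (generals (ones n))) n (state (ones n) (empties (rows lam))) (boxesˢ-empties (ones n) (rows lam) ⊙ sum-rows lam)) ∙ *-identityʳ _
  where
  n = size lam
  ones : ∀ n → Vec Kind (length (replicate n 1))
  ones zero    = []
  ones (suc n) = single ∷ ones n
  singles-ones : ∀ n → singles (ones n) ≡ n
  singles-ones zero    = ≡.refl
  singles-ones (suc n) = cong suc (singles-ones n)
  evaluate : ∀ n (f : Ser (length (replicate n 1))) → Θ (ones n) 0 f ≈ f (fromList (replicate n 1))
  evaluate zero    f = refl
  evaluate (suc n) f = evaluate n (f ∘ (1 ∷_))

-- Positivity of the scalar product

combination : List (ℚ⟨α⟩ × List ℕ) → Λ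
combination []            = 0Λ
combination ((c , w) ∷ L) = c · word w +Λ combination L

span-combination : ∀ {f} → f ∈Span → ∃ λ L → f ≈Λ combination L
span-combination (∈word w) = (1# , w) ∷ [] , λ a → sym (+-cong (*-identityˡ _) (coeff-0Λ a) ∙ +-identityʳ _)
span-combination (∈+ s t) with span-combination s | span-combination t
... | L , e | M , e′ = L ++ M , λ a → +-cong (e a) (e′ a) ∙ append L M a
  where
  append : ∀ L M → combination L +Λ combination M ≈Λ combination (L ++ M)
  append []            M a = +-congʳ {coeff (combination M) a} (coeff-0Λ a) ∙ +-identityˡ _
  append ((c , w) ∷ L) M a = +-assoc _ _ _ ∙ +-congˡ {c * coeff (word w) a} (append L M a)
span-combination (∈· c s) with span-combination s
... | L , e = map (Prod.map₁ (c *_)) L , λ a → *-congˡ {c} (e a) ∙ scale L a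
  where
  scale : ∀ L → c · combination L ≈Λ combination (map (Prod.map₁ (c *_)) L)
  scale []            a = *-congˡ {c} (coeff-0Λ a) ∙ zeroʳ c ∙ sym (coeff-0Λ a)
  scale ((x , w) ∷ L) a = distribˡ c _ _ ∙ +-cong (sym (*-assoc c x _)) (scale L a)
span-combination (∈≈ e s) with span-combination s
... | L , e′ = L , λ a → sym (e a) ∙ e′ a

infix 4 _≋0
_≋0 : Λ → Set
f ≋0 = ∀ a → coeff f a ≈ 0#

vanishing : ∀ f → (∀ μ → [m μ ] f ≈ 0#) → f ≋0
vanishing f h a = coeff-shape f a ∙ h (shape a)

pos-^ : ∀ k → Pos (α ^ k)
pos-^ zero    = pos-1
pos-^ (suc k) = pos-* pos-α (pos-^ k)

module Anisotropy (𝒮 : JackScalarProduct) where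
  open Form 𝒮

  -- Collecting the terms of one word at a time makes f a sum of orthogonal vectors.
  extract : ∀ w L → ∃ λ c → ∃ λ L′ → length L′ ≤ length L × All (λ t → ¬ (w ↭ proj₂ t)) L′ × combination L ≈Λ c · word w +Λ combination L′
  extract w [] = 0# , [] , ℕ.z≤n , [] , λ a → sym (+-congʳ {coeff 0Λ a} (zeroˡ (coeff (word w) a)) ∙ +-identityˡ _)
  extract w ((x , w′) ∷ L) with extract w L | w ↭? w′
  ... | c , L′ , l , p , e | yes q = x + c , L′ , ℕ.m≤n⇒m≤1+n l , p , λ a → +-cong (*-congˡ {x} (sym (word-↭ q a))) (e a) ∙
    solve 4 (λ x c y z → x :* y :+ (c :* y :+ z) := (x :+ c) :* y :+ z) refl x c (coeff (word w) a) (coeff (combination L′) a)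
  ... | c , L′ , l , p , e | no ¬q = c , (x , w′) ∷ L′ , ℕ.s≤s l , ¬q ∷ p , λ a → +-congˡ {x * coeff (word w′) a} (e a) ∙
    solve 3 (λ x y z → x :+ (y :+ z) := y :+ (x :+ z)) refl (x * coeff (word w′) a) (c * coeff (word w) a) (coeff (combination L′) a)

  word-combination : ∀ w L → All (λ t → ¬ (w ↭ proj₂ t)) L → ⟪ word w , combination L ⟫ ≈ 0#
  word-combination w []             []      = ⟨⟩-0ʳ (word w)
  word-combination w ((c , w′) ∷ L) (h ∷ p) = linear-+ʳ (c · word w′) (combination L) (word w) ∙
    +-cong (linear-·ʳ c (word w′) (word w) ∙ *-congˡ {c} (word-orthogonal w w′ h) ∙ zeroʳ c) (word-combination w L p) ∙ +-identityˡ 0#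

  pos-norm : ∀ w → Pos ⟪ word w , word w ⟫
  pos-norm w = pos-resp (sym (word-norm w)) (pos-* (pos-z (toPartition w)) (pos-^ (length w)))
    where
    pos-z : ∀ lam → Pos (ν (z lam))
    pos-z lam = subst (λ k → Pos (ν k)) (ℕ.suc-pred (z lam) {{z≢0}}) (pos-ν (pred (z lam)))
      where
      z≢0 : ℕ.NonZero (z lam)
      z≢0 = product≢0 (All.map⁺ (All.applyUpTo⁺₂ suc (size lam) go))
        where
        go : ∀ i → ℕ.NonZero (suc i ℕ.^ multiplicity (suc i) lam ℕ.* multiplicity (suc i) lam !)
        go i = ℕ.m*n≢0 _ _ {{ℕ.m^n≢0 (suc i) (multiplicity (suc i) lam)}} {{multiplicity (suc i) lam ℕ.!≢0}}

  norm-split : ∀ c w f → ⟪ word w , f ⟫ ≈ 0# → ⟪ c · word w +Λ f , c · word w +Λ f ⟫ ≈ c * c * ⟪ word w , word w ⟫ + ⟪ f , f ⟫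
  norm-split c w f h = begin
    ⟪ g +Λ f , g +Λ f ⟫
      ≈⟨ linear-+ g f (g +Λ f) ∙ +-cong (linear-+ʳ g f g) (linear-+ʳ g f f) ⟩
    (⟪ g , g ⟫ + ⟪ g , f ⟫) + (⟪ f , g ⟫ + ⟪ f , f ⟫)
      ≈⟨ +-cong (+-cong (linear-· c (word w) g ∙ *-congˡ {c} (linear-·ʳ c (word w) (word w))) gf) (+-congʳ {⟪ f , f ⟫} (⟨⟩-comm f g ∙ gf)) ⟩
    (c * (c * ⟪ word w , word w ⟫) + 0#) + (0# + ⟪ f , f ⟫)
      ≈⟨ solve 3 (λ c x y → (c :* (c :* x) :+ :0) :+ (:0 :+ y) := c :* c :* x :+ y) refl c ⟪ word w , word w ⟫ ⟪ f , f ⟫ ⟩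
    c * c * ⟪ word w , word w ⟫ + ⟪ f , f ⟫ ∎
    where
    g = c · word w
    gf : ⟪ g , f ⟫ ≈ 0#
    gf = linear-· c (word w) f ∙ *-congˡ {c} h ∙ zeroʳ c

  -- Each round collects one word. Its norm is positive, and the remainder is orthogonal to it and
  -- has fewer terms.
  definite : ∀ k L → length L ≤ k → combination L ≋0 ⊎ Pos ⟪ combination L , combination L ⟫
  definite k       []            l = inj₁ coeff-0Λ
  definite (suc k) ((x , w) ∷ L) l with extract w L
  ... | c , L′ , l′ , p , e = go (zero? (x + c)) (definite k L′ (ℕ.≤-trans l′ (ℕ.s≤s⁻¹ l)))
    where
    f = combination ((x , w) ∷ L)
    f≈ : f ≈Λ (x + c) · word w +Λ combination L′
    f≈ a = +-congˡ {x * coeff (word w) a} (e a) ∙ solve 4 (λ x c y z → x :* y :+ (c :* y :+ z) := (x :+ c) :* y :+ z) refl x c (coeff (word w) a) (coeff (combination L′) a)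
    norm≈ : ⟪ f , f ⟫ ≈ (x + c) * (x + c) * ⟪ word w , word w ⟫ + ⟪ combination L′ , combination L′ ⟫
    norm≈ = ⟨⟩-cong {f} {(x + c) · word w +Λ combination L′} {f} {(x + c) · word w +Λ combination L′} f≈ f≈ ∙ norm-split (x + c) w (combination L′) (word-combination w L′ p)
    go : Dec (x + c ≈ 0#) → combination L′ ≋0 ⊎ Pos ⟪ combination L′ , combination L′ ⟫ → f ≋0 ⊎ Pos ⟪ f , f ⟫
    go (yes q) (inj₁ h) = inj₁ λ a → f≈ a ∙ +-cong (*-congʳ {coeff (word w) a} q ∙ zeroˡ (coeff (word w) a)) (h a) ∙ +-identityˡ 0#
    go (yes q) (inj₂ h) = inj₂ (pos-resp (sym (norm≈ ∙ +-congʳ {⟪ combination L′ , combination L′ ⟫} (*-congʳ {⟪ word w , word w ⟫} (*-congʳ {x + c} q ∙ zeroˡ (x + c)) ∙ zeroˡ _) ∙ +-identityˡ _)) h)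
    go (no q)  (inj₁ h) = inj₂ (pos-resp (sym norm≈) (pos-+-nonneg (pos-* (pos-square q) (pos-norm w))
      (inj₁ (⟨⟩-congˡ (combination L′) {combination L′} {0Λ} (λ a → h a ∙ sym (coeff-0Λ a)) ∙ ⟨⟩-0ʳ (combination L′)))))
    go (no q)  (inj₂ h) = inj₂ (pos-resp (sym norm≈) (pos-+ (pos-* (pos-square q) (pos-norm w)) h))

  anisotropic : ∀ f → ⟪ f , f ⟫ ≈ 0# → f ≋0
  anisotropic f h with span-combination (spanning f)
  ... | L , e with definite (length L) L ℕ.≤-refl
  ...   | inj₁ z′ = λ a → e a ∙ z′ a
  ...   | inj₂ q  = contradiction (⟨⟩-cong {combination L} {f} {combination L} {f} (λ a → sym (e a)) (λ a → sym (e a)) ∙ h) (pos-≉0 q)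

shape-parts : ∀ μ → parts (shape (parts μ)) ≡ parts μ
shape-parts μ = sorted-unique (shape (parts μ)) μ (subst (λ b → parts (shape (parts μ)) ↭ b) (nonzeros-positive (positive μ)) (sort-↭ (nonzeros (parts μ))))
  where
  nonzeros-positive : ∀ {xs} → All (1 ≤_) xs → nonzeros xs ≡ xs
  nonzeros-positive []                    = ≡.refl
  nonzeros-positive (ℕ.s≤s {n = x} _ ∷ p) = cong (suc x ∷_) (nonzeros-positive p)

-- Elimination along a triangular family

module _ (d : ℕ) where

  lists : ℕ → List (List ℕ)
  lists zero    = [] ∷ []
  lists (suc k) = [] ∷ concatMap (λ i → map (i ∷_) (lists k)) (upTo (suc d))

  ∈-lists : ∀ k {a} → length a ≤ k → All (_≤ d) a → a ∈ lists k
  ∈-lists zero    {[]}    l h = here ≡.refl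
  ∈-lists (suc k) {[]}    l h = here ≡.refl
  ∈-lists (suc k) {x ∷ a} l (p ∷ h) = there (Mem.∈-concatMap⁺ (λ i → map (i ∷_) (lists k)) (Any.map (λ { ≡.refl → Mem.∈-map⁺ (x ∷_) (∈-lists k (ℕ.s≤s⁻¹ l) h) }) (Mem.∈-upTo⁺ (ℕ.s≤s p))))

  partitions : List Partition
  partitions = map shape (lists d)

  ∈-partitions : ∀ μ → size μ ≤ d → μ ∈ partitions
  ∈-partitions μ h = subst (_∈ partitions) (parts-injective (shape-parts μ)) (Mem.∈-map⁺ shape (∈-lists d (ℕ.≤-trans (length≤sum (parts μ) (positive μ)) h) (All.map (λ q → ℕ.≤-trans q h) (bounds (parts μ)))))
    where
    bounds : ∀ xs → All (_≤ sumᴸ xs) xs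
    bounds []       = []
    bounds (x ∷ xs) = ℕ.m≤m+n x _ ∷ All.map (λ q → ℕ.≤-trans q (ℕ.m≤n+m _ x)) (bounds xs)

record Subspace (Q : Λ → Set) : Set where
  field
    resp  : ∀ {f g} → f ≈Λ g → Q f → Q g
    null  : Q 0Λ
    plus  : ∀ {f g} → Q f → Q g → Q (f +Λ g)
    scale : ∀ c {f} → Q f → Q (c · f)

record Functional (φ : Λ → ℚ⟨α⟩) : Set where
  field
    resp  : ∀ {f g} → f ≈Λ g → φ f ≈ φ g
    plus  : ∀ f g → φ (f +Λ g) ≈ φ f + φ g
    scale : ∀ c f → φ (c · f) ≈ c * φ f

equalizer : ∀ {φ ψ} → Functional φ → Functional ψ → Subspace (λ x → φ x ≈ ψ x)
equalizer {φ} {ψ} Φ Ψ = record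
  { resp  = λ e q → sym (Φ.resp e) ∙ q ∙ Ψ.resp e
  ; null  = Φ.scale 0# 1Λ ∙ zeroˡ (φ 1Λ) ∙ sym (Ψ.scale 0# 1Λ ∙ zeroˡ (ψ 1Λ))
  ; plus  = λ {f} {g} q r → Φ.plus f g ∙ +-cong q r ∙ sym (Ψ.plus f g)
  ; scale = λ c {f} q → Φ.scale c f ∙ *-congˡ {c} q ∙ sym (Ψ.scale c f) }
  where
  module Φ = Functional Φ
  module Ψ = Functional Ψ

scaled : ∀ {φ} k → Functional φ → Functional (λ x → k * φ x)
scaled {φ} k Φ = record
  { resp  = λ e → *-congˡ {k} (Φ.resp e)
  ; plus  = λ f g → *-congˡ {k} (Φ.plus f g) ∙ distribˡ k (φ f) (φ g)
  ; scale = λ c f → *-congˡ {k} (Φ.scale c f) ∙ solve 3 (λ k c x → k :* (c :* x) := c :* (k :* x)) refl k c (φ f) }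
  where module Φ = Functional Φ

Supported : (Partition → Set) → Λ → Set
Supported P f = ∀ μ → ¬ [m μ ] f ≈ 0# → P μ

nonzero-+ : ∀ {x y} → ¬ x + y ≈ 0# → ¬ x ≈ 0# ⊎ ¬ y ≈ 0#
nonzero-+ {x} {y} h with zero? x
... | no p  = inj₁ p
... | yes p = inj₂ λ q → h (+-cong p q ∙ +-identityˡ 0#)

nonzero-* : ∀ {x y} → ¬ x * y ≈ 0# → ¬ y ≈ 0#
nonzero-* {x} h q = h (*-congˡ {x} q ∙ zeroʳ x)

-- Stated for an arbitrary family because it serves both f_λ and J_λ.
module Elimination (G : Partition → Λ) (triangular : ∀ {lam μ} → ¬ μ ⊴ lam → [m μ ] G lam ≈ 0#) (leading : ∀ lam → ¬ [m lam ] G lam ≈ 0#) where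

  support : ∀ {lam μ} → ¬ [m μ ] G lam ≈ 0# → μ ⊴ lam
  support {lam} {μ} h = ⊴-stable {μ} {lam} λ n → h (triangular {lam} {μ} n)

  ratio : ℚ⟨α⟩ → Partition → ℚ⟨α⟩
  ratio x lam = x * proj₁ (inverse ([m lam ] G lam) (leading lam))

  ratio-spec : ∀ x lam → ratio x lam * [m lam ] G lam ≈ x
  ratio-spec x lam = *-assoc x _ _ ∙ *-congˡ {x} (*-comm _ _ ∙ proj₂ (inverse ([m lam ] G lam) (leading lam))) ∙ *-identityʳ x

  subtract : Λ → Partition → Λ
  subtract f μ = f +Λ (- ratio ([m μ ] f) μ) · G μ

  subtract-zero : ∀ f μ → [m μ ] subtract f μ ≈ 0#
  subtract-zero f μ = solve 3 (λ x r g → x :+ (:- r) :* g := x :- r :* g) refl ([m μ ] f) (ratio ([m μ ] f) μ) ([m μ ] G μ) ∙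
    +-congˡ {[m μ ] f} (-‿cong (ratio-spec ([m μ ] f) μ)) ∙ -‿inverseʳ _

  subtract-undo : ∀ f μ → subtract f μ +Λ ratio ([m μ ] f) μ · G μ ≈Λ f
  subtract-undo f μ a = solve 3 (λ x r g → (x :+ (:- r) :* g) :+ r :* g := x) refl (coeff f a) (ratio ([m μ ] f) μ) (coeff (G μ) a)

  -- Partitions are cleared by increasing weight: those remaining have weight at least d² - c, and
  -- those attaining it are in L. Subtracting a multiple of G μ creates only partitions strictly
  -- below μ, of larger weight, and no weight exceeds d².
  eliminate : ∀ {P : Partition → Set} → (∀ {κ μ} → κ ⊴ μ → P μ → P κ) → ∀ {Q} → Subspace Q → (∀ μ → P μ → Q (G μ)) → ∀ f → Supported P f → Q f
  eliminate {P} down {Q} sub base f₀ supp₀ = go (d ℕ.* d) (partitions d) f₀ supp₀ size₀ (λ κ _ → ℕ.m≤n+m _ _) (λ κ h _ → ∈-partitions d κ (size₀ κ h))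
    where
    open Subspace sub
    d = proj₁ (bounded f₀)
    size₀ : Supported (λ κ → size κ ≤ d) f₀
    size₀ κ h = ℕ.≮⇒≥ λ l → h (proj₂ (bounded f₀) (parts κ) l)
    go : ∀ c L f → Supported P f → Supported (λ κ → size κ ≤ d) f → Supported (λ κ → d ℕ.* d ≤ weight (parts κ) ℕ.+ c) f →
         Supported (λ κ → d ℕ.* d ≡ weight (parts κ) ℕ.+ c → κ ∈ L) f → Q f
    go zero [] f p s w m₀ = resp (λ a → coeff-0Λ a ∙ sym (vanishing f all-zero a)) null
      where
      all-zero : ∀ μ → [m μ ] f ≈ 0#
      all-zero μ with zero? ([m μ ] f)
      ... | yes e = e
      ... | no h  = contradiction (m₀ μ h (ℕ.≤-antisym (w μ h) (ℕ.≤-trans (ℕ.≤-reflexive (ℕ.+-identityʳ _)) (ℕ.≤-trans (weight-bound (parts μ) (positive μ)) (ℕ.*-mono-≤ (s μ h) (s μ h)))))) λ ()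
    go (suc c) [] f p s w m₀ = go c (partitions d) f p s (λ κ h → lower κ h) (λ κ h _ → ∈-partitions d κ (s κ h))
      where
      lower : ∀ κ → ¬ [m κ ] f ≈ 0# → d ℕ.* d ≤ weight (parts κ) ℕ.+ c
      lower κ h with ℕ.m≤n⇒m<n∨m≡n (w κ h)
      ... | inj₁ l = ℕ.s≤s⁻¹ (ℕ.≤-trans l (ℕ.≤-reflexive (ℕ.+-suc _ c)))
      ... | inj₂ e = contradiction (m₀ κ h e) λ ()
    go c (μ ∷ L) f p s w m₀ with zero? ([m μ ] f)
    ... | yes e = go c L f p s w λ κ h q → drop-head (m₀ κ h q) λ { ≡.refl → h e }
      where
      drop-head : ∀ {κ} → κ ∈ μ ∷ L → κ ≢ μ → κ ∈ L
      drop-head (here e)  h = contradiction e h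
      drop-head (there i) h = i
    ... | no h = resp (subtract-undo f μ) (plus (go c L f′ (supported p λ κ le → down {κ} {μ} le (p μ h)) (supported s λ κ le → subst (_≤ d) (≡.sym (proj₁ le)) (s μ h)) w′ m′) (scale (ratio ([m μ ] f) μ) (base μ (p μ h))))
      where
      f′ = subtract f μ
      split : ∀ κ → ¬ [m κ ] f′ ≈ 0# → ¬ [m κ ] f ≈ 0# ⊎ κ ⊴ μ
      split κ k = [ inj₁ , (λ q → inj₂ (support {μ} {κ} (nonzero-* { - ratio ([m μ ] f) μ} q))) ]′ (nonzero-+ {[m κ ] f} k)
      supported : ∀ {R : Partition → Set} → Supported R f → (∀ κ → κ ⊴ μ → R κ) → Supported R f′
      supported r g κ k = [ r κ , g κ ]′ (split κ k)
      w′ = supported {λ κ → d ℕ.* d ≤ weight (parts κ) ℕ.+ c} w λ κ le → ℕ.≤-trans (w μ h) (ℕ.+-monoˡ-≤ c (⊴-weight {κ} {μ} le))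
      m′ : Supported (λ κ → d ℕ.* d ≡ weight (parts κ) ℕ.+ c → κ ∈ L) f′
      m′ κ k q with κ ≟ᴾ μ
      ... | yes ≡.refl = contradiction (subtract-zero f κ) k
      ... | no κ≢μ with split κ k
      ...   | inj₂ le = contradiction (⊴-weight-strict {κ} {μ} le (ℕ.≤-antisym (ℕ.+-cancelʳ-≤ c _ _ (subst (_≤ weight (parts μ) ℕ.+ c) q (w μ h))) (⊴-weight {κ} {μ} le))) κ≢μ
      ...   | inj₁ r with m₀ κ r q
      ...     | here e  = contradiction e κ≢μ
      ...     | there i = i

-- Identification with the Jack functions

module Identification (𝒮 : JackScalarProduct) (𝒥 : JackFunctions 𝒮) where
  open Form 𝒮
  open Operator 𝒮
  open Anisotropy 𝒮
  open JackFunctions 𝒥 renaming (orthogonal to J-orthogonal)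

  pair : ∀ g → Functional ⟪ g ,_⟫
  pair g = record { resp = λ {f} {h} → ⟨⟩-congˡ g {f} {h} ; plus = λ f h → linear-+ʳ f h g ; scale = λ c f → linear-·ʳ c f g }

  multiply : ∀ g h → Functional (λ x → ⟪ g , h *Λ x ⟫)
  multiply g h = record
    { resp  = λ {x} {y} e → ⟨⟩-congˡ g {h *Λ x} {h *Λ y} (convolve-cong (λ _ → refl) e)
    ; plus  = λ x y → ⟨⟩-congˡ g {h *Λ (x +Λ y)} {h *Λ x +Λ h *Λ y} (convolve-+ʳ (coeff h) (coeff x) (coeff y)) ∙ linear-+ʳ (h *Λ x) (h *Λ y) g
    ; scale = λ c x → ⟨⟩-congˡ g {h *Λ (c · x)} {c · (h *Λ x)} (convolve-*ʳ (coeff h) (coeff x) c) ∙ linear-·ʳ c (h *Λ x) g }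

  orthogonal-to : ∀ g → Subspace (λ f → ⟪ g , f ⟫ ≈ 0#)
  orthogonal-to g = equalizer (pair g) (record { resp = λ _ → refl ; plus = λ _ _ → sym (+-identityˡ 0#) ; scale = λ c _ → sym (zeroʳ c) })

  -- A function of degree n is determined by its restriction to n variables, where the Dunkl
  -- operators apply.
  jack-eigen : ∀ lam → D (size lam) (size lam) (jack lam) ≈Λ jack-eigenvalue (size lam) lam · jack lam
  jack-eigen lam = determined {n} {D n n (jack lam)} {e · jack lam} (D-homogeneous {n} {jack lam} n (jack-homogeneous lam))
      (λ a h → *-congˡ {e} (jack-homogeneous lam a h) ∙ zeroʳ e)
      λ a → sym (D-restrict {n} {jack lam} (jack-homogeneous lam) a) ∙ trans
        (sum-cong λ r → U-cong r (U-cong r (λ b → reflexive (restrict-jack lam b))) a)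
        (jackˢ-eigen lam (length≤sum (parts lam) (positive lam)) a ∙ *-congˡ {e} (reflexive (≡.sym (restrict-jack lam a))))
    where
    n = size lam
    e = jack-eigenvalue n lam

  -- Equal eigenvalues mean equal weights, which comparable partitions have only if they coincide.
  -- The incomparable (4,1,1) and (3,3) do share their eigenvalue.
  jack-orthogonal : ∀ {lam μ} → μ ⊴ lam → μ ≢ lam → ⟪ jack lam , jack μ ⟫ ≈ 0#
  jack-orthogonal {lam} {μ} le ne = *-integral (e - e′) (λ q → ne (⊴-weight-strict {μ} {lam} le (≡.sym (separated {n} n {lam} {μ} (≡.sym (proj₁ le)) (equal q))))) (begin
    (e - e′) * x  ≈⟨ solve 3 (λ a b x → (a :- b) :* x := a :* x :- b :* x) refl e e′ x ⟩
    e * x - e′ * x  ≈⟨ +-cong eigenˡ (-‿cong eigenʳ) ⟩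
    ⟪ D n n (jack lam) , jack μ ⟫ - ⟪ jack lam , D n n (jack μ) ⟫ ≈⟨ +-congʳ { - ⟪ jack lam , D n n (jack μ) ⟫} (D-adjoint n n (jack lam) (jack μ)) ⟩
    ⟪ jack lam , D n n (jack μ) ⟫ - ⟪ jack lam , D n n (jack μ) ⟫ ≈⟨ -‿inverseʳ _ ⟩
    0# ∎)
    where
    n = size lam
    e = jack-eigenvalue n lam
    e′ = jack-eigenvalue n μ
    x = ⟪ jack lam , jack μ ⟫
    eigenˡ : e * x ≈ ⟪ D n n (jack lam) , jack μ ⟫
    eigenˡ = sym (⟨⟩-congʳ {D n n (jack lam)} {e · jack lam} (jack μ) (jack-eigen lam) ∙ linear-· e (jack lam) (jack μ))
    eigenʳ : e′ * x ≈ ⟪ jack lam , D n n (jack μ) ⟫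
    eigenʳ = sym (⟨⟩-congˡ (jack lam) {D n n (jack μ)} {e′ · jack μ} (subst (λ k → D k k (jack μ) ≈Λ jack-eigenvalue k μ · jack μ) (proj₁ le) (jack-eigen μ)) ∙ linear-·ʳ e′ (jack μ) (jack lam))
    equal : e - e′ ≈ 0# → e ≈ e′
    equal q = solve 2 (λ a b → a := (a :- b) :+ b) refl e e′ ∙ +-congʳ {e′} q ∙ +-identityˡ e′

  private
    module Jack = Elimination jack (λ {lam} {μ} → jack-triangular {lam} {μ}) (λ lam → pos-≉0 (jack-leading lam))

    weight-room : ∀ {μ lam} → μ ⊴ lam → μ ≢ lam → size μ ℕ.* size μ ∸ weight (parts μ) < size lam ℕ.* size lam ∸ weight (parts lam)
    weight-room {μ} {lam} le ne = subst (λ s → s ℕ.* s ∸ weight (parts μ) < size lam ℕ.* size lam ∸ weight (parts lam)) (≡.sym (proj₁ le))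
      (ℕ.∸-monoʳ-< (ℕ.≤∧≢⇒< (⊴-weight {μ} {lam} le) (λ e → ne (⊴-weight-strict {μ} {lam} le (≡.sym e))))
        (subst (λ s → weight (parts μ) ≤ s ℕ.* s) (proj₁ le) (weight-bound (parts μ) (positive μ))))

  -- Induction down the dominance order, measured by `room`. For lower μ, J_λ is orthogonal to f_μ
  -- because f_μ is J_μ by induction, and f_λ is so by the operator.
  J≈jack : ∀ lam → J lam ≈Λ jack lam
  J≈jack lam = go (suc (room lam)) lam ℕ.≤-refl
    where
    room : Partition → ℕ
    room κ = size κ ℕ.* size κ ∸ weight (parts κ)
    go : ∀ fuel lam → room lam < fuel → J lam ≈Λ jack lam
    go (suc fuel) lam h a = J≈ a ∙ *-congʳ {coeff (jack lam) a} x≈1 ∙ *-identityˡ _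
      where
      x = Jack.ratio ([m lam ] J lam) lam
      -- In the span of the lower Jack functions and orthogonal to all of them.
      g : Λ
      g = J lam +Λ (- x) · jack lam
      Lower : Partition → Set
      Lower μ = μ ⊴ lam × μ ≢ lam
      g-lead : [m lam ] g ≈ 0#
      g-lead = solve 3 (λ y r z → y :+ (:- r) :* z := y :- r :* z) refl ([m lam ] J lam) x ([m lam ] jack lam) ∙
        +-congˡ {[m lam ] J lam} (-‿cong (Jack.ratio-spec ([m lam ] J lam) lam)) ∙ -‿inverseʳ _
      lower : Supported Lower g
      lower μ k = [ (λ q → ⊴-stable {μ} {lam} (λ n → q (triangular {lam} {μ} n))) , (λ q → Jack.support {lam} {μ} (nonzero-* { - x} q)) ]′ (nonzero-+ {[m μ ] J lam} k) , λ { ≡.refl → k g-lead }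
      g-orthogonal : ∀ μ → Lower μ → ⟪ g , jack μ ⟫ ≈ 0#
      g-orthogonal μ (le , ne) = linear-+ (J lam) ((- x) · jack lam) (jack μ) ∙ +-cong
          (⟨⟩-congˡ (J lam) {jack μ} {J μ} (λ a → sym (go fuel μ (ℕ.<-≤-trans (weight-room {μ} {lam} le ne) (ℕ.s≤s⁻¹ h)) a)) ∙ J-orthogonal (ne ∘ ≡.sym))
          (linear-· (- x) (jack lam) (jack μ) ∙ *-congˡ { - x} (jack-orthogonal {lam} {μ} le ne) ∙ zeroʳ _) ∙ +-identityˡ 0#
      down : ∀ {κ μ} → κ ⊴ μ → Lower μ → Lower κ
      down {κ} {μ} le (le′ , ne) = ⊴-trans {κ} {μ} {lam} le le′ , λ { ≡.refl → ne (⊴-weight-strict {μ} {lam} le′ (ℕ.≤-antisym (⊴-weight {lam} {μ} le) (⊴-weight {μ} {lam} le′))) }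
      g≈0 : g ≋0
      g≈0 = anisotropic g (Jack.eliminate {Lower} (λ {κ} {μ} → down {κ} {μ}) (orthogonal-to g) g-orthogonal g lower)
      J≈ : ∀ a → coeff (J lam) a ≈ x * coeff (jack lam) a
      J≈ a = solve 3 (λ y r z → y := (y :+ (:- r) :* z) :+ r :* z) refl (coeff (J lam) a) x (coeff (jack lam) a) ∙ +-congʳ {x * coeff (jack lam) a} (g≈0 a) ∙ +-identityˡ _
      n! = ν (size lam !)
      x≈1 : x ≈ 1#
      x≈1 = *-cancelˡ n! (ν≉0 (size lam !) {{size lam ℕ.!≢0}}) (begin
        n! * x  ≈⟨ *-comm n! x ∙ *-congˡ {x} (sym (jack-normalized lam)) ⟩
        x * [m 1^ (size lam) ] jack lam ≈⟨ J≈ (parts (1^ (size lam))) ⟨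
        [m 1^ (size lam) ] J lam  ≈⟨ normalized lam ∙ fromℕ≈ν (size lam !) ⟩
        n!  ≈⟨ *-identityʳ n! ⟨
        n! * 1#  ∎)

  J-leading : ∀ lam → ¬ [m lam ] J lam ≈ 0#
  J-leading lam e = pos-≉0 (jack-leading lam) (sym (J≈jack lam (parts lam)) ∙ e)

  module J where
    open Elimination J (λ {lam} {μ} → triangular {lam} {μ}) J-leading public

  C : Partition → ℚ⟨α⟩
  C μ = ⟪ m μ , J μ ⟫

  -- Downward closure of the condition on ρ puts f into the span of the J_ρ with ρ not above μ, and
  -- J_μ is not among them.
  away-from : ∀ μ f → Supported (λ ρ → ¬ μ ⊴ ρ) f → ⟪ J μ , f ⟫ ≈ 0#
  away-from μ f s = J.eliminate {λ ρ → ¬ μ ⊴ ρ} (λ {κ} {ρ} le h q → h (⊴-trans {μ} {κ} {ρ} q le)) (orthogonal-to (J μ))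
    (λ ρ h → J-orthogonal λ { ≡.refl → h (≡.refl , λ k → ℕ.≤-refl) }) f s

  m-diagonal : ∀ μ → [m μ ] m μ ≈ 1#
  m-diagonal μ = indicator-yes (parts (shape (parts μ)) ≟ᴸ parts μ) (shape-parts μ)

  m-support : ∀ {μ} → Supported (_≡ μ) (m μ)
  m-support {μ} ρ h with parts (shape (parts ρ)) ≟ᴸ parts μ
  ... | yes e = parts-injective (≡.sym (shape-parts ρ) ⊙ e)
  ... | no ne = contradiction refl h

  -- Once its multiple of m_μ is removed, f is supported on partitions not above μ.
  pairing : ∀ μ f → Supported (λ ρ → μ ⊴ ρ → ρ ≡ μ) f → ⟪ J μ , f ⟫ ≈ [m μ ] f * C μ
  pairing μ f s = begin
    ⟪ J μ , f ⟫
      ≈⟨ ⟨⟩-congˡ (J μ) {f} {f′ +Λ x · m μ} (λ a → solve 3 (λ y x z → y := (y :+ (:- x) :* z) :+ x :* z) refl (coeff f a) x (coeff (m μ) a)) ⟩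
    ⟪ J μ , f′ +Λ x · m μ ⟫
      ≈⟨ linear-+ʳ f′ (x · m μ) (J μ) ∙ +-cong (away-from μ f′ supp′) (linear-·ʳ x (m μ) (J μ) ∙ *-congˡ {x} (⟨⟩-comm (J μ) (m μ))) ⟩
    0# + x * C μ
      ≈⟨ +-identityˡ _ ⟩
    x * C μ ∎
    where
    x = [m μ ] f
    f′ = f +Λ (- x) · m μ
    at-μ : [m μ ] f′ ≈ 0#
    at-μ = +-congˡ {x} (*-congˡ { - x} (m-diagonal μ)) ∙ solve 1 (λ x → x :+ (:- x) :* :1 := :0) refl x
    supp′ : Supported (λ ρ → ¬ μ ⊴ ρ) f′
    supp′ ρ h q with nonzero-+ {[m ρ ] f} h
    ... | inj₁ r with ≡.refl ← s ρ r q = h at-μ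
    ... | inj₂ r with ≡.refl ← m-support {μ} ρ (nonzero-* { - x} r) = h at-μ

-- Polynomial identities over ℚ(α)

open Spectral ℚ⟨α⟩-commutativeRing α

-- Horner form, with d a bound on the number of coefficients.
data IsPoly : ℕ → (ℚ⟨α⟩ → ℚ⟨α⟩) → Set where
  zeroᵖ : ∀ {d f} → (∀ x → f x ≈ 0#) → IsPoly d f
  stepᵖ : ∀ {d f} c g → IsPoly d g → (∀ x → f x ≈ c + x * g x) → IsPoly (suc d) f

poly-resp : ∀ {d f g} → (∀ x → g x ≈ f x) → IsPoly d f → IsPoly d g
poly-resp e (zeroᵖ h)       = zeroᵖ λ x → e x ∙ h x
poly-resp e (stepᵖ c g p h) = stepᵖ c g p λ x → e x ∙ h x

poly-raise : ∀ {d f} → IsPoly d f → IsPoly (suc d) f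
poly-raise (zeroᵖ h)       = zeroᵖ h
poly-raise (stepᵖ c g p h) = stepᵖ c g (poly-raise p) h

poly-+ : ∀ {d f g} → IsPoly d f → IsPoly d g → IsPoly d (λ x → f x + g x)
poly-+ {g = g} (zeroᵖ h) q = poly-resp (λ x → +-congʳ {g x} (h x) ∙ +-identityˡ (g x)) q
poly-+ {f = f} p (zeroᵖ h) = poly-resp (λ x → +-congˡ {f x} (h x) ∙ +-identityʳ (f x)) p
poly-+ (stepᵖ c g p h) (stepᵖ c′ g′ p′ h′) = stepᵖ (c + c′) (λ x → g x + g′ x) (poly-+ p p′) λ x → +-cong (h x) (h′ x) ∙
  solve 5 (λ c c′ x y y′ → (c :+ x :* y) :+ (c′ :+ x :* y′) := (c :+ c′) :+ x :* (y :+ y′)) refl c c′ x (g x) (g′ x)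

poly-* : ∀ {d f} b → IsPoly d f → IsPoly d (λ x → b * f x)
poly-* b (zeroᵖ h)       = zeroᵖ λ x → *-congˡ {b} (h x) ∙ zeroʳ b
poly-* b (stepᵖ c g p h) = stepᵖ (b * c) (λ x → b * g x) (poly-* b p) λ x → *-congˡ {b} (h x) ∙
  solve 4 (λ b c x y → b :* (c :+ x :* y) := b :* c :+ x :* (b :* y)) refl b c x (g x)

poly-x : ∀ {d f} → IsPoly d f → IsPoly (suc d) (λ x → x * f x)
poly-x {f = f} p = stepᵖ 0# f p λ x → sym (+-identityˡ (x * f x))

poly-const : ∀ c → IsPoly 1 (λ _ → c)
poly-const c = stepᵖ c (λ _ → 0#) (zeroᵖ λ _ → refl) λ x → sym (+-congˡ {c} (zeroʳ x) ∙ +-identityʳ c)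

poly-shift : ∀ {d f} → IsPoly d f → IsPoly d (λ x → f (x + 1#))
poly-shift (zeroᵖ h)       = zeroᵖ λ x → h (x + 1#)
poly-shift {suc d} (stepᵖ c g p h) = poly-resp (λ x → h (x + 1#) ∙ solve 3 (λ c x y → c :+ (x :+ :1) :* y := (c :+ x :* y) :+ y) refl c x (g (x + 1#)))
  (poly-+ (stepᵖ c (λ x → g (x + 1#)) (poly-shift p) λ x → refl) (poly-raise (poly-shift p)))

poly-cong : ∀ {d f} → IsPoly d f → ∀ {x y} → x ≈ y → f x ≈ f y
poly-cong (zeroᵖ h)       {x} {y} e = h x ∙ sym (h y)
poly-cong (stepᵖ c g p h) {x} {y} e = h x ∙ +-congˡ {c} (*-cong e (poly-cong p e)) ∙ sym (h y)

-- The constant term is the value at 0. Cancelling x at the points n + 1 leaves a polynomial with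
-- one coefficient fewer that vanishes there, and the shift by one restores all natural zeros.
poly-identity : ∀ d {f} → IsPoly d f → (∀ n → f (ν n) ≈ 0#) → ∀ x → f x ≈ 0#
poly-identity d       (zeroᵖ h)       r x = h x
poly-identity (suc d) {f} (stepᵖ c g p h) r x = h x ∙ +-cong c≈0 (*-congˡ {x} gx≈0 ∙ zeroʳ x) ∙ +-identityˡ 0#
  where
  c≈0 : c ≈ 0#
  c≈0 = solve 2 (λ c y → c := c :+ :0 :* y) refl c (g 0#) ∙ sym (h 0#) ∙ r 0
  roots : ∀ n → g (ν n + 1#) ≈ 0#
  roots n = poly-cong p (+-comm (ν n) 1#) ∙ *-integral (ν (suc n)) (ν≉0 (suc n)) (sym (+-congʳ {ν (suc n) * g (ν (suc n))} c≈0 ∙ +-identityˡ _) ∙ sym (h (ν (suc n))) ∙ r (suc n))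
  gx≈0 : g x ≈ 0#
  gx≈0 = poly-cong p (solve 1 (λ x → x := (x :- :1) :+ :1) refl x) ∙ poly-identity d (poly-shift p) roots (x - 1#)

poly-agree : ∀ d {f g} → IsPoly d f → IsPoly d g → (∀ n → f (ν n) ≈ g (ν n)) → ∀ x → f x ≈ g x
poly-agree d {f} {g} p q h x = solve 2 (λ a b → a := (a :+ (:- :1) :* b) :+ b) refl (f x) (g x) ∙
  +-congʳ {g x} (poly-identity d (poly-+ p (poly-* (- 1#) q)) (λ n → +-congʳ {(- 1#) * g (ν n)} (h n) ∙ solve 1 (λ b → b :+ (:- :1) :* b := :0) refl (g (ν n))) x) ∙ +-identityˡ (g x)

poly-raise⋯ : ∀ k {d f} → IsPoly d f → IsPoly (k ℕ.+ d) f
poly-raise⋯ zero    p = p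
poly-raise⋯ (suc k) p = poly-raise (poly-raise⋯ k p)

Polynomial : (ℚ⟨α⟩ → ℚ⟨α⟩) → Set
Polynomial f = ∃ λ d → IsPoly d f

polynomial-+ : ∀ {f g} → Polynomial f → Polynomial g → Polynomial (λ x → f x + g x)
polynomial-+ {f} (d , p) (d′ , q) = d ℕ.+ d′ , poly-+ (subst (λ k → IsPoly k f) (ℕ.+-comm d′ d) (poly-raise⋯ d′ p)) (poly-raise⋯ d q)

polynomial-agree : ∀ {f g} → Polynomial f → Polynomial g → (∀ n → f (ν n) ≈ g (ν n)) → ∀ x → f x ≈ g x
polynomial-agree {f} (d , p) (d′ , q) = poly-agree (d ℕ.+ d′) (subst (λ k → IsPoly k f) (ℕ.+-comm d′ d) (poly-raise⋯ d′ p)) (poly-raise⋯ d q)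

-- Each mark brings in one factor linear in x.
polynomial-E : ∀ n Q r → Polynomial (λ x → E (- x) n Q r)
polynomial-E n       []                zero    = 1 , poly-const 1#
polynomial-E n       []                (suc r) = 0 , zeroᵖ λ _ → refl
polynomial-E n       ((zero  , s) ∷ Q) r       = polynomial-E n Q r
polynomial-E zero    ((suc l , s) ∷ Q) r       = 0 , zeroᵖ λ _ → refl
polynomial-E (suc n) ((suc l , s) ∷ Q) r       = polynomial-+ (polynomial-E n (Q ∷ʳ (l , false)) r) (marked r)
  where
  marked : ∀ r → Polynomial (λ x → onPred r (λ r′ → markWeight (- x) l s Q * E (- x) n (Q ∷ʳ (l , true)) r′))
  marked zero    = 0 , zeroᵖ λ _ → refl
  marked (suc r) with polynomial-E n (Q ∷ʳ (l , true)) r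
  ... | d , p = suc d , poly-resp (λ x → solve 4 (λ x q k y → ((:- x :+ q) :- k) :* y := (:- :1) :* (x :* y) :+ (q :- k) :* y) refl x (ν (marks Q)) k (E (- x) n (Q ∷ʳ (l , true)) r))
      (poly-+ (poly-* (- 1#) (poly-x p)) (poly-* (ν (marks Q) - k) (poly-raise p)))
    where
    k = when s (α * ν (suc l) + ν (shorterᴸ l (map proj₁ Q)))

-- Elementary functions and evaluation at -α variables

elementary : ℕ → Λ
elementary n = m (1^ n)

shape⇒↭ : ∀ {a μ} → parts (shape a) ≡ parts μ → nonzeros a ↭ parts μ
shape⇒↭ {a} e = ↭-trans (↭-sym (sort-↭ (nonzeros a))) (Perm.↭-reflexive e)

↭⇒shape : ∀ {a μ} → nonzeros a ↭ parts μ → parts (shape a) ≡ parts μ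
↭⇒shape {a} {μ} q = sorted-unique (shape a) μ (↭-trans (sort-↭ (nonzeros a)) q)

ones-↭ : ∀ {n b} → b ↭ replicate n 1 → All (_≡ 1) b
ones-↭ {n} q = Perm.All-resp-↭ (↭-sym q) (All.replicate⁺ n ≡.refl)

-- drops k n is the (n − k)-th elementary function, zero for n < k.
drops : ℕ → ℕ → Λ
drops zero    n       = elementary n
drops (suc k) zero    = 0Λ
drops (suc k) (suc n) = drops k n

drops-zero : ∀ k n a → coeff (drops k n) (0 ∷ a) ≈ coeff (drops k n) a
drops-zero k n a = coeff-zero∷ (drops k n) a

drops-one : ∀ k n a → coeff (drops k n) (1 ∷ a) ≈ coeff (drops (suc k) n) a
drops-one zero    zero    a = indicator-¬ (parts (shape (1 ∷ a)) ≟ᴸ []) (λ e → Perm.¬x∷xs↭[] (shape⇒↭ {1 ∷ a} {1^ 0} e)) ∙ sym (coeff-0Λ a)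
drops-one zero    (suc n) a = indicator-⇔ (parts (shape (1 ∷ a)) ≟ᴸ parts (1^ (suc n))) (parts (shape a) ≟ᴸ parts (1^ n))
  (λ e → ↭⇒shape {a} {1^ n} (Perm.drop-∷ (shape⇒↭ {1 ∷ a} {1^ (suc n)} e))) (λ e → ↭⇒shape {1 ∷ a} {1^ (suc n)} (Perm.prep 1 (shape⇒↭ {a} {1^ n} e)))
drops-one (suc k) zero    a = coeff-0Λ (1 ∷ a) ∙ sym (coeff-0Λ a)
drops-one (suc k) (suc n) a = drops-one k n a

drops-many : ∀ k n i a → coeff (drops k n) (suc (suc i) ∷ a) ≈ 0#
drops-many zero    n       i a = indicator-¬ (parts (shape (suc (suc i) ∷ a)) ≟ᴸ parts (1^ n)) λ e → contradiction (All.head (ones-↭ {n} (shape⇒↭ {suc (suc i) ∷ a} {1^ n} e))) λ ()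
drops-many (suc k) zero    i a = coeff-0Λ (suc (suc i) ∷ a)
drops-many (suc k) (suc n) i a = drops-many k n i a

-- This identifies p_(k+1)^⊥ e_n as (-1)^k α e_(n-k-1). As e_n is squarefree, beyond exponent one
-- the left side vanishes and on the right the last two summands cancel.
newton-elementary : ∀ n → Newton (elementary n) (λ k → (sgn k * α) · drops (suc k) n)
newton-elementary n zero          a = solve 2 (λ α x → α :* :0 :* x := :0) refl α (coeff (elementary n) (0 ∷ a))
newton-elementary n (suc zero)    a = *-congˡ {α * ν 1} (drops-one 0 n a) ∙ solve 2 (λ α x → α :* (:1 :+ :0) :* x := (:1 :* α) :* x :+ :0) refl α (coeff (drops 1 n) a) ∙
  +-congʳ {0#} (*-congˡ {1# * α} (sym (drops-zero 1 n a)))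
newton-elementary n (suc (suc i)) a = *-congˡ {α * ν (suc (suc i))} (drops-many 0 n i a) ∙ zeroʳ _ ∙ sym (begin
  Σ< (suc (suc i)) g
    ≈⟨ Σ<-last (suc i) g ∙ +-congʳ {g (suc i)} (Σ<-last i g) ⟩
  (Σ< i g + g i) + g (suc i)
    ≈⟨ +-cong (+-cong (Σ<-zero i early) (*-congˡ {sgn i * α} (cong-≈ (λ y → coeff (drops (suc i) n) (y ∷ a)) one ∙ drops-one (suc i) n a)))
         (*-congˡ {(- sgn i) * α} (cong-≈ (λ y → coeff (drops (suc (suc i)) n) (y ∷ a)) (ℕ.n∸n≡0 i) ∙ drops-zero (suc (suc i)) n a)) ⟩
  (0# + (sgn i * α) * coeff (drops (suc (suc i)) n) a) + ((- sgn i) * α) * coeff (drops (suc (suc i)) n) a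
    ≈⟨ solve 3 (λ s α x → (:0 :+ (s :* α) :* x) :+ ((:- s) :* α) :* x := :0) refl (sgn i) α (coeff (drops (suc (suc i)) n) a) ⟩
  0# ∎)
  where
  g : ℕ → ℚ⟨α⟩
  g k = coeff ((sgn k * α) · drops (suc k) n) (suc (suc i) ∸ suc k ∷ a)
  one : suc i ∸ i ≡ 1
  one = ℕ.+-∸-assoc 1 (ℕ.≤-refl {i}) ⊙ cong suc (ℕ.n∸n≡0 i)
  early : ∀ k → k < i → g k ≈ 0#
  early k k<i = *-congˡ {sgn k * α} (cong-≈ (λ y → coeff (drops (suc k) n) (y ∷ a)) two ∙ drops-many (suc k) n (i ∸ suc k) a) ∙ zeroʳ _
    where
    two : suc i ∸ k ≡ suc (suc (i ∸ suc k))
    two = ℕ.+-∸-assoc 1 (ℕ.<⇒≤ k<i) ⊙ cong suc (≡.sym (ℕ.m+n∸m≡n 1 (i ∸ k)) ⊙ cong (_∸ 1) (ℕ.+-comm 1 (i ∸ k)) ⊙ pred-lemma k<i)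
      where
      pred-lemma : ∀ {k i} → k < i → (i ∸ k ℕ.+ 1) ∸ 1 ≡ suc (i ∸ suc k)
      pred-lemma {zero}  {suc i} _         = ℕ.m+n∸n≡m (suc i) 1
      pred-lemma {suc k} {suc i} (ℕ.s≤s l) = pred-lemma l

allGeneral : ∀ N → Vec Kind N
allGeneral N = Vec.replicate N general

generals-all : ∀ N → generals (allGeneral N) ≡ N
generals-all zero    = ≡.refl
generals-all (suc N) = cong suc (generals-all N)

singles-all : ∀ N → singles (allGeneral N) ≡ 0
singles-all zero    = ≡.refl
singles-all (suc N) = singles-all N

-- The sum of all coefficients of degree r in N variables.
total-coefficient : ℕ → ℕ → Λ → ℚ⟨α⟩
total-coefficient N r f = Θ (allGeneral N) r (restrict f)

monus : ℕ → ℕ → (ℕ → ℚ⟨α⟩) → ℚ⟨α⟩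
monus zero    r       φ = φ r
monus (suc k) zero    φ = 0#
monus (suc k) (suc r) φ = monus k r φ

Θ-Xs : ∀ N r k j (f : Ser N) → Θ (allGeneral N) r (Xs k j f) ≈ monus k r (λ i → Θ (allGeneral N) i f)
Θ-Xs N r       zero    j f = refl
Θ-Xs N zero    (suc k) j f = Θ-X-general (allGeneral N) 0 j (Xs k j f) (Vec.lookup-replicate j general)
Θ-Xs N (suc r) (suc k) j f = Θ-X-general (allGeneral N) (suc r) j (Xs k j f) (Vec.lookup-replicate j general) ∙ Θ-Xs N r k j f

total-power : ∀ N r k f → total-coefficient N r (power (suc k) *Λ f) ≈ ν N * monus (suc k) r (λ i → total-coefficient N i f)
total-power N r k f = begin
  Θ (allGeneral N) r (restrict (power (suc k) *Λ f))
    ≈⟨ Θ-cong (allGeneral N) r (λ a → sym (powers-restrict k f a)) ⟩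
  Θ (allGeneral N) r (powers (suc k) (restrict f))
    ≈⟨ Θ-sum (allGeneral N) r (λ j → Xs (suc k) j (restrict f)) ⟩
  sum (λ j → Θ (allGeneral N) r (Xs (suc k) j (restrict f)))
    ≈⟨ sum-cong (λ j → Θ-Xs N r (suc k) j (restrict f)) ⟩
  sum (λ j → monus (suc k) r (λ i → total-coefficient N i f))
    ≈⟨ sum-const N _ ⟩
  ν N * monus (suc k) r (λ i → total-coefficient N i f) ∎

total-1 : ∀ N r → total-coefficient N r 1Λ ≈ monus r 0 (λ _ → 1#)
total-1 N zero = zero-degree N 1Λ ∙ refl
  where
  zero-degree : ∀ N f → total-coefficient N 0 f ≈ coeff f []
  zero-degree zero    f = refl
  zero-degree (suc N) f = zero-degree N (shift 0 f) ∙ coeff-zero∷ f []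
total-1 N (suc r) = go N (suc r) 1Λ (λ a h → one a h)
  where
  one : ∀ a → sumᴸ a ≢ 0 → coeff 1Λ a ≈ 0#
  one a h = indicator-¬ (parts (shape a) ≟ᴸ []) λ e → h (≡.sym (sum-nonzeros a) ⊙ sum-↭ (shape⇒↭ {a} {1^ 0} e))
  go : ∀ N r f → (∀ a → sumᴸ a ≢ 0 → coeff f a ≈ 0#) → total-coefficient N (suc (pred r)) f ≈ 0#
  go N r f h = homogeneous N (suc (pred r)) f λ a e → h a λ z′ → contradiction (≡.sym e ⊙ z′) λ ()
    where
    homogeneous : ∀ N r f → (∀ a → sumᴸ a ≡ r → coeff f a ≈ 0#) → total-coefficient N r f ≈ 0#
    homogeneous zero    zero    f h = h [] ≡.refl
    homogeneous zero    (suc r) f h = refl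
    homogeneous (suc N) r       f h = (upto-all r (λ i j → Θ (allGeneral N) j (restrict (shift i f))) λ i j e → homogeneous N j (shift i f) λ a e′ → h (i ∷ a) (cong (i ℕ.+_) e′ ⊙ e)) ∙ refl
      where
      upto-all : ∀ r (φ : ℕ → ℕ → ℚ⟨α⟩) → (∀ i j → i ℕ.+ j ≡ r → φ i j ≈ 0#) → upto r φ ≈ 0#
      upto-all zero    φ h = h 0 0 ≡.refl
      upto-all (suc r) φ h = +-cong (h 0 (suc r) ≡.refl) (upto-all r (φ ∘ suc) λ i j e → h (suc i) j (cong suc e)) ∙ +-identityˡ 0#

E-cong : ∀ {A B} → A ≈ B → ∀ n Q r → E A n Q r ≈ E B n Q r
E-cong e n       []                zero    = refl
E-cong e n       []                (suc r) = refl
E-cong e n       ((zero  , s) ∷ Q) r       = E-cong e n Q r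
E-cong e zero    ((suc l , s) ∷ Q) r       = refl
E-cong e (suc n) ((suc l , s) ∷ Q) r       = +-cong (E-cong e n (Q ∷ʳ (l , false)) r) (onPred-cong r λ r′ →
  *-cong (+-congʳ { - when s (α * ν (suc l) + ν (shorterᴸ l (map proj₁ Q)))} (+-congʳ {ν (marks Q)} e)) (E-cong e n (Q ∷ʳ (l , true)) r′))

sgn-square : ∀ r → sgn r * sgn r ≈ 1#
sgn-square zero    = *-identityˡ 1#
sgn-square (suc r) = solve 1 (λ s → (:- s) :* (:- s) := s :* s) refl (sgn r) ∙ sgn-square r

monus-sgn : ∀ k r (φ : ℕ → ℚ⟨α⟩) → sgn k * monus k r (λ i → sgn i * φ i) ≈ sgn r * monus k r φ
monus-sgn zero    r       φ = *-identityˡ _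
monus-sgn (suc k) zero    φ = solve 1 (λ s → s :* :0 := :1 :* :0) refl (sgn (suc k))
monus-sgn (suc k) (suc r) φ = solve 2 (λ s x → (:- s) :* x := :- (s :* x)) refl (sgn k) (monus k r (λ i → sgn i * φ i)) ∙
  -‿cong (monus-sgn k r φ) ∙ solve 2 (λ s x → :- (s :* x) := (:- s) :* x) refl (sgn r) (monus k r φ)

monus-cong : ∀ k r {φ ψ : ℕ → ℚ⟨α⟩} → (∀ i → φ i ≈ ψ i) → monus k r φ ≈ monus k r ψ
monus-cong zero    r       e = e r
monus-cong (suc k) zero    e = refl
monus-cong (suc k) (suc r) e = monus-cong k r e

shifts : ℕ → Λ → Λ
shifts zero    f = f
shifts (suc k) f = shifts k (shift 1 f)

kinds : ∀ k N → Vec Kind (k ℕ.+ N)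
kinds zero    N = allGeneral N
kinds (suc k) N = single ∷ kinds k N

singles-kinds : ∀ k N → singles (kinds k N) ≡ k
singles-kinds zero    N = singles-all N
singles-kinds (suc k) N = cong suc (singles-kinds k N)

generals-kinds : ∀ k N → generals (kinds k N) ≡ N
generals-kinds zero    N = generals-all N
generals-kinds (suc k) N = generals-kinds k N

total-shifts : ∀ k N r f → total-coefficient N r (shifts k f) ≈ Θ (kinds k N) r (restrict f)
total-shifts zero    N r f = refl
total-shifts (suc k) N r f = total-shifts k N r (shift 1 f)

state-empties : ∀ {N} (ty : Vec Kind N) ls → state ty (empties ls) ≡ unmarked ls
state-empties ty []       = ≡.refl
state-empties ty (l ∷ ls) = cong ((l , false) ∷_) (state-empties ty ls)

convolve-1ʳ : ∀ (F : Coeffs) a → convolve F (coeff 1Λ) a ≈ F a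
convolve-1ʳ F a = convolve-comm F (coeff 1Λ) a ∙ convolve-1 F a

module Evaluations (𝒮 : JackScalarProduct) (𝒥 : JackFunctions 𝒮) where
  open Form 𝒮
  open Operator 𝒮
  open Identification 𝒮 𝒥
  open JackFunctions 𝒥 using (J)

  -- The empty word has norm one and is orthogonal to all other words.
  one-pairing : ∀ f → ⟪ 1Λ , f ⟫ ≈ coeff f []
  one-pairing f = go (spanning f)
    where
    go : ∀ {f} → f ∈Span → ⟪ 1Λ , f ⟫ ≈ coeff f []
    go (∈word [])      = word-norm [] ∙ *-identityʳ _ ∙ +-identityʳ 1#
    go (∈word (k ∷ w)) = word-orthogonal [] (k ∷ w) (Perm.¬x∷xs↭[] ∘ ↭-sym) ∙ sym (zeroˡ (coeff (word w) []))
    go (∈+ {f} {g} s t) = linear-+ʳ f g 1Λ ∙ +-cong (go s) (go t)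
    go (∈· c {f} s)     = linear-·ʳ c f 1Λ ∙ *-congˡ {c} (go s)
    go (∈≈ {f} {g} e s) = ⟨⟩-congˡ 1Λ {g} {f} (λ a → sym (e a)) ∙ go s ∙ e []

  d-elementary : ∀ n k → d (elementary n) k ≈Λ (sgn k * α) · drops (suc k) n
  d-elementary n = newton-unique (elementary n) {d (elementary n)} {λ k → (sgn k * α) · drops (suc k) n} (Perp.newton (perp (elementary n))) (newton-elementary n)

  d-zero : ∀ f → d f 0 ≈Λ α · shift 1 f
  d-zero f a = sym (coeff-zero∷ (d f 0) a) ∙ sym (+-identityʳ _) ∙ sym (Perp.newton (perp f) 1 a) ∙
    solve 2 (λ α x → α :* (:1 :+ :0) :* x := α :* x) refl α (coeff f (1 ∷ a))

  pairing-drops : ∀ h k r → ⟪ h , drops k r ⟫ ≈ monus k r (λ i → ⟪ h , elementary i ⟫)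
  pairing-drops h zero    r       = refl
  pairing-drops h (suc k) zero    = ⟨⟩-0ʳ h
  pairing-drops h (suc k) (suc r) = pairing-drops h k r

  -- Pairing with an elementary function is evaluation of the total coefficient at −α variables.
  record Specialised (f : Λ) (r : ℕ) : Set where
    field
      q          : ℚ⟨α⟩ → ℚ⟨α⟩
      polynomial : Polynomial q
      values     : ∀ N → total-coefficient N r f ≈ q (ν N)
      paired     : ⟪ f , elementary r ⟫ ≈ sgn r * q (- α)
  open Specialised

  -- A factor p_(k+1) multiplies totals by N and the pairing by (-1)^k α; with the sign (-1)^r split
  -- off, the latter factor is - α.
  specialised-power : ∀ k f → (∀ r → Specialised f r) → ∀ r → Specialised (power (suc k) *Λ f) r
  specialised-power k f s r = record
    { q          = λ x → x * monus (suc k) r (λ i → q (s i) x)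
    ; polynomial = Prod.map suc poly-x (poly (suc k) r)
    ; values     = λ N → total-power N r k f ∙ *-congˡ {ν N} (monus-cong (suc k) r λ i → values (s i) N)
    ; paired     = begin
        ⟪ power (suc k) *Λ f , elementary r ⟫
          ≈⟨ adjoint k f (elementary r) ⟩
        ⟪ f , d (elementary r) k ⟫
          ≈⟨ ⟨⟩-congˡ f {d (elementary r) k} {(sgn k * α) · drops (suc k) r} (d-elementary r k) ∙ linear-·ʳ (sgn k * α) (drops (suc k) r) f ⟩
        (sgn k * α) * ⟪ f , drops (suc k) r ⟫
          ≈⟨ *-congˡ {sgn k * α} (pairing-drops f (suc k) r ∙ (monus-cong (suc k) r λ i → paired (s i))) ⟩
        (sgn k * α) * monus (suc k) r (λ i → sgn i * q (s i) (- α))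
          ≈⟨ solve 3 (λ s α x → (s :* α) :* x := (:- α) :* ((:- s) :* x)) refl (sgn k) α (monus (suc k) r (λ i → sgn i * q (s i) (- α))) ⟩
        (- α) * (sgn (suc k) * monus (suc k) r (λ i → sgn i * q (s i) (- α)))
          ≈⟨ *-congˡ { - α} (monus-sgn (suc k) r (λ i → q (s i) (- α))) ⟩
        (- α) * (sgn r * monus (suc k) r (λ i → q (s i) (- α)))
          ≈⟨ solve 3 (λ α s x → α :* (s :* x) := s :* (α :* x)) refl (- α) (sgn r) (monus (suc k) r (λ i → q (s i) (- α))) ⟩
        sgn r * ((- α) * monus (suc k) r (λ i → q (s i) (- α))) ∎ }
    where
    poly : ∀ k r → Polynomial (λ x → monus k r (λ i → q (s i) x))
    poly zero    r       = polynomial (s r)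
    poly (suc k) zero    = 0 , zeroᵖ λ _ → refl
    poly (suc k) (suc r) = poly k r

  specialised-1 : ∀ r → Specialised 1Λ r
  specialised-1 r = record
    { q          = λ _ → monus r 0 (λ _ → 1#)
    ; polynomial = 1 , poly-const (monus r 0 (λ _ → 1#))
    ; values     = λ N → total-1 N r
    ; paired     = one-pairing (elementary r) ∙ at r }
    where
    at : ∀ r → coeff (elementary r) [] ≈ sgn r * monus r 0 (λ _ → 1#)
    at zero    = sym (*-identityˡ 1#)
    at (suc r) = sym (zeroʳ (sgn (suc r)))

  specialised : ∀ f r → Specialised f r
  specialised f r = go (spanning f) r
    where
    go : ∀ {f} → f ∈Span → ∀ r → Specialised f r
    go (∈word [])      r = specialised-1 r
    go (∈word (k ∷ w)) r = specialised-power k (word w) (go (∈word w)) r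
    go (∈+ {f} {g} s t) r = record
      { q = λ x → q a x + q b x ; polynomial = polynomial-+ (polynomial a) (polynomial b)
      ; values = λ N → Θ-+ (allGeneral N) r (restrict f) (restrict g) ∙ +-cong (values a N) (values b N)
      ; paired = linear-+ f g (elementary r) ∙ +-cong (paired a) (paired b) ∙ sym (distribˡ (sgn r) (q a (- α)) (q b (- α))) }
      where
      a = go s r
      b = go t r
    go (∈· c {f} s) r = record
      { q = λ x → c * q a x ; polynomial = proj₁ (polynomial a) , poly-* c (proj₂ (polynomial a))
      ; values = λ N → Θ-* (allGeneral N) r c (restrict f) ∙ *-congˡ {c} (values a N)
      ; paired = linear-· c f (elementary r) ∙ *-congˡ {c} (paired a) ∙ solve 3 (λ c s x → c :* (s :* x) := s :* (c :* x)) refl c (sgn r) (q a (- α)) }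
      where a = go s r
    go (∈≈ {f} {g} e s) r = record
      { q = q a ; polynomial = polynomial a
      ; values = λ N → Θ-cong (allGeneral N) r (λ b → sym (e (toList b))) ∙ values a N
      ; paired = ⟨⟩-congʳ {g} {f} (elementary r) (λ b → sym (e b)) ∙ paired a }
      where a = go s r

  -- The adjoint of p₁ is α times the coefficient of the first power of x₁.
  peel : ∀ k h f → ⟪ h *Λ word (replicate k 0) , f ⟫ ≈ α ^ k * ⟪ h , shifts k f ⟫
  peel zero    h f = ⟨⟩-congʳ {h *Λ 1Λ} {h} f (convolve-1ʳ (coeff h)) ∙ sym (*-identityˡ _)
  peel (suc k) h f = begin
    ⟪ h *Λ (power 1 *Λ w) , f ⟫
      ≈⟨ ⟨⟩-congʳ {h *Λ (power 1 *Λ w)} {power 1 *Λ (h *Λ w)} f rotate′ ⟩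
    ⟪ power 1 *Λ (h *Λ w) , f ⟫
      ≈⟨ adjoint 0 (h *Λ w) f ∙ ⟨⟩-congˡ (h *Λ w) {d f 0} {α · shift 1 f} (d-zero f) ⟩
    ⟪ h *Λ w , α · shift 1 f ⟫
      ≈⟨ linear-·ʳ α (shift 1 f) (h *Λ w) ∙ *-congˡ {α} (peel k h (shift 1 f)) ⟩
    α * (α ^ k * ⟪ h , shifts k (shift 1 f) ⟫)
      ≈⟨ *-assoc α (α ^ k) _ ⟨
    α ^ suc k * ⟪ h , shifts k (shift 1 f) ⟫ ∎
    where
    w = word (replicate k 0)
    rotate′ : h *Λ (power 1 *Λ w) ≈Λ power 1 *Λ (h *Λ w)
    rotate′ a = sym (convolve-assoc (coeff h) (coeff (power 1)) (coeff w) a) ∙ convolve-cong (convolve-comm (coeff h) (coeff (power 1))) (λ _ → refl) a ∙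
      convolve-assoc (coeff (power 1)) (coeff h) (coeff w) a

  -- With k singles and N general variables, `Θ-F` gives the total as a polynomial in N. It is read
  -- at N = - α, where the parameter of E is α.
  evaluation : ∀ lam k r → size lam ≡ k ℕ.+ r → ⟪ elementary r *Λ word (replicate k 0) , J lam ⟫ ≈ α ^ k * (ν (k !) * E α (size lam) (unmarked (rows lam)) r)
  evaluation lam k r h = peel k (elementary r) (J lam) ∙ *-congˡ {α ^ k} (begin
    ⟪ elementary r , g ⟫
      ≈⟨ ⟨⟩-comm (elementary r) g ∙ paired sp ⟩
    sgn r * q sp (- α)
      ≈⟨ *-congˡ {sgn r} (polynomial-agree (polynomial sp) poly agree (- α)) ⟩
    sgn r * (ν (k !) * (sgn r * E (- (- α)) n Q r))
      ≈⟨ *-congˡ {sgn r} (*-congˡ {ν (k !)} (*-congˡ {sgn r} (E-cong (solve 1 (λ x → :- (:- x) := x) refl α) n Q r))) ⟩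
    sgn r * (ν (k !) * (sgn r * E α n Q r))
      ≈⟨ solve 3 (λ s k x → s :* (k :* (s :* x)) := (s :* s) :* (k :* x)) refl (sgn r) (ν (k !)) (E α n Q r) ⟩
    (sgn r * sgn r) * (ν (k !) * E α n Q r)
      ≈⟨ *-congʳ {ν (k !) * E α n Q r} (sgn-square r) ∙ *-identityˡ _ ⟩
    ν (k !) * E α n Q r ∎)
    where
    n = size lam
    Q = unmarked (rows lam)
    g = shifts k (J lam)
    sp = specialised g r
    poly : Polynomial (λ x → ν (k !) * (sgn r * E (- x) n Q r))
    poly = proj₁ (polynomial-E n Q r) , poly-* (ν (k !)) (poly-* (sgn r) (proj₂ (polynomial-E n Q r)))
    agree : ∀ N → q sp (ν N) ≈ ν (k !) * (sgn r * E (- ν N) n Q r)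
    agree N = begin
      q sp (ν N)
        ≈⟨ values sp N ⟨
      total-coefficient N r g
        ≈⟨ total-shifts k N r (J lam) ⟩
      Θ ty r (restrict (J lam))
        ≈⟨ Θ-cong ty r (λ a → J≈jack lam (toList a) ∙ reflexive (restrict-jack lam a)) ⟩
      Θ ty r (jackˢ lam (k ℕ.+ N))
        ≈⟨ Θ-F n ty (empties (rows lam)) r (settled-empties ty (rows lam)) (boxesˢ-empties ty (rows lam) ⊙ sum-rows lam) (h ⊙ cong (ℕ._+ r) (≡.sym (singles-kinds k N))) ⟩
      ν (singles ty !) * (sgn r * E (- ν (generals ty)) n (state ty (empties (rows lam))) r)
        ≈⟨ reflexive (cong₂ (λ i j → ν (i !) * (sgn r * E (- ν j) n (state ty (empties (rows lam))) r)) (singles-kinds k N) (generals-kinds k N)) ⟩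
      ν (k !) * (sgn r * E (- ν N) n (state ty (empties (rows lam))) r)
        ≈⟨ cong-≈ (λ P → ν (k !) * (sgn r * E (- ν N) n P r)) (state-empties ty (rows lam)) ⟩
      ν (k !) * (sgn r * E (- ν N) n Q r) ∎
      where
      ty = kinds k N

-- Removing the first column

stepX : Bool → ℕ → (ℕ → ℚ⟨α⟩) → ℚ⟨α⟩
stepX true  x φ = onPred x φ
stepX false x φ = φ x

stepX-cong : ∀ b x {φ ψ : ℕ → ℚ⟨α⟩} → (∀ n → φ n ≈ ψ n) → stepX b x φ ≈ stepX b x ψ
stepX-cong true  x e = onPred-cong x e
stepX-cong false x e = e x

-- Multiplication by the product of the variables in A.
Xset : ∀ {N} → (Fin N → Bool) → Ser N → Ser N
Xset {zero}  A f []      = f []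
Xset {suc N} A f (x ∷ a) = stepX (A zero) x (λ n → Xset (A ∘ suc) (f ∘ (n ∷_)) a)

Xset-cong : ∀ {N} {A B : Fin N → Bool} {f g : Ser N} → (∀ k → A k ≡ B k) → f ≐ g → Xset A f ≐ Xset B g
Xset-cong {zero}  e e′ []      = e′ []
Xset-cong {suc N} {A} {B} {f} e e′ (x ∷ a) = cong-≈ (λ b → stepX b x (λ n → Xset (A ∘ suc) (f ∘ (n ∷_)) a)) (e zero) ∙
  (stepX-cong (B zero) x λ n → Xset-cong (e ∘ suc) (e′ ∘ (n ∷_)) a)

Xset-none : ∀ {N} {A : Fin N → Bool} f a → (∀ k → A k ≡ false) → Xset A f a ≈ f a
Xset-none {zero}  f []      h = refl
Xset-none {suc N} {A} f (x ∷ a) h = cong-≈ (λ b → stepX b x (λ n → Xset (A ∘ suc) (f ∘ (n ∷_)) a)) (h zero) ∙ Xset-none (f ∘ (x ∷_)) a (h ∘ suc)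

Xset-without : ∀ {N} (A : Fin N → Bool) k f a → A k ≡ true → X k (Xset (without A k) f) a ≈ Xset A f a
Xset-without {suc N} A zero f (x ∷ a) h = (onPred-cong x λ n → Xset-cong {A = without A zero ∘ suc} {A ∘ suc} (λ _ → ≡.refl) (λ _ → refl) a) ∙
  cong-≈ (λ b → stepX b x (λ n → Xset (A ∘ suc) (f ∘ (n ∷_)) a)) (≡.sym h)
Xset-without {suc N} A (suc k) f (x ∷ a) h = swap (A zero) (lookup a k) ∙ (stepX-cong (A zero) x λ n →
    X-cong k (Xset-cong {A = without A (suc k) ∘ suc} {without (A ∘ suc) k} (λ _ → ≡.refl) λ _ → refl) a ∙ Xset-without (A ∘ suc) k (f ∘ (n ∷_)) a h)
  where
  G : ℕ → ℕ → ℚ⟨α⟩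
  G n i = Xset (without A (suc k) ∘ suc) (f ∘ (n ∷_)) (a [ k ]≔ i)
  swap : ∀ b y → onPred y (λ i → stepX b x (λ n → G n i)) ≈ stepX b x (λ n → onPred y (G n))
  swap false y       = refl
  swap true  (suc y) = refl
  swap true  zero    = zeros x
    where
    zeros : ∀ x → 0# ≈ onPred x (λ _ → 0#)
    zeros zero    = refl
    zeros (suc x) = refl

Xall : ∀ {N} → Ser N → Ser N
Xall = Xset (λ _ → true)

-- Which coefficient is read does not depend on the series, so `Xall` passes through sums over
-- labellings.
Xall-cases : ∀ {N} (a : Vec ℕ N) → (∀ f → Xall f a ≈ 0#) ⊎ ∃ λ b → ∀ f → Xall f a ≡ f b
Xall-cases []          = inj₂ ([] , λ f → ≡.refl)
Xall-cases (zero  ∷ a) = inj₁ λ f → refl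
Xall-cases (suc x ∷ a) with Xall-cases a
... | inj₁ h       = inj₁ λ f → h (f ∘ (x ∷_))
... | inj₂ (b , h) = inj₂ (x ∷ b , λ f → h (f ∘ (x ∷_)))

Xall-suc : ∀ {N} (f : Ser N) b → Xall f (Vec.map suc b) ≡ f b
Xall-suc f []      = ≡.refl
Xall-suc f (x ∷ b) = Xall-suc (f ∘ (x ∷_)) b

all-labelled : ∀ {N} {D : Queue N} → Good D → length D ≡ N → ∀ k → has k D ≡ true
all-labelled {N} {D} g e k with has k D in h
... | true  = ≡.refl
... | false = contradiction (sum-fresh g 1# ∙ *-congʳ {1#} (+-congˡ {ν N} (-‿cong (cong-≈ ν e)) ∙ -‿inverseʳ (ν N)) ∙ zeroˡ 1#)
  (pos-≉0 (sum-pos (λ j → unless (has j D) 1#) k (λ j → nonneg (has j D)) (subst (λ b → Pos (unless b 1#)) (≡.sym h) pos-1)))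
  where
  nonneg : ∀ b → NonNeg (unless b 1#)
  nonneg true  = inj₁ refl
  nonneg false = inj₂ pos-1

fresh : ∀ {N} → Queue N → Fin N → Bool
fresh D k = not (has k D)

fresh-∷ʳ : ∀ {N} (D : Queue N) l k j → fresh (D ∷ʳ (l , just k)) j ≡ without (fresh D) k j
fresh-∷ʳ D l k j = cong not (has-∷ʳ j D l k) ⊙ go (has j D) (does (j Fin.≟ k))
  where
  go : ∀ b c → not (b ∨ c) ≡ (if c then false else not b)
  go true  true  = ≡.refl
  go true  false = ≡.refl
  go false true  = ≡.refl
  go false false = ≡.refl

-- The first column of the rows td receives each label outside D exactly once.
unfold-column : ∀ {N} n td {D : Queue N} → Good D → length td ℕ.+ length D ≡ N → ∀ a →
  F (length td ℕ.+ n) (empties (map suc td) ++ D) a ≈ sumQ td D (λ P → Xset (fresh D) (F n (D ++ take (length td) P)) a)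
unfold-column n [] {D} g e a = cong-≈ (λ Q → F n Q a) (≡.sym (List.++-identityʳ D)) ∙
  sym (Xset-none (F n (D ++ [])) a λ k → cong not (all-labelled g e k))
unfold-column {N} n (l ∷ td) {D} g e a = begin
  sum (λ k → unless (has k (empties (map suc td) ++ D)) (X k (F n′ ((empties (map suc td) ++ D) ∷ʳ (l , just k))) a)) + κ l (empties (map suc td) ++ D) * 0#
    ≈⟨ +-congˡ {sum _} (zeroʳ _) ∙ +-identityʳ _ ⟩
  sum (λ k → unless (has k (empties (map suc td) ++ D)) (X k (F n′ ((empties (map suc td) ++ D) ∷ʳ (l , just k))) a))
    ≈⟨ sum-cong (λ k → reflexive (cong₂ (λ b Q → unless b (X k (F n′ Q) a)) (has-empties k (map suc td) D) (List.++-assoc (empties (map suc td)) D _)) ∙ each k) ⟩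
  sum (λ k → unless (has k D) (sumQ td (D ∷ʳ (l , just k)) (Ψ k)))
    ≈⟨ sumQ-exchange td D l Ψ ⟨
  sumQ td D (λ P → sum (λ k → unless (has k P) (Ψ k (P ∷ʳ (l , just k)))))
    ≈⟨ sumQ-cong td g (λ P _ q → sum-cong λ k → unless-cong (has k P) (cong-≈ (λ T → Xset (fresh D) (F n (D ++ (l , just k) ∷ T)) a) (take-∷ʳ P k q))) ⟩
  sumQ td D (λ P → sum (λ k → unless (has k P) (Xset (fresh D) (F n (D ++ (l , just k) ∷ take (length td) P)) a))) ∎
  where
  n′ = length td ℕ.+ n
  Ψ : Fin N → Queue N → ℚ⟨α⟩
  Ψ k P = Xset (fresh D) (F n (D ++ (l , just k) ∷ take (length td) P)) a
  take-∷ʳ : ∀ P k → lengths P ≡ td ++ lengths D → take (length td) (P ∷ʳ (l , just k)) ≡ take (length td) P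
  take-∷ʳ P k q = go (length td) P (subst (length td ≤_) (≡.sym (lengths-length P q ⊙ List.length-++ td)) (ℕ.m≤m+n _ _))
    where
    go : ∀ i (P : Queue N) → i ≤ length P → take i (P ∷ʳ (l , just k)) ≡ take i P
    go zero    P       h         = ≡.refl
    go (suc i) (x ∷ P) (ℕ.s≤s h) = cong (x ∷_) (go i P h)
  each : ∀ k → unless (has k D) (X k (F n′ (empties (map suc td) ++ D ∷ʳ (l , just k))) a) ≈ unless (has k D) (sumQ td (D ∷ʳ (l , just k)) (Ψ k))
  each k with has k D in k∉
  ... | true  = refl
  ... | false = begin
    X k (F n′ (empties (map suc td) ++ D′)) a
      ≈⟨ X-cong k (unfold-column n td (good-∷ʳ g k∉) (cong (length td ℕ.+_) (List.length-++ D ⊙ ℕ.+-comm _ 1) ⊙ ℕ.+-suc _ _ ⊙ e)) a ⟩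
    X k (λ b → sumQ td D′ (λ P → Xset (fresh D′) (F n (D′ ++ take (length td) P)) b)) a
      ≈⟨ Linear.O-sumQ (X-linear k) td D′ (λ P → Xset (fresh D′) (F n (D′ ++ take (length td) P))) a ⟩
    sumQ td D′ (λ P → X k (Xset (fresh D′) (F n (D′ ++ take (length td) P))) a)
      ≈⟨ sumQ-cong′ td D′ (λ P → X-cong k (Xset-cong (fresh-∷ʳ D l k) λ _ → refl) a ∙ Xset-without (fresh D) k (F n (D′ ++ take (length td) P)) a (cong not k∉) ∙
           cong-≈ (λ Q → Xset (fresh D) (F n Q) a) (List.++-assoc D _ _)) ⟩
    sumQ td D′ (Ψ k) ∎
    where D′ = D ∷ʳ (l , just k)

-- With as many variables as rows the first column uses each label once and contributes the product
-- of all variables. What is left is the average over its labels, known from `sumQ-F`.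
column : ∀ {N} n ls → length ls ≡ N → ∀ (a : Vec ℕ N) → F (N ℕ.+ n) (empties (map suc ls)) a ≈ multiplicityᴸ {N} ls [] * Xall (F n (empties ls)) a
column {N} n ls ≡.refl a = cong-≈ (λ Q → F (length ls ℕ.+ n) Q a) (≡.sym (List.++-identityʳ (empties (map suc ls)))) ∙
  unfold-column n ls [] (ℕ.+-identityʳ _) a ∙ (sumQ-cong ls [] λ P _ q → cong-≈ (λ Q → Xall (F n Q) a) (List.take-all (length ls) P (ℕ.≤-reflexive (lengths-length P q ⊙ cong length (List.++-identityʳ ls))))) ∙
    go (Xall-cases a)
  where
  go : (∀ f → Xall f a ≈ 0#) ⊎ (∃ λ b → ∀ f → Xall f a ≡ f b) → sumQ ls [] (λ P → Xall (F n P) a) ≈ multiplicityᴸ {N} ls [] * Xall (F n (empties ls)) a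
  go (inj₁ h)       = (sumQ-cong′ ls [] λ P → h (F n P)) ∙ sumQ-zero ls [] ∙ sym (*-congˡ {multiplicityᴸ {N} ls []} (h (F n (empties ls))) ∙ zeroʳ _)
  go (inj₂ (b , h)) = (sumQ-cong′ ls [] λ P → reflexive (h (F n P))) ∙ sumQ-F n ls [] b ∙
    *-congˡ {multiplicityᴸ {N} ls []} (reflexive (cong (λ Q → F n Q b) (List.++-identityʳ (empties ls)) ⊙ ≡.sym (h (F n (empties ls)))))

convolve-length : ∀ {F F′ : Coeffs} G a → (∀ b → length b ≡ length a → F b ≈ F′ b) → convolve F G a ≈ convolve F′ G a
convolve-length G []      h = *-congʳ {G []} (h [] ≡.refl)
convolve-length G (n ∷ a) h = ∑-cong (upTo (suc n)) λ i → convolve-length (G ∘ (n ∸ i ∷_)) a λ b e → h (i ∷ b) (cong suc e)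

convolve-ones : ∀ {N} (a : Vec ℕ N) (F G : Coeffs) → (∀ b → length b ≡ N → F b ≈ indicator (b ≟ᴸ replicate N 1)) → convolve F G (toList a) ≈ Xall (G ∘ toList) a
convolve-ones []      F G h = *-congʳ {G []} (h [] ≡.refl) ∙ *-identityˡ _
convolve-ones {suc N} (n ∷ a) F G h = reflexive (∑-applyUpTo id (suc n) term) ∙ go n
  where
  term : ℕ → ℚ⟨α⟩
  term i = convolve (F ∘ (i ∷_)) (G ∘ (n ∸ i ∷_)) (toList a)
  vanish : ∀ i G′ → i ≢ 1 → convolve (F ∘ (i ∷_)) G′ (toList a) ≈ 0#
  vanish i G′ ne = (convolve-length {F ∘ (i ∷_)} {λ _ → 0#} G′ (toList a) λ b e → h (i ∷ b) (cong suc (e ⊙ Vec.length-toList a)) ∙ indicator-¬ ((i ∷ b) ≟ᴸ replicate (suc N) 1) (ne ∘ List.∷-injectiveˡ)) ∙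
    convolve-comm (λ _ → 0#) G′ (toList a) ∙ convolve-0ʳ G′ (toList a)
  go : ∀ n → Σ< (suc n) (λ i → convolve (F ∘ (i ∷_)) (G ∘ (n ∸ i ∷_)) (toList a)) ≈ onPred n (λ k → Xall (G ∘ toList ∘ (k ∷_)) a)
  go zero    = +-identityʳ _ ∙ (vanish 0 (G ∘ (0 ∷_)) λ ())
  go (suc n) = +-cong (vanish 0 (G ∘ (suc n ∷_)) λ ()) (+-cong (convolve-ones a (F ∘ (1 ∷_)) (G ∘ (n ∷_)) inner)
      (Σ<-zero n λ i _ → vanish (suc (suc i)) (G ∘ (n ∸ suc i ∷_)) λ ())) ∙ solve 1 (λ x → :0 :+ (x :+ :0) := x) refl (Xall (G ∘ toList ∘ (n ∷_)) a)
    where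
    inner : ∀ b → length b ≡ N → F (1 ∷ b) ≈ indicator (b ≟ᴸ replicate N 1)
    inner b e = h (1 ∷ b) (cong suc e) ∙ indicator-⇔ ((1 ∷ b) ≟ᴸ replicate (suc N) 1) (b ≟ᴸ replicate N 1) List.∷-injectiveʳ (cong (1 ∷_))

elementary-ones : ∀ {N} b → length b ≡ N → coeff (elementary N) b ≈ indicator (b ≟ᴸ replicate N 1)
elementary-ones {N} b e = indicator-⇔ (parts (shape b) ≟ᴸ replicate N 1) (b ≟ᴸ replicate N 1) to from
  where
  to : parts (shape b) ≡ replicate N 1 → b ≡ replicate N 1
  to h = all-ones (subst (All (_≡ 1)) full (ones-↭ {N} q)) ⊙ cong (λ k → replicate k 1) e
    where
    q : nonzeros b ↭ replicate N 1
    q = shape⇒↭ {b} {1^ N} h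
    full : nonzeros b ≡ b
    full = List.filter-complete (1 ℕ.≤?_) (Perm.↭-length q ⊙ List.length-replicate N ⊙ ≡.sym e)
    all-ones : ∀ {b} → All (_≡ 1) b → b ≡ replicate (length b) 1
    all-ones []           = ≡.refl
    all-ones (≡.refl ∷ a) = cong (1 ∷_) (all-ones a)
  from : b ≡ replicate N 1 → parts (shape b) ≡ replicate N 1
  from ≡.refl = shape-parts (1^ N)

restrict-elementary : ∀ {N} f (a : Vec ℕ N) → restrict (elementary N *Λ f) a ≈ Xall (restrict f) a
restrict-elementary f a = convolve-ones a (coeff (elementary _)) (coeff f) elementary-ones

grow : ℕ → List ℕ → List ℕ
grow zero    xs       = []
grow (suc n) []       = 1 ∷ grow n []
grow (suc n) (x ∷ xs) = suc x ∷ grow n xs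

grow-length : ∀ n xs → length (grow n xs) ≡ n
grow-length zero    xs       = ≡.refl
grow-length (suc n) []       = cong suc (grow-length n [])
grow-length (suc n) (x ∷ xs) = cong suc (grow-length n xs)

grow-as-map : ∀ n xs → length xs ≤ n → grow n xs ≡ map suc (xs ++ replicate (n ∸ length xs) 0)
grow-as-map zero    []       h         = ≡.refl
grow-as-map (suc n) []       h         = cong (1 ∷_) (grow-as-map n [] ℕ.z≤n)
grow-as-map (suc n) (x ∷ xs) (ℕ.s≤s h) = cong (suc x ∷_) (grow-as-map n xs h)

grow-sum : ∀ n xs → length xs ≤ n → sumᴸ (grow n xs) ≡ n ℕ.+ sumᴸ xs
grow-sum zero    []       h         = ≡.refl
grow-sum (suc n) []       h         = cong suc (grow-sum n [] ℕ.z≤n)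
grow-sum (suc n) (x ∷ xs) (ℕ.s≤s h) = cong suc (cong (x ℕ.+_) (grow-sum n xs h) ⊙ ℕ+.x∙yz≈y∙xz x n (sumᴸ xs))

grow-injective : ∀ n {xs ys} → length xs ≤ n → length ys ≤ n → All (1 ≤_) xs → All (1 ≤_) ys → grow n xs ≡ grow n ys → xs ≡ ys
grow-injective zero    {[]}     {[]}     _ _ _ _ e = ≡.refl
grow-injective (suc n) {[]}     {[]}     _ _ _ _ e = ≡.refl
grow-injective (suc n) {[]}     {y ∷ ys} _ _ _ (ℕ.s≤s _ ∷ _) e = contradiction (ℕ.suc-injective (List.∷-injectiveˡ e)) λ ()
grow-injective (suc n) {x ∷ xs} {[]}     _ _ (ℕ.s≤s _ ∷ _) _ e = contradiction (ℕ.suc-injective (List.∷-injectiveˡ e)) λ ()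
grow-injective (suc n) {x ∷ xs} {y ∷ ys} (ℕ.s≤s h) (ℕ.s≤s k) (_ ∷ p) (_ ∷ q) e =
  cong₂ _∷_ (ℕ.suc-injective (List.∷-injectiveˡ e)) (grow-injective n h k p q (List.∷-injectiveʳ e))

addColumn : ℕ → Partition → Partition
addColumn n κ .parts      = grow n (parts κ)
addColumn n κ .decreasing = sorted n (parts κ) (decreasing κ)
  where
  sorted : ∀ n xs → Linked _≥_ xs → Linked _≥_ (grow n xs)
  sorted zero          xs           s       = []
  sorted (suc zero)    []           s       = [-]
  sorted (suc (suc n)) []           s       = ℕ.≤-refl ∷ sorted (suc n) [] []
  sorted (suc zero)    (x ∷ xs)     s       = [-]
  sorted (suc (suc n)) (x ∷ [])     s       = ℕ.s≤s ℕ.z≤n ∷ sorted (suc n) [] []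
  sorted (suc (suc n)) (x ∷ y ∷ xs) (h ∷ s) = ℕ.s≤s h ∷ sorted (suc n) (y ∷ xs) s
addColumn n κ .positive   = pos n (parts κ)
  where
  pos : ∀ n xs → All (1 ≤_) (grow n xs)
  pos zero    xs       = []
  pos (suc n) []       = ℕ.s≤s ℕ.z≤n ∷ pos n []
  pos (suc n) (x ∷ xs) = ℕ.s≤s ℕ.z≤n ∷ pos n xs

-- Stops at the first part that disappears, since in a partition all later parts disappear too.
strip : List ℕ → List ℕ
strip (suc (suc x) ∷ xs) = suc x ∷ strip xs
strip _                  = []

strip-length : ∀ xs → length (strip xs) ≤ length xs
strip-length []                 = ℕ.z≤n
strip-length (zero ∷ xs)        = ℕ.z≤n
strip-length (suc zero ∷ xs)    = ℕ.z≤n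
strip-length (suc (suc x) ∷ xs) = ℕ.s≤s (strip-length xs)

grow-strip : ∀ {xs} → Linked _≥_ xs → All (1 ≤_) xs → grow (length xs) (strip xs) ≡ xs
grow-strip {[]}                 s p       = ≡.refl
grow-strip {suc zero ∷ xs}      s (_ ∷ p) = cong (1 ∷_) (ones s p)
  where
  ones : ∀ {xs} → Linked _≥_ (1 ∷ xs) → All (1 ≤_) xs → grow (length xs) [] ≡ xs
  ones [-]               []              = ≡.refl
  ones (ℕ.s≤s ℕ.z≤n ∷ s) (ℕ.s≤s _ ∷ p) = cong (1 ∷_) (ones s p)
grow-strip {suc (suc x) ∷ xs}   s (_ ∷ p) = cong (suc (suc x) ∷_) (grow-strip (Linked.tail s) p)

removeColumn : Partition → Partition
removeColumn lam .parts      = strip (parts lam)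
removeColumn lam .decreasing = sorted (decreasing lam)
  where
  sorted : ∀ {xs} → Linked _≥_ xs → Linked _≥_ (strip xs)
  sorted {[]}                             s       = []
  sorted {zero ∷ xs}                      s       = []
  sorted {suc zero ∷ xs}                  s       = []
  sorted {suc (suc x) ∷ []}               s       = [-]
  sorted {suc (suc x) ∷ zero ∷ xs}        s       = [-]
  sorted {suc (suc x) ∷ suc zero ∷ xs}    s       = [-]
  sorted {suc (suc x) ∷ suc (suc y) ∷ xs} (h ∷ s) = ℕ.s≤s⁻¹ h ∷ sorted s
removeColumn lam .positive   = pos (parts lam)
  where
  pos : ∀ xs → All (1 ≤_) (strip xs)
  pos []                 = []
  pos (zero ∷ xs)        = []
  pos (suc zero ∷ xs)    = []
  pos (suc (suc x) ∷ xs) = ℕ.s≤s ℕ.z≤n ∷ pos xs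

add-removeColumn : ∀ lam → addColumn (ℓ lam) (removeColumn lam) ≡ lam
add-removeColumn lam = parts-injective (grow-strip (decreasing lam) (positive lam))

reverse-zeros : ∀ i → reverse (replicate i 0) ≡ replicate i 0
reverse-zeros zero    = ≡.refl
reverse-zeros (suc i) = List.unfold-reverse 0 (replicate i 0) ⊙ cong (_∷ʳ 0) (reverse-zeros i) ⊙ snoc i
  where
  snoc : ∀ i → replicate i 0 ∷ʳ 0 ≡ replicate (suc i) 0
  snoc zero    = ≡.refl
  snoc (suc i) = cong (0 ∷_) (snoc i)

padded-rows : ∀ n κ → ℓ κ ≤ n → length (replicate (n ∸ ℓ κ) 0 ++ rows κ) ≡ n
padded-rows n κ h = List.length-++ (replicate (n ∸ ℓ κ) 0) ⊙ cong₂ ℕ._+_ (List.length-replicate (n ∸ ℓ κ)) (List.length-reverse (parts κ)) ⊙ ℕ.m∸n+n≡m h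

-- The averaging constant when the diagram is padded with empty rows to n rows.
columnFactor : ℕ → Partition → ℚ⟨α⟩
columnFactor n κ = multiplicityᴸ {n} (replicate (n ∸ ℓ κ) 0 ++ rows κ) []

pos-columnFactor : ∀ n κ → ℓ κ ≤ n → Pos (columnFactor n κ)
pos-columnFactor n κ h = pos-multiplicity {n} (replicate (n ∸ ℓ κ) 0 ++ rows κ) [] (ℕ.≤-reflexive (ℕ.+-identityʳ _ ⊙ padded-rows n κ h))

jackˢ-column : ∀ n κ → ℓ κ ≤ n → ∀ (a : Vec ℕ n) → jackˢ (addColumn n κ) n a ≈ columnFactor n κ * Xall (jackˢ κ n) a
jackˢ-column n κ h a = begin
  F (size (addColumn n κ)) (empties (rows (addColumn n κ))) a
    ≈⟨ reflexive (cong₂ (λ k ls → F k (empties ls) a) (grow-sum n (parts κ) h) reversed) ⟩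
  F (n ℕ.+ size κ) (empties (map suc ls)) a
    ≈⟨ column (size κ) ls (padded-rows n κ h) a ⟩
  columnFactor n κ * Xall (F (size κ) (empties ls)) a
    ≈⟨ *-congˡ {columnFactor n κ} (Xset-cong (λ _ → ≡.refl) (drop-zeros (n ∸ ℓ κ)) a) ⟩
  columnFactor n κ * Xall (jackˢ κ n) a ∎
  where
  ls = replicate (n ∸ ℓ κ) 0 ++ rows κ
  reversed : reverse (grow n (parts κ)) ≡ map suc ls
  reversed = cong reverse (grow-as-map n (parts κ) h) ⊙ ≡.sym (List.reverse-map suc (parts κ ++ replicate (n ∸ ℓ κ) 0)) ⊙
    cong (map suc) (List.reverse-++ (parts κ) (replicate (n ∸ ℓ κ) 0) ⊙ cong (_++ rows κ) (reverse-zeros (n ∸ ℓ κ)))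
  drop-zeros : ∀ i → F (size κ) (empties (replicate i 0 ++ rows κ)) ≐ jackˢ κ n
  drop-zeros zero    b = refl
  drop-zeros (suc i) b = drop-zeros i b

-- At k = ℓ κ the partial sum of κ is the full size, hence so is that of μ.
⊴-length : ∀ {κ μ} → κ ⊴ μ → ℓ μ ≤ ℓ κ
⊴-length {κ} {μ} (s , t) = (short (ℓ κ) (parts μ) (positive μ) (ℕ.n≤0⇒n≡0 (ℕ.+-cancelˡ-≤ (sumᴸ (take (ℓ κ) (parts μ))) _ _ bound)))
  where
  bound : sumᴸ (take (ℓ κ) (parts μ)) ℕ.+ sumᴸ (drop (ℓ κ) (parts μ)) ≤ sumᴸ (take (ℓ κ) (parts μ)) ℕ.+ 0
  bound = ℕ.≤-trans (ℕ.≤-reflexive (take-drop-sum (ℓ κ) (parts μ) ⊙ ≡.sym s ⊙ cong sumᴸ (≡.sym (List.take-all (ℓ κ) (parts κ) ℕ.≤-refl)))) (ℕ.≤-trans (t (ℓ κ)) (ℕ.m≤m+n _ 0))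
  short : ∀ k xs → All (1 ≤_) xs → sumᴸ (drop k xs) ≡ 0 → length xs ≤ k
  short k       []       p       e = ℕ.z≤n
  short (suc k) (x ∷ xs) (_ ∷ p) e = ℕ.s≤s (short k xs p e)
  short zero    (suc x ∷ xs) (_ ∷ p) ()

toList-grow : ∀ {n} b (h : length b ≤ n) → toList (Vec.map suc (padded b h)) ≡ grow n b
toList-grow {zero}  []      h         = ≡.refl
toList-grow {suc n} []      h         = cong (1 ∷_) (toList-grow {n} [] ℕ.z≤n)
toList-grow         (x ∷ b) (ℕ.s≤s h) = cong (suc x ∷_) (toList-grow b h)

-- Hook products and the first column

∏< : ℕ → (ℕ → ℚ⟨α⟩) → ℚ⟨α⟩
∏< zero    f = 1#
∏< (suc n) f = f 0 * ∏< n (f ∘ suc)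

∏<-cong : ∀ n {f g : ℕ → ℚ⟨α⟩} → (∀ i → i < n → f i ≈ g i) → ∏< n f ≈ ∏< n g
∏<-cong zero    e = refl
∏<-cong (suc n) e = *-cong (e 0 (ℕ.s≤s ℕ.z≤n)) (∏<-cong n λ i h → e (suc i) (ℕ.s≤s h))

∏<-* : ∀ n (f g : ℕ → ℚ⟨α⟩) → ∏< n (λ i → f i * g i) ≈ ∏< n f * ∏< n g
∏<-* zero    f g = sym (*-identityˡ 1#)
∏<-* (suc n) f g = *-congˡ {f 0 * g 0} (∏<-* n (f ∘ suc) (g ∘ suc)) ∙ solve 4 (λ a b c d → (a :* b) :* (c :* d) := (a :* c) :* (b :* d)) refl (f 0) (g 0) (∏< n (f ∘ suc)) (∏< n (g ∘ suc))

∏<-extend : ∀ {k n} → k ≤ n → ∀ {f : ℕ → ℚ⟨α⟩} → (∀ i → k ≤ i → f i ≈ 1#) → ∏< n f ≈ ∏< k f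
∏<-extend {zero}  {zero}  h         e = refl
∏<-extend {zero}  {suc n} h         e = *-cong (e 0 ℕ.z≤n) (∏<-extend {zero} {n} ℕ.z≤n λ i _ → e (suc i) ℕ.z≤n) ∙ *-identityˡ 1#
∏<-extend {suc k} {suc n} (ℕ.s≤s h) {f} e = *-congˡ {f 0} (∏<-extend h λ i l → e (suc i) (ℕ.s≤s l))

∏-applyUpTo : ∀ {A : Set} (g : ℕ → A) n (f : A → ℚ⟨α⟩) → ∏ (applyUpTo g n) f ≡ ∏< n (f ∘ g)
∏-applyUpTo g zero    f = ≡.refl
∏-applyUpTo g (suc n) f = cong (f (g 0) *_) (∏-applyUpTo (g ∘ suc) n f)

∏-map : ∀ {A B : Set} (g : A → B) xs (f : B → ℚ⟨α⟩) → ∏ (map g xs) f ≡ ∏ xs (f ∘ g)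
∏-map g []       f = ≡.refl
∏-map g (x ∷ xs) f = cong (f (g x) *_) (∏-map g xs f)

∏-concatMap : ∀ {A B : Set} (g : A → List B) xs (f : B → ℚ⟨α⟩) → ∏ (concatMap g xs) f ≈ ∏ xs (λ x → ∏ (g x) f)
∏-concatMap g []       f = refl
∏-concatMap g (x ∷ xs) f = append (g x) ∙ *-congˡ {∏ (g x) f} (∏-concatMap g xs f)
  where
  append : ∀ ys → ∏ (ys ++ concatMap g xs) f ≈ ∏ ys f * ∏ (concatMap g xs) f
  append []       = sym (*-identityˡ _)
  append (y ∷ ys) = *-congˡ {f y} (append ys) ∙ sym (*-assoc (f y) _ _)

hook : Partition → ℕ → ℕ → ℚ⟨α⟩
hook μ i j = fromℕ (suc (arm μ (suc i , suc j))) * α + fromℕ (leg μ (suc i , suc j))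

c′-rows : ∀ μ → c′ μ ≈ ∏< (ℓ μ) (λ i → ∏< (μ [ suc i ]) (hook μ i))
c′-rows μ = ∏-concatMap (λ i → map (i ,_) (1⋯ (μ [ i ]))) (1⋯ (ℓ μ)) f ∙ reflexive (∏-applyUpTo suc (ℓ μ) (λ i → ∏ (map (i ,_) (1⋯ (μ [ i ]))) f)) ∙
  (∏<-cong (ℓ μ) λ i _ → reflexive (∏-map (suc i ,_) (1⋯ (μ [ suc i ])) f ⊙ ∏-applyUpTo suc (μ [ suc i ]) (λ j → f (suc i , j))))
  where
  f : ℕ × ℕ → ℚ⟨α⟩
  f s = fromℕ (suc (arm μ s)) * α + fromℕ (leg μ s)

columnProduct-∷ʳ : ∀ c ls l → columnProduct c (ls ∷ʳ l) ≈ columnProduct c ls * (α * ν l + ν (c ℕ.+ length ls))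
columnProduct-∷ʳ c []       l = *-comm _ _ ∙ *-congˡ {1#} (cong-≈ (λ k → α * ν l + ν k) (≡.sym (ℕ.+-identityʳ c)))
columnProduct-∷ʳ c (k ∷ ls) l = *-congˡ {α * ν k + ν c} (columnProduct-∷ʳ (suc c) ls l ∙ *-congˡ {columnProduct (suc c) ls} (cong-≈ (λ i → α * ν l + ν i) (≡.sym (ℕ.+-suc c (length ls))))) ∙ sym (*-assoc _ _ _)

columnProduct-heads : ∀ xs → columnProduct 0 (reverse xs) ≈ ∏< (length xs) (λ i → fromℕ (entry xs (suc i)) * α + fromℕ (length xs ∸ suc i))
columnProduct-heads []       = refl
columnProduct-heads (x ∷ xs) = cong-≈ (columnProduct 0) (List.unfold-reverse x xs) ∙ columnProduct-∷ʳ 0 (reverse xs) x ∙ *-comm _ _ ∙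
  *-cong (+-cong (*-comm α (ν x) ∙ *-congʳ {α} (sym (fromℕ≈ν x))) (cong-≈ ν (List.length-reverse xs) ∙ sym (fromℕ≈ν (length xs)))) (columnProduct-heads xs)

entry-grow : ∀ n xs i → i < n → entry (grow n xs) (suc i) ≡ suc (entry xs (suc i))
entry-grow (suc n) []       zero    h         = ≡.refl
entry-grow (suc n) []       (suc i) (ℕ.s≤s h) = entry-grow n [] i h
entry-grow (suc n) (x ∷ xs) zero    h         = ≡.refl
entry-grow (suc n) (x ∷ xs) (suc i) (ℕ.s≤s h) = entry-grow n xs i h

entry-beyond : ∀ xs i → length xs ≤ i → entry xs (suc i) ≡ 0
entry-beyond []       i       h         = ≡.refl
entry-beyond (x ∷ xs) (suc i) (ℕ.s≤s h) = entry-beyond xs i h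

longer-grow : ∀ n xs j → length xs ≤ n → length (filter (suc (suc j) ℕ.≤?_) (grow n xs)) ≡ length (filter (suc j ℕ.≤?_) xs)
longer-grow zero    []       j h = ≡.refl
longer-grow (suc n) []       j h = longer-grow n [] j ℕ.z≤n
longer-grow (suc n) (x ∷ xs) j (ℕ.s≤s h) with suc (suc j) ℕ.≤? suc x | suc j ℕ.≤? x
... | yes p | yes q = cong length (List.filter-accept (suc (suc j) ℕ.≤?_) p) ⊙ cong suc (longer-grow n xs j h) ⊙ ≡.sym (cong length (List.filter-accept (suc j ℕ.≤?_) q))
... | no p  | no q  = cong length (List.filter-reject (suc (suc j) ℕ.≤?_) p) ⊙ longer-grow n xs j h ⊙ ≡.sym (cong length (List.filter-reject (suc j ℕ.≤?_) q))
... | yes p | no q  = contradiction (ℕ.s≤s⁻¹ p) q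
... | no p  | yes q = contradiction (ℕ.s≤s q) p

-- Boxes outside the first column keep arm and leg when it is removed; the first column itself gives
-- `columnProduct`.
c′-column : ∀ n κ → ℓ κ ≤ n → c′ (addColumn n κ) ≈ columnProduct 0 (rows (addColumn n κ)) * c′ κ
c′-column n κ h = begin
  c′ lam
    ≈⟨ c′-rows lam ⟩
  ∏< (ℓ lam) (λ i → ∏< (lam [ suc i ]) (hook lam i))
    ≈⟨ ∏<-cong (ℓ lam) (λ i l → row i (subst (i <_) (grow-length n (parts κ)) l)) ⟩
  ∏< (ℓ lam) (λ i → head i * ∏< (κ [ suc i ]) (hook κ i))
    ≈⟨ ∏<-* (ℓ lam) head (λ i → ∏< (κ [ suc i ]) (hook κ i)) ⟩
  ∏< (ℓ lam) head * ∏< (ℓ lam) (λ i → ∏< (κ [ suc i ]) (hook κ i))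
    ≈⟨ *-cong (sym (columnProduct-heads (parts lam))) ((∏<-extend (subst (ℓ κ ≤_) (≡.sym (grow-length n (parts κ))) h) λ i l → cong-≈ (λ k → ∏< k (hook κ i)) (entry-beyond (parts κ) i l)) ∙ sym (c′-rows κ)) ⟩
  columnProduct 0 (rows lam) * c′ κ ∎
  where
  lam = addColumn n κ
  head : ℕ → ℚ⟨α⟩
  head i = fromℕ (lam [ suc i ]) * α + fromℕ (ℓ lam ∸ suc i)
  row : ∀ i → i < n → ∏< (lam [ suc i ]) (hook lam i) ≈ head i * ∏< (κ [ suc i ]) (hook κ i)
  row i l = cong-≈ (λ k → ∏< k (hook lam i)) (entry-grow n (parts κ) i l) ∙ *-cong
    (reflexive (cong₂ (λ x y → fromℕ x * α + fromℕ (y ∸ suc i)) (cong (λ x → suc (x ∸ 1)) (entry-grow n (parts κ) i l) ⊙ ≡.sym (entry-grow n (parts κ) i l)) (cong length (List.filter-all (1 ℕ.≤?_) (positive lam)))))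
    (∏<-cong (κ [ suc i ]) λ j _ → reflexive (cong₂ (λ x y → fromℕ (suc (x ∸ suc (suc j))) * α + fromℕ (y ∸ suc i)) (entry-grow n (parts κ) i l) (longer-grow n (parts κ) j h)))

-- The pairing of m_μ with J_μ

module Norms (𝒮 : JackScalarProduct) (𝒥 : JackFunctions 𝒮) where
  open Form 𝒮
  open Identification 𝒮 𝒥
  open Evaluations 𝒮 𝒥
  open JackFunctions 𝒥 renaming (orthogonal to J-orthogonal)

  J-norm : ∀ lam → ⟪ J lam , J lam ⟫ ≈ [m lam ] J lam * C lam
  J-norm lam = pairing lam (J lam) λ ρ h le → let le′ = J.support {lam} {ρ} h in
    ⊴-weight-strict {ρ} {lam} le′ (ℕ.≤-antisym (⊴-weight {lam} {ρ} le) (⊴-weight {ρ} {lam} le′))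

  -- Partitions above λ have at most ℓ(λ) parts, and f has no coefficient on those.
  low-orthogonal : ∀ lam {n} f → ℓ lam ≤ n → (∀ (a : Vec ℕ n) → restrict f a ≈ 0#) → ⟪ J lam , f ⟫ ≈ 0#
  low-orthogonal lam f h e = away-from lam f λ ρ k le →
    k (sym (restrict-padded f (parts ρ) (ℕ.≤-trans (⊴-length {lam} {ρ} le) h)) ∙ e (padded (parts ρ) (ℕ.≤-trans (⊴-length {lam} {ρ} le) h)))

  restrict-J : ∀ κ {N} (a : Vec ℕ N) → restrict (J κ) a ≈ jackˢ κ N a
  restrict-J κ a = J≈jack κ (toList a) ∙ reflexive (restrict-jack κ a)

  module _ (n : ℕ) (κ₀ : Partition) (h₀ : ℓ κ₀ ≤ n) where
    private
      lam = addColumn n κ₀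

      length-lam : ℓ lam ≤ n
      length-lam = ℕ.≤-reflexive (grow-length n (parts κ₀))

      restrict-column : ∀ κ → ℓ κ ≤ n → ∀ (a : Vec ℕ n) → restrict (J (addColumn n κ)) a ≈ columnFactor n κ * restrict (elementary n *Λ J κ) a
      restrict-column κ h a = restrict-J (addColumn n κ) a ∙ jackˢ-column n κ h a ∙
        *-congˡ {columnFactor n κ} (Xset-cong (λ _ → ≡.refl) (λ b → sym (restrict-J κ b)) a ∙ sym (restrict-elementary (J κ) a))

      leading-column : [m lam ] J lam ≈ columnFactor n κ₀ * [m κ₀ ] J κ₀
      leading-column = cong-≈ (coeff (J lam)) (≡.sym (toList-grow (parts κ₀) h₀)) ∙ restrict-column κ₀ h₀ v₀ ∙
        *-congˡ {columnFactor n κ₀} (restrict-elementary (J κ₀) v₀ ∙ reflexive (Xall-suc (restrict (J κ₀)) (padded (parts κ₀) h₀)) ∙ restrict-padded (J κ₀) (parts κ₀) h₀)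
        where v₀ = Vec.map suc (padded (parts κ₀) h₀)

      -- In n variables the two functions agree up to the constant; their difference vanishes there
      -- and is orthogonal to J_lam.
      column-pairing : ∀ κ → ℓ κ ≤ n → columnFactor n κ * ⟪ J lam , elementary n *Λ J κ ⟫ ≈ ⟪ J lam , J (addColumn n κ) ⟫
      column-pairing κ h = (solve 2 (λ x y → x := (y :+ x) :- y) refl (c * ⟪ J lam , y ⟫) ⟪ J lam , g ⟫) ∙
        +-cong (+-congˡ {⟪ J lam , g ⟫} (sym (linear-·ʳ c y (J lam))) ∙ sym (linear-+ʳ g (c · y) (J lam)) ∙
          (⟨⟩-congˡ (J lam) {g +Λ c · y} {J (addColumn n κ)} λ a → solve 3 (λ x c y → (x :+ (:- c) :* y) :+ c :* y := x) refl (coeff (J (addColumn n κ)) a) c (coeff y a)))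
          (-‿cong (low-orthogonal lam {n} g length-lam λ a → +-congʳ {(- c) * restrict y a} (restrict-column κ h a) ∙ solve 2 (λ c y → c :* y :+ (:- c) :* y := :0) refl c (restrict y a))) ∙
        (solve 1 (λ x → x :- :0 := x) refl ⟪ J lam , J (addColumn n κ) ⟫)
        where
        c = columnFactor n κ
        y = elementary n *Λ J κ
        g = J (addColumn n κ) +Λ (- c) · y

      -- J_κ vanishes in fewer variables than κ has rows.
      long-pairing : ∀ κ → n < ℓ κ → ⟪ J lam , elementary n *Λ J κ ⟫ ≈ 0#
      long-pairing κ h = low-orthogonal lam {n} (elementary n *Λ J κ) length-lam λ a → restrict-elementary (J κ) a ∙
        Xset-cong (λ _ → ≡.refl) vanish a ∙ ([ (λ z′ → z′ (λ _ → 0#)) , (λ (b , e) → reflexive (e (λ _ → 0#))) ]′ (Xall-cases a))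
        where
        vanish : ∀ (b : Vec ℕ n) → restrict (J κ) b ≈ 0#
        vanish b = coeff-shape (J κ) (toList b) ∙ (triangular {κ} {shape (toList b)} λ le → ℕ.<⇒≱ h (ℕ.≤-trans (⊴-length {shape (toList b)} {κ} le)
          (ℕ.≤-trans (ℕ.≤-reflexive (Perm.↭-length (sort-↭ (nonzeros (toList b))))) (ℕ.≤-trans (List.length-filter (1 ℕ.≤?_) (toList b)) (ℕ.≤-reflexive (Vec.length-toList b))))))

      Transferred : Λ → Set
      Transferred x = C κ₀ * ⟪ J lam , elementary n *Λ x ⟫ ≈ C lam * ⟪ J κ₀ , x ⟫

      both-zero : ∀ {x y} κ → x ≈ 0# → κ₀ ≢ κ → y ≈ ⟪ J κ₀ , J κ ⟫ → C κ₀ * x ≈ C lam * y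
      both-zero κ p ne q = *-congˡ {C κ₀} p ∙ zeroʳ (C κ₀) ∙ sym (*-congˡ {C lam} (q ∙ J-orthogonal ne) ∙ zeroʳ (C lam))

      base : ∀ κ → Transferred (J κ)
      base κ with ℓ κ ℕ.≤? n
      ... | no h = both-zero κ (long-pairing κ (ℕ.≰⇒> h)) (λ { ≡.refl → h h₀ }) refl
      ... | yes h with κ₀ ≟ᴾ κ
      ...   | no ne = both-zero κ (*-integral (columnFactor n κ) (pos-≉0 (pos-columnFactor n κ h)) (column-pairing κ h ∙
                (J-orthogonal λ e → ne (parts-injective (grow-injective n h₀ h (positive κ₀) (positive κ) (cong parts e)))))) ne refl
      ...   | yes ≡.refl = *-congˡ {C κ₀} paired′ ∙ solve 3 (λ a v b → a :* (v :* b) := b :* (v :* a)) refl (C κ₀) ([m κ₀ ] J κ₀) (C lam) ∙ *-congˡ {C lam} (sym (J-norm κ₀))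
        where
        paired′ : ⟪ J lam , elementary n *Λ J κ₀ ⟫ ≈ [m κ₀ ] J κ₀ * C lam
        paired′ = *-cancelˡ (columnFactor n κ₀) (pos-≉0 (pos-columnFactor n κ₀ h₀)) (column-pairing κ₀ h₀ ∙ J-norm lam ∙ *-congʳ {C lam} leading-column ∙ *-assoc _ _ _)

    -- The adjoint of multiplication by e_n takes J_lam to a multiple of J_κ₀. Checked on the J_κ,
    -- where both sides vanish unless κ is κ₀.
    transfer : ∀ x → C κ₀ * ⟪ J lam , elementary n *Λ x ⟫ ≈ C lam * ⟪ J κ₀ , x ⟫
    transfer x = J.eliminate {λ _ → ⊤} (λ _ _ → tt) (equalizer (scaled (C κ₀) (multiply (J lam) (elementary n))) (scaled (C lam) (pair (J κ₀)))) (λ κ _ → base κ) x (λ _ _ → tt)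

    -- At x = p₁^k with k = size κ₀ both pairings are evaluations: at r = 0 the sum E is one, and at
    -- r = n it is the product over the rows.
    C-column : C lam ≈ columnProduct 0 (rows lam) * C κ₀
    C-column = *-cancelˡ c c≉0 (begin
      c * C lam
        ≈⟨ *-comm c (C lam) ⟩
      C lam * c
        ≈⟨ *-congˡ {C lam} (⟨⟩-congˡ (J κ₀) {w} {elementary 0 *Λ w} (λ a → sym (convolve-1 (coeff w) a)) ∙ ⟨⟩-comm (J κ₀) (elementary 0 *Λ w) ∙ evaluation κ₀ k 0 (≡.sym (ℕ.+-identityʳ k)) ∙
             *-congˡ {α ^ k} (*-congˡ {ν (k !)} (E-0 α k (unmarked (rows κ₀)) (cong sumᴸ (lengths-unmarked (rows κ₀)) ⊙ sum-rows κ₀)) ∙ *-identityʳ _)) ⟨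
      C lam * ⟪ J κ₀ , w ⟫
        ≈⟨ transfer w ⟨
      C κ₀ * ⟪ J lam , elementary n *Λ w ⟫
        ≈⟨ *-congˡ {C κ₀} (⟨⟩-comm (J lam) (elementary n *Λ w) ∙ evaluation lam k n (grow-sum n (parts κ₀) h₀ ⊙ ℕ.+-comm n k)) ⟩
      C κ₀ * (α ^ k * (ν (k !) * E α (size lam) (unmarked (rows lam)) n))
        ≈⟨ *-congˡ {C κ₀} (*-congˡ {α ^ k} (*-congˡ {ν (k !)} topmost)) ⟩
      C κ₀ * (α ^ k * (ν (k !) * columnProduct 0 (rows lam)))
        ≈⟨ solve 4 (λ a b c d → a :* (b :* (c :* d)) := (b :* c) :* (d :* a)) refl (C κ₀) (α ^ k) (ν (k !)) (columnProduct 0 (rows lam)) ⟩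
      c * (columnProduct 0 (rows lam) * C κ₀) ∎)
      where
      k = size κ₀
      w = word (replicate k 0)
      c = α ^ k * ν (k !)
      c≉0 : ¬ c ≈ 0#
      c≉0 = pos-≉0 (pos-* (pos-^ k) (subst (λ i → Pos (ν i)) (ℕ.suc-pred (k !) {{k ℕ.!≢0}}) (pos-ν (pred (k !)))))
      topmost : E α (size lam) (unmarked (rows lam)) n ≈ columnProduct 0 (rows lam)
      topmost = cong-≈ (E α (size lam) (unmarked (rows lam))) (≡.sym (open-unmarked (rows lam) ⊙ List.length-reverse (parts lam) ⊙ grow-length n (parts κ₀))) ∙
        E-top (λ j → *-cancelˡ (ν (suc j)) (ν≉0 (suc j))) (size lam) (unmarked (rows lam)) (cong sumᴸ (lengths-unmarked (rows lam)) ⊙ sum-rows lam) ∙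
          prodθ-ascending [] (rows lam) (All.universal (λ _ → []) (rows lam)) (rows-ascending lam)

  C≈c′ : ∀ lam → C lam ≈ c′ lam
  C≈c′ lam = go (suc (size lam)) lam ℕ.≤-refl
    where
    go : ∀ fuel lam → size lam < fuel → C lam ≈ c′ lam
    go (suc fuel) (mkPartition [] s p) h = one-pairing (J ∅) ∙ (normalized ∅) ∙ fromℕ≈ν 1 ∙ +-identityʳ 1#
      where ∅ = mkPartition [] s p
    go (suc fuel) lam@(mkPartition (x ∷ xs) s p) h = subst (λ μ → C μ ≈ c′ μ) (add-removeColumn lam) (C-column n κ₀ h₀ ∙ *-congˡ {columnProduct 0 (rows (addColumn n κ₀))} (go fuel κ₀ smaller) ∙ sym (c′-column n κ₀ h₀))
      where
      n = ℓ lam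
      κ₀ = removeColumn lam
      h₀ : ℓ κ₀ ≤ n
      h₀ = strip-length (parts lam)
      smaller : size κ₀ < fuel
      smaller = ℕ.<-≤-trans (subst (size κ₀ <_) (≡.sym (grow-sum n (parts κ₀) h₀) ⊙ cong size (add-removeColumn lam)) (ℕ.s≤s (ℕ.m≤n+m (size κ₀) (length xs)))) (ℕ.s≤s⁻¹ h)

-- Divisibility by factorials of multiplicities

record Divisible (w : ℕ) (x : ℚ⟨α⟩) : Set where
  constructor mkDivisible
  field
    quotient : ℚ⟨α⟩
    integral : NIP quotient
    factored : x ≈ ν w * quotient

divisible-resp : ∀ {w x y} → x ≈ y → Divisible w x → Divisible w y
divisible-resp e (mkDivisible z′ p q) = mkDivisible z′ p (sym e ∙ q)

divisible-0 : ∀ {w} → Divisible w 0#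
divisible-0 {w} = mkDivisible 0# nip-0 (sym (zeroʳ (ν w)))

divisible-+ : ∀ {w x y} → Divisible w x → Divisible w y → Divisible w (x + y)
divisible-+ {w} (mkDivisible a p q) (mkDivisible b p′ q′) = mkDivisible (a + b) (nip-+ p p′) (+-cong q q′ ∙ sym (distribˡ (ν w) a b))

divisible-* : ∀ {w c x} → NIP c → Divisible w x → Divisible w (c * x)
divisible-* {w} {c} n (mkDivisible a p q) = mkDivisible (c * a) (nip-* n p) (*-congˡ {c} q ∙ solve 3 (λ c w a → c :* (w :* a) := w :* (c :* a)) refl c (ν w) a)

divisible-sum : ∀ {w n} {f : Fin n → ℚ⟨α⟩} → (∀ i → Divisible w (f i)) → Divisible w (sum f)
divisible-sum {n = zero}  {f} h = divisible-resp (sym (sum-0 f)) divisible-0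
divisible-sum {n = suc n} {f} h = divisible-resp (sym (sum-suc f)) (divisible-+ (h zero) (divisible-sum (h ∘ suc)))

divisible-Σ< : ∀ {w} n {f : ℕ → ℚ⟨α⟩} → (∀ i → i < n → Divisible w (f i)) → Divisible w (Σ< n f)
divisible-Σ< zero    h = divisible-0
divisible-Σ< (suc n) h = divisible-+ (h 0 (ℕ.s≤s ℕ.z≤n)) (divisible-Σ< n λ i l → h (suc i) (ℕ.s≤s l))

card-none : ∀ {N} {A : Fin N → Bool} → (∀ k → A k ≡ false) → card A ≡ 0
card-none {zero}  h = ≡.refl
card-none {suc N} {A} h = cong₂ ℕ._+_ (cong bit (h zero)) (card-none (h ∘ suc))

search : ∀ {N} (A : Fin N → Bool) → (∃ λ k → A k ≡ true) ⊎ (∀ k → A k ≡ false)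
search {zero}  A = inj₂ λ ()
search {suc N} A with A zero in e | search (A ∘ suc)
... | true  | _            = inj₁ (zero , e)
... | false | inj₁ (k , h) = inj₁ (suc k , h)
... | false | inj₂ h       = inj₂ λ { zero → e ; (suc k) → h k }

sum-constant : ∀ {N} (A : Fin N → Bool) (T : Fin N → ℚ⟨α⟩) t → (∀ k → A k ≡ true → T k ≈ t) → sum (λ k → when (A k) (T k)) ≈ ν (card A) * t
sum-constant {zero}  A T t h = sum-0 _ ∙ sym (zeroˡ t)
sum-constant {suc N} A T t h = sum-suc _ ∙ +-cong (first′ (A zero) (h zero)) (sum-constant (A ∘ suc) (T ∘ suc) t (h ∘ suc)) ∙
  sym (distribʳ t (ν (bit (A zero))) (ν (card (A ∘ suc)))) ∙ *-congʳ {t} (sym (ν-+ (bit (A zero)) (card (A ∘ suc))))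
  where
  first′ : ∀ b → (b ≡ true → T zero ≈ t) → when b (T zero) ≈ ν (if b then 1 else 0) * t
  first′ true  e = e ≡.refl ∙ sym (*-congʳ {t} (+-identityʳ 1#) ∙ *-identityˡ t)
  first′ false e = sym (zeroˡ t)

class : ∀ {N} → (Fin N → Bool) → Vec ℕ N → ℕ → Fin N → Bool
class A a s k = A k ∧ does (suc s ℕ.≟ lookup a k)

-- A consists of labels not yet in the queue. Its labels of equal positive exponent form a class,
-- and B bounds the exponents; for all labels and the exponents of μ this is u μ.
factorials : ∀ {N} → ℕ → (Fin N → Bool) → Vec ℕ N → ℕ
factorials B A a = Π< B (λ s → card (class A a s) !)

class-≔ : ∀ {N} (A : Fin N → Bool) a k i s → A k ≡ false → ∀ j → class A (a [ k ]≔ i) s j ≡ class A a s j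
class-≔ A a k i s h j = go (j Fin.≟ k)
  where
  go : Dec (j ≡ k) → class A (a [ k ]≔ i) s j ≡ class A a s j
  go (yes ≡.refl) = cong (_∧ does (suc s ℕ.≟ lookup (a [ k ]≔ i) j)) h ⊙ cong (_∧ does (suc s ℕ.≟ lookup a j)) (≡.sym h)
  go (no ne)      = cong (λ x → A j ∧ does (suc s ℕ.≟ x)) (Vec.lookup∘update′ ne a i)

factorials-≔ : ∀ {N} B (A : Fin N → Bool) a k i → A k ≡ false → factorials B A (a [ k ]≔ i) ≡ factorials B A a
factorials-≔ B A a k i h = Π<-cong B λ s → cong _! (card-cong (class-≔ A a k i s h))

without-self : ∀ {N} (A : Fin N → Bool) k → without A k k ≡ false
without-self A k = cong (λ b → if b then false else A k) (dec-true (k Fin.≟ k) ≡.refl)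

class-without : ∀ {N} (A : Fin N → Bool) a s k → (if class A a s k then 1 else 0) ℕ.+ card (class (without A k) a s) ≡ card (class A a s)
class-without A a s k = cong ((if class A a s k then 1 else 0) ℕ.+_) (card-cong λ j → swap (does (j Fin.≟ k)) (A j) (does (suc s ℕ.≟ lookup a j))) ⊙ card-without (class A a s) k
  where
  swap : ∀ d b c → (if d then false else b) ∧ c ≡ (if d then false else (b ∧ c))
  swap true  b c = ≡.refl
  swap false b c = ≡.refl

-- Removing k shrinks only its own class, by one.
factorials-without : ∀ {N} B (A : Fin N → Bool) a k s → A k ≡ true → lookup a k ≡ suc s → s < B →
  factorials B A a ≡ card (class A a s) ℕ.* factorials B (without A k) a
factorials-without B A a k s h e l = Π<-change B s (card (class A a s)) l
  (λ i i≢s → cong _! (≡.sym (class-without A a i k) ⊙ cong (λ b → (if b then 1 else 0) ℕ.+ card (class (without A k) a i))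
    (cong₂ (λ b x → b ∧ does (suc i ℕ.≟ x)) h e ⊙ dec-false (suc i ℕ.≟ suc s) (i≢s ∘ ℕ.suc-injective))))
  ((cong _! (≡.sym grown)) ⊙ cong (ℕ._* card (class (without A k) a s) !) grown)
  where
  grown : suc (card (class (without A k) a s)) ≡ card (class A a s)
  grown = cong (λ b → (if b then 1 else 0) ℕ.+ card (class (without A k) a s))
    (≡.sym (cong₂ (λ b x → b ∧ does (suc s ℕ.≟ x)) h e ⊙ dec-true (suc s ℕ.≟ suc s) ≡.refl)) ⊙ class-without A a s k

Disjoint : ∀ {N} → (Fin N → Bool) → Queue N → Set
Disjoint A Q = ∀ k → A k ≡ true → has k Q ≡ false

true≢false : ∀ {b} → b ≡ true → b ≢ false
true≢false ≡.refl ()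

disjoint-∷ʳ : ∀ {N} {A : Fin N → Bool} Q l k → A k ≡ false → Disjoint A Q → Disjoint A (Q ∷ʳ (l , just k))
disjoint-∷ʳ Q l k h d j e = has-∷ʳ-false Q l (d j e) λ { ≡.refl → true≢false e h }

disjoint-without : ∀ {N} {A : Fin N → Bool} Q k → Disjoint A Q → Disjoint (without A k) Q
disjoint-without {A = A} Q k d j e = d j (go (does (j Fin.≟ k)) e)
  where
  go : ∀ b → (if b then false else A j) ≡ true → A j ≡ true
  go false e = e

-- Exchanging j and k fixes both the exponents and the labels of Q.
exchange : ∀ {N} n l (Q : Queue N) a {j k} s → has j Q ≡ false → has k Q ≡ false → lookup a j ≡ suc s → lookup a k ≡ suc s →
           F n (Q ∷ʳ (l , just j)) (a [ j ]≔ s) ≈ F n (Q ∷ʳ (l , just k)) (a [ k ]≔ s)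
exchange n l Q a {j} {k} s p q e e′ = cong-≈ (F n (Q ∷ʳ (l , just j))) (≡.sym swapped) ∙
  F-relabel n (Q ∷ʳ (l , just j)) j k (a [ k ]≔ s) ∙ reflexive (cong (λ P → F n P (a [ k ]≔ s))
    (relabel-∷ʳ j k Q l j ⊙ cong₂ (λ P i → P ∷ʳ (l , just i)) (relabel-fresh Q p q) (transpose-left j k)))
  where
  fixed : swapᵛ j k a ≡ a
  fixed = vec-ext λ i → lookup-swapᵛ j k a i ⊙ go i (i Fin.≟ j) (i Fin.≟ k)
    where
    go : ∀ i → Dec (i ≡ j) → Dec (i ≡ k) → lookup a (transpose j k i) ≡ lookup a i
    go i (yes ≡.refl) _            = cong (lookup a) (transpose-left i k) ⊙ e′ ⊙ ≡.sym e
    go i (no _)       (yes ≡.refl) = cong (lookup a) (transpose-right j i) ⊙ e ⊙ ≡.sym e′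
    go i (no i≢j)     (no i≢k)     = cong (lookup a) (transpose-other j k i≢j i≢k)
  swapped : swapᵛ j k (a [ k ]≔ s) ≡ a [ j ]≔ s
  swapped = swapᵛ-≔ j k k a s ⊙ cong₂ (λ b i → b [ i ]≔ s) fixed (transpose-right j k)

-- The terms of unused labels with equal exponents are equal; a class of k of them supplies a factor k.
divisible-F : ∀ n {N} B (A : Fin N → Bool) Q a → Disjoint A Q → (∀ k → lookup a k ≤ B) → Divisible (factorials B A a) (F n Q a)
divisible-F n B A [] a d b with isZero a in e
... | false = divisible-0
... | true  = mkDivisible 1# (nip-resp (+-identityʳ 1#) (nip-ν 1)) (sym (*-congʳ {1#} (cong-≈ ν trivial ∙ +-identityʳ 1#) ∙ *-identityˡ 1#))
  where
  Π<-1 : ∀ n {f : ℕ → ℕ} → (∀ i → f i ≡ 1) → Π< n f ≡ 1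
  Π<-1 zero    h = ≡.refl
  Π<-1 (suc n) h = (cong₂ ℕ._*_ (h 0) (Π<-1 n (h ∘ suc))) ⊙ ≡.refl
  trivial : factorials B A a ≡ 1
  trivial = Π<-1 B λ s → cong _! (card-none λ k → cong (λ x → A k ∧ does (suc s ℕ.≟ x)) (isZero-lookup a e k) ⊙ Bool.∧-zeroʳ (A k))
divisible-F n B A ((zero , c) ∷ Q) a d b = divisible-F n B A Q a (λ k e → tail c k (d k e)) b
  where
  tail : ∀ c k → has k ((zero , c) ∷ Q) ≡ false → has k Q ≡ false
  tail nothing  k h = h
  tail (just j) k h = proj₂ (∨-false {does (k Fin.≟ j)} h)
divisible-F zero B A ((suc l , c) ∷ Q) a d b = divisible-0
divisible-F (suc n) {N} B A ((suc l , c) ∷ Q) a d b = divisible-+ (divisible-resp (sym (KR.sum-when-unless A (λ k → unless (has k Q) (T k)))) (divisible-+ within outside)) (divisible-* (nip-κ l Q) (marked c d))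
  where
  w = factorials B A a
  T : Fin N → ℚ⟨α⟩
  T k = X k (F n (Q ∷ʳ (l , just k))) a
  tail : ∀ c → Disjoint A ((suc l , c) ∷ Q) → Disjoint A Q
  tail nothing  d k e = d k e
  tail (just j) d k e = proj₂ (∨-false {does (k Fin.≟ j)} (d k e))
  dQ : Disjoint A Q
  dQ = tail c d
  bound : ∀ k {x i} → lookup a k ≡ x → i ≤ x → ∀ j → lookup (a [ k ]≔ i) j ≤ B
  bound k {i = i} e h j = go (j Fin.≟ k)
    where
    go : Dec (j ≡ k) → lookup (a [ k ]≔ i) j ≤ B
    go (yes ≡.refl) = subst (_≤ B) (≡.sym (Vec.lookup∘update k a i)) (ℕ.≤-trans h (subst (_≤ B) e (b k)))
    go (no ne)      = subst (_≤ B) (≡.sym (Vec.lookup∘update′ ne a i)) (b j)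
  unaffected : ∀ k → A k ≡ false → Divisible w (T k)
  unaffected k h = go (lookup a k) ≡.refl
    where
    go : ∀ x → lookup a k ≡ x → Divisible w (onPred x (λ i → F n (Q ∷ʳ (l , just k)) (a [ k ]≔ i)))
    go zero    e = divisible-0
    go (suc i) e = subst (λ w → Divisible w (F n (Q ∷ʳ (l , just k)) (a [ k ]≔ i))) (factorials-≔ B A a k i h)
      (divisible-F n B A (Q ∷ʳ (l , just k)) (a [ k ]≔ i) (disjoint-∷ʳ Q l k h dQ) (bound k e (ℕ.n≤1+n i)))
  marked : ∀ c → Disjoint A ((suc l , c) ∷ Q) → Divisible w (onLabel c T)
  marked nothing  d = divisible-0
  marked (just j) d with A j in e
  ... | false = unaffected j e
  ... | true  = contradiction (d j e) (true≢false (cong (_∨ has j Q) (dec-true (j Fin.≟ j) ≡.refl)))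
  outside : Divisible w (sum (λ k → unless (A k) (unless (has k Q) (T k))))
  outside = divisible-sum λ k → go k (A k) (has k Q) ≡.refl
    where
    go : ∀ k x y → A k ≡ x → Divisible w (unless x (unless y (T k)))
    go k true  y     e = divisible-0
    go k false true  e = divisible-0
    go k false false e = unaffected k e
  evaluate : ∀ k {s} → lookup a k ≡ suc s → T k ≈ F n (Q ∷ʳ (l , just k)) (a [ k ]≔ s)
  evaluate k e = cong-≈ (λ x → onPred x (λ i → F n (Q ∷ʳ (l , just k)) (a [ k ]≔ i))) e
  in-class : ∀ {s k} → class A a s k ≡ true → A k ≡ true × lookup a k ≡ suc s
  in-class {s} {k} h = go (A k) (suc s ℕ.≟ lookup a k) ≡.refl h
    where
    go : ∀ x (y : Dec (suc s ≡ lookup a k)) → A k ≡ x → x ∧ does y ≡ true → A k ≡ true × lookup a k ≡ suc s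
    go true (yes q) e _ = e , ≡.sym q
  by-class : ∀ s → s < B → Divisible w (sum (λ k → when (class A a s k) (T k)))
  by-class s s<B with search (class A a s)
  ... | inj₂ none = divisible-resp (sym (sum-zero λ k → cong-≈ (λ x → when x (T k)) (none k))) divisible-0
  ... | inj₁ (k , h) with in-class {s} {k} h
  ...   | Ak , ak with divisible-F n B (without A k) (Q ∷ʳ (l , just k)) (a [ k ]≔ s) (disjoint-∷ʳ Q l k (without-self A k) (disjoint-without Q k dQ)) (bound k ak (ℕ.n≤1+n s))
  ...     | mkDivisible y p q = mkDivisible y p (sum-constant (class A a s) T (F n (Q ∷ʳ (l , just k)) (a [ k ]≔ s)) same ∙ *-congˡ {ν (card (class A a s))} q ∙
        sym (*-assoc (ν (card (class A a s))) _ y) ∙ *-congʳ {y} (sym (ν-* (card (class A a s)) (factorials B (without A k) (a [ k ]≔ s))) ∙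
          cong-≈ ν (cong (card (class A a s) ℕ.*_) (factorials-≔ B (without A k) a k s (without-self A k)) ⊙ ≡.sym (factorials-without B A a k s Ak ak s<B))))
    where
    same : ∀ j → class A a s j ≡ true → T j ≈ F n (Q ∷ʳ (l , just k)) (a [ k ]≔ s)
    same j h′ with in-class {s} {j} h′
    ... | Aj , aj = evaluate j aj ∙ exchange n l Q a s (dQ j Aj) (dQ k Ak) aj ak
  within : Divisible w (sum (λ k → when (A k) (unless (has k Q) (T k))))
  within = divisible-resp (sym ((sum-cong λ k → split k (A k) ≡.refl) ∙ sum-Σ< {N} B (λ k s → when (class A a s k) (T k)))) (divisible-Σ< B by-class)
    where
    split : ∀ k x → A k ≡ x → when x (unless (has k Q) (T k)) ≈ Σ< B (λ s → when (class A a s k) (T k))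
    split k false e = sym (Σ<-zero B λ s _ → cong-≈ (λ x → when (x ∧ does (suc s ℕ.≟ lookup a k)) (T k)) e)
    split k true  e = cong-≈ (λ x → unless x (T k)) (dQ k e) ∙ go (lookup a k) ≡.refl ∙ (Σ<-cong B λ s _ → cong-≈ (λ x → when (x ∧ does (suc s ℕ.≟ lookup a k)) (T k)) (≡.sym e))
      where
      go : ∀ x → lookup a k ≡ x → T k ≈ Σ< B (λ s → when (does (suc s ℕ.≟ lookup a k)) (T k))
      go zero    q = cong-≈ (λ x → onPred x (λ i → F n (Q ∷ʳ (l , just k)) (a [ k ]≔ i))) q ∙ sym (Σ<-zero B λ s _ → cong-≈ (λ x → when (does (suc s ℕ.≟ x)) (T k)) q)
      go (suc r) q = sym ((Σ<-cong B λ s _ → cong-≈ (λ x → when (does (suc s ℕ.≟ x)) (T k)) q) ∙ Σ<-δ B r (λ _ → T k) ∙ cong-≈ (λ x → when x (T k)) (dec-true (suc r ℕ.≤? B) (subst (_≤ B) q (b k))))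

u-as-Π : ∀ μ k → u μ ≡ Π< (size μ ℕ.+ k) (λ i → multiplicity (suc i) μ !)
u-as-Π μ k = product-1⋯ (size μ) (λ i → multiplicity i μ !) ⊙ ≡.sym (Π<-extend (size μ) k λ i h → cong _! (occurrences-large (suc i) (parts μ) (ℕ.s≤s h)))

-- At the start no label is in use, so A can be the set of all labels.
jack-divisible : ∀ lam μ → Divisible (u μ) ([m μ ] jack lam)
jack-divisible lam μ = subst (λ w → Divisible w ([m μ ] jack lam)) ((Π<-cong (size μ) λ s → cong _! (count-class s (parts μ))) ⊙ ≡.sym (product-1⋯ (size μ) (λ i → multiplicity i μ !)))
  (divisible-F (size lam) (size μ) (λ _ → true) (empties (rows lam)) (fromList (parts μ)) (λ k _ → cong (has k) (≡.sym (List.++-identityʳ (empties (rows lam)))) ⊙ has-empties k (rows lam) []) (bounds (parts μ)))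
  where
  count-class : ∀ s xs → card (class (λ _ → true) (fromList xs) s) ≡ occurrences (suc s) xs
  count-class s []       = ≡.refl
  count-class s (x ∷ xs) = cong (bit (does (suc s ℕ.≟ x)) ℕ.+_) (count-class s xs) ⊙ go (suc s ℕ.≟ x)
    where
    go : (d : Dec (suc s ≡ x)) → bit (does (suc s ℕ.≟ x)) ℕ.+ occurrences (suc s) xs ≡ occurrences (suc s) (x ∷ xs)
    go (yes e) = cong (λ c → (if c then 1 else 0) ℕ.+ occurrences (suc s) xs) (dec-true (suc s ℕ.≟ x) e) ⊙ ≡.sym (cong (λ y → occurrences (suc s) (y ∷ xs)) (≡.sym e) ⊙ occurrences-same (suc s) xs)
    go (no e)  = cong (λ c → (if c then 1 else 0) ℕ.+ occurrences (suc s) xs) (dec-false (suc s ℕ.≟ x) e) ⊙ ≡.sym (occurrences-other xs e)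
  bounds : ∀ xs k → lookup (fromList xs) k ≤ sumᴸ xs
  bounds (x ∷ xs) zero    = ℕ.m≤m+n x (sumᴸ xs)
  bounds (x ∷ xs) (suc k) = ℕ.≤-trans (bounds xs k) (ℕ.m≤n+m (sumᴸ xs) x)

u-∪ : ∀ μ κ → u κ ∣ u (μ ∪ κ)
u-∪ μ κ = subst₂ _∣_ (≡.sym (u-as-Π κ (size μ))) (cong (λ k → Π< k (λ i → multiplicity (suc i) (μ ∪ κ) !)) (ℕ.+-comm (size κ) (size μ) ⊙ ≡.sym (sum-↭ merged ⊙ sum-++ (parts μ) (parts κ))) ⊙ cong (λ k → Π< k (λ i → multiplicity (suc i) (μ ∪ κ) !)) (≡.sym (ℕ.+-identityʳ (size (μ ∪ κ)))) ⊙ ≡.sym (u-as-Π (μ ∪ κ) 0))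
  (Π<-∣ (size κ ℕ.+ size μ) λ i → m≤n⇒m!∣n! (subst (multiplicity (suc i) κ ≤_) (≡.sym (multiplicities (suc i))) (ℕ.m≤n+m _ (multiplicity (suc i) μ))))
  where
  merged : parts (μ ∪ κ) ↭ parts μ ++ parts κ
  merged = Perm.merge-↭ _ (parts μ) (parts κ)
  multiplicities : ∀ i → multiplicity i (μ ∪ κ) ≡ multiplicity i μ ℕ.+ multiplicity i κ
  multiplicities i = occurrences-↭ i merged ⊙ cong length (List.filter-++ (i ℕ.≟_) (parts μ) (parts κ)) ⊙ List.length-++ (filter (i ℕ.≟_) (parts μ))
  Π<-∣ : ∀ n {f g : ℕ → ℕ} → (∀ i → f i ∣ g i) → Π< n f ∣ Π< n g
  Π<-∣ zero    h = ∣-refl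
  Π<-∣ (suc n) h = *-pres-∣ (h 0) (Π<-∣ n (h ∘ suc))

nip-fromℕ : ∀ n → NIP (fromℕ n)
nip-fromℕ n = n ∷ [] , refl

nip-c′ : ∀ μ → NIP (c′ μ)
nip-c′ μ = go (diagram μ)
  where
  go : ∀ xs → NIP (∏ xs λ s → fromℕ (suc (arm μ s)) * α + fromℕ (leg μ s))
  go []       = nip-resp (+-identityʳ 1#) (nip-ν 1)
  go (s ∷ xs) = nip-* (nip-+ (nip-* (nip-fromℕ (suc (arm μ s))) nip-α) (nip-fromℕ (leg μ s))) (go xs)

const-inverse : ∀ n .{{_ : ℕ.NonZero n}} → const (ℤ.+ 1 ℚ./ n) * ν n ≈ 1#
const-inverse n = *-congˡ {const (ℤ.+ 1 ℚ./ n)} (sym (fromℕ≈ν n)) ∙ sym (⌜⌝-* (ℤ.+ 1 ℚ./ n ∷ []) (ℕ→ℚ n ∷ [])) ∙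
  ⌜⌝-cong (Polynomials.∷-cong (ℚ.+-identityʳ _ ⊙ reciprocal n) Polynomials.≈-refl)
  where
  reciprocal : ∀ n .{{_ : ℕ.NonZero n}} → (ℤ.+ 1 ℚ./ n) ℚ.* ℕ→ℚ n ≡ 1ℚ
  reciprocal (suc n) = ℚ.toℚᵘ-injective (ℚᵘ.≃-trans (ℚ.toℚᵘ-homo-* (ℤ.+ 1 ℚ./ suc n) (ℕ→ℚ (suc n))) (ℚᵘ.≃-trans (ℚᵘ.*-cong (ℚ.toℚᵘ-fromℚᵘ (ℚᵘ.mkℚᵘ (ℤ.+ 1) n)) (toℚᵘ-ℕ→ℚ (suc n)))
    (ℚᵘ.*≡* (ℤ.*-identityʳ _ ⊙ ℤ.*-identityˡ (ℤ.+ suc n) ⊙ ≡.sym (ℤ.*-identityˡ _ ⊙ cong (λ k → ℤ.+ suc k) (ℕ.*-identityʳ n))))))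

-- Coefficients of skew Jack functions

sum-take-++ : ∀ k xs ys → sumᴸ (take k xs) ≤ sumᴸ (take k (xs ++ ys))
sum-take-++ zero    xs       ys = ℕ.z≤n
sum-take-++ (suc k) []       ys = ℕ.z≤n
sum-take-++ (suc k) (x ∷ xs) ys = ℕ.+-monoʳ-≤ x (sum-take-++ k xs ys)

take-entries : ∀ k xs ys → (∀ i → 1 ≤ i → i ≤ k → entry xs i ≡ entry ys i) → sumᴸ (take k xs) ≡ sumᴸ (take k ys)
take-entries zero    xs       ys       h = ≡.refl
take-entries (suc k) []       []       h = ≡.refl
take-entries (suc k) []       (y ∷ ys) h = cong₂ ℕ._+_ (h 1 ℕ.≤-refl (ℕ.s≤s ℕ.z≤n)) (cong sumᴸ (≡.sym (List.take-[] k)) ⊙ (take-entries k [] ys λ { (suc i) p q → h (suc (suc i)) (ℕ.s≤s ℕ.z≤n) (ℕ.s≤s q) }))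
take-entries (suc k) (x ∷ xs) []       h = cong₂ ℕ._+_ (h 1 ℕ.≤-refl (ℕ.s≤s ℕ.z≤n)) ((take-entries k xs [] λ { (suc i) p q → h (suc (suc i)) (ℕ.s≤s ℕ.z≤n) (ℕ.s≤s q) }) ⊙ cong sumᴸ (List.take-[] k))
take-entries (suc k) (x ∷ xs) (y ∷ ys) h = cong₂ ℕ._+_ (h 1 ℕ.≤-refl (ℕ.s≤s ℕ.z≤n)) (take-entries k xs ys λ { (suc i) p q → h (suc (suc i)) (ℕ.s≤s ℕ.z≤n) (ℕ.s≤s q) })

-- For f = J_λ this is Σ_ρ v_(λ, ρ ∪ a) m_ρ, the function that is paired with J_μ.
prefix : List ℕ → Λ → Λ
prefix []      f = f
prefix (n ∷ a) f = prefix a (shift n f)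

coeff-prefix : ∀ a f b → coeff (prefix a f) b ≈ coeff f (a ++ b)
coeff-prefix []      f b = refl
coeff-prefix (n ∷ a) f b = coeff-prefix a (shift n f) b

module Skew (𝒮 : JackScalarProduct) (𝒥 : JackFunctions 𝒮) where
  open Form 𝒮
  open Identification 𝒮 𝒥
  open Evaluations 𝒮 𝒥
  open Norms 𝒮 𝒥
  open JackFunctions 𝒥

  completes : List ℕ → Λ
  completes []      = 1Λ
  completes (n ∷ a) = proj₁ (complete n) *Λ completes a

  completes-adjoint : ∀ a f g → ⟪ f , g *Λ completes a ⟫ ≈ ⟪ prefix a f , g ⟫
  completes-adjoint []      f g = ⟨⟩-congˡ f {g *Λ 1Λ} {g} (convolve-1ʳ (coeff g))
  completes-adjoint (n ∷ a) f g = ⟨⟩-congˡ f {g *Λ (h *Λ completes a)} {h *Λ (g *Λ completes a)} swap ∙ proj₂ (complete n) f (g *Λ completes a) ∙ completes-adjoint a (shift n f) g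
    where
    h = proj₁ (complete n)
    swap : g *Λ (h *Λ completes a) ≈Λ h *Λ (g *Λ completes a)
    swap b = sym (convolve-assoc (coeff g) (coeff h) (coeff (completes a)) b) ∙ convolve-cong (convolve-comm (coeff g) (coeff h)) (λ _ → refl) b ∙ convolve-assoc (coeff h) (coeff g) (coeff (completes a)) b

  -- The J_ν span, so the defining property extends from them to all x.
  skew-adjoint : ∀ {lam μ f} → IsSkewJack lam μ f → ∀ x → ⟪ f , x ⟫ ≈ ⟪ J lam , J μ *Λ x ⟫
  skew-adjoint {lam} {μ} {f} sk x = J.eliminate {λ _ → ⊤} (λ _ _ → tt) (equalizer (pair f) (multiply (J lam) (J μ))) (λ κ₀ _ → sk κ₀) x (λ _ _ → tt)

  -- A coefficient of f is its pairing with a product of complete functions. The skew property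
  -- carries that product over to J_λ, where it again takes a coefficient.
  skew-coefficient : ∀ {lam μ f} → IsSkewJack lam μ f → ∀ a → coeff f a ≈ ⟪ J μ , prefix a (J lam) ⟫
  skew-coefficient {lam} {μ} {f} sk a = begin
    coeff f a  ≈⟨ cong-≈ (coeff f) (List.++-identityʳ a) ⟨
    coeff f (a ++ [])  ≈⟨ coeff-prefix a f [] ⟨
    coeff (prefix a f) []  ≈⟨ one-pairing (prefix a f) ⟨
    ⟪ 1Λ , prefix a f ⟫  ≈⟨ ⟨⟩-comm 1Λ (prefix a f) ⟩
    ⟪ prefix a f , 1Λ ⟫  ≈⟨ completes-adjoint a f 1Λ ⟨
    ⟪ f , 1Λ *Λ completes a ⟫  ≈⟨ ⟨⟩-congˡ f {1Λ *Λ completes a} {completes a} (convolve-1 (coeff (completes a))) ⟩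
    ⟪ f , completes a ⟫  ≈⟨ skew-adjoint {lam} {μ} {f} sk (completes a) ⟩
    ⟪ J lam , J μ *Λ completes a ⟫  ≈⟨ completes-adjoint a (J lam) (J μ) ⟩
    ⟪ prefix a (J lam) , J μ ⟫  ≈⟨ ⟨⟩-comm (prefix a (J lam)) (J μ) ⟩
    ⟪ J μ , prefix a (J lam) ⟫  ∎

  -- If ρ lies above μ and the union of ρ and a below λ, then the partial sums of ρ are squeezed to those of μ.
  squeezed : ∀ {lam μ} → ((i : ℕ) → 1 ≤ i → i < ℓ μ → μ [ i ] ≡ lam [ i ]) → ∀ a → Supported (λ ρ → μ ⊴ ρ → ρ ≡ μ) (prefix a (J lam))
  squeezed {lam} {μ} h a ρ k le = ⊴-weight-strict {ρ} {μ} ge (ℕ.≤-antisym (⊴-weight {μ} {ρ} le) (⊴-weight {ρ} {μ} ge))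
    where
    nonzero : ¬ coeff (jack lam) (parts ρ ++ a) ≈ 0#
    nonzero e = k (coeff-prefix a (J lam) (parts ρ) ∙ symmetric (J lam) (Perm.++-comm a (parts ρ)) ∙ J≈jack lam (parts ρ ++ a) ∙ e)
    below-lam : ∀ c → sumᴸ (take c (parts ρ)) ≤ sumᴸ (take c (parts lam))
    below-lam c = ℕ.≤-trans (sum-take-++ c (parts ρ) a) (ℕ.≮⇒≥ λ l → nonzero (jack-dominance lam (parts ρ ++ a) c l))
    ge : ρ ⊴ μ
    ge = ≡.sym (proj₁ le) , λ c → go c (c ℕ.<? ℓ μ)
      where
      -- Before ℓ μ the hypothesis on rows equates the partial sums of μ and λ; from ℓ μ on, the
      -- partial sum of μ is the full size.
      go : ∀ c → Dec (c < ℓ μ) → sumᴸ (take c (parts ρ)) ≤ sumᴸ (take c (parts μ))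
      go c (yes l) = ℕ.≤-trans (below-lam c) (ℕ.≤-reflexive (≡.sym (take-entries c (parts μ) (parts lam) λ i p q → h i p (ℕ.≤-<-trans q l))))
      go c (no l)  = ℕ.≤-trans (ℕ.≤-trans (ℕ.m≤m+n _ _) (ℕ.≤-reflexive (take-drop-sum c (parts ρ)))) (ℕ.≤-reflexive (≡.sym (proj₁ le) ⊙ cong sumᴸ (≡.sym (List.take-all c (parts μ) (ℕ.≮⇒≥ l)))))

  skew-formula : ∀ {lam μ f} → ((i : ℕ) → 1 ≤ i → i < ℓ μ → μ [ i ] ≡ lam [ i ]) → IsSkewJack lam μ f → ∀ κ₀ → [m κ₀ ] f ≈ c′ μ * v lam (μ ∪ κ₀)
  skew-formula {lam} {μ} {f} h sk κ₀ = begin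
    [m κ₀ ] f  ≈⟨ skew-coefficient {lam} {μ} {f} sk (parts κ₀) ⟩
    ⟪ J μ , prefix (parts κ₀) (J lam) ⟫  ≈⟨ pairing μ (prefix (parts κ₀) (J lam)) (squeezed {lam} {μ} h (parts κ₀)) ⟩
    [m μ ] prefix (parts κ₀) (J lam) * C μ  ≈⟨ *-cong (coeff-prefix (parts κ₀) (J lam) (parts μ) ∙ symmetric (J lam) (↭-trans (Perm.++-comm (parts κ₀) (parts μ)) (↭-sym (Perm.merge-↭ _ (parts μ) (parts κ₀))))) (C≈c′ μ) ⟩
    v lam (μ ∪ κ₀) * c′ μ  ≈⟨ *-comm _ _ ⟩
    c′ μ * v lam (μ ∪ κ₀)  ∎

  skew-integral : ∀ {lam μ f} → ((i : ℕ) → 1 ≤ i → i < ℓ μ → μ [ i ] ≡ lam [ i ]) → IsSkewJack lam μ f → ∀ κ₀ → NIP ([m̃ κ₀ ] f)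
  skew-integral {lam} {μ} {f} h sk κ₀ with jack-divisible lam (μ ∪ κ₀) | u-∪ μ κ₀
  ... | mkDivisible y p e | divides w q = nip-resp (sym (begin
    x * [m κ₀ ] f  ≈⟨ *-congˡ {x} (skew-formula {lam} {μ} {f} h sk κ₀) ⟩
    x * (c′ μ * v lam (μ ∪ κ₀))  ≈⟨ *-congˡ {x} (*-congˡ {c′ μ} (J≈jack lam (parts (μ ∪ κ₀)) ∙ e ∙ *-congʳ {y} (cong-≈ ν q ∙ ν-* w (u κ₀)))) ⟩
    x * (c′ μ * ((ν w * ν (u κ₀)) * y))  ≈⟨ solve 5 (λ x c w u y → x :* (c :* ((w :* u) :* y)) := (x :* u) :* (c :* (w :* y))) refl x (c′ μ) (ν w) (ν (u κ₀)) y ⟩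
    (x * ν (u κ₀)) * (c′ μ * (ν w * y))  ≈⟨ *-congʳ {c′ μ * (ν w * y)} (const-inverse (u κ₀) {{u≢0 κ₀}}) ∙ *-identityˡ _ ⟩
    c′ μ * (ν w * y)  ∎)) (nip-* (nip-c′ μ) (nip-* (nip-ν w) p))
    where
    x = const (ℚ._/_ (ℤ.+ 1) (u κ₀) {{u≢0 κ₀}})

proposition16 : (S : JackScalarProduct) (𝒥 : JackFunctions S) → let open JackFunctions 𝒥 in
  (lam μ : Partition) → μ ⊂ lam →
  ((i : ℕ) → 1 ≤ i → i < ℓ μ → μ [ i ] ≡ lam [ i ]) →
  (Jlam/μ : Λ) → IsSkewJack lam μ Jlam/μ →
  (ν : Partition) →
  ([m ν ] Jlam/μ ≈ c′ μ * v lam (μ ∪ ν)) ×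
  IsNonnegativeIntegerPolynomial ([m̃ ν ] Jlam/μ)
proposition16 S 𝒥 lam μ _ h f sk κ₀ = skew-formula {lam} {μ} {f} h sk κ₀ , skew-integral {lam} {μ} {f} h sk κ₀
  where open Skew S 𝒥
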